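{- Let $(m,\ell)$ be a pair of primes with $m=13$ and $\ell \in \{1811, 1871, 1949, 2207, 3301, 4001, 4079, 4289, 4931\}$, or $m=17$ and $\ell\in\{2039, 2719, 3331, 4079\}$, or $m=19$ and $\ell\in\{151, 1091, 2659, 3989\}$. Then $$\overline{p}\left(m \ell^3 n\right) \equiv 0 \pmod m$$ for every positive integer $n$ prime to $\ell$.
   Context: $\overline{p}(n)$ denotes the number of overpartitions of $n$; its generating function is $\sum_{n\ge0}\overline{p}(n)q^n=\prod_{n\ge1}\frac{1+q^n}{1-q^n}$. -}

module Defs where

open import Data.Nat using (ℕ; zero; suc; _+_; _∸_; _<ᵇ_)
open import Data.Bool using (if_then_else_)

Series : Set
Series = ℕ → ℕ

one : Series
one zero    = 1
one (suc _) = 0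

mul1+ : ℕ → Series → Series
mul1+ k a i = if i <ᵇ k then a i else a i + a (i ∸ k)

-- Multiplication by 1/(1 - q^k) = Σ_{j≥0} q^{jk}, for k ≥ 1 (written k = suc k'):
-- coefficient i is Σ_{j, jk ≤ i} a (i - jk).  Computed with fuel i+1.
geomSum : ℕ → ℕ → Series → ℕ → ℕ
geomSum zero       k a i = a i
geomSum (suc fuel) k a i =
  if i <ᵇ k then a i else a i + geomSum fuel k a (i ∸ k)

mul1/1- : ℕ → Series → Series
mul1/1- k a i = geomSum i k a i

partialProd : ℕ → Series
partialProd zero    = one
partialProd (suc N) = mul1/1- (suc N) (mul1+ (suc N) (partialProd N))

-- Overpartition function: coefficient of q^n in ∏_{k≥1} (1+q^k)/(1-q^k).
-- Factors with k > n do not affect the coefficient of q^n, so truncating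
-- the product at k = n is exact.
overpartition : ℕ → ℕ
overpartition n = partialProd n n

{-# OPTIONS --safe #-}

-- By Gauss, Σ (-1)ⁿ p̄(n) qⁿ = 1/θ with θ = Σ q^(s²).  Modulo a prime p, Frobenius gives θ · U_p(1/θ) as the U_p-section of a power of θ;
-- multiplying by forms in θ(q)², θ(-q)² that are 1 modulo p by Landen's transformation, and by the Wronskian of the two parity halves of θ,
-- this section is a homogeneous polynomial in those halves.  Lambert series are polynomials in θ(q)², θ(-q)² as well, so that, for N not a square,
-- ± p̄(pN) is congruent to a sum over N = s² + de of characters and powers of d and de - c s², that is, over the binary quadratic forms
-- d x² + 2 s x y - e y² of discriminant N with values of opposite sign at the points (1,0) and (0,1).
-- Such sums behave like modular symbols: they are additive under subdivision of the cone between two points and change sign when these are swapped.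
-- For N = ℓ n with ℓ ∤ n, each form of discriminant N ℓ² comes from exactly one of ℓ + 1 matrices of determinant ℓ, and the Euclidean algorithm
-- cuts the resulting cones into unimodular ones.  The additivity relations leave a space of dimension at most 7 modulo p,
-- in which this Hecke operator is computed and seen to annihilate the sum in question for the listed ℓ.

module Submission where

import Algebra.Solver.Ring as RingSolver
import Data.Integer.DivMod as ℤDM
import Data.Integer.Properties as ℤP
import Data.List.Membership.Propositional.Properties as ∈P
import Data.List.Relation.Unary.All.Properties as AllP
import Data.List.Relation.Unary.Unique.Propositional.Properties as UniqueP
import Data.Nat as ℕ
import Data.Nat.DivMod as ℕDM
import Data.Nat.Divisibility as ℕD
import Data.Nat.Properties as ℕP
import Data.Nat.Tactic.RingSolver as ℕSolver
import Data.Vec as Vec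
import Defs
import Relation.Binary.Reasoning.Setoid as SetoidReasoning
open import Data.Bool using (Bool; true; false; _∧_)
open import Data.Empty using (⊥; ⊥-elim)
open import Data.Integer as ℤ using (ℤ; +_; -[1+_]; 0ℤ; 1ℤ; -1ℤ; ∣_∣) renaming (_+_ to _+ᶻ_; _*_ to _*ᶻ_; -_ to -ᶻ_; _-_ to _-ᶻ_; _^_ to _^ᶻ_)
open import Data.Integer.Divisibility.Signed as ℤD using () renaming (_∣_ to _∣ℤ_)
open import Data.Integer.Tactic.RingSolver using (solve-∀)
open import Data.List using (List; []; _∷_; _++_; map; filter; cartesianProduct; upTo; concatMap; length)
open import Data.List.Membership.Propositional using (_∈_)
open import Data.List.Properties using (filter-accept; filter-reject)
open import Data.List.Relation.Unary.All as All using (All; []; _∷_; all?)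
open import Data.List.Relation.Unary.AllPairs using ([]; _∷_)
open import Data.List.Relation.Unary.Any using (here; there)
open import Data.List.Relation.Unary.Unique.Propositional using (Unique)
open import Data.Nat using (ℕ; zero; suc; _≤_; _<_; z≤n; s≤s; _%_; _/_)
open import Data.Nat.Coprimality using (Coprime; coprime-Bézout)
open import Data.Nat.GCD using (module Bézout)
open import Data.Nat.Induction using (<-rec)
open import Data.Nat.Primality using (Prime; prime?; ¬prime[1]; euclidsLemma; prime⇒irreducible; prime⇒nonZero; prime⇒nonTrivial)
open import Data.Product using (Σ; ∃; ∃₂; _×_; _,_; proj₁; proj₂)
open import Data.Sum using (_⊎_; inj₁; inj₂)
open import Data.Unit using (⊤; tt)
open import Data.Vec using (Vec; []; _∷_; zipWith; toList)
open import Function using (_∘_; id; mk⇔)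
open import Level using (0ℓ)
open import Relation.Binary.Definitions using (tri<; tri≈; tri>)
open import Relation.Binary.PropositionalEquality
open import Relation.Nullary using (¬_; Dec; yes; no; ¬?)
open import Relation.Nullary.Decidable using (True; toWitness; from-yes; from-no)
open import Relation.Unary using (Decidable)

-- No theory of modular forms enters. The basic series are pinned down by the way they relate to
-- their own values at q², and coefficient induction does the rest; congruences between forms become
-- equality of coefficient vectors modulo p, which is decided by evaluation. Weights explain the
-- constants. `θ ⊛ U k 1/θ` has weight (p - 1)/2, and taking out θ² leaves 5, 7, 8 for p = 13, 17,
-- 19. An odd weight calls for the character modulo 4, an even one for parity conditions. For 17 and
-- 19 a Rankin-Cohen bracket of θ with Lambert series of weight two less is added to the Lambert
-- series. Constant terms of Eisenstein series are never determined: they only multiply θ or its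
-- derivative, whose coefficients vanish at nonsquares. The cube of ℓ comes from the Hecke step: ℓ³n
-- is ℓ² times ℓn, and ℓ divides ℓn exactly once. For this reason neither number is a square, and no
-- form of the larger discriminant arises from two of the matrices.

module PowerSeries where

 -- Formal power series over ℤ, exactly and modulo m.

 open import Algebra.Bundles using (CommutativeRing; RawRing)
 open import Algebra.Solver.Ring.AlmostCommutativeRing using (AlmostCommutativeRing; fromCommutativeRing; _-Raw-AlmostCommutative⟶_)
 open import Data.Maybe using (Maybe; just; nothing)

 PS : Set
 PS = ℕ → ℤ

 infixl 6 _⊕_ _⊖_
 infixl 7 _⊛_
 infix 8 ⊝_
 infix 4 _≗ₛ_

 _≗ₛ_ : PS → PS → Set
 f ≗ₛ g = ∀ n → f n ≡ g n

 tl : PS → PS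
 tl f n = f (suc n)

 con : ℤ → PS
 con c zero    = c
 con c (suc _) = 0ℤ

 _⊕_ : PS → PS → PS
 (f ⊕ g) n = f n +ᶻ g n

 ⊝_ : PS → PS
 (⊝ f) n = -ᶻ f n

 _⊖_ : PS → PS → PS
 f ⊖ g = f ⊕ ⊝ g

 -- The Cauchy product by recursion on the left factor: the constant term is split off and the tail
 -- is multiplied. Products whose left factor starts with zeros then compute, and most identities
 -- follow by the same recursion.
 _⊛_ : PS → PS → PS
 (f ⊛ g) zero    = f 0 *ᶻ g 0
 (f ⊛ g) (suc n) = f 0 *ᶻ g (suc n) +ᶻ (tl f ⊛ g) n

 addˡ : ∀ x {y z} → y ≡ z → x +ᶻ y ≡ x +ᶻ z
 addˡ x = cong (λ y → x +ᶻ y)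

 ⊛-cong : ∀ {f f′ g g′} → f ≗ₛ f′ → g ≗ₛ g′ → f ⊛ g ≗ₛ f′ ⊛ g′
 ⊛-cong p q zero    = cong₂ _*ᶻ_ (p 0) (q 0)
 ⊛-cong p q (suc n) = cong₂ _+ᶻ_ (cong₂ _*ᶻ_ (p 0) (q (suc n))) (⊛-cong (p ∘ suc) q n)

 ⊛-zeroˡ : ∀ {f} g → (∀ n → f n ≡ 0ℤ) → ∀ n → (f ⊛ g) n ≡ 0ℤ
 ⊛-zeroˡ g p zero    = cong (ℤ._* g 0) (p 0)
 ⊛-zeroˡ g p (suc n) = cong₂ _+ᶻ_ (cong (ℤ._* g (suc n)) (p 0)) (⊛-zeroˡ g (p ∘ suc) n)

 con-⊛ : ∀ c g n → (con c ⊛ g) n ≡ c *ᶻ g n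
 con-⊛ c g zero    = refl
 con-⊛ c g (suc n) = trans (addˡ (c *ᶻ g (suc n)) (⊛-zeroˡ g (λ _ → refl) n)) (ℤP.+-identityʳ _)

 ⊛-sucʳ : ∀ f g n → (f ⊛ g) (suc n) ≡ f (suc n) *ᶻ g 0 +ᶻ (f ⊛ tl g) n
 ⊛-sucʳ f g zero    = ℤP.+-comm (f 0 *ᶻ g 1) (f 1 *ᶻ g 0)
 ⊛-sucʳ f g (suc n) = trans (addˡ (f 0 *ᶻ g (suc (suc n))) (⊛-sucʳ (tl f) g n))
                            (swap (f 0 *ᶻ g (suc (suc n))) (f (suc (suc n)) *ᶻ g 0) _)
   where
     swap : ∀ x y z → x +ᶻ (y +ᶻ z) ≡ y +ᶻ (x +ᶻ z)
     swap = solve-∀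

 ⊛-comm : ∀ f g → f ⊛ g ≗ₛ g ⊛ f
 ⊛-comm f g zero    = ℤP.*-comm (f 0) (g 0)
 ⊛-comm f g (suc n) = trans (cong₂ _+ᶻ_ (ℤP.*-comm (f 0) (g (suc n))) (⊛-comm (tl f) g n))
                            (sym (⊛-sucʳ g f n))

 ⊛-distribʳ : ∀ h f g → (f ⊕ g) ⊛ h ≗ₛ f ⊛ h ⊕ g ⊛ h
 ⊛-distribʳ h f g zero    = ℤP.*-distribʳ-+ (h 0) (f 0) (g 0)
 ⊛-distribʳ h f g (suc n) = trans (addˡ ((f 0 +ᶻ g 0) *ᶻ h (suc n)) (⊛-distribʳ h (tl f) (tl g) n)) (lem (f 0) (g 0) (h (suc n)) _ _)
   where
     lem : ∀ a b c d e → (a +ᶻ b) *ᶻ c +ᶻ (d +ᶻ e) ≡ (a *ᶻ c +ᶻ d) +ᶻ (b *ᶻ c +ᶻ e)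
     lem = solve-∀

 ⊛-distribˡ : ∀ h f g → h ⊛ (f ⊕ g) ≗ₛ h ⊛ f ⊕ h ⊛ g
 ⊛-distribˡ h f g n = trans (⊛-comm h (f ⊕ g) n)
   (trans (⊛-distribʳ h f g n) (cong₂ _+ᶻ_ (⊛-comm f h n) (⊛-comm g h n)))

 scale-⊛ : ∀ c f g n → ((λ i → c *ᶻ f i) ⊛ g) n ≡ c *ᶻ (f ⊛ g) n
 scale-⊛ c f g zero    = ℤP.*-assoc c (f 0) (g 0)
 scale-⊛ c f g (suc n) = trans (addˡ (c *ᶻ f 0 *ᶻ g (suc n)) (scale-⊛ c (tl f) g n)) (lem c (f 0) (g (suc n)) _)
   where
     lem : ∀ a b d e → a *ᶻ b *ᶻ d +ᶻ a *ᶻ e ≡ a *ᶻ (b *ᶻ d +ᶻ e)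
     lem = solve-∀

 ⊛-assoc : ∀ f g h → (f ⊛ g) ⊛ h ≗ₛ f ⊛ (g ⊛ h)
 ⊛-assoc f g h zero    = ℤP.*-assoc (f 0) (g 0) (h 0)
 ⊛-assoc f g h (suc n) = trans
   (addˡ (f 0 *ᶻ g 0 *ᶻ h (suc n)) (trans (⊛-distribʳ h (λ i → f 0 *ᶻ g (suc i)) (tl f ⊛ g) n)
                         (cong₂ _+ᶻ_ (scale-⊛ (f 0) (tl g) h n) (⊛-assoc (tl f) g h n))))
   (lem (f 0) (g 0) (h (suc n)) _ _)
   where
     lem : ∀ a b c d e → a *ᶻ b *ᶻ c +ᶻ (a *ᶻ d +ᶻ e) ≡ a *ᶻ (b *ᶻ c +ᶻ d) +ᶻ e
     lem = solve-∀

 psRing : CommutativeRing 0ℓ 0ℓ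
 psRing = record
   { Carrier = PS ; _≈_ = _≗ₛ_ ; _+_ = _⊕_ ; _*_ = _⊛_ ; -_ = ⊝_ ; 0# = con 0ℤ ; 1# = con 1ℤ
   ; isCommutativeRing = record
     { isRing = record
       { +-isAbelianGroup = record
         { isGroup = record
           { isMonoid = record
             { isSemigroup = record
               { isMagma = record
                 { isEquivalence = record { refl = λ _ → refl ; sym = λ p n → sym (p n) ; trans = λ p q n → trans (p n) (q n) }
                 ; ∙-cong = λ p q n → cong₂ _+ᶻ_ (p n) (q n) }
               ; assoc = λ f g h n → ℤP.+-assoc (f n) (g n) (h n) }
             ; identity = (λ f n → trans (cong (ℤ._+ f n) (con0 n)) (ℤP.+-identityˡ (f n)))
                        , (λ f n → trans (cong (f n +ᶻ_) (con0 n)) (ℤP.+-identityʳ (f n))) }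
           ; inverse = (λ f n → trans (ℤP.+-inverseˡ (f n)) (sym (con0 n)))
                     , (λ f n → trans (ℤP.+-inverseʳ (f n)) (sym (con0 n)))
           ; ⁻¹-cong = λ p n → cong -ᶻ_ (p n) }
         ; comm = λ f g n → ℤP.+-comm (f n) (g n) }
       ; *-cong = ⊛-cong
       ; *-assoc = ⊛-assoc
       ; *-identity = (λ f n → trans (con-⊛ 1ℤ f n) (ℤP.*-identityˡ (f n)))
                    , (λ f n → trans (⊛-comm f (con 1ℤ) n) (trans (con-⊛ 1ℤ f n) (ℤP.*-identityˡ (f n))))
       ; distrib = ⊛-distribˡ , ⊛-distribʳ }
     ; *-comm = ⊛-comm } }
   where
     con0 : ∀ n → con 0ℤ n ≡ 0ℤ
     con0 zero    = refl
     con0 (suc _) = refl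

 ℤRaw : RawRing 0ℓ 0ℓ
 ℤRaw = record { Carrier = ℤ ; _≈_ = _≡_ ; _+_ = _+ᶻ_ ; _*_ = _*ᶻ_ ; -_ = -ᶻ_ ; 0# = 0ℤ ; 1# = 1ℤ }

 module S where
   open CommutativeRing psRing public using (refl; sym; trans; +-cong; *-cong; -‿cong; setoid; *-assoc; *-comm; +-comm; +-assoc)
   acr : AlmostCommutativeRing 0ℓ 0ℓ
   acr = fromCommutativeRing psRing
   morph : ℤRaw -Raw-AlmostCommutative⟶ acr
   morph = record
     { ⟦_⟧ = con
     ; +-homo = λ { x y zero → P.refl ; x y (suc n) → P.refl }
     ; *-homo = λ { x y zero → P.refl ; x y (suc n) → P.sym (P.trans (con-⊛ x (con y) (suc n)) (ℤP.*-zeroʳ x)) }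
     ; -‿homo = λ { x zero → P.refl ; x (suc n) → P.refl }
     ; 0-homo = λ _ → P.refl
     ; 1-homo = λ _ → P.refl }
     where module P = Relation.Binary.PropositionalEquality
   dec : ∀ x y → Maybe (con x ≗ₛ con y)
   dec x y with x ℤ.≟ y
   ... | yes p = just (λ n → cong (λ z → con z n) p)
   ... | no  _ = nothing
   open RingSolver ℤRaw acr morph dec public using (solve; _:=_; _:+_; _:*_; :-_; _:-_; _:^_) renaming (con to :con)

 module Mod (m : ℤ) where

   infix 4 _≡ₘ_ _≈_

   record _≡ₘ_ (x y : ℤ) : Set where
     constructor mk
     field div : m ∣ℤ (x -ᶻ y)
   open _≡ₘ_ public

   ≡ₘ-reflexive : ∀ {x y} → x ≡ y → x ≡ₘ y
   ≡ₘ-reflexive {x} refl = mk (subst (m ∣ℤ_) (sym (ℤP.+-inverseʳ x)) (ℤD.divides 0ℤ refl))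

   ≡ₘ-refl : ∀ {x} → x ≡ₘ x
   ≡ₘ-refl = ≡ₘ-reflexive refl

   ≡ₘ-sym : ∀ {x y} → x ≡ₘ y → y ≡ₘ x
   ≡ₘ-sym {x} {y} (mk p) = mk (subst (m ∣ℤ_) (lem x y) (ℤD.∣m⇒∣-m p))
     where
       lem : ∀ x y → -ᶻ (x -ᶻ y) ≡ y -ᶻ x
       lem = solve-∀

   ≡ₘ-trans : ∀ {x y z} → x ≡ₘ y → y ≡ₘ z → x ≡ₘ z
   ≡ₘ-trans {x} {y} {z} (mk p) (mk q) = mk (subst (m ∣ℤ_) (lem x y z) (ℤD.∣m∣n⇒∣m+n p q))
     where
       lem : ∀ x y z → (x -ᶻ y) +ᶻ (y -ᶻ z) ≡ x -ᶻ z
       lem = solve-∀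

   +-congₘ : ∀ {x y u v} → x ≡ₘ y → u ≡ₘ v → x +ᶻ u ≡ₘ y +ᶻ v
   +-congₘ {x} {y} {u} {v} (mk p) (mk q) = mk (subst (m ∣ℤ_) (lem x y u v) (ℤD.∣m∣n⇒∣m+n p q))
     where
       lem : ∀ x y u v → (x -ᶻ y) +ᶻ (u -ᶻ v) ≡ (x +ᶻ u) -ᶻ (y +ᶻ v)
       lem = solve-∀

   -‿congₘ : ∀ {x y} → x ≡ₘ y → -ᶻ x ≡ₘ -ᶻ y
   -‿congₘ {x} {y} (mk p) = mk (subst (m ∣ℤ_) (lem x y) (ℤD.∣m⇒∣-m p))
     where
       lem : ∀ x y → -ᶻ (x -ᶻ y) ≡ -ᶻ x -ᶻ (-ᶻ y)
       lem = solve-∀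

   *-congₘ : ∀ {x y u v} → x ≡ₘ y → u ≡ₘ v → x *ᶻ u ≡ₘ y *ᶻ v
   *-congₘ {x} {y} {u} {v} (mk p) (mk q) =
     mk (subst (m ∣ℤ_) (lem x y u v) (ℤD.∣m∣n⇒∣m+n (ℤD.∣m⇒∣m*n u p) (ℤD.∣n⇒∣m*n y q)))
     where
       lem : ∀ x y u v → (x -ᶻ y) *ᶻ u +ᶻ y *ᶻ (u -ᶻ v) ≡ x *ᶻ u -ᶻ y *ᶻ v
       lem = solve-∀

   ∣⇒≡0 : ∀ {x} → m ∣ℤ x → x ≡ₘ 0ℤ
   ∣⇒≡0 {x} p = mk (subst (m ∣ℤ_) (sym (ℤP.+-identityʳ x)) p)

   ≡0⇒∣ : ∀ {x} → x ≡ₘ 0ℤ → m ∣ℤ x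
   ≡0⇒∣ {x} (mk p) = subst (m ∣ℤ_) (ℤP.+-identityʳ x) p

   _≈_ : PS → PS → Set
   f ≈ g = ∀ n → f n ≡ₘ g n

   ⊛-congₘ : ∀ {f f′ g g′} → f ≈ f′ → g ≈ g′ → f ⊛ g ≈ f′ ⊛ g′
   ⊛-congₘ p q zero    = *-congₘ (p 0) (q 0)
   ⊛-congₘ p q (suc n) = +-congₘ (*-congₘ (p 0) (q (suc n))) (⊛-congₘ (p ∘ suc) q n)

   exact : ∀ {f g} → f ≗ₛ g → f ≈ g
   exact p n = ≡ₘ-reflexive (p n)

   psRingₘ : CommutativeRing 0ℓ 0ℓ
   psRingₘ = record
     { Carrier = PS ; _≈_ = _≈_ ; _+_ = _⊕_ ; _*_ = _⊛_ ; -_ = ⊝_ ; 0# = con 0ℤ ; 1# = con 1ℤ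
     ; isCommutativeRing = record
       { isRing = record
         { +-isAbelianGroup = record
           { isGroup = record
             { isMonoid = record
               { isSemigroup = record
                 { isMagma = record
                   { isEquivalence = record { refl = λ _ → ≡ₘ-reflexive refl ; sym = λ p n → ≡ₘ-sym (p n) ; trans = λ p q n → ≡ₘ-trans (p n) (q n) }
                   ; ∙-cong = λ p q n → +-congₘ (p n) (q n) }
                 ; assoc = λ f g h → exact (R.+-assoc f g h) }
               ; identity = (λ f → exact (R.+-identityˡ f)) , (λ f → exact (R.+-identityʳ f)) }
             ; inverse = (λ f → exact (R.-‿inverseˡ f)) , (λ f → exact (R.-‿inverseʳ f))
             ; ⁻¹-cong = λ p n → -‿congₘ (p n) }
           ; comm = λ f g → exact (R.+-comm f g) }
         ; *-cong = ⊛-congₘ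
         ; *-assoc = λ f g h → exact (⊛-assoc f g h)
         ; *-identity = (λ f → exact (R.*-identityˡ f)) , (λ f → exact (R.*-identityʳ f))
         ; distrib = (λ f g h → exact (⊛-distribˡ f g h)) , (λ f g h → exact (⊛-distribʳ f g h)) }
       ; *-comm = λ f g → exact (⊛-comm f g) } }
     where module R = CommutativeRing psRing

   open CommutativeRing psRingₘ public using () renaming
     (refl to ≈-refl; sym to ≈-sym; trans to ≈-trans; +-cong to ⊕-congₘ; -‿cong to ⊝-congₘ; setoid to ≈-setoid)

 -- All other terms meet a zero coefficient of g. The uniqueness proofs rest on this: a difference
 -- is multiplied by a known series, and its first possibly nonzero coefficient is read off.
 low-⊛ : ∀ f g r → (∀ i → i < r → g i ≡ 0ℤ) → (f ⊛ g) r ≡ f 0 *ᶻ g r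
 low-⊛ f g zero    p = refl
 low-⊛ f g (suc r) p = trans (addˡ (f 0 *ᶻ g (suc r)) (trans (low-⊛ (tl f) g r (λ i i<r → p i (ℕP.m<n⇒m<1+n i<r)))
                                                    (trans (cong (f 1 *ᶻ_) (p r (ℕP.n<1+n r))) (ℤP.*-zeroʳ (f 1)))))
                             (ℤP.+-identityʳ _)

-- Finite sums over enumerated sets, and products of graded sums.

module FiniteSums where

 open PowerSeries
 open import Data.List.Membership.Propositional.Properties.WithK using (unique∧set⇒bag)
 open import Data.List.Relation.Binary.BagAndSetEquality using (∼bag⇒↭)
 open import Data.List.Relation.Binary.Permutation.Propositional using (_↭_; prep; swap) renaming (refl to ↭-refl; trans to ↭-trans)

 private
   variable
     A B : Set
     P Q : A → Set

 ∑ : List A → (A → ℤ) → ℤ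
 ∑ []       f = 0ℤ
 ∑ (x ∷ xs) f = f x +ᶻ ∑ xs f

 ∑-cong-∈ : ∀ (xs : List A) {f g} → (∀ {x} → x ∈ xs → f x ≡ g x) → ∑ xs f ≡ ∑ xs g
 ∑-cong-∈ []       p = refl
 ∑-cong-∈ (x ∷ xs) p = cong₂ _+ᶻ_ (p (here refl)) (∑-cong-∈ xs (p ∘ there))

 ∑-cong : ∀ (xs : List A) {f g} → (∀ x → f x ≡ g x) → ∑ xs f ≡ ∑ xs g
 ∑-cong xs p = ∑-cong-∈ xs (λ {x} _ → p x)

 ∑-++ : ∀ (xs ys : List A) f → ∑ (xs ++ ys) f ≡ ∑ xs f +ᶻ ∑ ys f
 ∑-++ []       ys f = sym (ℤP.+-identityˡ _)
 ∑-++ (x ∷ xs) ys f = trans (addˡ (f x) (∑-++ xs ys f)) (sym (ℤP.+-assoc (f x) (∑ xs f) (∑ ys f)))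

 ∑-map : ∀ (h : A → B) xs f → ∑ (map h xs) f ≡ ∑ xs (f ∘ h)
 ∑-map h []       f = refl
 ∑-map h (x ∷ xs) f = addˡ (f (h x)) (∑-map h xs f)

 ∑-⊕ : ∀ (xs : List A) f g → ∑ xs (λ x → f x +ᶻ g x) ≡ ∑ xs f +ᶻ ∑ xs g
 ∑-⊕ []       f g = refl
 ∑-⊕ (x ∷ xs) f g = trans (addˡ (f x +ᶻ g x) (∑-⊕ xs f g)) (lem (f x) (g x) (∑ xs f) (∑ xs g))
   where
     lem : ∀ a b c d → a +ᶻ b +ᶻ (c +ᶻ d) ≡ a +ᶻ c +ᶻ (b +ᶻ d)
     lem = solve-∀

 ∑-scale : ∀ c (xs : List A) f → ∑ xs (λ x → c *ᶻ f x) ≡ c *ᶻ ∑ xs f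
 ∑-scale c []       f = sym (ℤP.*-zeroʳ c)
 ∑-scale c (x ∷ xs) f = trans (addˡ (c *ᶻ f x) (∑-scale c xs f)) (sym (ℤP.*-distribˡ-+ c (f x) (∑ xs f)))

 ∑-zero : ∀ (xs : List A) {f} → (∀ {x} → x ∈ xs → f x ≡ 0ℤ) → ∑ xs f ≡ 0ℤ
 ∑-zero []       p = refl
 ∑-zero (x ∷ xs) p = cong₂ _+ᶻ_ (p (here refl)) (∑-zero xs (p ∘ there))

 ∑-neg : ∀ (xs : List A) f → ∑ xs (λ x → -ᶻ f x) ≡ -ᶻ ∑ xs f
 ∑-neg []       f = refl
 ∑-neg (x ∷ xs) f = trans (addˡ (-ᶻ f x) (∑-neg xs f)) (sym (ℤP.neg-distrib-+ (f x) (∑ xs f)))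

 ∑-↭ : ∀ {xs ys : List A} f → xs ↭ ys → ∑ xs f ≡ ∑ ys f
 ∑-↭ f ↭-refl = refl
 ∑-↭ f (prep x p) = addˡ (f x) (∑-↭ f p)
 ∑-↭ f (swap {xs} {ys} x y p) = trans (addˡ (f x) (addˡ (f y) (∑-↭ f p))) (lem (f x) (f y) (∑ ys f))
   where
     lem : ∀ a b c → a +ᶻ (b +ᶻ c) ≡ b +ᶻ (a +ᶻ c)
     lem = solve-∀
 ∑-↭ f (↭-trans p q) = trans (∑-↭ f p) (∑-↭ f q)

 ∑-× : ∀ (xs : List A) (ys : List B) f g →
       ∑ (cartesianProduct xs ys) (λ z → f (proj₁ z) *ᶻ g (proj₂ z)) ≡ ∑ xs f *ᶻ ∑ ys g
 ∑-× []       ys f g = refl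
 ∑-× (x ∷ xs) ys f g = trans (∑-++ (map (x ,_) ys) (cartesianProduct xs ys) _)
   (trans (cong₂ _+ᶻ_ (trans (∑-map (x ,_) ys _) (∑-scale (f x) ys g)) (∑-× xs ys f g))
          (sym (ℤP.*-distribʳ-+ (∑ ys g) (f x) (∑ xs f))))

 ∑-filter : ∀ (P? : Decidable P) xs f → ∑ xs f ≡ ∑ (filter P? xs) f +ᶻ ∑ (filter (¬? ∘ P?) xs) f
 ∑-filter P? []       f = refl
 ∑-filter P? (x ∷ xs) f with P? x
 ... | yes _ = trans (addˡ (f x) (∑-filter P? xs f)) (sym (ℤP.+-assoc (f x) (∑ (filter P? xs) f) _))
 ... | no  _ = trans (addˡ (f x) (∑-filter P? xs f)) (lem (f x) (∑ (filter P? xs) f) (∑ (filter (¬? ∘ P?) xs) f))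
   where
     lem : ∀ a b c → a +ᶻ (b +ᶻ c) ≡ b +ᶻ (a +ᶻ c)
     lem = solve-∀

 -- The bridge from lists to sets: a sum depends only on the predicate that is enumerated, so a
 -- change of variables is a bijection of predicates, whatever the order of the lists.
 record Enum {A : Set} (P : A → Set) (xs : List A) : Set where
   field
     unique   : Unique xs
     sound    : ∀ {x} → x ∈ xs → P x
     complete : ∀ {x} → P x → x ∈ xs
 open Enum public

 map-unique : ∀ (h : A → B) xs → (∀ {x y} → x ∈ xs → y ∈ xs → h x ≡ h y → x ≡ y) → Unique xs → Unique (map h xs)
 map-unique h []       inj u        = []
 map-unique h (x ∷ xs) inj (px ∷ u) =
   AllP.map⁺ (All.tabulate (λ y∈ eq → All.lookup px y∈ (inj (here refl) (there y∈) eq)))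
   ∷ map-unique h xs (λ x∈ y∈ → inj (there x∈) (there y∈)) u

 Enum-map : ∀ {A B : Set} {P : A → Set} {Q : B → Set} {xs} → Enum P xs → (h : A → B) →
            (∀ {x} → P x → Q (h x)) → (∀ {x y} → P x → P y → h x ≡ h y → x ≡ y) →
            (∀ {y} → Q y → ∃ λ x → P x × h x ≡ y) → Enum Q (map h xs)
 Enum-map {Q = Q} {xs = xs} e h pq inj surj = record
   { unique = map-unique h xs (λ x∈ y∈ → inj (sound e x∈) (sound e y∈)) (unique e)
   ; sound = λ y∈ → let x , x∈ , eq = ∈P.∈-map⁻ h y∈ in subst Q (sym eq) (pq (sound e x∈))
   ; complete = λ qy → let x , px , eq = surj qy in subst (_∈ map h xs) eq (∈P.∈-map⁺ h (complete e px)) }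

 Enum-filter : ∀ {A : Set} {P Q : A → Set} {xs} (Q? : Decidable Q) → Enum P xs → Enum (λ x → P x × Q x) (filter Q? xs)
 Enum-filter Q? e = record
   { unique = UniqueP.filter⁺ Q? (unique e)
   ; sound = λ x∈ → let x∈xs , qx = ∈P.∈-filter⁻ Q? x∈ in sound e x∈xs , qx
   ; complete = λ { (px , qx) → ∈P.∈-filter⁺ Q? (complete e px) qx } }

 Enum-⇔ : ∀ {A : Set} {P Q : A → Set} {xs} → (∀ {x} → P x → Q x) → (∀ {x} → Q x → P x) → Enum P xs → Enum Q xs
 Enum-⇔ pq qp e = record { unique = unique e ; sound = pq ∘ sound e ; complete = complete e ∘ qp }

 Enum-++ : ∀ {A : Set} {P Q : A → Set} {xs ys} → Enum P xs → Enum Q ys → (∀ {x} → P x → Q x → ⊥) →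
           Enum (λ x → P x ⊎ Q x) (xs ++ ys)
 Enum-++ {xs = xs} {ys} e e′ disj = record
   { unique = UniqueP.++⁺ (unique e) (unique e′) (λ { (x∈ , x∈′) → disj (sound e x∈) (sound e′ x∈′) })
   ; sound = λ x∈ → Data.Sum.map (sound e) (sound e′) (∈P.∈-++⁻ xs x∈)
   ; complete = λ { (inj₁ p) → ∈P.∈-++⁺ˡ (complete e p) ; (inj₂ q) → ∈P.∈-++⁺ʳ xs (complete e′ q) } }
   where import Data.Sum

 Enum-× : ∀ {A B : Set} {P : A → Set} {Q : B → Set} {xs ys} → Enum P xs → Enum Q ys →
          Enum (λ z → P (proj₁ z) × Q (proj₂ z)) (cartesianProduct xs ys)
 Enum-× {xs = xs} {ys} e e′ = record
   { unique = UniqueP.cartesianProduct⁺ (unique e) (unique e′)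
   ; sound = λ z∈ → let x∈ , y∈ = ∈P.∈-cartesianProduct⁻ xs ys z∈ in sound e x∈ , sound e′ y∈
   ; complete = λ { (p , q) → ∈P.∈-cartesianProduct⁺ (complete e p) (complete e′ q) } }

 ∑-bij : ∀ {A B : Set} {P : A → Set} {Q : B → Set} {xs ys f g} → Enum P xs → Enum Q ys → (h : A → B) →
         (∀ {x} → P x → Q (h x)) → (∀ {x y} → P x → P y → h x ≡ h y → x ≡ y) →
         (∀ {y} → Q y → ∃ λ x → P x × h x ≡ y) → (∀ {x} → P x → f x ≡ g (h x)) → ∑ xs f ≡ ∑ ys g
 ∑-bij {xs = xs} {ys} {f} {g} e e′ h pq inj surj eq =
   trans (∑-cong-∈ xs (λ x∈ → eq (sound e x∈)))
   (trans (sym (∑-map h xs g))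
          (∑-↭ g (∼bag⇒↭ (unique∧set⇒bag (unique m) (unique e′) (mk⇔ (complete e′ ∘ sound m) (complete m ∘ sound e′))))))
   where m = Enum-map e h pq inj surj

 ∑-Enum : ∀ {A : Set} {P : A → Set} {xs ys} f → Enum P xs → Enum P ys → ∑ xs f ≡ ∑ ys f
 ∑-Enum f e e′ = ∑-bij e e′ id id (λ _ _ p → p) (λ p → _ , p , refl) (λ _ → refl)

 ser : (ℕ → List A) → (A → ℤ) → PS
 ser L f n = ∑ (L n) f

 -- Repeats the recursion of `_⊛_`, which makes `ser-⊛` a plain induction.
 _⊠_ : (ℕ → List A) → (ℕ → List B) → ℕ → List (A × B)
 (L ⊠ K) zero    = cartesianProduct (L 0) (K 0)
 (L ⊠ K) (suc n) = cartesianProduct (L 0) (K (suc n)) ++ ((L ∘ suc) ⊠ K) n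

 ser-⊛ : ∀ (L : ℕ → List A) (K : ℕ → List B) f g →
         ser L f ⊛ ser K g ≗ₛ ser (L ⊠ K) (λ z → f (proj₁ z) *ᶻ g (proj₂ z))
 ser-⊛ L K f g zero    = sym (∑-× (L 0) (K 0) f g)
 ser-⊛ L K f g (suc n) = sym (trans (∑-++ (cartesianProduct (L 0) (K (suc n))) _ _)
   (cong₂ _+ᶻ_ (∑-× (L 0) (K (suc n)) f g) (sym (ser-⊛ (L ∘ suc) K f g n))))

 -- The offset o makes the notion stable under tails: `L ∘ suc` is graded with offset o + 1.
 Graded : {A : Set} → (A → ℕ) → (A → Set) → ℕ → (ℕ → List A) → Set
 Graded deg P o L = ∀ n → Enum (λ x → P x × deg x ≡ o ℕ.+ n) (L n)

 -- The bound o ≤ d on the left degree is what the induction needs: the first summand of `_⊠_` holds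
 -- the pairs of left degree exactly o, the tail those of larger left degree.
 ⊠-Graded : ∀ {A B : Set} {d : A → ℕ} {e : B → ℕ} {P : A → Set} {Q : B → Set} {o} {L K} → Graded d P o L → Graded e Q 0 K →
            Graded (λ z → d (proj₁ z) ℕ.+ e (proj₂ z)) (λ z → P (proj₁ z) × Q (proj₂ z) × o ≤ d (proj₁ z)) o (L ⊠ K)
 ⊠-Graded {d = d} {e} {P} {Q} {o} GL GK zero = Enum-⇔
   (λ { ((p , d≡) , (q , e≡)) → (p , q , ℕP.≤-trans (ℕP.m≤m+n o 0) (ℕP.≤-reflexive (sym d≡))) , trans (cong₂ ℕ._+_ d≡ e≡) (ℕP.+-identityʳ _) })
   (λ {z} h → let (p , q , o≤) , eq = h
                  eq′ = trans eq (ℕP.+-identityʳ o)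
                  d≡o = ℕP.≤-antisym (ℕP.≤-trans (ℕP.m≤m+n _ _) (ℕP.≤-reflexive eq′)) o≤
              in (p , trans d≡o (sym (ℕP.+-identityʳ o))) ,
                 (q , ℕP.+-cancelˡ-≡ o _ _ (trans (cong (ℕ._+ e (proj₂ z)) (sym d≡o)) eq)))
   (Enum-× (GL 0) (GK 0))
 ⊠-Graded {d = d} {e} {P} {Q} {o} {L} {K} GL GK (suc n) = Enum-⇔ to from
   (Enum-++ (Enum-× (GL 0) (GK (suc n)))
            (⊠-Graded {o = suc o} (λ i → Enum-⇔ (λ { (p , eq) → p , trans eq (ℕP.+-suc o i) }) (λ { (p , eq) → p , trans eq (sym (ℕP.+-suc o i)) }) (GL (suc i))) GK n)
            (λ { ((_ , eq) , _) ((_ , _ , so≤) , _) → ℕP.<-irrefl refl (ℕP.≤-trans so≤ (ℕP.≤-reflexive (trans eq (ℕP.+-identityʳ o)))) }))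
   where
     R : _ → Set
     R z = (P (proj₁ z) × Q (proj₂ z) × o ≤ d (proj₁ z)) × d (proj₁ z) ℕ.+ e (proj₂ z) ≡ o ℕ.+ suc n
     L₁ : _ → Set
     L₁ z = (P (proj₁ z) × d (proj₁ z) ≡ o ℕ.+ 0) × (Q (proj₂ z) × e (proj₂ z) ≡ suc n)
     L₂ : _ → Set
     L₂ z = (P (proj₁ z) × Q (proj₂ z) × suc o ≤ d (proj₁ z)) × d (proj₁ z) ℕ.+ e (proj₂ z) ≡ suc o ℕ.+ n
     to : ∀ {z} → L₁ z ⊎ L₂ z → R z
     to (inj₁ ((p , d≡) , (q , e≡))) = (p , q , ℕP.≤-trans (ℕP.m≤m+n o 0) (ℕP.≤-reflexive (sym d≡))) ,
                                       trans (cong₂ ℕ._+_ d≡ e≡) (cong (ℕ._+ suc n) (ℕP.+-identityʳ o))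
     to (inj₂ ((p , q , so≤) , eq)) = (p , q , ℕP.<⇒≤ so≤) , trans eq (sym (ℕP.+-suc o n))
     from : ∀ {z} → R z → L₁ z ⊎ L₂ z
     from {z} ((p , q , o≤) , eq) with o ℕ.≟ d (proj₁ z)
     ... | yes o≡ = inj₁ ((p , trans (sym o≡) (sym (ℕP.+-identityʳ o))) ,
                          (q , ℕP.+-cancelˡ-≡ o _ _ (trans (cong (ℕ._+ e (proj₂ z)) o≡) eq)))
     ... | no o≢  = inj₂ ((p , q , ℕP.≤∧≢⇒< o≤ o≢) , trans eq (ℕP.+-suc o n))

 ⊠-Graded₀ : ∀ {A B : Set} {d : A → ℕ} {e : B → ℕ} {P : A → Set} {Q : B → Set} {L K} → Graded d P 0 L → Graded e Q 0 K →
             Graded (λ z → d (proj₁ z) ℕ.+ e (proj₂ z)) (λ z → P (proj₁ z) × Q (proj₂ z)) 0 (L ⊠ K)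
 ⊠-Graded₀ GL GK n = Enum-⇔ (λ { ((p , q , _) , eq) → (p , q) , eq }) (λ { ((p , q) , eq) → (p , q , z≤n) , eq }) (⊠-Graded GL GK n)

-- The operators V, U, q d/dq and q ↦ -q on power series.

module Substitution where

 open PowerSeries

 -- spread k c f places f 0, f 1, … at the exponents c, c + (k+1), c + 2(k+1), …

 spread : ℕ → ℕ → PS → PS
 spread k zero    f zero    = f 0
 spread k zero    f (suc n) = spread k k (tl f) n
 spread k (suc c) f zero    = 0ℤ
 spread k (suc c) f (suc n) = spread k c f n

 -- V k f is f(q^(k+1)), and U k f keeps the coefficients at multiples of k+1.

 V : ℕ → PS → PS
 V k = spread k 0

 U : ℕ → PS → PS
 U k f n = f (n ℕ.* suc k)

 spread-cong : ∀ k c {f g} → f ≗ₛ g → spread k c f ≗ₛ spread k c g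
 spread-cong k zero    p zero    = p 0
 spread-cong k zero    p (suc n) = spread-cong k k (p ∘ suc) n
 spread-cong k (suc c) p zero    = refl
 spread-cong k (suc c) p (suc n) = spread-cong k c p n

 spread-⊕ : ∀ k c f g → spread k c (f ⊕ g) ≗ₛ spread k c f ⊕ spread k c g
 spread-⊕ k zero    f g zero    = refl
 spread-⊕ k zero    f g (suc n) = spread-⊕ k k (tl f) (tl g) n
 spread-⊕ k (suc c) f g zero    = refl
 spread-⊕ k (suc c) f g (suc n) = spread-⊕ k c f g n

 spread-⊝ : ∀ k c f → spread k c (⊝ f) ≗ₛ ⊝ spread k c f
 spread-⊝ k zero    f zero    = refl
 spread-⊝ k zero    f (suc n) = spread-⊝ k k (tl f) n
 spread-⊝ k (suc c) f zero    = refl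
 spread-⊝ k (suc c) f (suc n) = spread-⊝ k c f n

 spread-scale : ∀ k c x f → spread k c (λ i → x *ᶻ f i) ≗ₛ (λ i → x *ᶻ spread k c f i)
 spread-scale k zero    x f zero    = refl
 spread-scale k zero    x f (suc n) = spread-scale k k x (tl f) n
 spread-scale k (suc c) x f zero    = sym (ℤP.*-zeroʳ x)
 spread-scale k (suc c) x f (suc n) = spread-scale k c x f n

 spread-⊛ : ∀ k c f g → spread k c f ⊛ V k g ≗ₛ spread k c (f ⊛ g)
 spread-⊛ k zero    f g zero    = refl
 spread-⊛ k zero    f g (suc n) = trans
   (cong₂ _+ᶻ_ (sym (spread-scale k k (f 0) (tl g) n)) (spread-⊛ k k (tl f) g n))
   (sym (spread-⊕ k k (λ i → f 0 *ᶻ g (suc i)) (tl f ⊛ g) n))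
 spread-⊛ k (suc c) f g zero    = refl
 spread-⊛ k (suc c) f g (suc n) = trans (ℤP.+-identityˡ _) (spread-⊛ k c f g n)

 V-⊛ : ∀ k f g → V k (f ⊛ g) ≗ₛ V k f ⊛ V k g
 V-⊛ k f g n = sym (spread-⊛ k 0 f g n)

 V-con : ∀ k x → V k (con x) ≗ₛ con x
 V-con k x zero    = refl
 V-con k x (suc n) = go k k n
   where
     go : ∀ k c n → spread k c (λ _ → 0ℤ) n ≡ 0ℤ
     go k zero    zero    = refl
     go k zero    (suc n) = go k k n
     go k (suc c) zero    = refl
     go k (suc c) (suc n) = go k c n

 spread-at : ∀ k c f m → spread k c f (c ℕ.+ m ℕ.* suc k) ≡ f m
 spread-at k zero    f zero    = refl
 spread-at k zero    f (suc m) = spread-at k k (tl f) m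
 spread-at k (suc c) f m       = spread-at k c f m

 V-at : ∀ k f m → V k f (m ℕ.* suc k) ≡ f m
 V-at k = spread-at k 0

 spread-off : ∀ k c f r m → c ≤ k → r ≤ k → r ≢ c → spread k c f (r ℕ.+ m ℕ.* suc k) ≡ 0ℤ
 spread-off k zero    f zero    m       c≤ r≤ r≢ = ⊥-elim (r≢ refl)
 spread-off k zero    f (suc r) m       c≤ r≤ r≢ = spread-off k k (tl f) r m ℕP.≤-refl (ℕP.<⇒≤ r≤) (λ { refl → ℕP.<-irrefl refl r≤ })
 spread-off k (suc c) f zero    zero    c≤ r≤ r≢ = refl
 spread-off k (suc c) f zero    (suc m) c≤ r≤ r≢ = spread-off k c f k m (ℕP.<⇒≤ c≤) ℕP.≤-refl (λ { refl → ℕP.<-irrefl refl c≤ })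
 spread-off k (suc c) f (suc r) m       c≤ r≤ r≢ = spread-off k c f r m (ℕP.<⇒≤ c≤) (ℕP.<⇒≤ r≤) (r≢ ∘ cong suc)

 spread-skip : ∀ k c f g n → (spread k c f ⊛ g) (c ℕ.+ n) ≡ (V k f ⊛ g) n
 spread-skip k zero    f g n = refl
 spread-skip k (suc c) f g n = trans (ℤP.+-identityˡ _) (spread-skip k c f g n)

 -- A factor in q^(k+1) passes through the section. Combined with Frobenius, p-th powers modulo p
 -- do.
 U-V : ∀ k f g → U k (V k f ⊛ g) ≗ₛ f ⊛ U k g
 U-V k f g zero    = refl
 U-V k f g (suc n) = addˡ (f 0 *ᶻ g (suc n ℕ.* suc k)) (trans (spread-skip k k (tl f) g (n ℕ.* suc k)) (U-V k (tl f) g n))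

 D : PS → PS
 D f n = + n *ᶻ f n

 D-⊛ : ∀ f g → D (f ⊛ g) ≗ₛ D f ⊛ g ⊕ f ⊛ D g
 D-⊛ f g zero = sym (trans (cong₂ _+ᶻ_ (ℤP.*-zeroˡ (g 0)) (ℤP.*-zeroʳ (f 0))) refl)
 D-⊛ f g (suc n) = trans (lem₁ (+ n) (f 0) (g (suc n)) ((tl f ⊛ g) n))
   (trans (cong (λ z → f 0 *ᶻ ((1ℤ +ᶻ + n) *ᶻ g (suc n)) +ᶻ (z +ᶻ (tl f ⊛ g) n)) (D-⊛ (tl f) g n))
   (trans (lem₂ (f 0 *ᶻ ((1ℤ +ᶻ + n) *ᶻ g (suc n))) ((D (tl f) ⊛ g) n) ((tl f ⊛ D g) n) ((tl f ⊛ g) n))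
   (cong (λ z → z +ᶻ (f 0 *ᶻ ((1ℤ +ᶻ + n) *ᶻ g (suc n)) +ᶻ (tl f ⊛ D g) n))
     (sym (trans (ℤP.+-identityˡ _)
       (trans (⊛-cong (λ i → lem₃ (+ i) (f (suc i))) (λ _ → refl) n)
              (⊛-distribʳ g (D (tl f)) (tl f) n)))))))
   where
     lem₁ : ∀ n a b c → (1ℤ +ᶻ n) *ᶻ (a *ᶻ b +ᶻ c) ≡ a *ᶻ ((1ℤ +ᶻ n) *ᶻ b) +ᶻ (n *ᶻ c +ᶻ c)
     lem₁ = solve-∀
     lem₂ : ∀ x a b c → x +ᶻ (a +ᶻ b +ᶻ c) ≡ (a +ᶻ c) +ᶻ (x +ᶻ b)
     lem₂ = solve-∀
     lem₃ : ∀ n a → (1ℤ +ᶻ n) *ᶻ a ≡ n *ᶻ a +ᶻ a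
     lem₃ = solve-∀

 D-⊕ : ∀ f g → D (f ⊕ g) ≗ₛ D f ⊕ D g
 D-⊕ f g n = ℤP.*-distribˡ-+ (+ n) (f n) (g n)

 -- The offset o counts the coefficients already passed, because a tail forgets its exponents.
 D-spread : ∀ k c o f n → (+ (o ℕ.+ n)) *ᶻ spread k c f n ≡ spread k c (λ m → + (o ℕ.+ (c ℕ.+ m ℕ.* suc k)) *ᶻ f m) n
 D-spread k zero    o f zero    = refl
 D-spread k zero    o f (suc n) =
   trans (cong (λ z → + z *ᶻ spread k k (tl f) n) (ℕP.+-suc o n))
   (trans (D-spread k k (suc o) (tl f) n)
          (spread-cong k k (λ m → cong (λ z → + z *ᶻ f (suc m)) (lem o k (m ℕ.* suc k))) n))
   where
     lem : ∀ o k x → suc o ℕ.+ (k ℕ.+ x) ≡ o ℕ.+ (suc k ℕ.+ x)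
     lem = ℕSolver.solve-∀
 D-spread k (suc c) o f zero    = ℤP.*-zeroʳ (+ (o ℕ.+ 0))
 D-spread k (suc c) o f (suc n) =
   trans (cong (λ z → + z *ᶻ spread k c f n) (ℕP.+-suc o n))
   (trans (D-spread k c (suc o) f n)
          (spread-cong k c (λ m → cong (λ z → + z *ᶻ f m) (sym (ℕP.+-suc o (c ℕ.+ m ℕ.* suc k)))) n))

 D-V : ∀ k f → D (V k f) ≗ₛ (λ n → + suc k *ᶻ V k (D f) n)
 D-V k f n = trans (D-spread k 0 0 f n)
   (trans (spread-cong k 0 (λ m → trans (cong (λ z → z *ᶻ f m) (trans (cong +_ (ℕP.*-comm m (suc k))) (ℤP.pos-* (suc k) m))) (ℤP.*-assoc (+ suc k) (+ m) (f m))) n)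
          (spread-scale k 0 (+ suc k) (D f) n))

 sgn : ℕ → ℤ
 sgn zero    = 1ℤ
 sgn (suc n) = -ᶻ sgn n

 alt : PS → PS
 alt f n = sgn n *ᶻ f n

 alt-⊛ : ∀ f g → alt (f ⊛ g) ≗ₛ alt f ⊛ alt g
 alt-⊛ f g zero    = lem (f 0) (g 0)
   where
     lem : ∀ x y → 1ℤ *ᶻ (x *ᶻ y) ≡ 1ℤ *ᶻ x *ᶻ (1ℤ *ᶻ y)
     lem = solve-∀
 alt-⊛ f g (suc n) = trans (lem (sgn n) (f 0) (g (suc n)) ((tl f ⊛ g) n))
   (addˡ (1ℤ *ᶻ f 0 *ᶻ (-ᶻ sgn n *ᶻ g (suc n)))
     (trans (cong -ᶻ_ (alt-⊛ (tl f) g n))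
     (trans (lem′ ((alt (tl f) ⊛ alt g) n))
     (trans (sym (scale-⊛ (-ᶻ 1ℤ) (alt (tl f)) (alt g) n))
            (⊛-cong (λ i → lem″ (sgn i) (f (suc i))) (λ _ → refl) n)))))
   where
     lem : ∀ s x y z → -ᶻ s *ᶻ (x *ᶻ y +ᶻ z) ≡ 1ℤ *ᶻ x *ᶻ (-ᶻ s *ᶻ y) +ᶻ -ᶻ (s *ᶻ z)
     lem = solve-∀
     lem′ : ∀ z → -ᶻ z ≡ -ᶻ 1ℤ *ᶻ z
     lem′ = solve-∀
     lem″ : ∀ s z → -ᶻ 1ℤ *ᶻ (s *ᶻ z) ≡ -ᶻ s *ᶻ z
     lem″ = solve-∀

 ev od : ℕ → ℤ
 ev zero    = 1ℤ
 ev (suc n) = od n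
 od zero    = 0ℤ
 od (suc n) = ev n

 data Parity : ℕ → Set where
   even : ∀ m → Parity (m ℕ.* 2)
   odd  : ∀ m → Parity (suc (m ℕ.* 2))

 parity : ∀ n → Parity n
 parity zero = even 0
 parity (suc n) with parity n
 ... | even m = odd m
 ... | odd m  = even (suc m)

 sgn-even : ∀ m → sgn (m ℕ.* 2) ≡ 1ℤ
 sgn-even zero    = refl
 sgn-even (suc m) = trans (ℤP.neg-involutive (sgn (m ℕ.* 2))) (sgn-even m)

 ev-even : ∀ m → ev (m ℕ.* 2) ≡ 1ℤ
 ev-even zero    = refl
 ev-even (suc m) = ev-even m

 od-even : ∀ m → od (m ℕ.* 2) ≡ 0ℤ
 od-even zero    = refl
 od-even (suc m) = od-even m

 ev-sgn : ∀ n → ev n ≡ od n +ᶻ sgn n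
 ev-sgn n with parity n
 ... | even m rewrite ev-even m | od-even m | sgn-even m = refl
 ... | odd m rewrite ev-even m | od-even m | sgn-even m = refl

 ev+od : ∀ n → ev n +ᶻ od n ≡ 1ℤ
 ev+od zero    = refl
 ev+od (suc n) = trans (ℤP.+-comm (od n) (ev n)) (ev+od n)

 sgn-+ : ∀ m n → sgn (m ℕ.+ n) ≡ sgn m *ᶻ sgn n
 sgn-+ zero    n = sym (ℤP.*-identityˡ (sgn n))
 sgn-+ (suc m) n = trans (cong -ᶻ_ (sgn-+ m n)) (ℤP.neg-distribˡ-* (sgn m) (sgn n))

 sgn-*2 : ∀ n → sgn n *ᶻ sgn n ≡ 1ℤ
 sgn-*2 n with parity n
 ... | even m rewrite sgn-even m = refl
 ... | odd m rewrite sgn-even m = refl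

-- Theta series and Landen's transformation.

module ThetaSeries where

 open PowerSeries
 open FiniteSums
 open Substitution

 sq : ℤ → ℕ
 sq s = ∣ s ∣ ℕ.* ∣ s ∣

 +sq : ∀ s → + sq s ≡ s *ᶻ s
 +sq (+ n)    = trans (ℤP.pos-* n n) refl
 +sq -[1+ n ] = refl

 symRange : ℕ → List ℤ
 symRange zero    = 0ℤ ∷ []
 symRange (suc n) = + suc n ∷ -[1+ n ] ∷ symRange n

 symRange-Enum : ∀ n → Enum (λ s → ∣ s ∣ ≤ n) (symRange n)
 symRange-Enum n = record { unique = uq n ; sound = so n ; complete = co n }
   where
     so : ∀ n {s} → s ∈ symRange n → ∣ s ∣ ≤ n
     so zero    (here refl)         = z≤n
     so (suc n) (here refl)         = ℕP.≤-refl
     so (suc n) (there (here refl)) = ℕP.≤-refl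
     so (suc n) (there (there p))   = ℕP.m≤n⇒m≤1+n (so n p)
     co : ∀ n {s} → ∣ s ∣ ≤ n → s ∈ symRange n
     co zero    {+ zero} p = here refl
     co (suc n) {s} p with ∣ s ∣ ℕ.≟ suc n
     co (suc n) {+ .(suc n)} p | yes refl    = here refl
     co (suc n) { -[1+ .n ]} p | yes refl = there (here refl)
     ... | no ≢ = there (there (co n (ℕP.≤-pred (ℕP.≤∧≢⇒< p ≢))))
     uq : ∀ n → Unique (symRange n)
     uq zero    = [] ∷ []
     uq (suc n) = ((λ ()) ∷ All.tabulate (λ s∈ eq → ℕP.<-irrefl (cong ∣_∣ (sym eq)) (s≤s (so n s∈))))
                ∷ All.tabulate (λ s∈ eq → ℕP.<-irrefl (cong ∣_∣ (sym eq)) (s≤s (so n s∈)))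
                ∷ uq n

 roots : ℕ → List ℤ
 roots n = filter (λ s → sq s ℕ.≟ n) (symRange n)

 n≤n*n : ∀ n → n ≤ n ℕ.* n
 n≤n*n zero    = z≤n
 n≤n*n (suc n) = ℕP.m≤m+n (suc n) _

 roots-Graded : Graded sq (λ _ → ⊤) 0 roots
 roots-Graded n = Enum-⇔ (λ { (_ , eq) → tt , eq }) (λ { {s} (_ , eq) → ℕP.≤-trans (n≤n*n ∣ s ∣) (ℕP.≤-reflexive eq) , eq })
                    (Enum-filter (λ s → sq s ℕ.≟ n) (symRange-Enum n))

 -- θ = θ₃, split as a + b by the parity of s; then θ(-q) = a - b.

 θ θ₄ a b : PS
 θ  = ser roots (λ _ → 1ℤ)
 θ₄ = ser roots (λ s → sgn ∣ s ∣)
 a  = ser roots (λ s → ev ∣ s ∣)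
 b  = ser roots (λ s → od ∣ s ∣)

 θ≗a+b : θ ≗ₛ a ⊕ b
 θ≗a+b n = trans (∑-cong (roots n) (λ s → sym (ev+od ∣ s ∣))) (∑-⊕ (roots n) _ _)

 θ₄≗a-b : θ₄ ≗ₛ a ⊖ b
 θ₄≗a-b n = trans (∑-cong (roots n) (λ s → lem (ev-sgn ∣ s ∣)))
   (trans (∑-⊕ (roots n) _ _) (addˡ (a n) (∑-neg (roots n) _)))
   where
     lem : ∀ {x y z} → x ≡ y +ᶻ z → z ≡ x +ᶻ -ᶻ y
     lem {y = y} {z} refl = lem′ y z
       where
         lem′ : ∀ y z → z ≡ y +ᶻ z +ᶻ -ᶻ y
         lem′ = solve-∀

 sgn-sq : ∀ s → sgn (sq s) ≡ sgn ∣ s ∣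
 sgn-sq s = go ∣ s ∣
   where
     odd-sq : ∀ m → suc (m ℕ.* 2) ℕ.* suc (m ℕ.* 2) ≡ suc ((m ℕ.* suc (m ℕ.* 2) ℕ.+ m) ℕ.* 2)
     odd-sq = ℕSolver.solve-∀
     go : ∀ n → sgn (n ℕ.* n) ≡ sgn n
     go n with parity n
     ... | even m = trans (cong sgn (sym (ℕP.*-assoc (m ℕ.* 2) m 2))) (trans (sgn-even (m ℕ.* 2 ℕ.* m)) (sym (sgn-even m)))
     ... | odd m  = trans (cong sgn (odd-sq m)) (cong -ᶻ_ (trans (sgn-even (m ℕ.* suc (m ℕ.* 2) ℕ.+ m)) (sym (sgn-even m))))

 altθ : alt θ ≗ₛ θ₄
 altθ n = trans (sym (∑-scale (sgn n) (roots n) (λ _ → 1ℤ)))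
   (∑-cong-∈ (roots n) (λ {s} s∈ → trans (ℤP.*-identityʳ (sgn n))
      (trans (cong sgn (sym (proj₂ (sound (roots-Graded n) s∈)))) (sgn-sq s))))

 halve : ∀ x → (∃ λ u → x ≡ u +ᶻ u) ⊎ (∃ λ u → x ≡ 1ℤ +ᶻ (u +ᶻ u))
 halve (+ n) with parity n
 ... | even m = inj₁ (+ m , cong +_ (lem m))
   where
     lem : ∀ m → m ℕ.* 2 ≡ m ℕ.+ m
     lem = ℕSolver.solve-∀
 ... | odd m  = inj₂ (+ m , cong +_ (lem m))
   where
     lem : ∀ m → 1 ℕ.+ m ℕ.* 2 ≡ 1 ℕ.+ (m ℕ.+ m)
     lem = ℕSolver.solve-∀
 halve -[1+ n ] with halve (+ n)
 ... | inj₁ (u , eq) = inj₂ (-ᶻ 1ℤ +ᶻ -ᶻ u , trans (cong (λ z → -ᶻ (1ℤ +ᶻ z)) eq) (lem u))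
   where
     lem : ∀ u → -ᶻ (1ℤ +ᶻ (u +ᶻ u)) ≡ 1ℤ +ᶻ ((-ᶻ 1ℤ +ᶻ -ᶻ u) +ᶻ (-ᶻ 1ℤ +ᶻ -ᶻ u))
     lem = solve-∀
 ... | inj₂ (u , eq) = inj₁ (-ᶻ 1ℤ +ᶻ -ᶻ u , trans (cong (λ z → -ᶻ (1ℤ +ᶻ z)) eq) (lem u))
   where
     lem : ∀ u → -ᶻ (1ℤ +ᶻ (1ℤ +ᶻ (u +ᶻ u))) ≡ (-ᶻ 1ℤ +ᶻ -ᶻ u) +ᶻ (-ᶻ 1ℤ +ᶻ -ᶻ u)
     lem = solve-∀

 double-injective : ∀ {x y} → x +ᶻ x ≡ y +ᶻ y → x ≡ y
 double-injective {x} {y} p = ℤP.*-cancelˡ-≡ (+ 2) x y (trans (lem x) (trans p (sym (lem y))))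
   where
     lem : ∀ x → + 2 *ᶻ x ≡ x +ᶻ x
     lem = solve-∀

 odd≢even : ∀ {x y} → 1ℤ +ᶻ (x +ᶻ x) ≢ y +ᶻ y
 odd≢even {x} {y} p = contra {y -ᶻ x} (trans (lem₁ x y) (trans (cong (_+ᶻ (-ᶻ x +ᶻ -ᶻ x)) p) (lem₂ x y)))
   where
     lem₁ : ∀ x y → 1ℤ ≡ 1ℤ +ᶻ (x +ᶻ x) +ᶻ (-ᶻ x +ᶻ -ᶻ x)
     lem₁ = solve-∀
     lem₂ : ∀ x y → y +ᶻ y +ᶻ (-ᶻ x +ᶻ -ᶻ x) ≡ (y -ᶻ x) +ᶻ (y -ᶻ x)
     lem₂ = solve-∀
     contra : ∀ {z} → 1ℤ ≡ z +ᶻ z → ⊥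
     contra {+ zero} ()
     contra {+ suc n} q with trans q (cong +_ (cong suc (ℕP.+-suc n n)))
     ... | ()
     contra { -[1+ n ]} ()

 deg₂ : ℤ × ℤ → ℕ
 deg₂ z = sq (proj₁ z) ℕ.+ sq (proj₂ z)

 pairs : ℕ → List (ℤ × ℤ)
 pairs = roots ⊠ roots

 pairs-Enum : ∀ n → Enum (λ z → deg₂ z ≡ n) (pairs n)
 pairs-Enum n = Enum-⇔ proj₂ (λ eq → (tt , tt) , eq) (⊠-Graded₀ roots-Graded roots-Graded n)

 +deg₂ : ∀ x y → + deg₂ (x , y) ≡ x *ᶻ x +ᶻ y *ᶻ y
 +deg₂ x y = cong₂ _+ᶻ_ (+sq x) (+sq y)

 rotate : ℤ × ℤ → ℤ × ℤ
 rotate (u , v) = u +ᶻ v , u -ᶻ v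

 -- Rotation by 45 degrees doubles the norm. It reaches every pair of even norm, because x² + y² is
 -- even only if x + y is.
 ∑-rotate : ∀ m {w w′ : ℤ × ℤ → ℤ} → (∀ z → w z ≡ w′ (rotate z)) → ∑ (pairs m) w ≡ ∑ (pairs (m ℕ.* 2)) w′
 ∑-rotate m {w} {w′} eq = ∑-bij (pairs-Enum m) (pairs-Enum (m ℕ.* 2)) rotate
   (λ { {u , v} p → ℤP.+-injective (trans (+deg₂ (u +ᶻ v) (u -ᶻ v)) (trans (lem u v)
         (trans (cong (λ z → z *ᶻ + 2) (trans (sym (+deg₂ u v)) (cong +_ p))) (sym (ℤP.pos-* m 2))))) })
   (λ { {u , v} {u′ , v′} _ _ p → inj u v u′ v′ (cong proj₁ p) (cong proj₂ p) })
   (λ { {x , y} p → surj x y p })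
   (λ {z} _ → eq z)
   where
     lem : ∀ u v → (u +ᶻ v) *ᶻ (u +ᶻ v) +ᶻ (u -ᶻ v) *ᶻ (u -ᶻ v) ≡ (u *ᶻ u +ᶻ v *ᶻ v) *ᶻ + 2
     lem = solve-∀
     inj : ∀ u v u′ v′ → u +ᶻ v ≡ u′ +ᶻ v′ → u -ᶻ v ≡ u′ -ᶻ v′ → (u , v) ≡ (u′ , v′)
     inj u v u′ v′ p q = cong₂ _,_
       (double-injective (trans (l₁ u v) (trans (cong₂ _+ᶻ_ p q) (sym (l₁ u′ v′)))))
       (double-injective (trans (l₂ u v) (trans (cong₂ _-ᶻ_ p q) (sym (l₂ u′ v′)))))
       where
         l₁ : ∀ u v → u +ᶻ u ≡ (u +ᶻ v) +ᶻ (u -ᶻ v)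
         l₁ = solve-∀
         l₂ : ∀ u v → v +ᶻ v ≡ (u +ᶻ v) -ᶻ (u -ᶻ v)
         l₂ = solve-∀
     surj : ∀ x y → deg₂ (x , y) ≡ m ℕ.* 2 → ∃ λ z → deg₂ z ≡ m × rotate z ≡ (x , y)
     surj x y p with halve (x +ᶻ y)
     ... | inj₁ (u , eq′) = (u , u -ᶻ y) , ℤP.+-injective (double-injective (trans (l₁ u y) (trans step (l₂ (+ m)))))
                        , cong₂ _,_ (trans (l₃ u y) (trans (cong (_-ᶻ y) (sym eq′)) (l₄ x y))) (l₅ u y)
       where
         l₁ : ∀ u y → + deg₂ (u , u -ᶻ y) +ᶻ + deg₂ (u , u -ᶻ y) ≡ (u +ᶻ u -ᶻ y) *ᶻ (u +ᶻ u -ᶻ y) +ᶻ y *ᶻ y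
         l₁ u y = trans (cong (λ z → z +ᶻ z) (+deg₂ u (u -ᶻ y))) (l u y)
           where
             l : ∀ u y → (u *ᶻ u +ᶻ (u -ᶻ y) *ᶻ (u -ᶻ y)) +ᶻ (u *ᶻ u +ᶻ (u -ᶻ y) *ᶻ (u -ᶻ y)) ≡ (u +ᶻ u -ᶻ y) *ᶻ (u +ᶻ u -ᶻ y) +ᶻ y *ᶻ y
             l = solve-∀
         l₂ : ∀ m → m *ᶻ + 2 ≡ m +ᶻ m
         l₂ = solve-∀
         l₄ : ∀ x y → x +ᶻ y -ᶻ y ≡ x
         l₄ = solve-∀
         step : (u +ᶻ u -ᶻ y) *ᶻ (u +ᶻ u -ᶻ y) +ᶻ y *ᶻ y ≡ + m *ᶻ + 2
         step = trans (cong (λ z → z *ᶻ z +ᶻ y *ᶻ y) (trans (cong (_-ᶻ y) (sym eq′)) (l₄ x y)))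
                      (trans (sym (+deg₂ x y)) (trans (cong +_ p) (ℤP.pos-* m 2)))
         l₃ : ∀ u y → u +ᶻ (u -ᶻ y) ≡ u +ᶻ u -ᶻ y
         l₃ = solve-∀
         l₅ : ∀ u y → u -ᶻ (u -ᶻ y) ≡ y
         l₅ = solve-∀
     -- From x + y = 1 + 2u the norm (x + y)² - 2xy equals 1 + 2(2u + 2u² - xy), which is odd.
     ... | inj₂ (u , eq′) = ⊥-elim (odd≢even {u +ᶻ u +ᶻ u *ᶻ u +ᶻ u *ᶻ u -ᶻ x *ᶻ y} {+ m} (trans (l₁ x y u) (trans (cong (λ z → z *ᶻ z +ᶻ -ᶻ (x *ᶻ y +ᶻ x *ᶻ y)) (sym eq′))
                         (trans (l₂ x y) (trans (sym (+deg₂ x y)) (trans (cong +_ p) (trans (ℤP.pos-* m 2) (l₃ (+ m)))))))))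
       where
         l₁ : ∀ x y u → 1ℤ +ᶻ ((u +ᶻ u +ᶻ u *ᶻ u +ᶻ u *ᶻ u -ᶻ x *ᶻ y) +ᶻ (u +ᶻ u +ᶻ u *ᶻ u +ᶻ u *ᶻ u -ᶻ x *ᶻ y)) ≡ (1ℤ +ᶻ (u +ᶻ u)) *ᶻ (1ℤ +ᶻ (u +ᶻ u)) +ᶻ -ᶻ (x *ᶻ y +ᶻ x *ᶻ y)
         l₁ = solve-∀
         l₂ : ∀ x y → (x +ᶻ y) *ᶻ (x +ᶻ y) +ᶻ -ᶻ (x *ᶻ y +ᶻ x *ᶻ y) ≡ x *ᶻ x +ᶻ y *ᶻ y
         l₂ = solve-∀
         l₃ : ∀ m → m *ᶻ + 2 ≡ m +ᶻ m
         l₃ = solve-∀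

 ev-+ : ∀ m n → ev (m ℕ.+ n) ≡ ev m *ᶻ ev n +ᶻ od m *ᶻ od n
 od-+ : ∀ m n → od (m ℕ.+ n) ≡ od m *ᶻ ev n +ᶻ ev m *ᶻ od n
 ev-+ zero    n = sym (trans (ℤP.+-identityʳ _) (ℤP.*-identityˡ (ev n)))
 ev-+ (suc m) n = od-+ m n
 od-+ zero    n = sym (trans (ℤP.+-identityˡ _) (ℤP.*-identityˡ (od n)))
 od-+ (suc m) n = ev-+ m n

 ev-square : ∀ n → ev (n ℕ.* n) ≡ ev n
 ev-square n with parity n
 ... | even m = trans (cong ev (sym (ℕP.*-assoc (m ℕ.* 2) m 2))) (trans (ev-even (m ℕ.* 2 ℕ.* m)) (sym (ev-even m)))
 ... | odd m  = trans (cong ev (lem m)) (trans (od-even (m ℕ.* suc (m ℕ.* 2) ℕ.+ m)) (sym (od-even m)))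
   where
     lem : ∀ m → suc (m ℕ.* 2) ℕ.* suc (m ℕ.* 2) ≡ suc ((m ℕ.* suc (m ℕ.* 2) ℕ.+ m) ℕ.* 2)
     lem = ℕSolver.solve-∀

 od-square : ∀ n → od (n ℕ.* n) ≡ od n
 od-square n with parity n
 ... | even m = trans (cong od (sym (ℕP.*-assoc (m ℕ.* 2) m 2))) (trans (od-even (m ℕ.* 2 ℕ.* m)) (sym (od-even m)))
 ... | odd m  = trans (cong od (lem m)) (trans (ev-even (m ℕ.* suc (m ℕ.* 2) ℕ.+ m)) (sym (ev-even m)))
   where
     lem : ∀ m → suc (m ℕ.* 2) ℕ.* suc (m ℕ.* 2) ≡ suc ((m ℕ.* suc (m ℕ.* 2) ℕ.+ m) ℕ.* 2)
     lem = ℕSolver.solve-∀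

 ev-deg₂ : ∀ x y → ev (deg₂ (x , y)) ≡ ev ∣ x ∣ *ᶻ ev ∣ y ∣ +ᶻ od ∣ x ∣ *ᶻ od ∣ y ∣
 ev-deg₂ x y = trans (ev-+ (sq x) (sq y))
   (cong₂ _+ᶻ_ (cong₂ _*ᶻ_ (ev-square ∣ x ∣) (ev-square ∣ y ∣)) (cong₂ _*ᶻ_ (od-square ∣ x ∣) (od-square ∣ y ∣)))

 sgn-⊖ : ∀ m n → sgn ∣ m ℤ.⊖ n ∣ ≡ sgn m *ᶻ sgn n
 sgn-⊖ m       zero    = trans (cong (sgn ∘ ∣_∣) (ℤP.⊖-≥ {m} {0} z≤n)) (sym (ℤP.*-identityʳ (sgn m)))
 sgn-⊖ zero    (suc n) = sym (ℤP.*-identityˡ _)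
 sgn-⊖ (suc m) (suc n) = trans (cong (sgn ∘ ∣_∣) (ℤP.[1+m]⊖[1+n]≡m⊖n m n)) (trans (sgn-⊖ m n) (lem (sgn m) (sgn n)))
   where
     lem : ∀ x y → x *ᶻ y ≡ -ᶻ x *ᶻ -ᶻ y
     lem = solve-∀

 sgn-+ℤ : ∀ x y → sgn ∣ x +ᶻ y ∣ ≡ sgn ∣ x ∣ *ᶻ sgn ∣ y ∣
 sgn-+ℤ (+ m)    (+ n)    = sgn-+ m n
 sgn-+ℤ (+ m)    -[1+ n ] = sgn-⊖ m (suc n)
 sgn-+ℤ -[1+ m ] (+ n)    = trans (sgn-⊖ n (suc m)) (ℤP.*-comm (sgn n) _)
 sgn-+ℤ -[1+ m ] -[1+ n ] = trans (cong (λ z → -ᶻ -ᶻ z) (sgn-+ m n)) (lem (sgn m) (sgn n))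
   where
     lem : ∀ x y → -ᶻ -ᶻ (x *ᶻ y) ≡ -ᶻ x *ᶻ -ᶻ y
     lem = solve-∀

 sgn*ev : ∀ n → sgn n *ᶻ ev n ≡ ev n
 sgn*ev n with parity n
 ... | even m rewrite ev-even m | sgn-even m = refl
 ... | odd m rewrite od-even m = ℤP.*-zeroʳ (-ᶻ sgn (m ℕ.* 2))

 sgn*od : ∀ n → sgn n *ᶻ od n ≡ -ᶻ od n
 sgn*od n with parity n
 ... | even m rewrite od-even m | sgn-even m = refl
 ... | odd m rewrite ev-even m | sgn-even m = refl

 V-odd : ∀ f m → V 1 f (suc (m ℕ.* 2)) ≡ 0ℤ
 V-odd f m = spread-off 1 0 f 1 m z≤n (s≤s z≤n) (λ ())

 V₂ : PS → PS
 V₂ = V 1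

 V₂-char : ∀ {f g} → (∀ m → f (m ℕ.* 2) ≡ g m) → (∀ m → f (suc (m ℕ.* 2)) ≡ 0ℤ) → f ≗ₛ V₂ g
 V₂-char {f} {g} p q n with parity n
 ... | even m = trans (p m) (sym (V-at 1 g m))
 ... | odd m  = trans (q m) (sym (V-odd g m))

 -- The factor `ev` keeps the points of even norm, and these are the rotated points of half the
 -- norm.
 landen : (w : ℤ → ℤ) (r : ℤ × ℤ → ℤ) → (∀ u v → r (u , v) ≡ w (u +ᶻ v)) →
          ser pairs (λ z → w (proj₁ z) *ᶻ ev (deg₂ z)) ≗ₛ V₂ (ser pairs r)
 landen w r eq = V₂-char
   (λ m → trans (∑-cong-∈ (pairs (m ℕ.* 2)) (λ {z} z∈ → trans (cong (λ d → w (proj₁ z) *ᶻ ev d) (sound (pairs-Enum (m ℕ.* 2)) z∈))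
                   (trans (cong (w (proj₁ z) *ᶻ_) (ev-even m)) (ℤP.*-identityʳ (w (proj₁ z))))))
                (sym (∑-rotate m {w′ = w ∘ proj₁} (λ { (u , v) → eq u v }))))
   (λ m → ∑-zero (pairs (suc (m ℕ.* 2))) (λ {z} z∈ → trans (cong (λ d → w (proj₁ z) *ᶻ ev d) (sound (pairs-Enum (suc (m ℕ.* 2))) z∈))
                   (trans (cong (w (proj₁ z) *ᶻ_) (od-even m)) (ℤP.*-zeroʳ (w (proj₁ z))))))

 landen₊ : a ⊛ a ⊕ b ⊛ b ≗ₛ V₂ (θ ⊛ θ)
 landen₊ n = trans (cong₂ _+ᶻ_ (ser-⊛ roots roots _ _ n) (ser-⊛ roots roots _ _ n))
   (trans (sym (∑-⊕ (pairs n) _ _))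
   (trans (∑-cong (pairs n) (λ { (x , y) → trans (sym (ev-deg₂ x y)) (sym (ℤP.*-identityˡ _)) }))
   (trans (landen (λ _ → 1ℤ) (λ _ → 1ℤ) (λ _ _ → refl) n)
          (spread-cong 1 0 (λ i → sym (ser-⊛ roots roots (λ _ → 1ℤ) (λ _ → 1ℤ) i)) n))))

 -- On points of even norm the weight is the sign of x. After rotation x = u + v, and the sign of a
 -- sum is the product of the signs.
 landen₋ : a ⊛ a ⊖ b ⊛ b ≗ₛ V₂ (θ₄ ⊛ θ₄)
 landen₋ n = trans (cong₂ _-ᶻ_ (ser-⊛ roots roots _ _ n) (ser-⊛ roots roots _ _ n))
   (trans (addˡ (∑ (pairs n) (λ z → ev ∣ proj₁ z ∣ *ᶻ ev ∣ proj₂ z ∣)) (sym (∑-neg (pairs n) (λ z → od ∣ proj₁ z ∣ *ᶻ od ∣ proj₂ z ∣))))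
   (trans (sym (∑-⊕ (pairs n) _ _))
   (trans (∑-cong (pairs n) (λ { (x , y) → lem x y }))
   (trans (landen (λ x → sgn ∣ x ∣) (λ z → sgn ∣ proj₁ z ∣ *ᶻ sgn ∣ proj₂ z ∣) (λ u v → sym (sgn-+ℤ u v)) n)
          (spread-cong 1 0 (λ i → sym (ser-⊛ roots roots _ _ i)) n)))))
   where
     lem : ∀ x y → ev ∣ x ∣ *ᶻ ev ∣ y ∣ +ᶻ -ᶻ (od ∣ x ∣ *ᶻ od ∣ y ∣) ≡ sgn ∣ x ∣ *ᶻ ev (deg₂ (x , y))
     lem x y = sym (trans (cong (sgn ∣ x ∣ *ᶻ_) (ev-deg₂ x y))
       (trans (l₁ (sgn ∣ x ∣) (ev ∣ x ∣) (ev ∣ y ∣) (od ∣ x ∣) (od ∣ y ∣))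
       (trans (cong₂ (λ s t → s *ᶻ ev ∣ y ∣ +ᶻ t *ᶻ od ∣ y ∣) (sgn*ev ∣ x ∣) (sgn*od ∣ x ∣))
              (l₂ (ev ∣ x ∣) (ev ∣ y ∣) (od ∣ x ∣) (od ∣ y ∣)))))
       where
         l₁ : ∀ s x y u v → s *ᶻ (x *ᶻ y +ᶻ u *ᶻ v) ≡ s *ᶻ x *ᶻ y +ᶻ s *ᶻ u *ᶻ v
         l₁ = solve-∀
         l₂ : ∀ x y u v → x *ᶻ y +ᶻ -ᶻ u *ᶻ v ≡ x *ᶻ y +ᶻ -ᶻ (u *ᶻ v)
         l₂ = solve-∀

-- The Wronskian of the two halves of θ.

module Wronskian where

 open PowerSeries
 open Substitution
 open ThetaSeries

 module ≗-Reasoning = SetoidReasoning S.setoid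

 ⊕-double : ∀ {f g} → f ⊕ f ≗ₛ g ⊕ g → f ≗ₛ g
 ⊕-double p n = double-injective (p n)

 V₂-⊕ : ∀ f g → V₂ (f ⊕ g) ≗ₛ V₂ f ⊕ V₂ g
 V₂-⊕ = spread-⊕ 1 0

 V₂-⊛ : ∀ f g → V₂ (f ⊛ g) ≗ₛ V₂ f ⊛ V₂ g
 V₂-⊛ = V-⊛ 1

 V₂-cong : ∀ {f g} → f ≗ₛ g → V₂ f ≗ₛ V₂ g
 V₂-cong = spread-cong 1 0

 V₂-⊖ : ∀ f g → V₂ (f ⊖ g) ≗ₛ V₂ f ⊖ V₂ g
 V₂-⊖ f g = S.trans (V₂-⊕ f (⊝ g)) (S.+-cong {V₂ f} S.refl (spread-⊝ 1 0 g))

 a′ b′ : PS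
 a′ = V₂ a
 b′ = V₂ b

 landenθ² : a ⊛ a ⊕ b ⊛ b ≗ₛ (a′ ⊕ b′) ⊛ (a′ ⊕ b′)
 landenθ² = S.trans landen₊ (S.trans (V₂-⊛ θ θ) (S.*-cong eq eq))
   where
     eq : V₂ θ ≗ₛ a′ ⊕ b′
     eq = S.trans (V₂-cong θ≗a+b) (V₂-⊕ a b)

 landenθ₄² : a ⊛ a ⊖ b ⊛ b ≗ₛ (a′ ⊖ b′) ⊛ (a′ ⊖ b′)
 landenθ₄² = S.trans landen₋ (S.trans (V₂-⊛ θ₄ θ₄) (S.*-cong eq eq))
   where
     eq : V₂ θ₄ ≗ₛ a′ ⊖ b′
     eq = S.trans (V₂-cong θ₄≗a-b) (V₂-⊖ a b)

 -- Half the sum of the two Landen identities, as `b²` is half their difference. Together they are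
 -- the duplication formulas of the halves.
 a² : a ⊛ a ≗ₛ a′ ⊛ a′ ⊕ b′ ⊛ b′
 a² = ⊕-double (S.trans (S.solve 2 (λ x y → x :+ x S.:= (x :+ y) :+ (x :- y)) S.refl (a ⊛ a) (b ⊛ b))
   (S.trans (S.+-cong landenθ² landenθ₄²)
     (S.solve 2 (λ x y → (x :+ y) :* (x :+ y) :+ (x :- y) :* (x :- y) S.:= (x :* x :+ y :* y) :+ (x :* x :+ y :* y)) S.refl a′ b′)))
   where open S using (_:+_; _:*_; _:-_)

 b² : b ⊛ b ≗ₛ a′ ⊛ b′ ⊕ a′ ⊛ b′
 b² = ⊕-double (S.trans (S.solve 2 (λ x y → y :+ y S.:= (x :+ y) :- (x :- y)) S.refl (a ⊛ a) (b ⊛ b))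
   (S.trans (S.+-cong landenθ² (S.-‿cong landenθ₄²))
     (S.solve 2 (λ x y → (x :+ y) :* (x :+ y) :- (x :- y) :* (x :- y) S.:= (x :* y :+ x :* y) :+ (x :* y :+ x :* y)) S.refl a′ b′)))
   where open S using (_:+_; _:*_; _:-_)

 D-cong : ∀ {f g} → f ≗ₛ g → D f ≗ₛ D g
 D-cong p n = cong (+ n *ᶻ_) (p n)

 D-V₂ : ∀ f → D (V₂ f) ≗ₛ V₂ (D f) ⊕ V₂ (D f)
 D-V₂ f n = trans (D-V 1 f n) (lem (V₂ (D f) n))
   where
     lem : ∀ x → + 2 *ᶻ x ≡ x +ᶻ x
     lem = solve-∀

 D-square : ∀ f → D (f ⊛ f) ≗ₛ f ⊛ D f ⊕ f ⊛ D f
 D-square f = S.trans (D-⊛ f f) (S.+-cong {D f ⊛ f} (S.*-comm (D f) f) S.refl)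

 α β : PS
 α = V₂ (D a)
 β = V₂ (D b)

 -- The duplication formula differentiated; q d/dq picks up a factor 2 when q is replaced by q².
 aDa : a ⊛ D a ≗ₛ (a′ ⊛ α ⊕ b′ ⊛ β) ⊕ (a′ ⊛ α ⊕ b′ ⊛ β)
 aDa = ⊕-double (begin
   a ⊛ D a ⊕ a ⊛ D a                             ≈⟨ S.sym (D-square a) ⟩
   D (a ⊛ a)                                     ≈⟨ D-cong a² ⟩
   D (a′ ⊛ a′ ⊕ b′ ⊛ b′)                         ≈⟨ D-⊕ (a′ ⊛ a′) (b′ ⊛ b′) ⟩
   D (a′ ⊛ a′) ⊕ D (b′ ⊛ b′)                     ≈⟨ S.+-cong (D-square a′) (D-square b′) ⟩
   (a′ ⊛ D a′ ⊕ a′ ⊛ D a′) ⊕ (b′ ⊛ D b′ ⊕ b′ ⊛ D b′)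
     ≈⟨ S.+-cong (S.+-cong (S.*-cong {a′} S.refl (D-V₂ a)) (S.*-cong {a′} S.refl (D-V₂ a)))
                 (S.+-cong (S.*-cong {b′} S.refl (D-V₂ b)) (S.*-cong {b′} S.refl (D-V₂ b))) ⟩
   (a′ ⊛ (α ⊕ α) ⊕ a′ ⊛ (α ⊕ α)) ⊕ (b′ ⊛ (β ⊕ β) ⊕ b′ ⊛ (β ⊕ β))
     ≈⟨ S.solve 4 (λ a′ b′ α β → (a′ :* (α :+ α) :+ a′ :* (α :+ α)) :+ (b′ :* (β :+ β) :+ b′ :* (β :+ β))
          S.:= ((a′ :* α :+ b′ :* β) :+ (a′ :* α :+ b′ :* β)) :+ ((a′ :* α :+ b′ :* β) :+ (a′ :* α :+ b′ :* β))) S.refl a′ b′ α β ⟩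
   ((a′ ⊛ α ⊕ b′ ⊛ β) ⊕ (a′ ⊛ α ⊕ b′ ⊛ β)) ⊕ ((a′ ⊛ α ⊕ b′ ⊛ β) ⊕ (a′ ⊛ α ⊕ b′ ⊛ β)) ∎)
   where
     open ≗-Reasoning
     open S using (_:+_; _:*_; _:-_)

 bDb : b ⊛ D b ≗ₛ (a′ ⊛ β ⊕ b′ ⊛ α) ⊕ (a′ ⊛ β ⊕ b′ ⊛ α)
 bDb = ⊕-double (begin
   b ⊛ D b ⊕ b ⊛ D b                             ≈⟨ S.sym (D-square b) ⟩
   D (b ⊛ b)                                     ≈⟨ D-cong b² ⟩
   D (a′ ⊛ b′ ⊕ a′ ⊛ b′)                         ≈⟨ D-⊕ (a′ ⊛ b′) (a′ ⊛ b′) ⟩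
   D (a′ ⊛ b′) ⊕ D (a′ ⊛ b′)                     ≈⟨ S.+-cong eq eq ⟩
   ((α ⊕ α) ⊛ b′ ⊕ a′ ⊛ (β ⊕ β)) ⊕ ((α ⊕ α) ⊛ b′ ⊕ a′ ⊛ (β ⊕ β))
     ≈⟨ S.solve 4 (λ a′ b′ α β → ((α :+ α) :* b′ :+ a′ :* (β :+ β)) :+ ((α :+ α) :* b′ :+ a′ :* (β :+ β))
          S.:= ((a′ :* β :+ b′ :* α) :+ (a′ :* β :+ b′ :* α)) :+ ((a′ :* β :+ b′ :* α) :+ (a′ :* β :+ b′ :* α))) S.refl a′ b′ α β ⟩
   ((a′ ⊛ β ⊕ b′ ⊛ α) ⊕ (a′ ⊛ β ⊕ b′ ⊛ α)) ⊕ ((a′ ⊛ β ⊕ b′ ⊛ α) ⊕ (a′ ⊛ β ⊕ b′ ⊛ α)) ∎)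
   where
     open ≗-Reasoning
     open S using (_:+_; _:*_; _:-_)
     eq : D (a′ ⊛ b′) ≗ₛ (α ⊕ α) ⊛ b′ ⊕ a′ ⊛ (β ⊕ β)
     eq = S.trans (D-⊛ a′ b′) (S.+-cong (S.*-cong (D-V₂ a) (S.refl {b′})) (S.*-cong (S.refl {a′}) (D-V₂ b)))

 Δ₁ Δ₂ : PS
 Δ₁ = a ⊛ D b ⊖ b ⊛ D a
 Δ₂ = (a ⊛ b) ⊛ ((a ⊛ a ⊕ b ⊛ b) ⊛ (a ⊛ a ⊖ b ⊛ b))

 -- Both sides satisfy ab·Δ = 2(a′² - b′²)·V₂ Δ, by Landen's transformation.

 Δ₁-landen : (a ⊛ b) ⊛ Δ₁ ≗ₛ (a′ ⊛ a′ ⊖ b′ ⊛ b′) ⊛ (V₂ Δ₁ ⊕ V₂ Δ₁)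
 Δ₁-landen = begin
   (a ⊛ b) ⊛ (a ⊛ D b ⊖ b ⊛ D a)
     ≈⟨ S.solve 4 (λ a b x y → (a :* b) :* (a :* y :- b :* x) S.:= (a :* a) :* (b :* y) :- (b :* b) :* (a :* x)) S.refl a b (D a) (D b) ⟩
   (a ⊛ a) ⊛ (b ⊛ D b) ⊖ (b ⊛ b) ⊛ (a ⊛ D a)
     ≈⟨ S.+-cong (S.*-cong a² bDb) (S.-‿cong (S.*-cong b² aDa)) ⟩
   (a′ ⊛ a′ ⊕ b′ ⊛ b′) ⊛ ((a′ ⊛ β ⊕ b′ ⊛ α) ⊕ (a′ ⊛ β ⊕ b′ ⊛ α)) ⊖ (a′ ⊛ b′ ⊕ a′ ⊛ b′) ⊛ ((a′ ⊛ α ⊕ b′ ⊛ β) ⊕ (a′ ⊛ α ⊕ b′ ⊛ β))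
     ≈⟨ S.solve 4 (λ a′ b′ α β →
          (a′ :* a′ :+ b′ :* b′) :* ((a′ :* β :+ b′ :* α) :+ (a′ :* β :+ b′ :* α)) :- (a′ :* b′ :+ a′ :* b′) :* ((a′ :* α :+ b′ :* β) :+ (a′ :* α :+ b′ :* β))
          S.:= (a′ :* a′ :- b′ :* b′) :* ((a′ :* β :- b′ :* α) :+ (a′ :* β :- b′ :* α))) S.refl a′ b′ α β ⟩
   (a′ ⊛ a′ ⊖ b′ ⊛ b′) ⊛ ((a′ ⊛ β ⊖ b′ ⊛ α) ⊕ (a′ ⊛ β ⊖ b′ ⊛ α))
     ≈⟨ S.*-cong (S.refl {a′ ⊛ a′ ⊖ b′ ⊛ b′}) (S.+-cong (S.sym eq) (S.sym eq)) ⟩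
   (a′ ⊛ a′ ⊖ b′ ⊛ b′) ⊛ (V₂ Δ₁ ⊕ V₂ Δ₁) ∎
   where
     open ≗-Reasoning
     open S using (_:+_; _:*_; _:-_)
     eq : V₂ Δ₁ ≗ₛ a′ ⊛ β ⊖ b′ ⊛ α
     eq = S.trans (V₂-⊖ (a ⊛ D b) (b ⊛ D a)) (S.+-cong (V₂-⊛ a (D b)) (S.-‿cong (V₂-⊛ b (D a))))

 Δ₂-landen : (a ⊛ b) ⊛ Δ₂ ≗ₛ (a′ ⊛ a′ ⊖ b′ ⊛ b′) ⊛ (V₂ Δ₂ ⊕ V₂ Δ₂)
 Δ₂-landen = begin
   (a ⊛ b) ⊛ ((a ⊛ b) ⊛ ((a ⊛ a ⊕ b ⊛ b) ⊛ (a ⊛ a ⊖ b ⊛ b)))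
     ≈⟨ S.solve 3 (λ a b x → (a :* b) :* ((a :* b) :* x) S.:= ((a :* a) :* (b :* b)) :* x) S.refl a b ((a ⊛ a ⊕ b ⊛ b) ⊛ (a ⊛ a ⊖ b ⊛ b)) ⟩
   ((a ⊛ a) ⊛ (b ⊛ b)) ⊛ ((a ⊛ a ⊕ b ⊛ b) ⊛ (a ⊛ a ⊖ b ⊛ b))
     ≈⟨ S.*-cong (S.*-cong a² b²) (S.*-cong landenθ² landenθ₄²) ⟩
   ((a′ ⊛ a′ ⊕ b′ ⊛ b′) ⊛ (a′ ⊛ b′ ⊕ a′ ⊛ b′)) ⊛ (((a′ ⊕ b′) ⊛ (a′ ⊕ b′)) ⊛ ((a′ ⊖ b′) ⊛ (a′ ⊖ b′)))
     ≈⟨ S.solve 2 (λ a′ b′ → ((a′ :* a′ :+ b′ :* b′) :* (a′ :* b′ :+ a′ :* b′)) :* (((a′ :+ b′) :* (a′ :+ b′)) :* ((a′ :- b′) :* (a′ :- b′)))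
          S.:= (a′ :* a′ :- b′ :* b′) :* ((a′ :* b′) :* ((a′ :* a′ :+ b′ :* b′) :* (a′ :* a′ :- b′ :* b′)) :+ (a′ :* b′) :* ((a′ :* a′ :+ b′ :* b′) :* (a′ :* a′ :- b′ :* b′)))) S.refl a′ b′ ⟩
   (a′ ⊛ a′ ⊖ b′ ⊛ b′) ⊛ ((a′ ⊛ b′) ⊛ ((a′ ⊛ a′ ⊕ b′ ⊛ b′) ⊛ (a′ ⊛ a′ ⊖ b′ ⊛ b′)) ⊕ (a′ ⊛ b′) ⊛ ((a′ ⊛ a′ ⊕ b′ ⊛ b′) ⊛ (a′ ⊛ a′ ⊖ b′ ⊛ b′)))
     ≈⟨ S.*-cong (S.refl {a′ ⊛ a′ ⊖ b′ ⊛ b′}) (S.+-cong (S.sym eq) (S.sym eq)) ⟩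
   (a′ ⊛ a′ ⊖ b′ ⊛ b′) ⊛ (V₂ Δ₂ ⊕ V₂ Δ₂) ∎
   where
     open ≗-Reasoning
     open S using (_:+_; _:*_; _:-_)
     eq : V₂ Δ₂ ≗ₛ (a′ ⊛ b′) ⊛ ((a′ ⊛ a′ ⊕ b′ ⊛ b′) ⊛ (a′ ⊛ a′ ⊖ b′ ⊛ b′))
     eq = S.trans (V₂-⊛ (a ⊛ b) _) (S.*-cong (V₂-⊛ a b) (S.trans (V₂-⊛ _ _)
       (S.*-cong (S.trans (V₂-⊕ (a ⊛ a) (b ⊛ b)) (S.+-cong (V₂-⊛ a a) (V₂-⊛ b b)))
                 (S.trans (V₂-⊖ (a ⊛ a) (b ⊛ b)) (S.+-cong (V₂-⊛ a a) (S.-‿cong (V₂-⊛ b b)))))))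

 vanish-⊛ : ∀ f g r → (∀ i → i ≤ r → g i ≡ 0ℤ) → (f ⊛ g) r ≡ 0ℤ
 vanish-⊛ f g r p = trans (low-⊛ f g r (λ i i<r → p i (ℕP.<⇒≤ i<r))) (trans (cong (f 0 *ᶻ_) (p r ℕP.≤-refl)) (ℤP.*-zeroʳ (f 0)))

 -- Let δ be the difference of the sides. The series ab begins with 2q, so if δ vanishes below r,
 -- coefficient r + 1 of ab·δ is 2δ(r). In the other expression for ab·δ only δ(m) with 2m ≤ r + 1
 -- occurs there, and m < r once r ≥ 2. The coefficients 0 and 1 are computed.
 wronskian : Δ₁ ≗ₛ Δ₂
 wronskian n = ℤP.i-j≡0⇒i≡j (Δ₁ n) (Δ₂ n) (<-rec (λ n → δ n ≡ 0ℤ) step n)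
   where
     δ : PS
     δ = Δ₁ ⊖ Δ₂
     δ-landen : (a ⊛ b) ⊛ δ ≗ₛ (a′ ⊛ a′ ⊖ b′ ⊛ b′) ⊛ (V₂ δ ⊕ V₂ δ)
     δ-landen = begin
       (a ⊛ b) ⊛ (Δ₁ ⊖ Δ₂)   ≈⟨ S.solve 3 (λ c x y → c :* (x :- y) S.:= c :* x :- c :* y) S.refl (a ⊛ b) Δ₁ Δ₂ ⟩
       (a ⊛ b) ⊛ Δ₁ ⊖ (a ⊛ b) ⊛ Δ₂ ≈⟨ S.+-cong Δ₁-landen (S.-‿cong Δ₂-landen) ⟩
       c ⊛ (V₂ Δ₁ ⊕ V₂ Δ₁) ⊖ c ⊛ (V₂ Δ₂ ⊕ V₂ Δ₂)
         ≈⟨ S.solve 3 (λ c x y → c :* (x :+ x) :- c :* (y :+ y) S.:= c :* ((x :- y) :+ (x :- y))) S.refl c (V₂ Δ₁) (V₂ Δ₂) ⟩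
       c ⊛ ((V₂ Δ₁ ⊖ V₂ Δ₂) ⊕ (V₂ Δ₁ ⊖ V₂ Δ₂)) ≈⟨ S.*-cong (S.refl {c}) (S.+-cong (S.sym (V₂-⊖ Δ₁ Δ₂)) (S.sym (V₂-⊖ Δ₁ Δ₂))) ⟩
       c ⊛ (V₂ δ ⊕ V₂ δ) ∎
       where
         open ≗-Reasoning
         open S using (_:+_; _:*_; _:-_)
         c = a′ ⊛ a′ ⊖ b′ ⊛ b′
     step : ∀ n → (∀ {i} → i < n → δ i ≡ 0ℤ) → δ n ≡ 0ℤ
     step 0 _ = refl
     step 1 _ = refl
     step r@(suc (suc r′)) ih = ℤP.*-cancelˡ-≡ (+ 2) (δ r) 0ℤ (trans (sym lhs) rhs)
       where
         lhs : ((a ⊛ b) ⊛ δ) (suc r) ≡ + 2 *ᶻ δ r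
         lhs = trans (ℤP.+-identityˡ _) (low-⊛ (tl (a ⊛ b)) δ r (λ i i<r → ih i<r))
         Vδ : ∀ i → i ≤ suc r → V₂ δ i ≡ 0ℤ
         Vδ i i≤ with parity i
         ... | odd m  = V-odd δ m
         ... | even m = trans (V-at 1 δ m) (ih (ℕP.*-cancelʳ-< 2 m r (ℕP.≤-trans (s≤s i≤) (bound r′))))
           where
             bound : ∀ r′ → suc (suc (suc (suc r′))) ≤ suc (suc r′) ℕ.* 2
             bound r′ = s≤s (s≤s (s≤s (s≤s (ℕP.m≤m*n r′ 2))))
         rhs : ((a ⊛ b) ⊛ δ) (suc r) ≡ + 2 *ᶻ 0ℤ
         rhs = trans (δ-landen (suc r)) (vanish-⊛ (a′ ⊛ a′ ⊖ b′ ⊛ b′) (V₂ δ ⊕ V₂ δ) (suc r) (λ i i≤ → cong₂ _+ᶻ_ (Vδ i i≤) (Vδ i i≤)))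

-- Gauss's identity for the generating function of overpartitions.

module Gauss where

 open PowerSeries
 open FiniteSums
 open Substitution
 open ThetaSeries
 open Wronskian
 open import Data.Bool using (T)

 -- Gauss: θ(-q) ∏ (1 + q^n)/(1 - q^n) = 1

 mon : ℕ → PS
 mon zero            = con 1ℤ
 mon (suc k) zero    = 0ℤ
 mon (suc k) (suc n) = mon k n

 mon-< : ∀ k f i → i < k → (mon k ⊛ f) i ≡ 0ℤ
 mon-< (suc k) f zero    p       = refl
 mon-< (suc k) f (suc i) (s≤s p) = trans (ℤP.+-identityˡ _) (mon-< k f i p)

 mon-shift : ∀ k f n → (mon k ⊛ f) (k ℕ.+ n) ≡ f n
 mon-shift zero    f n = trans (con-⊛ 1ℤ f n) (ℤP.*-identityˡ (f n))
 mon-shift (suc k) f n = trans (ℤP.+-identityˡ _) (mon-shift k f n)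

 mon-+ : ∀ j k → mon (j ℕ.+ k) ≗ₛ mon j ⊛ mon k
 mon-+ zero    k n       = sym (trans (con-⊛ 1ℤ (mon k) n) (ℤP.*-identityˡ (mon k n)))
 mon-+ (suc j) k zero    = refl
 mon-+ (suc j) k (suc n) = trans (mon-+ j k n) (sym (ℤP.+-identityˡ _))

 mon-diag : ∀ k → mon k k ≡ 1ℤ
 mon-diag zero    = refl
 mon-diag (suc k) = mon-diag k

 mon-off : ∀ k n → k ≢ n → mon k n ≡ 0ℤ
 mon-off zero    zero    p = ⊥-elim (p refl)
 mon-off zero    (suc n) p = refl
 mon-off (suc k) zero    p = refl
 mon-off (suc k) (suc n) p = mon-off k n (p ∘ cong suc)

 cast : Defs.Series → PS
 cast f n = + f n

 mul1+-cast : ∀ k f → cast (Defs.mul1+ k f) ≗ₛ (con 1ℤ ⊕ mon k) ⊛ cast f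
 mul1+-cast k f n = trans (go n) (sym (trans (⊛-distribʳ (cast f) (con 1ℤ) (mon k) n)
                                             (cong (λ z → z +ᶻ (mon k ⊛ cast f) n) (trans (con-⊛ 1ℤ (cast f) n) (ℤP.*-identityˡ (+ f n))))))
   where
     go : ∀ n → cast (Defs.mul1+ k f) n ≡ + f n +ᶻ (mon k ⊛ cast f) n
     go n with n ℕ.<ᵇ k in eq
     ... | true  = sym (trans (addˡ (+ f n) (mon-< k (cast f) n (ℕP.<ᵇ⇒< n k (subst T (sym eq) tt)))) (ℤP.+-identityʳ _))
     ... | false = addˡ (+ f n) (sym (trans (cong (mon k ⊛ cast f) (sym (ℕP.m+[n∸m]≡n k≤n))) (mon-shift k (cast f) (n ℕ.∸ k))))
       where
         k≤n : k ≤ n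
         k≤n = ℕP.≮⇒≥ (λ n<k → subst T eq (ℕP.<⇒<ᵇ n<k))

 geomSum-fuel : ∀ fuel fuel′ k f n → n ≤ fuel → n ≤ fuel′ → Defs.geomSum fuel (suc k) f n ≡ Defs.geomSum fuel′ (suc k) f n
 geomSum-fuel zero    zero    k f n p q = refl
 geomSum-fuel zero    (suc x) k f zero p q = refl
 geomSum-fuel (suc x) zero    k f zero p q = refl
 geomSum-fuel (suc x) (suc y) k f n p q with n ℕ.<ᵇ suc k
 ... | true  = refl
 ... | false = cong (f n ℕ.+_) (geomSum-fuel x y k f (n ℕ.∸ suc k) (bound n p) (bound n q))
   where
     bound : ∀ n {z} → n ≤ suc z → n ℕ.∸ suc k ≤ z
     bound zero    _       = z≤n
     bound (suc n) (s≤s p) = ℕP.≤-trans (ℕP.m∸n≤m n k) p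

 mul1/1--cast : ∀ k f → (con 1ℤ ⊖ mon (suc k)) ⊛ cast (Defs.mul1/1- (suc k) f) ≗ₛ cast f
 mul1/1--cast k f n = trans (⊛-distribʳ g (con 1ℤ) (⊝ mon (suc k)) n)
   (trans (cong₂ _+ᶻ_ (trans (con-⊛ 1ℤ g n) (ℤP.*-identityˡ (g n))) (trans (⊛-cong (λ i → lem (mon (suc k) i)) (λ _ → refl) n) (trans (scale-⊛ (-ᶻ 1ℤ) (mon (suc k)) g n) (sym (lem _)))))
          (go n))
   where
     g : PS
     g = cast (Defs.mul1/1- (suc k) f)
     lem : ∀ z → -ᶻ z ≡ -ᶻ 1ℤ *ᶻ z
     lem = solve-∀
     cancel : ∀ x y → x +ᶻ y +ᶻ -ᶻ y ≡ x
     cancel = solve-∀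
     go : ∀ n → g n +ᶻ -ᶻ (mon (suc k) ⊛ g) n ≡ + f n
     go zero    = ℤP.+-identityʳ _
     go (suc n) with suc n ℕ.<ᵇ suc k in eq
     ... | true  = trans (addˡ (+ f (suc n)) (cong -ᶻ_ (mon-< (suc k) g (suc n) (ℕP.<ᵇ⇒< (suc n) (suc k) (subst T (sym eq) tt))))) (ℤP.+-identityʳ _)
     ... | false = trans (addˡ (+ (f (suc n) ℕ.+ Defs.geomSum n (suc k) f (n ℕ.∸ k)))
                      (cong -ᶻ_ (trans (cong (mon (suc k) ⊛ g) (sym (ℕP.m+[n∸m]≡n k≤n)))
                                 (trans (mon-shift (suc k) g (suc n ℕ.∸ suc k)) (cong +_ (geomSum-fuel (n ℕ.∸ k) n k f (n ℕ.∸ k) ℕP.≤-refl (ℕP.m∸n≤m n k)))))))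
                   (cancel (+ f (suc n)) (+ Defs.geomSum n (suc k) f (n ℕ.∸ k)))
       where
         k≤n : suc k ≤ suc n
         k≤n = ℕP.≮⇒≥ (λ n<k → subst T eq (ℕP.<⇒<ᵇ n<k))

 -- P n is the partial product, R (s) = P (s-1)/(1 - q^s).

 P R : ℕ → PS
 P n = cast (Defs.partialProd n)
 R zero    = con 0ℤ
 R (suc s) = cast (Defs.mul1/1- (suc s) (Defs.partialProd s))

 P-cast : ∀ s → (con 1ℤ ⊖ mon (suc s)) ⊛ P (suc s) ≗ₛ (con 1ℤ ⊕ mon (suc s)) ⊛ P s
 P-cast s = S.trans (mul1/1--cast s (Defs.mul1+ (suc s) (Defs.partialProd s))) (mul1+-cast (suc s) (Defs.partialProd s))

 R-cast : ∀ s → (con 1ℤ ⊖ mon (suc s)) ⊛ R (suc s) ≗ₛ P s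
 R-cast s = mul1/1--cast s (Defs.partialProd s)

 cancel-unit : ∀ f {g h} → f 0 ≡ 1ℤ → f ⊛ g ≗ₛ f ⊛ h → g ≗ₛ h
 cancel-unit f {g} {h} f0 eq n = ℤP.i-j≡0⇒i≡j (g n) (h n) (<-rec (λ n → (g ⊖ h) n ≡ 0ℤ) step n)
   where
     fδ : ∀ n → (f ⊛ (g ⊖ h)) n ≡ 0ℤ
     fδ n = trans (⊛-distribˡ f g (⊝ h) n)
       (trans (cong (λ z → z +ᶻ (f ⊛ ⊝ h) n) (eq n))
       (trans (sym (⊛-distribˡ f h (⊝ h) n)) (vanish-⊛ f (h ⊖ h) n (λ i _ → ℤP.+-inverseʳ (h i)))))
     step : ∀ n → (∀ {i} → i < n → (g ⊖ h) i ≡ 0ℤ) → (g ⊖ h) n ≡ 0ℤ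
     step n ih = trans (sym (ℤP.*-identityˡ _)) (trans (cong (_*ᶻ (g ⊖ h) n) (sym f0)) (trans (sym (low-⊛ f (g ⊖ h) n (λ i → ih))) (fδ n)))

 P-R : ∀ s → P (suc s) ≗ₛ (con 1ℤ ⊕ mon (suc s)) ⊛ R (suc s)
 P-R s = cancel-unit (con 1ℤ ⊖ mon (suc s)) refl (S.trans (P-cast s)
   (S.trans (S.*-cong (S.refl {con 1ℤ ⊕ mon (suc s)}) (S.sym (R-cast s)))
            (S.solve 2 (λ x r → (S.:con 1ℤ :+ x) :* ((S.:con 1ℤ :- x) :* r) S.:= (S.:con 1ℤ :- x) :* ((S.:con 1ℤ :+ x) :* r)) S.refl (mon (suc s)) (R (suc s)))))
   where open S using (_:+_; _:*_; _:-_)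

 -- The error term in Shanks's finite form of Gauss's identity, with the exponent e left free for
 -- telescoping.
 G : ℕ → ℕ → PS
 G e zero    = con 0ℤ
 G e (suc n) = G e n ⊕ con (sgn (suc n)) ⊛ (R (suc n) ⊛ mon (suc n ℕ.* e))

 con-neg : ∀ x → con (-ᶻ x) ≗ₛ ⊝ con x
 con-neg x zero    = refl
 con-neg x (suc n) = refl

 -- Passing from exponent m to m + 1 multiplies the s-th term by q^s. Since (1 - q^s)R(s) = P(s-1)
 -- and (1 + q^s)R(s) = P(s), the successive boundary terms cancel.
 telescope : ∀ m n → (con 1ℤ ⊕ mon m) ⊛ G m n ≗ₛ (con 1ℤ ⊖ mon m) ⊛ G (suc m) n ⊕ (con (sgn n) ⊛ (mon (suc n ℕ.* m) ⊛ P n) ⊖ mon m)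
 telescope m zero = S.trans
   (S.solve 1 (λ x → (S.:con 1ℤ :+ x) :* S.:con 0ℤ S.:= (S.:con 1ℤ :- x) :* S.:con 0ℤ :+ (S.:con 1ℤ :* (x :* S.:con 1ℤ) :- x)) S.refl (mon m))
   (S.+-cong {(con 1ℤ ⊖ mon m) ⊛ con 0ℤ} S.refl (S.+-cong {y = con 1ℤ ⊛ (mon (1 ℕ.* m) ⊛ P 0)} (S.*-cong (S.refl {con 1ℤ}) (S.*-cong (λ i → cong (λ z → mon z i) (sym (ℕP.*-identityˡ m))) P0)) S.refl))
   where
     open S using (_:+_; _:*_; _:-_)
     P0 : con 1ℤ ≗ₛ P 0
     P0 zero    = refl
     P0 (suc _) = refl
 telescope m (suc n) = begin
   (con 1ℤ ⊕ Q) ⊛ (G m n ⊕ σ′ ⊛ (r ⊛ mon (suc n ℕ.* m)))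
     ≈⟨ ⊛-distribˡ (con 1ℤ ⊕ Q) (G m n) _ ⟩
   (con 1ℤ ⊕ Q) ⊛ G m n ⊕ (con 1ℤ ⊕ Q) ⊛ (σ′ ⊛ (r ⊛ M))
     ≈⟨ S.+-cong (telescope m n) (S.*-cong (S.refl {con 1ℤ ⊕ Q}) (S.*-cong (con-neg (sgn n)) (S.refl {r ⊛ M}))) ⟩
   ((con 1ℤ ⊖ Q) ⊛ G (suc m) n ⊕ (σ ⊛ (M ⊛ P n) ⊖ Q)) ⊕ (con 1ℤ ⊕ Q) ⊛ (⊝ σ ⊛ (r ⊛ M))
     ≈⟨ S.+-cong (S.+-cong (S.refl {(con 1ℤ ⊖ Q) ⊛ G (suc m) n}) (S.+-cong (S.*-cong (S.refl {σ}) (S.*-cong (S.refl {M}) (S.sym (R-cast n)))) (S.refl {⊝ Q}))) S.refl ⟩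
   ((con 1ℤ ⊖ Q) ⊛ G (suc m) n ⊕ (σ ⊛ (M ⊛ ((con 1ℤ ⊖ t) ⊛ r)) ⊖ Q)) ⊕ (con 1ℤ ⊕ Q) ⊛ (⊝ σ ⊛ (r ⊛ M))
     ≈⟨ S.solve 6 (λ Q g σ M t r →
          ((S.:con 1ℤ :- Q) :* g :+ (σ :* (M :* ((S.:con 1ℤ :- t) :* r)) :- Q)) :+ (S.:con 1ℤ :+ Q) :* (:- σ :* (r :* M))
          S.:= (S.:con 1ℤ :- Q) :* (g :+ :- σ :* (r :* (t :* M))) :+ (:- σ :* ((Q :* M) :* ((S.:con 1ℤ :+ t) :* r)) :- Q)) S.refl Q (G (suc m) n) σ M t r ⟩
   (con 1ℤ ⊖ Q) ⊛ (G (suc m) n ⊕ ⊝ σ ⊛ (r ⊛ (t ⊛ M))) ⊕ (⊝ σ ⊛ ((Q ⊛ M) ⊛ ((con 1ℤ ⊕ t) ⊛ r)) ⊖ Q)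
     ≈⟨ S.+-cong (S.*-cong (S.refl {con 1ℤ ⊖ Q}) (S.+-cong (S.refl {G (suc m) n}) (S.*-cong (S.sym (con-neg (sgn n))) (S.*-cong (S.refl {r}) (S.sym tM)))))
                 (S.+-cong (S.*-cong (S.sym (con-neg (sgn n))) (S.*-cong (S.sym (mon-+ m (suc n ℕ.* m))) (S.sym (P-R n)))) (S.refl {⊝ Q})) ⟩
   (con 1ℤ ⊖ Q) ⊛ G (suc m) (suc n) ⊕ (σ′ ⊛ (mon (suc (suc n) ℕ.* m) ⊛ P (suc n)) ⊖ Q) ∎
   where
     open ≗-Reasoning
     open S using (_:+_; _:*_; _:-_; :-_)
     Q = mon m
     σ = con (sgn n)
     σ′ = con (sgn (suc n))
     M = mon (suc n ℕ.* m)
     t = mon (suc n)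
     r = R (suc n)
     tM : mon (suc n ℕ.* suc m) ≗ₛ t ⊛ M
     tM = S.trans (λ i → cong (λ z → mon z i) (ℕP.*-suc (suc n) m)) (mon-+ (suc n) (suc n ℕ.* m))

 Θ : ℕ → PS
 Θ zero    = con 1ℤ
 Θ (suc n) = Θ n ⊕ con (+ 2) ⊛ (con (sgn (suc n)) ⊛ mon (suc n ℕ.* suc n))

 -- Shanks's finite identity. As `G (suc n) n` starts at q^(n+1), the partial theta sum and the
 -- partial product are inverse to each other up to order n, which is all that `gauss` needs for
 -- coefficient n.
 shanks : ∀ n → Θ n ⊛ P n ≗ₛ con 1ℤ ⊕ con (+ 2) ⊛ G (suc n) n
 shanks zero    = S.trans (S.*-cong (S.refl {con 1ℤ}) P0) (S.solve 0 (S.:con 1ℤ :* S.:con 1ℤ S.:= S.:con 1ℤ :+ S.:con (+ 2) :* S.:con 0ℤ) S.refl)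
   where
     open S using (_:+_; _:*_; _:-_)
     P0 : P 0 ≗ₛ con 1ℤ
     P0 zero    = refl
     P0 (suc _) = refl
 -- Multiplication by 1 - q^(n+1) clears the denominators of P(n+1) and R(n+1).
 shanks (suc n) = cancel-unit (con 1ℤ ⊖ Q) refl (begin
   (con 1ℤ ⊖ Q) ⊛ ((Θ n ⊕ con (+ 2) ⊛ (σ′ ⊛ M)) ⊛ P m)
     ≈⟨ S.solve 4 (λ Q t x p → (S.:con 1ℤ :- Q) :* ((t :+ x) :* p) S.:= (t :+ x) :* ((S.:con 1ℤ :- Q) :* p)) S.refl Q (Θ n) _ (P m) ⟩
   (Θ n ⊕ con (+ 2) ⊛ (σ′ ⊛ M)) ⊛ ((con 1ℤ ⊖ Q) ⊛ P m)
     ≈⟨ S.*-cong (S.refl {Θ n ⊕ con (+ 2) ⊛ (σ′ ⊛ M)}) (P-cast n) ⟩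
   (Θ n ⊕ con (+ 2) ⊛ (σ′ ⊛ M)) ⊛ ((con 1ℤ ⊕ Q) ⊛ P n)
     ≈⟨ S.solve 5 (λ Q t s M p → (t :+ S.:con (+ 2) :* (s :* M)) :* ((S.:con 1ℤ :+ Q) :* p) S.:= (S.:con 1ℤ :+ Q) :* (t :* p) :+ S.:con (+ 2) :* (s :* (M :* ((S.:con 1ℤ :+ Q) :* p)))) S.refl Q (Θ n) σ′ M (P n) ⟩
   (con 1ℤ ⊕ Q) ⊛ (Θ n ⊛ P n) ⊕ con (+ 2) ⊛ (σ′ ⊛ (M ⊛ ((con 1ℤ ⊕ Q) ⊛ P n)))
     ≈⟨ S.+-cong (S.*-cong (S.refl {con 1ℤ ⊕ Q}) (shanks n)) (S.*-cong (S.refl {con (+ 2)}) (S.*-cong (con-neg (sgn n)) (S.refl {M ⊛ ((con 1ℤ ⊕ Q) ⊛ P n)}))) ⟩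
   (con 1ℤ ⊕ Q) ⊛ (con 1ℤ ⊕ con (+ 2) ⊛ G m n) ⊕ con (+ 2) ⊛ (⊝ σ ⊛ (M ⊛ ((con 1ℤ ⊕ Q) ⊛ P n)))
     ≈⟨ S.+-cong (S.solve 2 (λ Q g → (S.:con 1ℤ :+ Q) :* (S.:con 1ℤ :+ S.:con (+ 2) :* g) S.:= (S.:con 1ℤ :+ Q) :+ S.:con (+ 2) :* ((S.:con 1ℤ :+ Q) :* g)) S.refl Q (G m n)) S.refl ⟩
   ((con 1ℤ ⊕ Q) ⊕ con (+ 2) ⊛ ((con 1ℤ ⊕ Q) ⊛ G m n)) ⊕ con (+ 2) ⊛ (⊝ σ ⊛ (M ⊛ ((con 1ℤ ⊕ Q) ⊛ P n)))
     ≈⟨ S.+-cong (S.+-cong (S.refl {con 1ℤ ⊕ Q}) (S.*-cong (S.refl {con (+ 2)}) (telescope m n))) S.refl ⟩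
   ((con 1ℤ ⊕ Q) ⊕ con (+ 2) ⊛ ((con 1ℤ ⊖ Q) ⊛ G (suc m) n ⊕ (σ ⊛ (M ⊛ P n) ⊖ Q))) ⊕ con (+ 2) ⊛ (⊝ σ ⊛ (M ⊛ ((con 1ℤ ⊕ Q) ⊛ P n)))
     ≈⟨ S.solve 5 (λ Q g σ M p →
          ((S.:con 1ℤ :+ Q) :+ S.:con (+ 2) :* ((S.:con 1ℤ :- Q) :* g :+ (σ :* (M :* p) :- Q))) :+ S.:con (+ 2) :* (:- σ :* (M :* ((S.:con 1ℤ :+ Q) :* p)))
          S.:= (S.:con 1ℤ :- Q) :* (S.:con 1ℤ :+ S.:con (+ 2) :* g) :+ S.:con (+ 2) :* (:- σ :* (p :* (Q :* M)))) S.refl Q (G (suc m) n) σ M (P n) ⟩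
   (con 1ℤ ⊖ Q) ⊛ (con 1ℤ ⊕ con (+ 2) ⊛ G (suc m) n) ⊕ con (+ 2) ⊛ (⊝ σ ⊛ (P n ⊛ (Q ⊛ M)))
     ≈⟨ S.+-cong (S.refl {(con 1ℤ ⊖ Q) ⊛ (con 1ℤ ⊕ con (+ 2) ⊛ G (suc m) n)}) (S.*-cong (S.refl {con (+ 2)}) (S.*-cong (S.sym (con-neg (sgn n)))
          (S.*-cong (S.sym (R-cast n)) (S.sym QM)))) ⟩
   (con 1ℤ ⊖ Q) ⊛ (con 1ℤ ⊕ con (+ 2) ⊛ G (suc m) n) ⊕ con (+ 2) ⊛ (σ′ ⊛ (((con 1ℤ ⊖ Q) ⊛ R m) ⊛ mon (m ℕ.* suc m)))
     ≈⟨ S.solve 5 (λ Q g s r x → (S.:con 1ℤ :- Q) :* (S.:con 1ℤ :+ S.:con (+ 2) :* g) :+ S.:con (+ 2) :* (s :* (((S.:con 1ℤ :- Q) :* r) :* x))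
          S.:= (S.:con 1ℤ :- Q) :* (S.:con 1ℤ :+ S.:con (+ 2) :* (g :+ s :* (r :* x)))) S.refl Q (G (suc m) n) σ′ (R m) (mon (m ℕ.* suc m)) ⟩
   (con 1ℤ ⊖ Q) ⊛ (con 1ℤ ⊕ con (+ 2) ⊛ G (suc m) m) ∎)
   where
     open ≗-Reasoning
     open S using (_:+_; _:*_; _:-_; :-_)
     m = suc n
     Q = mon m
     σ = con (sgn n)
     σ′ = con (sgn m)
     M = mon (m ℕ.* m)
     QM : mon (m ℕ.* suc m) ≗ₛ Q ⊛ M
     QM = S.trans (λ i → cong (λ z → mon z i) (ℕP.*-suc m m)) (mon-+ m (m ℕ.* m))

 G-low : ∀ e n i → i < e → G e n i ≡ 0ℤ
 G-low e zero    zero    p = refl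
 G-low e zero    (suc i) p = refl
 G-low e (suc n) i       p = cong₂ _+ᶻ_ (G-low e n i p)
   (trans (con-⊛ (sgn (suc n)) (R (suc n) ⊛ mon (suc n ℕ.* e)) i)
   (trans (cong (sgn (suc n) *ᶻ_) (trans (⊛-comm (R (suc n)) (mon (suc n ℕ.* e)) i) (mon-< (suc n ℕ.* e) (R (suc n)) i (ℕP.≤-trans p (ℕP.m≤m+n e (n ℕ.* e))))))
          (ℤP.*-zeroʳ (sgn (suc n)))))

 ⊛-cong-≤ : ∀ n {f f′ g g′} → (∀ i → i ≤ n → f i ≡ f′ i) → (∀ i → i ≤ n → g i ≡ g′ i) → (f ⊛ g) n ≡ (f′ ⊛ g′) n
 ⊛-cong-≤ zero    p q = cong₂ _*ᶻ_ (p 0 z≤n) (q 0 z≤n)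
 ⊛-cong-≤ (suc n) p q = cong₂ _+ᶻ_ (cong₂ _*ᶻ_ (p 0 z≤n) (q (suc n) ℕP.≤-refl)) (⊛-cong-≤ n (λ i i≤ → p (suc i) (s≤s i≤)) (λ i i≤ → q i (ℕP.m≤n⇒m≤1+n i≤)))

 overpartitions : PS
 overpartitions n = + Defs.overpartition n

 P-stable : ∀ d j → P (d ℕ.+ j) j ≡ overpartitions j
 P-stable zero    j = refl
 P-stable (suc d) j = trans (cong +_ (step j (ℕP.m≤n+m j d))) (P-stable d j)
   where
     N = d ℕ.+ j
     <ᵇ-true : ∀ {j N} → j ≤ N → (j ℕ.<ᵇ suc N) ≡ true
     <ᵇ-true {j} {N} p with j ℕ.<ᵇ suc N in eq
     ... | true  = refl
     ... | false = ⊥-elim (subst T eq (ℕP.<⇒<ᵇ (s≤s p)))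
     mul1+-low : ∀ j → j ≤ N → Defs.mul1+ (suc N) (Defs.partialProd N) j ≡ Defs.partialProd N j
     mul1+-low j p rewrite <ᵇ-true p = refl
     step : ∀ j → j ≤ N → Defs.partialProd (suc N) j ≡ Defs.partialProd N j
     step zero    p = mul1+-low 0 z≤n
     step (suc j) p rewrite <ᵇ-true p = refl

 Θ-list : ∀ n k → Θ n k ≡ ∑ (filter (λ s → sq s ℕ.≟ k) (symRange n)) (λ s → sgn ∣ s ∣)
 Θ-list zero zero    = refl
 Θ-list zero (suc k) = refl
 Θ-list (suc n) k = trans (cong₂ _+ᶻ_ (Θ-list n k) (trans (con-⊛ (+ 2) (con (sgn (suc n)) ⊛ M) k) (cong (+ 2 *ᶻ_) (con-⊛ (sgn (suc n)) M k)))) (go (suc n ℕ.* suc n ℕ.≟ k))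
   where
     M = mon (suc n ℕ.* suc n)
     is? : ∀ s → Dec (sq s ≡ k)
     is? s = sq s ℕ.≟ k
     w : ℤ → ℤ
     w s = sgn ∣ s ∣
     rest : ℤ
     rest = ∑ (filter is? (symRange n)) w
     go : Dec (suc n ℕ.* suc n ≡ k) → rest +ᶻ + 2 *ᶻ (sgn (suc n) *ᶻ M k) ≡ ∑ (filter is? (symRange (suc n))) w
     go (yes eq) = trans (cong (λ z → rest +ᶻ + 2 *ᶻ (sgn (suc n) *ᶻ z)) (trans (cong M (sym eq)) (mon-diag (suc n ℕ.* suc n))))
       (trans (lem rest (sgn (suc n)))
       (sym (trans (cong (λ xs → ∑ xs w) (filter-accept is? {+ suc n} { -[1+ n ] ∷ symRange n} eq))
                   (addˡ (sgn (suc n)) (cong (λ xs → ∑ xs w) (filter-accept is? { -[1+ n ]} {symRange n} eq))))))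
       where
         lem : ∀ x s → x +ᶻ + 2 *ᶻ (s *ᶻ 1ℤ) ≡ s +ᶻ (s +ᶻ x)
         lem = solve-∀
     go (no ≢) = trans (cong (λ z → rest +ᶻ + 2 *ᶻ (sgn (suc n) *ᶻ z)) (mon-off _ k ≢))
       (trans (lem rest (sgn (suc n)))
       (sym (trans (cong (λ xs → ∑ xs w) (filter-reject is? {+ suc n} { -[1+ n ] ∷ symRange n} ≢))
                   (cong (λ xs → ∑ xs w) (filter-reject is? { -[1+ n ]} {symRange n} ≢)))))
       where
         lem : ∀ x s → x +ᶻ + 2 *ᶻ (s *ᶻ 0ℤ) ≡ x
         lem = solve-∀

 Θ-θ₄ : ∀ n k → k ≤ n → Θ n k ≡ θ₄ k
 Θ-θ₄ n k k≤n = trans (Θ-list n k) (∑-Enum (λ s → sgn ∣ s ∣)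
   (Enum-⇔ proj₂ (λ {s} eq → ℕP.≤-trans (n≤n*n ∣ s ∣) (ℕP.≤-trans (ℕP.≤-reflexive eq) k≤n) , eq) (Enum-filter (λ s → sq s ℕ.≟ k) (symRange-Enum n)))
   (Enum-⇔ proj₂ (tt ,_) (roots-Graded k)))

 gauss : θ₄ ⊛ overpartitions ≗ₛ con 1ℤ
 gauss n = trans (⊛-cong-≤ n (λ i i≤ → sym (Θ-θ₄ n i i≤)) (λ i i≤ → sym (trans (cong (λ z → P z i) (sym (ℕP.m∸n+n≡m i≤))) (P-stable (n ℕ.∸ i) i))))
   (trans (shanks n n) (trans (addˡ (con 1ℤ n) (trans (con-⊛ (+ 2) (G (suc n) n) n) (cong (+ 2 *ᶻ_) (G-low (suc n) n n ℕP.≤-refl)))) (ℤP.+-identityʳ _)))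

-- Sums over the solutions of nk + n′k′ = m.

module Factorizations where

 open PowerSeries
 open FiniteSums
 open Substitution
 open ThetaSeries
 open import Data.Nat using (∣_-_∣)

 -- The character χ modulo 4 is sin(nπ/2); γ is the cosine.

 χ γ : ℕ → ℤ
 χ zero    = 0ℤ
 χ (suc n) = γ n
 γ zero    = 1ℤ
 γ (suc n) = -ᶻ χ n

 χ-+ : ∀ m n → χ (m ℕ.+ n) ≡ χ m *ᶻ γ n +ᶻ γ m *ᶻ χ n
 γ-+ : ∀ m n → γ (m ℕ.+ n) ≡ γ m *ᶻ γ n -ᶻ χ m *ᶻ χ n
 χ-+ zero    n = sym (trans (ℤP.+-identityˡ _) (ℤP.*-identityˡ (χ n)))
 χ-+ (suc m) n = trans (γ-+ m n) (lem (χ m) (γ m) (χ n) (γ n))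
   where
     lem : ∀ x c x′ c′ → c *ᶻ c′ -ᶻ x *ᶻ x′ ≡ c *ᶻ c′ +ᶻ -ᶻ x *ᶻ x′
     lem = solve-∀
 γ-+ zero    n = sym (trans (ℤP.+-identityʳ _) (ℤP.*-identityˡ (γ n)))
 γ-+ (suc m) n = trans (cong -ᶻ_ (χ-+ m n)) (lem (χ m) (γ m) (χ n) (γ n))
   where
     lem : ∀ x c x′ c′ → -ᶻ (x *ᶻ c′ +ᶻ c *ᶻ x′) ≡ -ᶻ x *ᶻ c′ -ᶻ c *ᶻ x′
     lem = solve-∀

 quarters : List (ℤ × ℤ)
 quarters = (0ℤ , 1ℤ) ∷ (1ℤ , 0ℤ) ∷ (0ℤ , -ᶻ 1ℤ) ∷ (-ᶻ 1ℤ , 0ℤ) ∷ []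

 χγ∈ : ∀ n → (χ n , γ n) ∈ quarters
 χγ∈ zero    = here refl
 χγ∈ (suc n) = turn (χγ∈ n)
   where
     turn : ∀ {z} → z ∈ quarters → (proj₂ z , -ᶻ proj₁ z) ∈ quarters
     turn (here refl)                         = there (here refl)
     turn (there (here refl))                 = there (there (here refl))
     turn (there (there (here refl)))         = there (there (there (here refl)))
     turn (there (there (there (here refl)))) = here refl

 -- The pair (χ, γ) takes four values, so an identity in two arguments is a table with 16 entries.
 on-quarters : (f g : ℤ → ℤ → ℤ → ℤ → ℤ) →
   True (all? (λ z → all? (λ w → f (proj₁ z) (proj₂ z) (proj₁ w) (proj₂ w) ℤ.≟ g (proj₁ z) (proj₂ z) (proj₁ w) (proj₂ w)) quarters) quarters) →
   ∀ m n → f (χ m) (γ m) (χ n) (γ n) ≡ g (χ m) (γ m) (χ n) (γ n)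
 on-quarters f g t m n = All.lookup (All.lookup (toWitness t) (χγ∈ m)) (χγ∈ n)

 od≡χ² : ∀ n → od n ≡ χ n *ᶻ χ n
 ev≡γ² : ∀ n → ev n ≡ γ n *ᶻ γ n
 od≡χ² zero    = refl
 od≡χ² (suc n) = ev≡γ² n
 ev≡γ² zero    = refl
 ev≡γ² (suc n) = trans (od≡χ² n) (lem (χ n))
   where
     lem : ∀ x → x *ᶻ x ≡ -ᶻ x *ᶻ -ᶻ x
     lem = solve-∀

 Pos : ℕ × ℕ → Set
 Pos z = 0 < proj₁ z × 0 < proj₂ z

 upto : ℕ → List ℕ
 upto zero    = []
 upto (suc n) = suc n ∷ upto n

 below : ℕ → List ℕ
 below zero    = []
 below (suc n) = upto n

 upto-Enum : ∀ n → Enum (λ i → 0 < i × i ≤ n) (upto n)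
 upto-Enum n = record { unique = uq n ; sound = so n ; complete = λ { (p , q) → co n p q } }
   where
     so : ∀ n {i} → i ∈ upto n → 0 < i × i ≤ n
     so (suc n) (here refl) = s≤s z≤n , ℕP.≤-refl
     so (suc n) (there p)   = let q , r = so n p in q , ℕP.m≤n⇒m≤1+n r
     co : ∀ n {i} → 0 < i → i ≤ n → i ∈ upto n
     co zero    (s≤s p) ()
     co (suc n) {i} p q with i ℕ.≟ suc n
     ... | yes refl = here refl
     ... | no ≢     = there (co n p (ℕP.≤-pred (ℕP.≤∧≢⇒< q ≢)))
     uq : ∀ n → Unique (upto n)
     uq zero    = []
     uq (suc n) = All.tabulate (λ p eq → ℕP.<-irrefl (sym eq) (s≤s (proj₂ (so n p)))) ∷ uq n

 below-Enum : ∀ n → Enum (λ i → 0 < i × i < n) (below n)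
 below-Enum zero    = record { unique = [] ; sound = λ () ; complete = λ () }
 below-Enum (suc n) = Enum-⇔ (λ { (p , q) → p , s≤s q }) (λ { (p , s≤s q) → p , q }) (upto-Enum n)

 sig : ∀ {A B : Set} → List A → (A → List B) → List (A × B)
 sig []       ys = []
 sig (x ∷ xs) ys = map (x ,_) (ys x) ++ sig xs ys

 ∑-sig : ∀ {A B : Set} (xs : List A) (ys : A → List B) f → ∑ (sig xs ys) f ≡ ∑ xs (λ x → ∑ (ys x) (λ y → f (x , y)))
 ∑-sig []       ys f = refl
 ∑-sig (x ∷ xs) ys f = trans (∑-++ (map (x ,_) (ys x)) (sig xs ys) f) (cong₂ _+ᶻ_ (∑-map (x ,_) (ys x) f) (∑-sig xs ys f))

 sig-∈⁻ : ∀ {A B : Set} (xs : List A) (ys : A → List B) {z} → z ∈ sig xs ys → proj₁ z ∈ xs × proj₂ z ∈ ys (proj₁ z)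
 sig-∈⁻ (x ∷ xs) ys z∈ with ∈P.∈-++⁻ (map (x ,_) (ys x)) z∈
 ... | inj₂ p = let q , r = sig-∈⁻ xs ys p in there q , r
 ... | inj₁ p with ∈P.∈-map⁻ (x ,_) p
 ...   | _ , q , refl = here refl , q

 sig-∈⁺ : ∀ {A B : Set} (xs : List A) (ys : A → List B) {x y} → x ∈ xs → y ∈ ys x → (x , y) ∈ sig xs ys
 sig-∈⁺ (x ∷ xs) ys (here refl) q = ∈P.∈-++⁺ˡ (∈P.∈-map⁺ (x ,_) q)
 sig-∈⁺ (x ∷ xs) ys (there p)   q = ∈P.∈-++⁺ʳ (map (x ,_) (ys x)) (sig-∈⁺ xs ys p q)

 sig-Enum : ∀ {A B : Set} {P : A → Set} {Q : A → B → Set} {xs} {ys : A → List B} → Enum P xs → (∀ {x} → P x → Enum (Q x) (ys x)) →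
            Enum (λ z → P (proj₁ z) × Q (proj₁ z) (proj₂ z)) (sig xs ys)
 sig-Enum {P = P} {Q} {xs} {ys} e e′ = record
   { unique = uq xs (unique e) (sound e)
   ; sound = λ z∈ → let p , q = sig-∈⁻ xs ys z∈ in sound e p , sound (e′ (sound e p)) q
   ; complete = λ { (p , q) → sig-∈⁺ xs ys (complete e p) (complete (e′ p) q) } }
   where
     uq : ∀ xs → Unique xs → (∀ {x} → x ∈ xs → P x) → Unique (sig xs ys)
     uq []       u        h = []
     uq (x ∷ xs) (x∉ ∷ u) h = UniqueP.++⁺ (map-unique (x ,_) (ys x) (λ { _ _ refl → refl }) (unique (e′ (h (here refl))))) (uq xs u (h ∘ there))
       (λ { {z} (p , q) → let _ , _ , eq = ∈P.∈-map⁻ (x ,_) p in All.lookup x∉ (proj₁ (sig-∈⁻ xs ys q)) (sym (cong proj₁ eq)) })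

 ∑-tri : ∀ {A : Set} (u v : A → ℕ) xs f →
   ∑ xs f ≡ ∑ (filter (λ x → u x ℕ.<? v x) xs) f +ᶻ (∑ (filter (λ x → v x ℕ.<? u x) xs) f +ᶻ ∑ (filter (λ x → u x ℕ.≟ v x) xs) f)
 ∑-tri u v []       f = refl
 ∑-tri {A} u v (x ∷ xs) f = trans (addˡ (f x) (∑-tri u v xs f)) (go (ℕP.<-cmp (u x) (v x)))
   where
     L? = λ x → u x ℕ.<? v x
     G? = λ x → v x ℕ.<? u x
     E? = λ x → u x ℕ.≟ v x
     ∑F : {P : A → Set} → Decidable P → List A → ℤ
     ∑F P? ys = ∑ (filter P? ys) f
     acc : {P : A → Set} (P? : Decidable P) → P x → ∑F P? (x ∷ xs) ≡ f x +ᶻ ∑F P? xs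
     acc P? p = cong (λ ys → ∑ ys f) (filter-accept P? {x} {xs} p)
     rej : {P : A → Set} (P? : Decidable P) → ¬ P x → ∑F P? (x ∷ xs) ≡ ∑F P? xs
     rej P? p = cong (λ ys → ∑ ys f) (filter-reject P? {x} {xs} p)
     go : _ → f x +ᶻ (∑F L? xs +ᶻ (∑F G? xs +ᶻ ∑F E? xs)) ≡ ∑F L? (x ∷ xs) +ᶻ (∑F G? (x ∷ xs) +ᶻ ∑F E? (x ∷ xs))
     go (tri< l ≢ ≯) = trans (lem (f x) (∑F L? xs) (∑F G? xs) (∑F E? xs)) (sym (cong₂ _+ᶻ_ (acc L? l) (cong₂ _+ᶻ_ (rej G? ≯) (rej E? ≢))))
       where
         lem : ∀ f a b c → f +ᶻ (a +ᶻ (b +ᶻ c)) ≡ (f +ᶻ a) +ᶻ (b +ᶻ c)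
         lem = solve-∀
     go (tri≈ ≮ e ≯) = trans (lem (f x) (∑F L? xs) (∑F G? xs) (∑F E? xs)) (sym (cong₂ _+ᶻ_ (rej L? ≮) (cong₂ _+ᶻ_ (rej G? ≯) (acc E? e))))
       where
         lem : ∀ f a b c → f +ᶻ (a +ᶻ (b +ᶻ c)) ≡ a +ᶻ (b +ᶻ (f +ᶻ c))
         lem = solve-∀
     go (tri> ≮ ≢ g) = trans (lem (f x) (∑F L? xs) (∑F G? xs) (∑F E? xs)) (sym (cong₂ _+ᶻ_ (rej L? ≮) (cong₂ _+ᶻ_ (acc G? g) (rej E? ≢))))
       where
         lem : ∀ f a b c → f +ᶻ (a +ᶻ (b +ᶻ c)) ≡ a +ᶻ ((f +ᶻ b) +ᶻ c)
         lem = solve-∀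

 -- Lambert series Σ φ(n,k) q^(nk)

 factorizations : ℕ → List (ℕ × ℕ)
 factorizations m = filter (λ z → proj₁ z ℕ.* proj₂ z ℕ.≟ m) (cartesianProduct (below (suc m)) (below (suc m)))

 factorizations-Graded : Graded (λ z → proj₁ z ℕ.* proj₂ z) Pos 0 factorizations
 factorizations-Graded m = Enum-⇔
   (λ { (((p , _) , (q , _)) , eq) → (p , q) , eq })
   (λ { {n , k} ((p , q) , eq) →
      ((p , s≤s (ℕP.≤-trans (ℕP.m≤m*n n k {{ℕ.>-nonZero q}}) (ℕP.≤-reflexive eq))) ,
       (q , s≤s (ℕP.≤-trans (ℕP.m≤n*m k n {{ℕ.>-nonZero p}}) (ℕP.≤-reflexive eq)))) , eq })
   (Enum-filter (λ z → proj₁ z ℕ.* proj₂ z ℕ.≟ m) (Enum-× (below-Enum (suc m)) (below-Enum (suc m))))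

 unc : (ℕ → ℕ → ℤ) → ℕ × ℕ → ℤ
 unc φ z = φ (proj₁ z) (proj₂ z)

 Lam : (ℕ → ℕ → ℤ) → PS
 Lam φ = ser factorizations (unc φ)

 Quad : Set
 Quad = (ℕ × ℕ) × (ℕ × ℕ)

 quads : ℕ → List Quad
 quads = factorizations ⊠ factorizations

 IsQuad : ℕ → Quad → Set
 IsQuad m z = (Pos (proj₁ z) × Pos (proj₂ z)) × proj₁ (proj₁ z) ℕ.* proj₂ (proj₁ z) ℕ.+ proj₁ (proj₂ z) ℕ.* proj₂ (proj₂ z) ≡ m

 quads-Enum : ∀ m → Enum (IsQuad m) (quads m)
 quads-Enum = ⊠-Graded₀ factorizations-Graded factorizations-Graded

 Weight : Set
 Weight = ℕ → ℕ → ℕ → ℕ → ℤ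

 unc₄ : Weight → Quad → ℤ
 unc₄ φ z = φ (proj₁ (proj₁ z)) (proj₂ (proj₁ z)) (proj₁ (proj₂ z)) (proj₂ (proj₂ z))

 Lam-⊛ : ∀ φ ψ → Lam φ ⊛ Lam ψ ≗ₛ ser quads (unc₄ (λ n k n′ k′ → φ n k *ᶻ ψ n′ k′))
 Lam-⊛ φ ψ = ser-⊛ factorizations factorizations (unc φ) (unc ψ)

 module _ (m : ℕ) where

   nℓ kℓ nr kr : Quad → ℕ
   nℓ z = proj₁ (proj₁ z)
   kℓ z = proj₂ (proj₁ z)
   nr z = proj₁ (proj₂ z)
   kr z = proj₂ (proj₂ z)

   T : Weight → ℤ
   T φ = ∑ (quads m) (unc₄ φ)

   Tk> Tk< Tk≡ Tn> Tn< Tn≡ : Weight → ℤ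
   Tk> φ = ∑ (filter (λ z → kr z ℕ.<? kℓ z) (quads m)) (unc₄ φ)
   Tk< φ = ∑ (filter (λ z → kℓ z ℕ.<? kr z) (quads m)) (unc₄ φ)
   Tk≡ φ = ∑ (filter (λ z → kℓ z ℕ.≟ kr z) (quads m)) (unc₄ φ)
   Tn> φ = ∑ (filter (λ z → nr z ℕ.<? nℓ z) (quads m)) (unc₄ φ)
   Tn< φ = ∑ (filter (λ z → nℓ z ℕ.<? nr z) (quads m)) (unc₄ φ)
   Tn≡ φ = ∑ (filter (λ z → nℓ z ℕ.≟ nr z) (quads m)) (unc₄ φ)

   T-k : ∀ φ → T φ ≡ Tk< φ +ᶻ (Tk> φ +ᶻ Tk≡ φ)
   T-k φ = ∑-tri kℓ kr (quads m) (unc₄ φ)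

   T-n : ∀ φ → T φ ≡ Tn< φ +ᶻ (Tn> φ +ᶻ Tn≡ φ)
   T-n φ = ∑-tri nℓ nr (quads m) (unc₄ φ)

   -- nk + n'k' = n(k - k') + (n + n')k'

   R> : ∀ φ ψ → (∀ n k n′ k′ → φ n (k ℕ.+ k′) n′ k′ ≡ ψ n k (n ℕ.+ n′) k′) → Tk> φ ≡ Tn< ψ
   R> φ ψ eq = ∑-bij (Enum-filter (λ z → kr z ℕ.<? kℓ z) (quads-Enum m)) (Enum-filter (λ z → nℓ z ℕ.<? nr z) (quads-Enum m))
     (λ { ((n , k) , (n′ , k′)) → (n , k ℕ.∸ k′) , (n ℕ.+ n′ , k′) })
     (λ { {(n , k) , (n′ , k′)} ((((n>0 , _) , (n′>0 , k′>0)) , e) , lt) →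
          (((n>0 , ℕP.m<n⇒0<n∸m lt) , (ℕP.≤-trans n>0 (ℕP.m≤m+n n n′) , k′>0)) ,
            trans (lem n (k ℕ.∸ k′) n′ k′) (trans (cong (λ z → n ℕ.* z ℕ.+ n′ ℕ.* k′) (ℕP.m∸n+n≡m (ℕP.<⇒≤ lt))) e)) ,
          ℕP.m<m+n n n′>0 })
     (λ { {(n , k) , (n′ , k′)} {(x , y) , (x′ , y′)} (_ , lt) (_ , lt′) q → inj n k n′ k′ x y x′ y′ lt lt′ q })
     (λ { {(n , k) , (n′ , k′)} ((((n>0 , k>0) , (_ , k′>0)) , e) , lt) →
          ((n , k ℕ.+ k′) , (n′ ℕ.∸ n , k′)) ,
          ((((n>0 , ℕP.≤-trans k>0 (ℕP.m≤m+n k k′)) , (ℕP.m<n⇒0<n∸m lt , k′>0)) ,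
            trans (lem′ n k (n′ ℕ.∸ n) k′) (trans (cong (λ z → n ℕ.* k ℕ.+ z ℕ.* k′) (ℕP.m+[n∸m]≡n (ℕP.<⇒≤ lt))) e)) ,
           ℕP.m<n+m k′ k>0) ,
          cong₂ _,_ (cong (n ,_) (ℕP.m+n∸n≡m k k′)) (cong (_, k′) (ℕP.m+[n∸m]≡n (ℕP.<⇒≤ lt))) })
     (λ { {(n , k) , (n′ , k′)} (_ , lt) → trans (cong (λ z → φ n z n′ k′) (sym (ℕP.m∸n+n≡m (ℕP.<⇒≤ lt)))) (eq n (k ℕ.∸ k′) n′ k′) })
     where
       lem : ∀ n k n′ k′ → n ℕ.* k ℕ.+ (n ℕ.+ n′) ℕ.* k′ ≡ n ℕ.* (k ℕ.+ k′) ℕ.+ n′ ℕ.* k′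
       lem = ℕSolver.solve-∀
       lem′ : ∀ n k n′ k′ → n ℕ.* (k ℕ.+ k′) ℕ.+ n′ ℕ.* k′ ≡ n ℕ.* k ℕ.+ (n ℕ.+ n′) ℕ.* k′
       lem′ = ℕSolver.solve-∀
       inj : ∀ n k n′ k′ x y x′ y′ → k′ < k → y′ < y →
             ((n , k ℕ.∸ k′) , (n ℕ.+ n′ , k′)) ≡ ((x , y ℕ.∸ y′) , (x ℕ.+ x′ , y′)) → ((n , k) , (n′ , k′)) ≡ ((x , y) , (x′ , y′))
       inj n k n′ k′ x y x′ y′ lt lt′ q with cong nℓ q | cong kr q
       ... | refl | refl = cong₂ (λ s t → (n , s) , (t , k′))
               (trans (sym (ℕP.m∸n+n≡m (ℕP.<⇒≤ lt))) (trans (cong (ℕ._+ k′) (cong kℓ q)) (ℕP.m∸n+n≡m (ℕP.<⇒≤ lt′))))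
               (ℕP.+-cancelˡ-≡ n n′ x′ (cong nr q))

   private
     flip : Weight → Weight
     flip φ n k n′ k′ = φ n′ k′ n k

     sw : ∀ {R S : Quad → Set} (R? : Decidable R) (S? : Decidable S) φ → (∀ {n k n′ k′} → R ((n , k) , (n′ , k′)) → S ((n′ , k′) , (n , k))) →
          (∀ {n k n′ k′} → S ((n , k) , (n′ , k′)) → R ((n′ , k′) , (n , k))) →
          ∑ (filter R? (quads m)) (unc₄ φ) ≡ ∑ (filter S? (quads m)) (unc₄ (flip φ))
     sw R? S? φ rs sr = ∑-bij (Enum-filter R? (quads-Enum m)) (Enum-filter S? (quads-Enum m))
       (λ { (x , y) → y , x })
       (λ { {(n , k) , (n′ , k′)} (((p , q) , e) , r) → ((q , p) , trans (ℕP.+-comm (n′ ℕ.* k′) (n ℕ.* k)) e) , rs r })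
       (λ { _ _ refl → refl })
       (λ { {(n , k) , (n′ , k′)} (((p , q) , e) , s) → ((n′ , k′) , (n , k)) , (((q , p) , trans (ℕP.+-comm (n′ ℕ.* k′) (n ℕ.* k)) e) , sr s) , refl })
       (λ _ → refl)

   sw-k : ∀ φ → Tk> φ ≡ Tk< (flip φ)
   sw-k φ = sw (λ z → kr z ℕ.<? kℓ z) (λ z → kℓ z ℕ.<? kr z) φ id id

   sw-n : ∀ φ → Tn< φ ≡ Tn> (flip φ)
   sw-n φ = sw (λ z → nℓ z ℕ.<? nr z) (λ z → nr z ℕ.<? nℓ z) φ id id

   Tn≡-flip : ∀ φ → Tn≡ φ ≡ Tn≡ (λ n k n′ k′ → φ n′ k′ n k)
   Tn≡-flip φ = sw (λ z → nℓ z ℕ.≟ nr z) (λ z → nℓ z ℕ.≟ nr z) φ sym sym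

   R>′ : ∀ φ ψ → (∀ n k n′ k′ → φ n (k ℕ.+ k′) n′ k′ ≡ ψ (n ℕ.+ n′) k′ n k) → Tk> φ ≡ Tn> ψ
   R>′ φ ψ eq = trans (R> φ (flip ψ) eq) (sw-n (flip ψ))

   R< : ∀ φ ψ → (∀ n k n′ k′ → φ n k n′ (k ℕ.+ k′) ≡ ψ (n ℕ.+ n′) k n′ k′) → Tk< φ ≡ Tn> ψ
   R< φ ψ eq = trans (sym (sw-k (flip φ))) (R>′ (flip φ) ψ (λ n k n′ k′ →
     trans (cong (φ n′ k′ n) (ℕP.+-comm k k′)) (trans (eq n′ k′ n k) (cong (λ z → ψ z k′ n k) (ℕP.+-comm n′ n)))))

   R<′ : ∀ φ ψ → (∀ n k n′ k′ → φ n k n′ (k ℕ.+ k′) ≡ ψ n′ k′ (n ℕ.+ n′) k) → Tk< φ ≡ Tn< ψ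
   R<′ φ ψ eq = trans (R< φ (flip ψ) eq) (sym (sw-n ψ))

   -- When both second entries are k, the equation reads (n + n′)k = m: a factorization m = dk
   -- together with a splitting of d.
   Tk≡-∑ : ∀ φ → Tk≡ φ ≡ ∑ (factorizations m) (λ z → ∑ (below (proj₁ z)) (λ n′ → φ (proj₁ z ℕ.∸ n′) (proj₂ z) n′ (proj₂ z)))
   Tk≡-∑ φ = sym (trans (sym (∑-sig (factorizations m) (λ z → below (proj₁ z)) _))
     (∑-bij (sig-Enum (factorizations-Graded m) (λ {z} _ → below-Enum (proj₁ z))) (Enum-filter (λ z → kℓ z ℕ.≟ kr z) (quads-Enum m))
       (λ { ((d , k) , n′) → (d ℕ.∸ n′ , k) , (n′ , k) })
       (λ { {(d , k) , n′} (((_ , k>0) , e) , n′>0 , lt) → (((ℕP.m<n⇒0<n∸m lt , k>0) , (n′>0 , k>0)) ,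
             trans (sym (ℕP.*-distribʳ-+ k (d ℕ.∸ n′) n′)) (trans (cong (ℕ._* k) (ℕP.m∸n+n≡m (ℕP.<⇒≤ lt))) e)) , refl })
       (λ { {(d , k) , n′} {(d₁ , k₁) , n₁} (_ , _ , lt) (_ , _ , lt₁) q → inj lt lt₁ (cong nℓ q) (cong kℓ q) (cong nr q) })
       (λ { {(n , k) , (n′ , k′)} ((((n>0 , k>0) , (n′>0 , _)) , e) , refl) →
            ((n ℕ.+ n′ , k) , n′) , (((ℕP.≤-trans n>0 (ℕP.m≤m+n n n′) , k>0) , trans (ℕP.*-distribʳ-+ k n n′) e) , n′>0 , ℕP.m<n+m n′ n>0) ,
            cong (λ z → (z , k) , (n′ , k)) (ℕP.m+n∸n≡m n n′) })
       (λ _ → refl)))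
     where
       inj : ∀ {d k n′ d₁ k₁ n₁} → n′ < d → n₁ < d₁ → d ℕ.∸ n′ ≡ d₁ ℕ.∸ n₁ → k ≡ k₁ → n′ ≡ n₁ → ((d , k) , n′) ≡ ((d₁ , k₁) , n₁)
       inj {k = k} {n′} lt lt₁ e refl refl = cong (λ z → (z , k) , n′)
         (trans (sym (ℕP.m∸n+n≡m (ℕP.<⇒≤ lt))) (trans (cong (ℕ._+ n′) e) (ℕP.m∸n+n≡m (ℕP.<⇒≤ lt₁))))

   Tn≡-∑ : ∀ φ → Tn≡ φ ≡ ∑ (factorizations m) (λ z → ∑ (below (proj₂ z)) (λ k′ → φ (proj₁ z) (proj₂ z ℕ.∸ k′) (proj₁ z) k′))
   Tn≡-∑ φ = sym (trans (sym (∑-sig (factorizations m) (λ z → below (proj₂ z)) _))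
     (∑-bij (sig-Enum (factorizations-Graded m) (λ {z} _ → below-Enum (proj₂ z))) (Enum-filter (λ z → nℓ z ℕ.≟ nr z) (quads-Enum m))
       (λ { ((n , d) , k′) → (n , d ℕ.∸ k′) , (n , k′) })
       (λ { {(n , d) , k′} (((n>0 , _) , e) , k′>0 , lt) → (((n>0 , ℕP.m<n⇒0<n∸m lt) , (n>0 , k′>0)) ,
             trans (sym (ℕP.*-distribˡ-+ n (d ℕ.∸ k′) k′)) (trans (cong (n ℕ.*_) (ℕP.m∸n+n≡m (ℕP.<⇒≤ lt))) e)) , refl })
       (λ { {(n , d) , k′} {(n₁ , d₁) , k₁} (_ , _ , lt) (_ , _ , lt₁) q → inj lt lt₁ (cong kℓ q) (cong nℓ q) (cong kr q) })
       (λ { {(n , k) , (n′ , k′)} ((((n>0 , k>0) , (_ , k′>0)) , e) , refl) →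
            ((n , k ℕ.+ k′) , k′) , (((n>0 , ℕP.≤-trans k>0 (ℕP.m≤m+n k k′)) , trans (ℕP.*-distribˡ-+ n k k′) e) , k′>0 , ℕP.m<n+m k′ k>0) ,
            cong (λ z → (n , z) , (n , k′)) (ℕP.m+n∸n≡m k k′) })
       (λ _ → refl)))
     where
       inj : ∀ {n d k′ n₁ d₁ k₁} → k′ < d → k₁ < d₁ → d ℕ.∸ k′ ≡ d₁ ℕ.∸ k₁ → n ≡ n₁ → k′ ≡ k₁ → ((n , d) , k′) ≡ ((n₁ , d₁) , k₁)
       inj {n} {k′ = k′} lt lt₁ e refl refl = cong (λ z → (n , z) , k′)
         (trans (sym (ℕP.m∸n+n≡m (ℕP.<⇒≤ lt))) (trans (cong (ℕ._+ k′) e) (ℕP.m∸n+n≡m (ℕP.<⇒≤ lt₁))))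

   T-⊕ : ∀ φ ψ → T (λ n k n′ k′ → φ n k n′ k′ +ᶻ ψ n k n′ k′) ≡ T φ +ᶻ T ψ
   T-⊕ φ ψ = ∑-⊕ (quads m) (unc₄ φ) (unc₄ ψ)

-- Liouville's elementary identities for pairs of factorizations.

module QuadrupleIdentities where

 open PowerSeries
 open FiniteSums
 open Substitution
 open ThetaSeries
 open Factorizations
 open import Data.Nat using (∣_-_∣)

 ∣m+n-n∣ : ∀ m n → ∣ m ℕ.+ n - n ∣ ≡ m
 ∣m+n-n∣ m n = trans (ℕP.∣-∣-comm (m ℕ.+ n) n) (trans (cong ∣ n -_∣ (ℕP.+-comm m n)) (ℕP.∣m-m+n∣≡n n m))

 +-cancelˡ : ∀ x {y z} → x +ᶻ y ≡ x +ᶻ z → y ≡ z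
 +-cancelˡ x {y} {z} p = trans (lem x y) (trans (cong (-ᶻ x +ᶻ_) p) (sym (lem x z)))
   where
     lem : ∀ x y → y ≡ -ᶻ x +ᶻ (x +ᶻ y)
     lem = solve-∀

 χχ₁ : ∀ k k′ → χ (k ℕ.+ k′) *ᶻ χ k′ ≡ od k′ *ᶻ γ k
 χχ₁ k k′ rewrite χ-+ k k′ | od≡χ² k′ = on-quarters (λ x c x′ c′ → (x *ᶻ c′ +ᶻ c *ᶻ x′) *ᶻ x′) (λ x c x′ c′ → x′ *ᶻ x′ *ᶻ c) tt k k′

 χχ₂ : ∀ k k′ → χ k *ᶻ χ (k ℕ.+ k′) ≡ od k *ᶻ γ k′
 χχ₂ k k′ rewrite χ-+ k k′ | od≡χ² k = on-quarters (λ x c x′ c′ → x *ᶻ (x *ᶻ c′ +ᶻ c *ᶻ x′)) (λ x c x′ c′ → x *ᶻ x *ᶻ c′) tt k k′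

 χχ₃ : ∀ k k′ → χ k *ᶻ χ k′ ≡ -ᶻ (od k *ᶻ γ (k ℕ.+ k′))
 χχ₃ k k′ rewrite γ-+ k k′ | od≡χ² k = on-quarters (λ x c x′ c′ → x *ᶻ x′) (λ x c x′ c′ → -ᶻ (x *ᶻ x *ᶻ (c *ᶻ c′ -ᶻ x *ᶻ x′))) tt k k′

 oγ : ∀ k k′ → od (k ℕ.+ k′) *ᶻ γ k′ ≡ od k *ᶻ γ k′
 oγ k k′ rewrite od≡χ² (k ℕ.+ k′) | χ-+ k k′ | od≡χ² k = on-quarters (λ x c x′ c′ → (x *ᶻ c′ +ᶻ c *ᶻ x′) *ᶻ (x *ᶻ c′ +ᶻ c *ᶻ x′) *ᶻ c′) (λ x c x′ c′ → x *ᶻ x *ᶻ c′) tt k k′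

 χo₁ : ∀ k k′ → χ (k ℕ.+ k′) *ᶻ od k′ ≡ χ k′ *ᶻ γ k
 χo₁ k k′ rewrite χ-+ k k′ | od≡χ² k′ = on-quarters (λ x c x′ c′ → (x *ᶻ c′ +ᶻ c *ᶻ x′) *ᶻ (x′ *ᶻ x′)) (λ x c x′ c′ → x′ *ᶻ c) tt k k′

 χo₂ : ∀ k k′ → χ k *ᶻ od (k ℕ.+ k′) ≡ χ k *ᶻ ev k′
 χo₂ k k′ rewrite od≡χ² (k ℕ.+ k′) | χ-+ k k′ | ev≡γ² k′ = on-quarters (λ x c x′ c′ → x *ᶻ ((x *ᶻ c′ +ᶻ c *ᶻ x′) *ᶻ (x *ᶻ c′ +ᶻ c *ᶻ x′))) (λ x c x′ c′ → x *ᶻ (c′ *ᶻ c′)) tt k k′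

 χe₂ : ∀ k k′ → χ k *ᶻ ev (k ℕ.+ k′) ≡ χ k *ᶻ od k′
 χe₂ k k′ rewrite ev≡γ² (k ℕ.+ k′) | γ-+ k k′ | od≡χ² k′ = on-quarters (λ x c x′ c′ → x *ᶻ ((c *ᶻ c′ -ᶻ x *ᶻ x′) *ᶻ (c *ᶻ c′ -ᶻ x *ᶻ x′))) (λ x c x′ c′ → x *ᶻ (x′ *ᶻ x′)) tt k k′

 χo₃ : ∀ k k′ → -ᶻ (χ k *ᶻ γ (k ℕ.+ k′)) ≡ χ k′ *ᶻ od k
 χo₃ k k′ rewrite γ-+ k k′ | od≡χ² k = on-quarters (λ x c x′ c′ → -ᶻ (x *ᶻ (c *ᶻ c′ -ᶻ x *ᶻ x′))) (λ x c x′ c′ → x′ *ᶻ (x *ᶻ x)) tt k k′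

 χe : ∀ k k′ → χ (k ℕ.+ k′) *ᶻ ev k′ ≡ χ k *ᶻ γ k′
 χe k k′ rewrite χ-+ k k′ | ev≡γ² k′ = on-quarters (λ x c x′ c′ → (x *ᶻ c′ +ᶻ c *ᶻ x′) *ᶻ (c′ *ᶻ c′)) (λ x c x′ c′ → x *ᶻ c′) tt k k′

 χγ : ∀ k k′ → χ (k ℕ.+ k′) *ᶻ γ k′ ≡ χ k *ᶻ ev k′
 χγ k k′ rewrite χ-+ k k′ | ev≡γ² k′ = on-quarters (λ x c x′ c′ → (x *ᶻ c′ +ᶻ c *ᶻ x′) *ᶻ c′) (λ x c x′ c′ → x *ᶻ (c′ *ᶻ c′)) tt k k′

 χ*γ : ∀ k → χ k *ᶻ γ k ≡ 0ℤ
 χ*γ k = on-quarters (λ x c _ _ → x *ᶻ c) (λ _ _ _ _ → 0ℤ) tt k 0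

 oγ₀ : ∀ k → od k *ᶻ γ k ≡ 0ℤ
 oγ₀ k rewrite od≡χ² k = on-quarters (λ x c _ _ → x *ᶻ x *ᶻ c) (λ _ _ _ _ → 0ℤ) tt k 0

 χe₀ : ∀ k → χ k *ᶻ ev k ≡ 0ℤ
 χe₀ k rewrite ev≡γ² k = on-quarters (λ x c _ _ → x *ᶻ (c *ᶻ c)) (λ _ _ _ _ → 0ℤ) tt k 0

 χ*od : ∀ k → χ k *ᶻ od k ≡ χ k
 χ*od k rewrite od≡χ² k = on-quarters (λ x c _ _ → x *ᶻ (x *ᶻ x)) (λ x _ _ _ → x) tt k 0

 ∑χ : ∀ n → ∑ (upto n) χ +ᶻ ∑ (upto n) χ ≡ 1ℤ -ᶻ γ n +ᶻ χ n
 ∑χ zero    = refl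
 ∑χ (suc n) = trans (lem (γ n) (∑ (upto n) χ)) (trans (cong (λ z → γ n +ᶻ γ n +ᶻ z) (∑χ n)) (lem′ (γ n) (χ n)))
   where
     lem : ∀ c s → c +ᶻ s +ᶻ (c +ᶻ s) ≡ c +ᶻ c +ᶻ (s +ᶻ s)
     lem = solve-∀
     lem′ : ∀ c x → c +ᶻ c +ᶻ (1ℤ -ᶻ c +ᶻ x) ≡ 1ℤ -ᶻ -ᶻ x +ᶻ c
     lem′ = solve-∀

 ∑γ : ∀ n → ∑ (upto n) γ +ᶻ ∑ (upto n) γ ≡ χ n +ᶻ γ n -ᶻ 1ℤ
 ∑γ zero    = refl
 ∑γ (suc n) = trans (lem (χ n) (∑ (upto n) γ)) (trans (cong (λ z → -ᶻ χ n +ᶻ -ᶻ χ n +ᶻ z) (∑γ n)) (lem′ (γ n) (χ n)))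
   where
     lem : ∀ x s → -ᶻ x +ᶻ s +ᶻ (-ᶻ x +ᶻ s) ≡ -ᶻ x +ᶻ -ᶻ x +ᶻ (s +ᶻ s)
     lem = solve-∀
     lem′ : ∀ c x → -ᶻ x +ᶻ -ᶻ x +ᶻ (x +ᶻ c -ᶻ 1ℤ) ≡ c +ᶻ -ᶻ x -ᶻ 1ℤ
     lem′ = solve-∀

 ∑upto : ∀ n → ∑ (upto n) +_ +ᶻ ∑ (upto n) +_ ≡ + n *ᶻ (1ℤ +ᶻ + n)
 ∑upto zero    = refl
 ∑upto (suc n) = trans (lem (+ n) (∑ (upto n) +_)) (trans (cong (λ z → (1ℤ +ᶻ + n) +ᶻ (1ℤ +ᶻ + n) +ᶻ z) (∑upto n)) (lem′ (+ n)))
   where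
     lem : ∀ n s → (1ℤ +ᶻ n) +ᶻ s +ᶻ ((1ℤ +ᶻ n) +ᶻ s) ≡ (1ℤ +ᶻ n) +ᶻ (1ℤ +ᶻ n) +ᶻ (s +ᶻ s)
     lem = solve-∀
     lem′ : ∀ n → (1ℤ +ᶻ n) +ᶻ (1ℤ +ᶻ n) +ᶻ n *ᶻ (1ℤ +ᶻ n) ≡ (1ℤ +ᶻ n) *ᶻ (1ℤ +ᶻ (1ℤ +ᶻ n))
     lem′ = solve-∀

 ∑1 : ∀ n → ∑ (upto n) (λ _ → 1ℤ) ≡ + n
 ∑1 zero    = refl
 ∑1 (suc n) = addˡ 1ℤ (∑1 n)

 od∑γ : ∀ n → od n *ᶻ (∑ (below n) γ +ᶻ ∑ (below n) γ) ≡ χ n -ᶻ od n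
 od∑γ zero    = refl
 od∑γ (suc n) rewrite ∑γ n | ev≡γ² n = on-quarters (λ x c _ _ → c *ᶻ c *ᶻ (x +ᶻ c -ᶻ 1ℤ)) (λ x c _ _ → c -ᶻ c *ᶻ c) tt n 0

 od∑χ : ∀ n → od n *ᶻ (∑ (below n) χ +ᶻ ∑ (below n) χ) ≡ od n -ᶻ χ n
 od∑χ zero    = refl
 od∑χ (suc n) rewrite ∑χ n | ev≡γ² n = on-quarters (λ x c _ _ → c *ᶻ c *ᶻ (1ℤ -ᶻ c +ᶻ x)) (λ x c _ _ → c *ᶻ c -ᶻ c) tt n 0

 ev∑χ : ∀ n → ev n *ᶻ (∑ (below n) χ +ᶻ ∑ (below n) χ) ≡ ev n -ᶻ γ n
 ev∑χ zero    = refl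
 ev∑χ (suc n) rewrite ∑χ n | od≡χ² n = on-quarters (λ x c _ _ → x *ᶻ x *ᶻ (1ℤ -ᶻ c +ᶻ x)) (λ x c _ _ → x *ᶻ x -ᶻ -ᶻ x) tt n 0

 ∑-comb : ∀ {A : Set} (xs : List A) f g h → ∑ xs f +ᶻ ∑ xs g -ᶻ (∑ xs h +ᶻ ∑ xs h) ≡ ∑ xs (λ x → f x +ᶻ g x -ᶻ (h x +ᶻ h x))
 ∑-comb []       f g h = refl
 ∑-comb (x ∷ xs) f g h = trans (lem (f x) (g x) (h x) (∑ xs f) (∑ xs g) (∑ xs h)) (addˡ (f x +ᶻ g x -ᶻ (h x +ᶻ h x)) (∑-comb xs f g h))
   where
     lem : ∀ f g h F G H → (f +ᶻ F) +ᶻ (g +ᶻ G) -ᶻ ((h +ᶻ H) +ᶻ (h +ᶻ H)) ≡ (f +ᶻ g -ᶻ (h +ᶻ h)) +ᶻ (F +ᶻ G -ᶻ (H +ᶻ H))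
     lem = solve-∀

 -- For 0 < i < n the pair (n - i, i) has sum n.

 ∑-below : ∀ n (f : ℕ → ℕ → ℤ) (g : ℕ → ℤ) → (∀ i j → j ℕ.+ i ≡ n → f j i ≡ g i) → ∑ (below n) (λ i → f (n ℕ.∸ i) i) ≡ ∑ (below n) g
 ∑-below n f g eq = ∑-cong-∈ (below n) (λ {i} i∈ → eq i (n ℕ.∸ i) (ℕP.m∸n+n≡m (ℕP.<⇒≤ (proj₂ (sound (below-Enum n) i∈)))))

 module _ (g : ℕ → ℤ) (m : ℕ) where

   private
     ψ : Weight
     ψ n k n′ k′ = od k *ᶻ γ k′ *ᶻ g n

     -ψ : Weight
     -ψ n k n′ k′ = -ᶻ ψ n k n′ k′

     φ₁ φ₂ : Weight
     φ₁ n k n′ k′ = χ k *ᶻ χ k′ *ᶻ g (n ℕ.+ n′)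
     φ₂ n k n′ k′ = χ k *ᶻ χ k′ *ᶻ g ∣ n - n′ ∣

     τ : ℤ
     τ = Tn≡ m (λ n k n′ k′ → χ k *ᶻ χ k′)

   -- Liouville's method. The terms g(n + n′) are split by the order of k and k′, the terms g|n -
   -- n′| by the order of n and n′; each off-diagonal part becomes, up to sign, a part of the sum of
   -- the auxiliary weight ψ. That sum, split in both ways, relates these parts, and everything but
   -- the diagonals cancels. The diagonals are sums over single factorizations.
   α-identity : T m (λ n k n′ k′ → χ k *ᶻ χ k′ *ᶻ (g (n ℕ.+ n′) +ᶻ g ∣ n - n′ ∣)) +ᶻ Lam (λ n k → χ k *ᶻ g n) m
                ≡ Lam (λ n k → + n *ᶻ od k *ᶻ g n) m +ᶻ g 0 *ᶻ Tn≡ m (λ n k n′ k′ → χ k *ᶻ χ k′)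
   α-identity = trans (cong (_+ᶻ Lam (λ n k → χ k *ᶻ g n) m) total)
     (trans (lem (Tn> m ψ) (Tk≡ m φ₁) (Tk< m ψ) (g 0 *ᶻ τ) (Lam (λ n k → χ k *ᶻ g n) m) (Tn≡ m ψ) three)
            (trans (cong (λ z → z +ᶻ g 0 *ᶻ τ) diag) refl))
     where
       sum₁ : T m φ₁ ≡ Tn> m ψ +ᶻ (Tn> m ψ +ᶻ Tk≡ m φ₁)
       sum₁ = trans (T-k m φ₁) (cong₂ _+ᶻ_
         (R< m φ₁ ψ (λ n k n′ k′ → cong (_*ᶻ g (n ℕ.+ n′)) (χχ₂ k k′)))
         (cong (_+ᶻ Tk≡ m φ₁) (R>′ m φ₁ ψ (λ n k n′ k′ → cong (_*ᶻ g (n ℕ.+ n′)) (χχ₁ k k′)))))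
       diff : ∀ n k n′ k′ → -ψ n k n′ (k ℕ.+ k′) ≡ χ k *ᶻ χ k′ *ᶻ g n
       diff n k n′ k′ = trans (neg (od k) (γ (k ℕ.+ k′)) (g n)) (cong (_*ᶻ g n) (sym (χχ₃ k k′)))
         where
           neg : ∀ x y z → -ᶻ (x *ᶻ y *ᶻ z) ≡ -ᶻ (x *ᶻ y) *ᶻ z
           neg = solve-∀
       sum₂ : T m φ₂ ≡ Tk< m -ψ +ᶻ (Tk< m -ψ +ᶻ g 0 *ᶻ τ)
       sum₂ = trans (T-n m φ₂) (cong₂ _+ᶻ_
         (sym (R<′ m -ψ φ₂ (λ n k n′ k′ → trans (diff n k n′ k′) (cong₂ _*ᶻ_ (ℤP.*-comm (χ k) (χ k′)) (cong g (sym (trans (ℕP.∣-∣-comm n′ (n ℕ.+ n′)) (∣m+n-n∣ n n′))))))))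
         (cong₂ _+ᶻ_
           (sym (R< m -ψ φ₂ (λ n k n′ k′ → trans (diff n k n′ k′) (cong (λ z → χ k *ᶻ χ k′ *ᶻ g z) (sym (∣m+n-n∣ n n′))))))
           (trans (∑-cong-∈ (filter (λ z → nℓ m z ℕ.≟ nr m z) (quads m)) (λ { {(n , k) , (n′ , k′)} z∈ → lem≡ n k n′ k′ (proj₂ (sound (Enum-filter (λ z → nℓ m z ℕ.≟ nr m z) (quads-Enum m)) z∈)) }))
                  (∑-scale (g 0) (filter (λ z → nℓ m z ℕ.≟ nr m z) (quads m)) _))))
         where
           lem≡ : ∀ n k n′ k′ → n ≡ n′ → φ₂ n k n′ k′ ≡ g 0 *ᶻ (χ k *ᶻ χ k′)
           lem≡ n k .n k′ refl = trans (cong (λ z → χ k *ᶻ χ k′ *ᶻ g z) (ℕP.m≡n⇒∣m-n∣≡0 {n} refl)) (ℤP.*-comm _ (g 0))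
       neg< : Tk< m -ψ ≡ -ᶻ Tk< m ψ
       neg< = ∑-neg (filter (λ z → kℓ m z ℕ.<? kr m z) (quads m)) (unc₄ ψ)
       total : T m (λ n k n′ k′ → χ k *ᶻ χ k′ *ᶻ (g (n ℕ.+ n′) +ᶻ g ∣ n - n′ ∣))
             ≡ (Tn> m ψ +ᶻ (Tn> m ψ +ᶻ Tk≡ m φ₁)) +ᶻ (-ᶻ Tk< m ψ +ᶻ (-ᶻ Tk< m ψ +ᶻ g 0 *ᶻ τ))
       total = trans (∑-cong (quads m) (λ { ((n , k) , (n′ , k′)) → ℤP.*-distribˡ-+ (χ k *ᶻ χ k′) (g (n ℕ.+ n′)) (g ∣ n - n′ ∣) }))
         (trans (T-⊕ m φ₁ φ₂) (cong₂ _+ᶻ_ sum₁ (trans sum₂ (cong (λ z → z +ᶻ (z +ᶻ g 0 *ᶻ τ)) neg<))))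
       Tk≡ψ : Tk≡ m ψ ≡ 0ℤ
       Tk≡ψ = ∑-zero (filter (λ z → kℓ m z ℕ.≟ kr m z) (quads m)) (λ { {(n , k) , (n′ , k′)} z∈ →
         trans (cong (λ z → od k *ᶻ γ z *ᶻ g n) (sym (proj₂ (sound (Enum-filter (λ z → kℓ m z ℕ.≟ kr m z) (quads-Enum m)) z∈)))) (cong (_*ᶻ g n) (oγ₀ k)) })
       -- The sum of ψ split in both ways: its parts k > k′ and n < n′ agree, and the part k = k′ is
       -- zero because od k γ k = 0.
       three : Tn> m ψ +ᶻ Tn≡ m ψ ≡ Tk< m ψ
       three = +-cancelˡ (Tn< m ψ) (trans (sym (T-n m ψ)) (trans (T-k m ψ) (trans (cong₂ (λ s t → Tk< m ψ +ᶻ (s +ᶻ t))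
         (R> m ψ ψ (λ n k n′ k′ → cong (_*ᶻ g n) (oγ k k′))) Tk≡ψ) (swp (Tk< m ψ) (Tn< m ψ)))))
         where
           swp : ∀ x y → x +ᶻ (y +ᶻ 0ℤ) ≡ y +ᶻ x
           swp = solve-∀
       lem : ∀ A d B t l e → A +ᶻ e ≡ B → ((A +ᶻ (A +ᶻ d)) +ᶻ (-ᶻ B +ᶻ (-ᶻ B +ᶻ t))) +ᶻ l ≡ (d +ᶻ l -ᶻ (e +ᶻ e)) +ᶻ t
       lem A d _ t l e refl = lem′ A d t l e
         where
           lem′ : ∀ A d t l e → ((A +ᶻ (A +ᶻ d)) +ᶻ (-ᶻ (A +ᶻ e) +ᶻ (-ᶻ (A +ᶻ e) +ᶻ t))) +ᶻ l ≡ (d +ᶻ l -ᶻ (e +ᶻ e)) +ᶻ t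
           lem′ = solve-∀
       diag : Tk≡ m φ₁ +ᶻ Lam (λ n k → χ k *ᶻ g n) m -ᶻ (Tn≡ m ψ +ᶻ Tn≡ m ψ) ≡ Lam (λ n k → + n *ᶻ od k *ᶻ g n) m
       diag = trans (cong₂ (λ s t → s +ᶻ Lam (λ n k → χ k *ᶻ g n) m -ᶻ (t +ᶻ t)) (Tk≡-∑ m φ₁) (Tn≡-∑ m ψ))
         (trans (∑-comb F (λ z → ∑ (below (proj₁ z)) (λ n′ → φ₁ (proj₁ z ℕ.∸ n′) (proj₂ z) n′ (proj₂ z))) (unc (λ n k → χ k *ᶻ g n))
                          (λ z → ∑ (below (proj₂ z)) (λ k′ → ψ (proj₁ z) (proj₂ z ℕ.∸ k′) (proj₁ z) k′)))
                (∑-cong-∈ F (λ { {n , k} z∈ → pointwise n k (proj₁ (sound (factorizations-Graded m) z∈)) })))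
         where
           F = factorizations m
           pointwise : ∀ n k → Pos (n , k) →
             (∑ (below n) (λ n′ → φ₁ (n ℕ.∸ n′) k n′ k) +ᶻ χ k *ᶻ g n) +ᶻ -ᶻ (∑ (below k) (λ k′ → ψ n (k ℕ.∸ k′) n k′) +ᶻ ∑ (below k) (λ k′ → ψ n (k ℕ.∸ k′) n k′))
             ≡ + n *ᶻ od k *ᶻ g n
           pointwise (suc n) k _ = trans (cong₂ (λ s t → (s +ᶻ χ k *ᶻ g (suc n)) +ᶻ -ᶻ (t +ᶻ t)) e₁ e₂)
             (trans (rearr (od k) (g (suc n)) (+ n) (χ k) (∑ (below k) γ))
             (trans (cong (λ z → od k *ᶻ g (suc n) *ᶻ + n +ᶻ χ k *ᶻ g (suc n) -ᶻ z *ᶻ g (suc n)) (od∑γ k))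
                    (rearr′ (od k) (g (suc n)) (+ n) (χ k))))
             where
               e₁ : ∑ (below (suc n)) (λ n′ → φ₁ (suc n ℕ.∸ n′) k n′ k) ≡ od k *ᶻ g (suc n) *ᶻ + n
               e₁ = trans (∑-below (suc n) (λ j i → φ₁ j k i k) (λ _ → od k *ᶻ g (suc n) *ᶻ 1ℤ)
                       (λ i j eq → trans (cong₂ (λ s t → s *ᶻ g t) (sym (od≡χ² k)) eq) (sym (ℤP.*-identityʳ _))))
                     (trans (∑-scale (od k *ᶻ g (suc n)) (upto n) (λ _ → 1ℤ)) (cong (od k *ᶻ g (suc n) *ᶻ_) (∑1 n)))
               e₂ : ∑ (below k) (λ k′ → ψ (suc n) (k ℕ.∸ k′) (suc n) k′) ≡ od k *ᶻ g (suc n) *ᶻ ∑ (below k) γ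
               e₂ = trans (∑-below k (λ j i → ψ (suc n) j (suc n) i) (λ i → od k *ᶻ g (suc n) *ᶻ γ i)
                       (λ i j eq → trans (cong (_*ᶻ g (suc n)) (trans (sym (oγ j i)) (cong (λ z → od z *ᶻ γ i) eq))) (comm₃ (od k) (γ i) (g (suc n)))))
                     (∑-scale (od k *ᶻ g (suc n)) (below k) γ)
                 where
                   comm₃ : ∀ x y z → x *ᶻ y *ᶻ z ≡ x *ᶻ z *ᶻ y
                   comm₃ = solve-∀
               rearr : ∀ o G n x s → (o *ᶻ G *ᶻ n +ᶻ x *ᶻ G) +ᶻ -ᶻ (o *ᶻ G *ᶻ s +ᶻ o *ᶻ G *ᶻ s) ≡ o *ᶻ G *ᶻ n +ᶻ x *ᶻ G -ᶻ (o *ᶻ (s +ᶻ s)) *ᶻ G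
               rearr = solve-∀
               rearr′ : ∀ o G n x → o *ᶻ G *ᶻ n +ᶻ x *ᶻ G -ᶻ (x -ᶻ o) *ᶻ G ≡ (1ℤ +ᶻ n) *ᶻ o *ᶻ G
               rearr′ = solve-∀

   private
     κ₁ κ₂ : Weight
     κ₁ n k n′ k′ = χ k *ᶻ od k′ *ᶻ (+ n′ *ᶻ g (n ℕ.+ n′))
     κ₂ n k n′ k′ = χ k *ᶻ od k′ *ᶻ (+ n′ *ᶻ g ∣ n - n′ ∣)

     Φ Ψ Ω : Weight
     Φ n k n′ k′ = χ k *ᶻ g n *ᶻ (γ k′ *ᶻ (+ n -ᶻ + n′) +ᶻ ev k′ *ᶻ + n′)
     Ψ n k n′ k′ = χ k *ᶻ g n *ᶻ (ev k′ *ᶻ + n′ -ᶻ γ k′ *ᶻ (+ n +ᶻ + n′))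
     Ω n k n′ k′ = (χ k *ᶻ g n) *ᶻ (+ n′ *ᶻ (ev k′ -ᶻ γ k′))

     Φ₁ Φ₂ Ψ₂ Φ⁻ : Weight
     Φ₁ n k n′ k′ = χ k *ᶻ g n *ᶻ (γ k′ *ᶻ (+ n -ᶻ + n′))
     Φ₂ n k n′ k′ = χ k *ᶻ g n *ᶻ (ev k′ *ᶻ + n′)
     Ψ₂ n k n′ k′ = χ k *ᶻ g n *ᶻ -ᶻ (γ k′ *ᶻ (+ n +ᶻ + n′))
     Φ⁻ n k n′ k′ = -ᶻ Φ n k n′ k′

   -- The same method with two auxiliary weights. The terms with n + n′ give the part n > n′ of Φ,
   -- those with |n - n′| the part k < k′ of Ψ. The part n < n′ of Φ is minus the part k > k′ of Ψ,
   -- so up to diagonals the full sums of Φ and Ψ appear. Finally Φ + Ψ = 2Ω, and Ω is a product of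
   -- the weights of two Lambert series.
   β-identity : T m (λ n k n′ k′ → χ k *ᶻ od k′ *ᶻ (+ n′ *ᶻ (g (n ℕ.+ n′) +ᶻ g ∣ n - n′ ∣))) +ᶻ T m (λ n k n′ k′ → χ k *ᶻ od k′ *ᶻ (+ n′ *ᶻ (g (n ℕ.+ n′) +ᶻ g ∣ n - n′ ∣)))
                +ᶻ Lam (λ n k → + n *ᶻ od k *ᶻ g n) m
                ≡ Lam (λ n k → χ k *ᶻ (+ n *ᶻ + n *ᶻ g n)) m +ᶻ g 0 *ᶻ Lam (λ n k → + n *ᶻ (ev k -ᶻ γ k)) m +ᶻ + 4 *ᶻ T m Ω
   β-identity = trans (cong (λ z → z +ᶻ z +ᶻ Lam (λ n k → + n *ᶻ od k *ᶻ g n) m) total)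
     (trans (lem (T m Φ) (Tn≡ m Φ) (T m Ψ) (Tk≡ m κ₁) (Tn≡ m κ₂) L₀ (T m Ω) ΦΨ)
     (trans (cong (λ z → + 4 *ᶻ T m Ω +ᶻ z +ᶻ (Tn≡ m κ₂ +ᶻ Tn≡ m κ₂)) diag)
     (trans (cong (λ z → + 4 *ᶻ T m Ω +ᶻ Lam (λ n k → χ k *ᶻ (+ n *ᶻ + n *ᶻ g n)) m +ᶻ z) tau) (rot (+ 4 *ᶻ T m Ω) _ _))))
     where
       F = factorizations m
       L₀ = Lam (λ n k → + n *ᶻ od k *ᶻ g n) m
       rot : ∀ x y z → x +ᶻ y +ᶻ z ≡ y +ᶻ z +ᶻ x
       rot = solve-∀
       sw₄ : ∀ a b c d → a *ᶻ b *ᶻ (c *ᶻ d) ≡ a *ᶻ d *ᶻ (b *ᶻ c)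
       sw₄ = solve-∀
       -- moves a product identity x y = z w into the weights
       push : ∀ x y z w n G → x *ᶻ y ≡ z *ᶻ w → x *ᶻ y *ᶻ (n *ᶻ G) ≡ z *ᶻ G *ᶻ (w *ᶻ n)
       push x y z w n G p = trans (cong (_*ᶻ (n *ᶻ G)) p) (sw₄ z w n G)
       +cancel : ∀ n n′ → + n ≡ (+ n +ᶻ + n′) -ᶻ + n′
       +cancel n n′ = l (+ n) (+ n′)
         where
           l : ∀ x y → x ≡ (x +ᶻ y) -ᶻ y
           l = solve-∀
       sum₁ : T m κ₁ ≡ Tn> m Φ₂ +ᶻ (Tn> m Φ₁ +ᶻ Tk≡ m κ₁)
       sum₁ = trans (T-k m κ₁) (cong₂ _+ᶻ_
         (R< m κ₁ Φ₂ (λ n k n′ k′ → push (χ k) (od (k ℕ.+ k′)) (χ k) (ev k′) (+ n′) (g (n ℕ.+ n′)) (χo₂ k k′)))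
         (cong (_+ᶻ Tk≡ m κ₁) (R>′ m κ₁ Φ₁ (λ n k n′ k′ →
            trans (push (χ (k ℕ.+ k′)) (od k′) (χ k′) (γ k) (+ n′) (g (n ℕ.+ n′)) (χo₁ k k′))
                  (cong (λ z → χ k′ *ᶻ g (n ℕ.+ n′) *ᶻ (γ k *ᶻ z)) (l (+ n) (+ n′)))))))
         where
           l : ∀ x y → y ≡ (x +ᶻ y) -ᶻ x
           l = solve-∀
       sum₂ : T m κ₂ ≡ Tk< m Ψ₂ +ᶻ (Tk< m Φ₂ +ᶻ Tn≡ m κ₂)
       sum₂ = trans (T-n m κ₂) (cong₂ _+ᶻ_
         (sym (R<′ m Ψ₂ κ₂ (λ n k n′ k′ → trans (neg (χ k) (g n) (γ (k ℕ.+ k′)) (+ n +ᶻ (+ n +ᶻ + n′)) (+ n +ᶻ + n′)) (q n k n′ k′))))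
         (cong (_+ᶻ Tn≡ m κ₂) (sym (R< m Φ₂ κ₂ (λ n k n′ k′ →
           trans (sym (push (χ k) (ev (k ℕ.+ k′)) (χ k) (ev (k ℕ.+ k′)) (+ n′) (g n) refl))
           (cong₂ (λ s t → s *ᶻ (+ n′ *ᶻ g t)) (χe₂ k k′) (sym (∣m+n-n∣ n n′))))))))
         where
           neg : ∀ x G c s t → x *ᶻ G *ᶻ -ᶻ (c *ᶻ t) ≡ -ᶻ (x *ᶻ c) *ᶻ (t *ᶻ G)
           neg = λ x G c s t → l x G c t
             where
               l : ∀ x G c t → x *ᶻ G *ᶻ -ᶻ (c *ᶻ t) ≡ -ᶻ (x *ᶻ c) *ᶻ (t *ᶻ G)
               l = solve-∀
           q : ∀ n k n′ k′ → -ᶻ (χ k *ᶻ γ (k ℕ.+ k′)) *ᶻ ((+ n +ᶻ + n′) *ᶻ g n) ≡ χ k′ *ᶻ od k *ᶻ (+ (n ℕ.+ n′) *ᶻ g ∣ n′ - n ℕ.+ n′ ∣)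
           q n k n′ k′ = cong₂ (λ s t → s *ᶻ (+ (n ℕ.+ n′) *ᶻ g t)) (χo₃ k k′) (sym (trans (ℕP.∣-∣-comm n′ (n ℕ.+ n′)) (∣m+n-n∣ n n′)))
       add : ∀ (xs : List Quad) {f h r : Weight} → (∀ n k n′ k′ → r n k n′ k′ ≡ f n k n′ k′ +ᶻ h n k n′ k′) → ∑ xs (unc₄ r) ≡ ∑ xs (unc₄ f) +ᶻ ∑ xs (unc₄ h)
       add xs {f} {h} p = trans (∑-cong xs (λ { ((n , k) , (n′ , k′)) → p n k n′ k′ })) (∑-⊕ xs (unc₄ f) (unc₄ h))
       Φ-sum : ∀ n k n′ k′ → Φ n k n′ k′ ≡ Φ₁ n k n′ k′ +ᶻ Φ₂ n k n′ k′
       Φ-sum n k n′ k′ = ℤP.*-distribˡ-+ (χ k *ᶻ g n) _ _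
       Ψ-sum : ∀ n k n′ k′ → Ψ n k n′ k′ ≡ Φ₂ n k n′ k′ +ᶻ Ψ₂ n k n′ k′
       Ψ-sum n k n′ k′ = ℤP.*-distribˡ-+ (χ k *ᶻ g n) _ _
       Tk≡Ψ : Tk≡ m Ψ ≡ 0ℤ
       Tk≡Ψ = ∑-zero (filter (λ z → kℓ m z ℕ.≟ kr m z) (quads m)) (λ { {(n , k) , (n′ , k′)} z∈ →
         trans (cong (λ z → χ k *ᶻ g n *ᶻ (ev z *ᶻ + n′ -ᶻ γ z *ᶻ (+ n +ᶻ + n′))) (sym (proj₂ (sound (Enum-filter (λ z → kℓ m z ℕ.≟ kr m z) (quads-Enum m)) z∈))))
         (trans (l (χ k) (g n) (ev k) (γ k) (+ n′) (+ n +ᶻ + n′)) (cong₂ (λ s t → s *ᶻ (g n *ᶻ + n′) -ᶻ t *ᶻ (g n *ᶻ (+ n +ᶻ + n′))) (χe₀ k) (χ*γ k))) })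
         where
           l : ∀ x G e c n s → x *ᶻ G *ᶻ (e *ᶻ n -ᶻ c *ᶻ s) ≡ x *ᶻ e *ᶻ (G *ᶻ n) -ᶻ x *ᶻ c *ᶻ (G *ᶻ s)
           l = solve-∀
       Tk>Ψ : Tk> m Ψ ≡ -ᶻ Tn< m Φ
       Tk>Ψ = trans (R> m Ψ Φ⁻ (λ n k n′ k′ → trans (l (χ (k ℕ.+ k′)) (g n) (ev k′) (γ k′) (+ n′) (+ n +ᶻ + n′))
           (trans (cong₂ (λ s t → s *ᶻ (g n *ᶻ + n′) -ᶻ t *ᶻ (g n *ᶻ (+ n +ᶻ + n′))) (χe k k′) (χγ k k′))
                  (r (χ k) (g n) (ev k′) (γ k′) (+ n) (+ n′)))))
         (∑-neg (filter (λ z → nℓ m z ℕ.<? nr m z) (quads m)) (unc₄ Φ))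
         where
           l : ∀ x G e c n s → x *ᶻ G *ᶻ (e *ᶻ n -ᶻ c *ᶻ s) ≡ x *ᶻ e *ᶻ (G *ᶻ n) -ᶻ x *ᶻ c *ᶻ (G *ᶻ s)
           l = solve-∀
           r : ∀ x G e c n n′ → x *ᶻ c *ᶻ (G *ᶻ n′) -ᶻ x *ᶻ e *ᶻ (G *ᶻ (n +ᶻ n′)) ≡ -ᶻ (x *ᶻ G *ᶻ (c *ᶻ (n -ᶻ (n +ᶻ n′)) +ᶻ e *ᶻ (n +ᶻ n′)))
           r = solve-∀
       total : T m (λ n k n′ k′ → χ k *ᶻ od k′ *ᶻ (+ n′ *ᶻ (g (n ℕ.+ n′) +ᶻ g ∣ n - n′ ∣)))
             ≡ T m Φ -ᶻ Tn≡ m Φ +ᶻ T m Ψ +ᶻ Tk≡ m κ₁ +ᶻ Tn≡ m κ₂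
       total = trans (add (quads m) {κ₁} {κ₂} (λ n k n′ k′ → l (χ k *ᶻ od k′) (+ n′) (g (n ℕ.+ n′)) (g ∣ n - n′ ∣)))
         (trans (cong₂ _+ᶻ_ sum₁ sum₂)
         (combine (T m Φ) (T m Ψ) (Tn< m Φ) (Tn≡ m Φ) (Tn> m Φ₁) (Tn> m Φ₂) (Tk< m Φ₂) (Tk< m Ψ₂) (Tk≡ m κ₁) (Tn≡ m κ₂)
           (trans (T-n m Φ) (cong (λ z → Tn< m Φ +ᶻ (z +ᶻ Tn≡ m Φ)) (add (filter (λ z → nr m z ℕ.<? nℓ m z) (quads m)) {Φ₁} {Φ₂} Φ-sum)))
           (trans (T-k m Ψ) (cong₂ _+ᶻ_ (add (filter (λ z → kℓ m z ℕ.<? kr m z) (quads m)) {Φ₂} {Ψ₂} Ψ-sum) (trans (cong₂ _+ᶻ_ Tk>Ψ Tk≡Ψ) (ℤP.+-identityʳ _))))))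
         where
           l : ∀ x n s t → x *ᶻ (n *ᶻ (s +ᶻ t)) ≡ x *ᶻ (n *ᶻ s) +ᶻ x *ᶻ (n *ᶻ t)
           l = solve-∀
           combine : ∀ Φ Ψ a e p₁ p₂ q₁ q₂ s t → Φ ≡ a +ᶻ ((p₁ +ᶻ p₂) +ᶻ e) → Ψ ≡ (q₁ +ᶻ q₂) +ᶻ -ᶻ a →
                     (p₂ +ᶻ (p₁ +ᶻ s)) +ᶻ (q₂ +ᶻ (q₁ +ᶻ t)) ≡ Φ -ᶻ e +ᶻ Ψ +ᶻ s +ᶻ t
           combine _ _ a e p₁ p₂ q₁ q₂ s t refl refl = l′ a e p₁ p₂ q₁ q₂ s t
             where
               l′ : ∀ a e p₁ p₂ q₁ q₂ s t → (p₂ +ᶻ (p₁ +ᶻ s)) +ᶻ (q₂ +ᶻ (q₁ +ᶻ t)) ≡ a +ᶻ ((p₁ +ᶻ p₂) +ᶻ e) -ᶻ e +ᶻ ((q₁ +ᶻ q₂) +ᶻ -ᶻ a) +ᶻ s +ᶻ t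
               l′ = solve-∀
       ΦΨ : T m Φ +ᶻ T m Ψ ≡ + 2 *ᶻ T m Ω
       ΦΨ = trans (sym (T-⊕ m Φ Ψ)) (trans (∑-cong (quads m) (λ { ((n , k) , (n′ , k′)) → l (χ k) (g n) (γ k′) (ev k′) (+ n) (+ n′) })) (∑-scale (+ 2) (quads m) (unc₄ Ω)))
         where
           l : ∀ x G c e n n′ → x *ᶻ G *ᶻ (c *ᶻ (n -ᶻ n′) +ᶻ e *ᶻ n′) +ᶻ x *ᶻ G *ᶻ (e *ᶻ n′ -ᶻ c *ᶻ (n +ᶻ n′)) ≡ + 2 *ᶻ (x *ᶻ G *ᶻ (n′ *ᶻ (e -ᶻ c)))
           l = solve-∀
       lem : ∀ Φ e Ψ d t l W → Φ +ᶻ Ψ ≡ + 2 *ᶻ W → (Φ -ᶻ e +ᶻ Ψ +ᶻ d +ᶻ t) +ᶻ (Φ -ᶻ e +ᶻ Ψ +ᶻ d +ᶻ t) +ᶻ l ≡ + 4 *ᶻ W +ᶻ (d +ᶻ d +ᶻ l -ᶻ (e +ᶻ e)) +ᶻ (t +ᶻ t)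
       lem Φ e Ψ d t l W p = trans (l₁ Φ e Ψ d t l) (trans (cong (λ z → z +ᶻ z +ᶻ (d +ᶻ d +ᶻ l -ᶻ (e +ᶻ e)) +ᶻ (t +ᶻ t)) p) (l₂ W (d +ᶻ d +ᶻ l -ᶻ (e +ᶻ e)) (t +ᶻ t)))
         where
           l₁ : ∀ Φ e Ψ d t l → (Φ -ᶻ e +ᶻ Ψ +ᶻ d +ᶻ t) +ᶻ (Φ -ᶻ e +ᶻ Ψ +ᶻ d +ᶻ t) +ᶻ l ≡ (Φ +ᶻ Ψ) +ᶻ (Φ +ᶻ Ψ) +ᶻ (d +ᶻ d +ᶻ l -ᶻ (e +ᶻ e)) +ᶻ (t +ᶻ t)
           l₁ = solve-∀
           l₂ : ∀ W x y → + 2 *ᶻ W +ᶻ + 2 *ᶻ W +ᶻ x +ᶻ y ≡ + 4 *ᶻ W +ᶻ x +ᶻ y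
           l₂ = solve-∀
       ζ₁ ζ₂ : ℕ × ℕ → ℤ
       ζ₁ z = ∑ (below (proj₁ z)) (λ n′ → κ₁ (proj₁ z ℕ.∸ n′) (proj₂ z) n′ (proj₂ z))
       ζ₂ z = ∑ (below (proj₂ z)) (λ k′ → Φ (proj₁ z) k′ (proj₁ z) (proj₂ z ℕ.∸ k′))
       diag : Tk≡ m κ₁ +ᶻ Tk≡ m κ₁ +ᶻ L₀ -ᶻ (Tn≡ m Φ +ᶻ Tn≡ m Φ) ≡ Lam (λ n k → χ k *ᶻ (+ n *ᶻ + n *ᶻ g n)) m
       diag = trans (cong₂ (λ s t → s +ᶻ s +ᶻ L₀ -ᶻ (t +ᶻ t)) (Tk≡-∑ m κ₁) (trans (Tn≡-flip m Φ) (Tn≡-∑ m _)))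
         (trans (cong (λ z → z +ᶻ L₀ -ᶻ (∑ F ζ₂ +ᶻ ∑ F ζ₂)) (sym (∑-⊕ F ζ₁ ζ₁)))
         (trans (∑-comb F (λ z → ζ₁ z +ᶻ ζ₁ z) (unc (λ n k → + n *ᶻ od k *ᶻ g n)) ζ₂)
                (∑-cong-∈ F (λ { {n , k} z∈ → pointwise n k (proj₁ (sound (factorizations-Graded m) z∈)) }))))
         where
           pointwise : ∀ n k → Pos (n , k) → ζ₁ (n , k) +ᶻ ζ₁ (n , k) +ᶻ + n *ᶻ od k *ᶻ g n -ᶻ (ζ₂ (n , k) +ᶻ ζ₂ (n , k)) ≡ χ k *ᶻ (+ n *ᶻ + n *ᶻ g n)
           pointwise (suc n) k _ = trans (cong₂ (λ s t → s +ᶻ s +ᶻ + suc n *ᶻ od k *ᶻ g (suc n) -ᶻ (t +ᶻ t)) e₁ e₂)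
             (trans (r₁ (χ k) (g (suc n)) (∑ (upto n) +_) (+ suc n) (od k) (∑ (below k) χ))
             (trans (cong₂ (λ s t → χ k *ᶻ g (suc n) *ᶻ s +ᶻ + suc n *ᶻ od k *ᶻ g (suc n) -ᶻ + suc n *ᶻ g (suc n) *ᶻ t) (∑upto n) (od∑χ k))
                    (r₂ (χ k) (g (suc n)) (+ n) (od k))))
             where
               e₁ : ζ₁ (suc n , k) ≡ χ k *ᶻ g (suc n) *ᶻ ∑ (upto n) +_
               e₁ = trans (∑-below (suc n) (λ j i → κ₁ j k i k) (λ i → χ k *ᶻ g (suc n) *ᶻ + i)
                       (λ i j eq → trans (cong₂ (λ s t → s *ᶻ (+ i *ᶻ g t)) (χ*od k) eq) (l (χ k) (+ i) (g (suc n)))))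
                     (∑-scale (χ k *ᶻ g (suc n)) (upto n) +_)
                 where
                   l : ∀ x i G → x *ᶻ (i *ᶻ G) ≡ x *ᶻ G *ᶻ i
                   l = solve-∀
               e₂ : ζ₂ (suc n , k) ≡ + suc n *ᶻ g (suc n) *ᶻ od k *ᶻ ∑ (below k) χ
               e₂ = trans (∑-below k (λ j i → Φ (suc n) i (suc n) j) (λ i → + suc n *ᶻ g (suc n) *ᶻ od k *ᶻ χ i)
                       (λ i j eq → trans (l (χ i) (g (suc n)) (γ j) (ev j) (+ suc n))
                         (trans (cong (λ z → z *ᶻ (g (suc n) *ᶻ + suc n)) (trans (sym (χo₂ i j)) (cong (λ z → χ i *ᶻ od z) (trans (ℕP.+-comm i j) eq)))) (l′ (χ i) (od k) (g (suc n)) (+ suc n)))))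
                     (∑-scale (+ suc n *ᶻ g (suc n) *ᶻ od k) (below k) χ)
                 where
                   l : ∀ x G c e n → x *ᶻ G *ᶻ (c *ᶻ (n -ᶻ n) +ᶻ e *ᶻ n) ≡ x *ᶻ e *ᶻ (G *ᶻ n)
                   l = solve-∀
                   l′ : ∀ x o G n → x *ᶻ o *ᶻ (G *ᶻ n) ≡ n *ᶻ G *ᶻ o *ᶻ x
                   l′ = solve-∀
               r₁ : ∀ x G u n o s → x *ᶻ G *ᶻ u +ᶻ x *ᶻ G *ᶻ u +ᶻ n *ᶻ o *ᶻ G -ᶻ (n *ᶻ G *ᶻ o *ᶻ s +ᶻ n *ᶻ G *ᶻ o *ᶻ s) ≡ x *ᶻ G *ᶻ (u +ᶻ u) +ᶻ n *ᶻ o *ᶻ G -ᶻ n *ᶻ G *ᶻ (o *ᶻ (s +ᶻ s))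
               r₁ = solve-∀
               r₂ : ∀ x G n o → x *ᶻ G *ᶻ (n *ᶻ (1ℤ +ᶻ n)) +ᶻ (1ℤ +ᶻ n) *ᶻ o *ᶻ G -ᶻ (1ℤ +ᶻ n) *ᶻ G *ᶻ (o -ᶻ x) ≡ x *ᶻ ((1ℤ +ᶻ n) *ᶻ (1ℤ +ᶻ n) *ᶻ G)
               r₂ = solve-∀
       tau : Tn≡ m κ₂ +ᶻ Tn≡ m κ₂ ≡ g 0 *ᶻ Lam (λ n k → + n *ᶻ (ev k -ᶻ γ k)) m
       tau = trans (cong (λ z → z +ᶻ z) (trans (Tn≡-flip m κ₂) (Tn≡-∑ m _)))
         (trans (sym (∑-⊕ F _ _)) (trans (∑-cong F (λ { (n , k) → pointwise n k })) (∑-scale (g 0) F _)))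
         where
           pointwise : ∀ n k → ∑ (below k) (λ k′ → κ₂ n k′ n (k ℕ.∸ k′)) +ᶻ ∑ (below k) (λ k′ → κ₂ n k′ n (k ℕ.∸ k′)) ≡ g 0 *ᶻ (+ n *ᶻ (ev k -ᶻ γ k))
           pointwise n k = trans (cong (λ z → z +ᶻ z) e)
             (trans (l (+ n *ᶻ g 0) (ev k) (∑ (below k) χ)) (trans (cong (+ n *ᶻ g 0 *ᶻ_) (ev∑χ k)) (l″ (+ n) (g 0) (ev k -ᶻ γ k))))
             where
               e : ∑ (below k) (λ k′ → κ₂ n k′ n (k ℕ.∸ k′)) ≡ + n *ᶻ g 0 *ᶻ ev k *ᶻ ∑ (below k) χ
               e = trans (∑-below k (λ j i → κ₂ n i n j) (λ i → + n *ᶻ g 0 *ᶻ ev k *ᶻ χ i)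
                      (λ i j eq → trans (cong₂ (λ s t → s *ᶻ (+ n *ᶻ g t)) (trans (sym (χe₂ i j)) (cong (λ z → χ i *ᶻ ev z) (trans (ℕP.+-comm i j) eq))) (ℕP.m≡n⇒∣m-n∣≡0 {n} refl))
                                        (l′ (χ i) (ev k) (+ n) (g 0))))
                   (∑-scale (+ n *ᶻ g 0 *ᶻ ev k) (below k) χ)
                 where
                   l′ : ∀ x e n G → x *ᶻ e *ᶻ (n *ᶻ G) ≡ n *ᶻ G *ᶻ e *ᶻ x
                   l′ = solve-∀
               l : ∀ c e s → c *ᶻ e *ᶻ s +ᶻ c *ᶻ e *ᶻ s ≡ c *ᶻ (e *ᶻ (s +ᶻ s))
               l = solve-∀
               l″ : ∀ n G x → n *ᶻ G *ᶻ x ≡ G *ᶻ (n *ᶻ x)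
               l″ = solve-∀

-- Lambert series and the theorem on sums of two squares.

module LambertSeries where

 open PowerSeries
 open FiniteSums
 open Substitution
 open ThetaSeries
 open Wronskian
 open Gauss
 open Factorizations
 open QuadrupleIdentities
 open import Data.Nat using (∣_-_∣)

 -- The power n^(2j), built from n² because |n - n′| is accessible as a polynomial only through its
 -- square.
 e : ℕ → ℕ → ℤ
 e zero    n = 1ℤ
 e (suc j) n = + n *ᶻ + n *ᶻ e j n

 -- Eisenstein series without constant terms: L j has weight 2j + 1 and the character modulo 4, O j
 -- has weight 2j + 2.
 L O : ℕ → PS
 L j = Lam (λ n k → χ k *ᶻ e j n)
 O j = Lam (λ n k → + n *ᶻ od k *ᶻ e j n)

 L₀⁻ O₀⁻ H τₛ : PS
 L₀⁻ = Lam (λ n k → χ k *ᶻ sgn n)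
 O₀⁻ = Lam (λ n k → + n *ᶻ od k *ᶻ sgn n)
 H   = Lam (λ n k → + n *ᶻ (ev k -ᶻ γ k))
 τₛ m = Tn≡ m (λ n k n′ k′ → χ k *ᶻ χ k′)

 ∣-∣-sq : ∀ m n → + ∣ m - n ∣ *ᶻ + ∣ m - n ∣ ≡ (+ m -ᶻ + n) *ᶻ (+ m -ᶻ + n)
 ∣-∣-sq zero    n       = lem (+ n)
   where
     lem : ∀ n → n *ᶻ n ≡ (0ℤ -ᶻ n) *ᶻ (0ℤ -ᶻ n)
     lem = solve-∀
 ∣-∣-sq (suc m) zero    = lem (+ suc m)
   where
     lem : ∀ n → n *ᶻ n ≡ (n -ᶻ 0ℤ) *ᶻ (n -ᶻ 0ℤ)
     lem = solve-∀
 ∣-∣-sq (suc m) (suc n) = trans (∣-∣-sq m n) (lem (+ m) (+ n))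
   where
     lem : ∀ m n → (m -ᶻ n) *ᶻ (m -ᶻ n) ≡ (1ℤ +ᶻ m -ᶻ (1ℤ +ᶻ n)) *ᶻ (1ℤ +ᶻ m -ᶻ (1ℤ +ᶻ n))
     lem = solve-∀

 sgn-∣-∣ : ∀ m n → sgn ∣ m - n ∣ ≡ sgn m *ᶻ sgn n
 sgn-∣-∣ zero    n       = sym (ℤP.*-identityˡ (sgn n))
 sgn-∣-∣ (suc m) zero    = sym (ℤP.*-identityʳ _)
 sgn-∣-∣ (suc m) (suc n) = trans (sgn-∣-∣ m n) (lem (sgn m) (sgn n))
   where
     lem : ∀ x y → x *ᶻ y ≡ -ᶻ x *ᶻ -ᶻ y
     lem = solve-∀

 record Term : Set where
   constructor _·_⊗_
   field
     coef        : ℤ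
     left right  : ℕ → ℕ → ℤ
 infix 5 _·_⊗_

 -- A list of terms has two readings, as a weight on quadruples and as a combination of products of
 -- Lambert series; `T-value` equates them.
 weight : List Term → Weight
 weight []                n k n′ k′ = 0ℤ
 weight ((c · φ ⊗ ψ) ∷ ts) n k n′ k′ = c *ᶻ (φ n k *ᶻ ψ n′ k′) +ᶻ weight ts n k n′ k′

 value : List Term → PS
 value []                = con 0ℤ
 value ((c · φ ⊗ ψ) ∷ ts) = con c ⊛ (Lam φ ⊛ Lam ψ) ⊕ value ts

 T-value : ∀ ts {w : Weight} → (∀ n k n′ k′ → w n k n′ k′ ≡ weight ts n k n′ k′) → ∀ m → T m w ≡ value ts m
 T-value ts {w} eq m = trans (∑-cong (quads m) (λ { ((n , k) , (n′ , k′)) → eq n k n′ k′ })) (go ts)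
   where
     go : ∀ ts → ∑ (quads m) (unc₄ (weight ts)) ≡ value ts m
     go [] = trans (∑-zero (quads m) (λ _ → refl)) (sym (con0 m))
       where
         con0 : ∀ m → con 0ℤ m ≡ 0ℤ
         con0 zero    = refl
         con0 (suc m) = refl
     go ((c · φ ⊗ ψ) ∷ ts) = trans (∑-⊕ (quads m) (unc₄ (λ n k n′ k′ → c *ᶻ (φ n k *ᶻ ψ n′ k′))) (unc₄ (weight ts)))
       (cong₂ _+ᶻ_ (trans (∑-scale c (quads m) (unc₄ (λ n k n′ k′ → φ n k *ᶻ ψ n′ k′)))
                          (trans (cong (c *ᶻ_) (sym (Lam-⊛ φ ψ m))) (sym (con-⊛ c (Lam φ ⊛ Lam ψ) m))))
                   (go ts))

 private
   𝐋 𝐎 : ℕ → ℕ → ℕ → ℤ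
   𝐋 j n k = χ k *ᶻ e j n
   𝐎 j n k = + n *ᶻ od k *ᶻ e j n

   sum-sq : ∀ (u : ℤ → ℤ) n n′ → u (+ (n ℕ.+ n′) *ᶻ + (n ℕ.+ n′)) +ᶻ u (+ ∣ n - n′ ∣ *ᶻ + ∣ n - n′ ∣) ≡ u ((+ n +ᶻ + n′) *ᶻ (+ n +ᶻ + n′)) +ᶻ u ((+ n -ᶻ + n′) *ᶻ (+ n -ᶻ + n′))
   sum-sq u n n′ = cong (λ z → u ((+ n +ᶻ + n′) *ᶻ (+ n +ᶻ + n′)) +ᶻ u z) (∣-∣-sq n n′)

 -- The case g = 1, where g(0) = 1 leaves the diagonal sum `τₛ`. For positive powers g(0) = 0
 -- removes it.
 α₀ : con (+ 2) ⊛ (L 0 ⊛ L 0) ⊕ L 0 ≗ₛ O 0 ⊕ τₛ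
 α₀ m = trans (cong (_+ᶻ L 0 m) (sym (trans (T-value ((+ 2 · 𝐋 0 ⊗ 𝐋 0) ∷ []) (λ n k n′ k′ → lem (χ k) (χ k′)) m) (S.solve 1 (λ x → x S.:+ S.:con 0ℤ S.:= x) S.refl (con (+ 2) ⊛ (L 0 ⊛ L 0)) m))))
   (trans (α-identity (e 0) m) (cong (O 0 m +ᶻ_) (ℤP.*-identityˡ (τₛ m))))
   where
     lem : ∀ x y → x *ᶻ y *ᶻ (1ℤ +ᶻ 1ℤ) ≡ + 2 *ᶻ ((x *ᶻ 1ℤ) *ᶻ (y *ᶻ 1ℤ)) +ᶻ 0ℤ
     lem = solve-∀

 α₀⁻ : con (+ 2) ⊛ (L₀⁻ ⊛ L₀⁻) ⊕ L₀⁻ ≗ₛ O₀⁻ ⊕ τₛ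
 α₀⁻ m = trans (cong (_+ᶻ L₀⁻ m) (sym (trans (T-value ((+ 2 · (λ n k → χ k *ᶻ sgn n) ⊗ (λ n k → χ k *ᶻ sgn n)) ∷ []) eq m) (S.solve 1 (λ x → x S.:+ S.:con 0ℤ S.:= x) S.refl (con (+ 2) ⊛ (L₀⁻ ⊛ L₀⁻)) m))))
   (trans (α-identity sgn m) (cong (O₀⁻ m +ᶻ_) (ℤP.*-identityˡ (τₛ m))))
   where
     lem : ∀ x y s t → x *ᶻ y *ᶻ (s *ᶻ t +ᶻ s *ᶻ t) ≡ + 2 *ᶻ ((x *ᶻ s) *ᶻ (y *ᶻ t)) +ᶻ 0ℤ
     lem = solve-∀
     eq : ∀ n k n′ k′ → χ k *ᶻ χ k′ *ᶻ (sgn (n ℕ.+ n′) +ᶻ sgn ∣ n - n′ ∣) ≡ _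
     eq n k n′ k′ = trans (cong (χ k *ᶻ χ k′ *ᶻ_) (cong₂ _+ᶻ_ (sgn-+ n n′) (sgn-∣-∣ n n′))) (lem (χ k) (χ k′) (sgn n) (sgn n′))

 private
   α-series : ∀ j ts → (∀ n k n′ k′ → χ k *ᶻ χ k′ *ᶻ (e (suc j) (n ℕ.+ n′) +ᶻ e (suc j) ∣ n - n′ ∣) ≡ weight ts n k n′ k′) → value ts ⊕ L (suc j) ≗ₛ O (suc j)
   α-series j ts eq m = trans (cong (_+ᶻ L (suc j) m) (sym (T-value ts eq m))) (trans (α-identity (e (suc j)) m) (ℤP.+-identityʳ (O (suc j) m)))

 α₁ : con (+ 4) ⊛ (L 0 ⊛ L 1) ⊕ L 1 ≗ₛ O 1
 α₁ = S.trans (S.+-cong {y = value ts} (S.solve 2 (λ x y → S.:con (+ 4) :* (x :* y) S.:= S.:con (+ 2) :* (y :* x) :+ (S.:con (+ 2) :* (x :* y) :+ S.:con 0ℤ)) S.refl (L 0) (L 1)) S.refl)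
   (α-series 0 ts (λ n k n′ k′ → trans (cong (χ k *ᶻ χ k′ *ᶻ_) (sum-sq (_*ᶻ 1ℤ) n n′)) (lem (χ k) (χ k′) (+ n) (+ n′))))
   where
     open S using (_:+_; _:*_; _:-_)
     ts = (+ 2 · 𝐋 1 ⊗ 𝐋 0) ∷ (+ 2 · 𝐋 0 ⊗ 𝐋 1) ∷ []
     lem : ∀ x y n m → x *ᶻ y *ᶻ ((n +ᶻ m) *ᶻ (n +ᶻ m) *ᶻ 1ℤ +ᶻ (n -ᶻ m) *ᶻ (n -ᶻ m) *ᶻ 1ℤ)
           ≡ + 2 *ᶻ ((x *ᶻ (n *ᶻ n *ᶻ 1ℤ)) *ᶻ (y *ᶻ 1ℤ)) +ᶻ (+ 2 *ᶻ ((x *ᶻ 1ℤ) *ᶻ (y *ᶻ (m *ᶻ m *ᶻ 1ℤ))) +ᶻ 0ℤ)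
     lem = solve-∀

 α₂ : con (+ 4) ⊛ (L 0 ⊛ L 2) ⊕ con (+ 12) ⊛ (L 1 ⊛ L 1) ⊕ L 2 ≗ₛ O 2
 α₂ = S.trans (S.+-cong {y = value ts} (S.solve 3 (λ x y z → S.:con (+ 4) :* (x :* z) :+ S.:con (+ 12) :* (y :* y) S.:= S.:con (+ 2) :* (z :* x) :+ (S.:con (+ 12) :* (y :* y) :+ (S.:con (+ 2) :* (x :* z) :+ S.:con 0ℤ))) S.refl (L 0) (L 1) (L 2)) S.refl)
   (α-series 1 ts (λ n k n′ k′ → trans (cong (χ k *ᶻ χ k′ *ᶻ_) (sum-sq (λ z → z *ᶻ (z *ᶻ 1ℤ)) n n′)) (lem (χ k) (χ k′) (+ n) (+ n′))))
   where
     open S using (_:+_; _:*_; _:-_)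
     ts = (+ 2 · 𝐋 2 ⊗ 𝐋 0) ∷ (+ 12 · 𝐋 1 ⊗ 𝐋 1) ∷ (+ 2 · 𝐋 0 ⊗ 𝐋 2) ∷ []
     lem : ∀ x y n m → x *ᶻ y *ᶻ ((n +ᶻ m) *ᶻ (n +ᶻ m) *ᶻ ((n +ᶻ m) *ᶻ (n +ᶻ m) *ᶻ 1ℤ) +ᶻ (n -ᶻ m) *ᶻ (n -ᶻ m) *ᶻ ((n -ᶻ m) *ᶻ (n -ᶻ m) *ᶻ 1ℤ))
           ≡ + 2 *ᶻ ((x *ᶻ (n *ᶻ n *ᶻ (n *ᶻ n *ᶻ 1ℤ))) *ᶻ (y *ᶻ 1ℤ)) +ᶻ (+ 12 *ᶻ ((x *ᶻ (n *ᶻ n *ᶻ 1ℤ)) *ᶻ (y *ᶻ (m *ᶻ m *ᶻ 1ℤ))) +ᶻ (+ 2 *ᶻ ((x *ᶻ 1ℤ) *ᶻ (y *ᶻ (m *ᶻ m *ᶻ (m *ᶻ m *ᶻ 1ℤ)))) +ᶻ 0ℤ))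
     lem = solve-∀

 α₃ : con (+ 4) ⊛ (L 0 ⊛ L 3) ⊕ con (+ 60) ⊛ (L 1 ⊛ L 2) ⊕ L 3 ≗ₛ O 3
 α₃ = S.trans (S.+-cong {y = value ts} (S.solve 4 (λ x y z w → S.:con (+ 4) :* (x :* w) :+ S.:con (+ 60) :* (y :* z) S.:= S.:con (+ 2) :* (w :* x) :+ (S.:con (+ 30) :* (z :* y) :+ (S.:con (+ 30) :* (y :* z) :+ (S.:con (+ 2) :* (x :* w) :+ S.:con 0ℤ)))) S.refl (L 0) (L 1) (L 2) (L 3)) S.refl)
   (α-series 2 ts (λ n k n′ k′ → trans (cong (χ k *ᶻ χ k′ *ᶻ_) (sum-sq (λ z → z *ᶻ (z *ᶻ (z *ᶻ 1ℤ))) n n′)) (lem (χ k) (χ k′) (+ n) (+ n′))))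
   where
     open S using (_:+_; _:*_; _:-_)
     ts = (+ 2 · 𝐋 3 ⊗ 𝐋 0) ∷ (+ 30 · 𝐋 2 ⊗ 𝐋 1) ∷ (+ 30 · 𝐋 1 ⊗ 𝐋 2) ∷ (+ 2 · 𝐋 0 ⊗ 𝐋 3) ∷ []
     lem : ∀ x y n m → x *ᶻ y *ᶻ ((n +ᶻ m) *ᶻ (n +ᶻ m) *ᶻ ((n +ᶻ m) *ᶻ (n +ᶻ m) *ᶻ ((n +ᶻ m) *ᶻ (n +ᶻ m) *ᶻ 1ℤ)) +ᶻ (n -ᶻ m) *ᶻ (n -ᶻ m) *ᶻ ((n -ᶻ m) *ᶻ (n -ᶻ m) *ᶻ ((n -ᶻ m) *ᶻ (n -ᶻ m) *ᶻ 1ℤ)))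
           ≡ + 2 *ᶻ ((x *ᶻ (n *ᶻ n *ᶻ (n *ᶻ n *ᶻ (n *ᶻ n *ᶻ 1ℤ)))) *ᶻ (y *ᶻ 1ℤ)) +ᶻ (+ 30 *ᶻ ((x *ᶻ (n *ᶻ n *ᶻ (n *ᶻ n *ᶻ 1ℤ))) *ᶻ (y *ᶻ (m *ᶻ m *ᶻ 1ℤ))) +ᶻ (+ 30 *ᶻ ((x *ᶻ (n *ᶻ n *ᶻ 1ℤ)) *ᶻ (y *ᶻ (m *ᶻ m *ᶻ (m *ᶻ m *ᶻ 1ℤ)))) +ᶻ (+ 2 *ᶻ ((x *ᶻ 1ℤ) *ᶻ (y *ᶻ (m *ᶻ m *ᶻ (m *ᶻ m *ᶻ (m *ᶻ m *ᶻ 1ℤ))))) +ᶻ 0ℤ)))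
     lem = solve-∀

 private
   β-series : ∀ j ts → (∀ n k n′ k′ → χ k *ᶻ od k′ *ᶻ (+ n′ *ᶻ (e j (n ℕ.+ n′) +ᶻ e j ∣ n - n′ ∣)) ≡ weight ts n k n′ k′) →
              value ts ⊕ value ts ⊕ O j ≗ₛ L (suc j) ⊕ con (e j 0) ⊛ H ⊕ con (+ 4) ⊛ (L j ⊛ H)
   β-series j ts eq m = trans (cong (λ z → z +ᶻ z +ᶻ O j m) (sym (T-value ts eq m))) (trans (β-identity (e j) m)
     (cong₂ _+ᶻ_ (cong (L (suc j) m +ᶻ_) (sym (con-⊛ (e j 0) H m)))
       (trans (cong (+ 4 *ᶻ_) (sym (Lam-⊛ (𝐋 j) (λ n k → + n *ᶻ (ev k -ᶻ γ k)) m))) (sym (con-⊛ (+ 4) (L j ⊛ H) m)))))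

 β₀ : con (+ 4) ⊛ (L 0 ⊛ O 0) ⊕ O 0 ≗ₛ L 1 ⊕ H ⊕ con (+ 4) ⊛ (L 0 ⊛ H)
 β₀ = S.trans (S.solve 2 (λ x y → S.:con (+ 4) :* (x :* y) :+ y S.:= (S.:con (+ 2) :* (x :* y) :+ S.:con 0ℤ) :+ (S.:con (+ 2) :* (x :* y) :+ S.:con 0ℤ) :+ y) S.refl (L 0) (O 0))
   (S.trans (β-series 0 ((+ 2 · 𝐋 0 ⊗ 𝐎 0) ∷ []) (λ n k n′ k′ → lem (χ k) (od k′) (+ n′)))
            (S.solve 3 (λ x y z → x :+ S.:con 1ℤ :* y :+ z S.:= x :+ y :+ z) S.refl (L 1) H (con (+ 4) ⊛ (L 0 ⊛ H))))
   where
     open S using (_:+_; _:*_; _:-_)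
     lem : ∀ x o n → x *ᶻ o *ᶻ (n *ᶻ (1ℤ +ᶻ 1ℤ)) ≡ + 2 *ᶻ ((x *ᶻ 1ℤ) *ᶻ (n *ᶻ o *ᶻ 1ℤ)) +ᶻ 0ℤ
     lem = solve-∀

 β₁ : con (+ 4) ⊛ (L 1 ⊛ O 0 ⊕ L 0 ⊛ O 1) ⊕ O 1 ≗ₛ L 2 ⊕ con (+ 4) ⊛ (L 1 ⊛ H)
 β₁ = S.trans (S.solve 4 (λ x y u v → S.:con (+ 4) :* (y :* u :+ x :* v) :+ v S.:= (S.:con (+ 2) :* (y :* u) :+ (S.:con (+ 2) :* (x :* v) :+ S.:con 0ℤ)) :+ (S.:con (+ 2) :* (y :* u) :+ (S.:con (+ 2) :* (x :* v) :+ S.:con 0ℤ)) :+ v) S.refl (L 0) (L 1) (O 0) (O 1))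
   (S.trans (β-series 1 ((+ 2 · 𝐋 1 ⊗ 𝐎 0) ∷ (+ 2 · 𝐋 0 ⊗ 𝐎 1) ∷ [])
       (λ n k n′ k′ → trans (cong (λ z → χ k *ᶻ od k′ *ᶻ (+ n′ *ᶻ z)) (sum-sq (_*ᶻ 1ℤ) n n′)) (lem (χ k) (od k′) (+ n) (+ n′))))
            (S.solve 3 (λ x y z → x :+ S.:con 0ℤ :* y :+ z S.:= x :+ z) S.refl (L 2) H (con (+ 4) ⊛ (L 1 ⊛ H))))
   where
     open S using (_:+_; _:*_; _:-_)
     lem : ∀ x o n m → x *ᶻ o *ᶻ (m *ᶻ ((n +ᶻ m) *ᶻ (n +ᶻ m) *ᶻ 1ℤ +ᶻ (n -ᶻ m) *ᶻ (n -ᶻ m) *ᶻ 1ℤ))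
           ≡ + 2 *ᶻ ((x *ᶻ (n *ᶻ n *ᶻ 1ℤ)) *ᶻ (m *ᶻ o *ᶻ 1ℤ)) +ᶻ (+ 2 *ᶻ ((x *ᶻ 1ℤ) *ᶻ (m *ᶻ o *ᶻ (m *ᶻ m *ᶻ 1ℤ))) +ᶻ 0ℤ)
     lem = solve-∀

 β₂ : con (+ 4) ⊛ (L 2 ⊛ O 0 ⊕ con (+ 6) ⊛ (L 1 ⊛ O 1) ⊕ L 0 ⊛ O 2) ⊕ O 2 ≗ₛ L 3 ⊕ con (+ 4) ⊛ (L 2 ⊛ H)
 β₂ = S.trans (S.solve 6 (λ x y z u v w → S.:con (+ 4) :* (z :* u :+ S.:con (+ 6) :* (y :* v) :+ x :* w) :+ w
         S.:= (S.:con (+ 2) :* (z :* u) :+ (S.:con (+ 12) :* (y :* v) :+ (S.:con (+ 2) :* (x :* w) :+ S.:con 0ℤ))) :+ (S.:con (+ 2) :* (z :* u) :+ (S.:con (+ 12) :* (y :* v) :+ (S.:con (+ 2) :* (x :* w) :+ S.:con 0ℤ))) :+ w) S.refl (L 0) (L 1) (L 2) (O 0) (O 1) (O 2))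
   (S.trans (β-series 2 ((+ 2 · 𝐋 2 ⊗ 𝐎 0) ∷ (+ 12 · 𝐋 1 ⊗ 𝐎 1) ∷ (+ 2 · 𝐋 0 ⊗ 𝐎 2) ∷ [])
       (λ n k n′ k′ → trans (cong (λ z → χ k *ᶻ od k′ *ᶻ (+ n′ *ᶻ z)) (sum-sq (λ z → z *ᶻ (z *ᶻ 1ℤ)) n n′)) (lem (χ k) (od k′) (+ n) (+ n′))))
            (S.solve 3 (λ x y z → x :+ S.:con 0ℤ :* y :+ z S.:= x :+ z) S.refl (L 3) H (con (+ 4) ⊛ (L 2 ⊛ H))))
   where
     open S using (_:+_; _:*_; _:-_)
     lem : ∀ x o n m → x *ᶻ o *ᶻ (m *ᶻ ((n +ᶻ m) *ᶻ (n +ᶻ m) *ᶻ ((n +ᶻ m) *ᶻ (n +ᶻ m) *ᶻ 1ℤ) +ᶻ (n -ᶻ m) *ᶻ (n -ᶻ m) *ᶻ ((n -ᶻ m) *ᶻ (n -ᶻ m) *ᶻ 1ℤ)))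
           ≡ + 2 *ᶻ ((x *ᶻ (n *ᶻ n *ᶻ (n *ᶻ n *ᶻ 1ℤ))) *ᶻ (m *ᶻ o *ᶻ 1ℤ)) +ᶻ (+ 12 *ᶻ ((x *ᶻ (n *ᶻ n *ᶻ 1ℤ)) *ᶻ (m *ᶻ o *ᶻ (m *ᶻ m *ᶻ 1ℤ))) +ᶻ (+ 2 *ᶻ ((x *ᶻ 1ℤ) *ᶻ (m *ᶻ o *ᶻ (m *ᶻ m *ᶻ (m *ᶻ m *ᶻ 1ℤ)))) +ᶻ 0ℤ))
     lem = solve-∀

 Lam-cong : ∀ {φ ψ : ℕ → ℕ → ℤ} → (∀ n k → φ n k ≡ ψ n k) → Lam φ ≗ₛ Lam ψ
 Lam-cong p m = ∑-cong (factorizations m) (λ { (n , k) → p n k })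

 Lam-⊕ : ∀ (φ ψ : ℕ → ℕ → ℤ) → Lam (λ n k → φ n k +ᶻ ψ n k) ≗ₛ Lam φ ⊕ Lam ψ
 Lam-⊕ φ ψ m = ∑-⊕ (factorizations m) (unc φ) (unc ψ)

 Lam-scale : ∀ c (φ : ℕ → ℕ → ℤ) → Lam (λ n k → c *ᶻ φ n k) ≗ₛ con c ⊛ Lam φ
 Lam-scale c φ m = trans (∑-scale c (factorizations m) (unc φ)) (sym (con-⊛ c (Lam φ) m))

 Lam-flip : ∀ (φ : ℕ → ℕ → ℤ) → Lam φ ≗ₛ Lam (λ n k → φ k n)
 Lam-flip φ m = ∑-bij (factorizations-Graded m) (factorizations-Graded m) (λ { (n , k) → k , n })
   (λ { {n , k} ((p , q) , eq) → (q , p) , trans (ℕP.*-comm k n) eq })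
   (λ { _ _ refl → refl })
   (λ { {n , k} ((p , q) , eq) → (k , n) , ((q , p) , trans (ℕP.*-comm k n) eq) , refl })
   (λ _ → refl)

 Lam-ev : ∀ (φ : ℕ → ℕ → ℤ) → Lam (λ n k → ev n *ᶻ φ n k) ≗ₛ V₂ (Lam (λ n k → φ (n ℕ.* 2) k))
 Lam-ev φ = V₂-char at-even at-odd
   where
     w : ℕ × ℕ → ℤ
     w = unc (λ n k → ev n *ᶻ φ n k)
     even? : (z : ℕ × ℕ) → Dec (ev (proj₁ z) ≡ 1ℤ)
     even? z = ev (proj₁ z) ℤ.≟ 1ℤ
     shuffle : ∀ n k → n ℕ.* 2 ℕ.* k ≡ n ℕ.* k ℕ.* 2
     shuffle = ℕSolver.solve-∀
     at-even : ∀ m → Lam (λ n k → ev n *ᶻ φ n k) (m ℕ.* 2) ≡ Lam (λ n k → φ (n ℕ.* 2) k) m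
     at-even m = trans (∑-filter even? (factorizations (m ℕ.* 2)) w)
       (trans (cong₂ _+ᶻ_ (sym (∑-bij (factorizations-Graded m) (Enum-filter even? (factorizations-Graded (m ℕ.* 2))) (λ { (n , k) → n ℕ.* 2 , k })
           (λ { {n , k} ((p , q) , eq) → ((ℕP.≤-trans p (ℕP.m≤m*n n 2) , q) , trans (shuffle n k) (cong (ℕ._* 2) eq)) , ev-even n })
           (λ { {n , k} {n₁ , k₁} _ _ eq → cong₂ _,_ (ℕP.*-cancelʳ-≡ n n₁ 2 (cong proj₁ eq)) (cong proj₂ eq) })
           surj
           (λ { {n , k} _ → sym (trans (cong (_*ᶻ φ (n ℕ.* 2) k) (ev-even n)) (ℤP.*-identityˡ _)) })))
         (∑-zero (filter (¬?even) (factorizations (m ℕ.* 2))) zero-odd)) (ℤP.+-identityʳ _))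
       where
         open import Relation.Nullary using (¬?)
         ¬?even = λ z → ¬? (even? z)
         surj : ∀ {y} → (Pos y × proj₁ y ℕ.* proj₂ y ≡ m ℕ.* 2) × ev (proj₁ y) ≡ 1ℤ → ∃ λ x → (Pos x × proj₁ x ℕ.* proj₂ x ≡ m) × (proj₁ x ℕ.* 2 , proj₂ x) ≡ y
         surj {n , k} (((p , q) , eq) , e) with parity n
         ... | even (suc u) = (suc u , k) , ((s≤s z≤n , q) , ℕP.*-cancelʳ-≡ (suc u ℕ.* k) m 2 (trans (sym (shuffle (suc u) k)) eq)) , refl
         ... | odd u with trans (sym e) (od-even u)
         ...   | ()
         zero-odd : ∀ {z} → z ∈ filter ¬?even (factorizations (m ℕ.* 2)) → w z ≡ 0ℤ
         zero-odd {n , k} z∈ with parity n | proj₂ (sound (Enum-filter ¬?even (factorizations-Graded (m ℕ.* 2))) z∈)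
         ... | even u | ne = ⊥-elim (ne (ev-even u))
         ... | odd u  | _  = cong (_*ᶻ φ (suc (u ℕ.* 2)) k) (od-even u)
     at-odd : ∀ m → Lam (λ n k → ev n *ᶻ φ n k) (suc (m ℕ.* 2)) ≡ 0ℤ
     at-odd m = ∑-zero (factorizations (suc (m ℕ.* 2))) (λ { {n , k} z∈ → go n k (proj₂ (sound (factorizations-Graded (suc (m ℕ.* 2))) z∈)) })
       where
         go : ∀ n k → n ℕ.* k ≡ suc (m ℕ.* 2) → ev n *ᶻ φ n k ≡ 0ℤ
         go n k eq with parity n
         ... | odd u  = cong (_*ᶻ φ (suc (u ℕ.* 2)) k) (od-even u)
         ... | even u with trans (sym (ev-even (u ℕ.* k))) (trans (cong ev (trans (sym (shuffle u k)) eq)) (od-even m))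
         ...   | ()

 χ-even : ∀ m → χ (m ℕ.* 2) ≡ 0ℤ
 χ-even zero    = refl
 χ-even (suc m) = cong -ᶻ_ (χ-even m)

 sgn-χ : ∀ n k → sgn (n ℕ.* k) *ᶻ χ k ≡ χ k *ᶻ sgn n
 sgn-χ n k with parity k
 ... | even j = trans (cong (sgn (n ℕ.* (j ℕ.* 2)) *ᶻ_) (χ-even j)) (trans (ℤP.*-zeroʳ (sgn (n ℕ.* (j ℕ.* 2)))) (cong (_*ᶻ sgn n) (sym (χ-even j))))
 ... | odd j  = trans (cong (_*ᶻ χ (suc (j ℕ.* 2))) (trans (cong sgn (lem n j)) (trans (sgn-+ n (n ℕ.* j ℕ.* 2)) (trans (cong (sgn n *ᶻ_) (sgn-even (n ℕ.* j))) (ℤP.*-identityʳ (sgn n)))))) (ℤP.*-comm (sgn n) _)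
   where
     lem : ∀ n j → n ℕ.* suc (j ℕ.* 2) ≡ n ℕ.+ n ℕ.* j ℕ.* 2
     lem = ℕSolver.solve-∀

 alt-Lam : ∀ (u : ℕ → ℤ) → alt (Lam (λ n k → χ k *ᶻ u n)) ≗ₛ Lam (λ n k → χ k *ᶻ (sgn n *ᶻ u n))
 alt-Lam u m = trans (sym (∑-scale (sgn m) (factorizations m) _)) (∑-cong-∈ (factorizations m) (λ { {n , k} z∈ → go n k (proj₂ (sound (factorizations-Graded m) z∈)) }))
   where
     go : ∀ n k → n ℕ.* k ≡ m → sgn m *ᶻ (χ k *ᶻ u n) ≡ χ k *ᶻ (sgn n *ᶻ u n)
     go n k refl = trans (sym (ℤP.*-assoc (sgn (n ℕ.* k)) (χ k) (u n))) (trans (cong (_*ᶻ u n) (sgn-χ n k)) (ℤP.*-assoc (χ k) (sgn n) (u n)))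

 Lam-double : ∀ (u : ℕ → ℤ) c → (∀ n → u (n ℕ.* 2) ≡ c *ᶻ u n) →
   Lam (λ n k → χ k *ᶻ u n) ⊕ alt (Lam (λ n k → χ k *ᶻ u n)) ≗ₛ con (+ 2 *ᶻ c) ⊛ V₂ (Lam (λ n k → χ k *ᶻ u n))
 Lam-double u c hyp = S.trans (S.+-cong {Lam (λ n k → χ k *ᶻ u n)} S.refl (alt-Lam u))
   (S.trans (λ m → sym (Lam-⊕ _ _ m))
   (S.trans (Lam-cong (λ n k → lem (χ k) (u n) (od n) (sgn n) (ev n) (ev-sgn n) (ev+od n)))
   (S.trans (Lam-ev (λ n k → + 2 *ᶻ (χ k *ᶻ u n)))
   (S.trans (V₂-cong (S.trans (Lam-cong (λ n k → trans (cong (λ z → + 2 *ᶻ (χ k *ᶻ z)) (hyp n)) (lem′ (χ k) c (u n)))) (Lam-scale (+ 2 *ᶻ c) _)))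
   (S.trans (V₂-⊛ (con (+ 2 *ᶻ c)) _) (S.*-cong (V-con 1 (+ 2 *ᶻ c)) S.refl))))))
   where
     lem : ∀ x u o s e → e ≡ o +ᶻ s → e +ᶻ o ≡ 1ℤ → x *ᶻ u +ᶻ x *ᶻ (s *ᶻ u) ≡ e *ᶻ (+ 2 *ᶻ (x *ᶻ u))
     lem x u o s _ refl q = trans (l₀ x u s) (trans (cong (λ z → x *ᶻ (z *ᶻ u) +ᶻ x *ᶻ (s *ᶻ u)) (sym q)) (l x u o s))
       where
         l₀ : ∀ x u s → x *ᶻ u +ᶻ x *ᶻ (s *ᶻ u) ≡ x *ᶻ (1ℤ *ᶻ u) +ᶻ x *ᶻ (s *ᶻ u)
         l₀ = solve-∀
         l : ∀ x u o s → x *ᶻ ((o +ᶻ s +ᶻ o) *ᶻ u) +ᶻ x *ᶻ (s *ᶻ u) ≡ (o +ᶻ s) *ᶻ (+ 2 *ᶻ (x *ᶻ u))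
         l = solve-∀
     lem′ : ∀ x c u → + 2 *ᶻ (x *ᶻ (c *ᶻ u)) ≡ (+ 2 *ᶻ c) *ᶻ (x *ᶻ u)
     lem′ = solve-∀

 γ-double : ∀ n → 1ℤ -ᶻ γ (n ℕ.* 2) ≡ + 2 *ᶻ od n
 γ-double n rewrite ℕP.*-comm n 2 | ℕP.+-identityʳ n | γ-+ n n | od≡χ² n = on-quarters (λ x c _ _ → 1ℤ -ᶻ (c *ᶻ c -ᶻ x *ᶻ x)) (λ x c _ _ → + 2 *ᶻ (x *ᶻ x)) tt n 0

 -- Only even n survive on the left. Since 2 od k = 1 - γ(2k), the factor 2 can be moved from n to
 -- k, and the terms of H with even k appear; those with odd k are zero.
 O₀+O₀⁻ : O 0 ⊕ O₀⁻ ≗ₛ H ⊕ H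
 O₀+O₀⁻ = S.trans (λ m → sym (Lam-⊕ _ _ m))
   (S.trans (Lam-cong (λ n k → lem (+ n) (od k) (od n) (sgn n) (ev n) (ev-sgn n) (ev+od n)))
   (S.trans (Lam-ev (λ n k → + 2 *ᶻ (+ n *ᶻ od k)))
   (S.trans (V₂-cong (S.trans (Lam-cong (λ n k → lem₂ n k)) (Lam-flip _)))
   (S.trans (λ m → sym (Lam-ev (λ k n → + 2 *ᶻ (+ n *ᶻ (1ℤ -ᶻ γ k))) m))
   (S.trans (Lam-flip _)
   (S.trans (Lam-cong (λ n k → lem₃ n k)) (Lam-⊕ _ _)))))))
   where
     lem : ∀ n o u s e → e ≡ u +ᶻ s → e +ᶻ u ≡ 1ℤ → n *ᶻ o *ᶻ 1ℤ +ᶻ n *ᶻ o *ᶻ s ≡ e *ᶻ (+ 2 *ᶻ (n *ᶻ o))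
     lem n o u s _ refl q = trans (cong (λ z → n *ᶻ o *ᶻ z +ᶻ n *ᶻ o *ᶻ s) (sym q)) (l n o u s)
       where
         l : ∀ n o u s → n *ᶻ o *ᶻ (u +ᶻ s +ᶻ u) +ᶻ n *ᶻ o *ᶻ s ≡ (u +ᶻ s) *ᶻ (+ 2 *ᶻ (n *ᶻ o))
         l = solve-∀
     lem₂ : ∀ n k → + 2 *ᶻ (+ (n ℕ.* 2) *ᶻ od k) ≡ + 2 *ᶻ (+ n *ᶻ (1ℤ -ᶻ γ (k ℕ.* 2)))
     lem₂ n k = trans (cong (λ z → + 2 *ᶻ (z *ᶻ od k)) (ℤP.pos-* n 2)) (trans (l (+ n) (od k)) (cong (λ z → + 2 *ᶻ (+ n *ᶻ z)) (sym (γ-double k))))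
       where
         l : ∀ n o → + 2 *ᶻ (n *ᶻ + 2 *ᶻ o) ≡ + 2 *ᶻ (n *ᶻ (+ 2 *ᶻ o))
         l = solve-∀
     eγ : ∀ k → ev k *ᶻ γ k ≡ γ k
     eγ k rewrite ev≡γ² k = on-quarters (λ x c _ _ → c *ᶻ c *ᶻ c) (λ x c _ _ → c) tt k 0
     lem₃ : ∀ n k → ev k *ᶻ (+ 2 *ᶻ (+ n *ᶻ (1ℤ -ᶻ γ k))) ≡ + n *ᶻ (ev k -ᶻ γ k) +ᶻ + n *ᶻ (ev k -ᶻ γ k)
     lem₃ n k = trans (l₁ (ev k) (+ n) (γ k)) (trans (cong (λ z → + 2 *ᶻ (+ n *ᶻ (ev k -ᶻ z))) (eγ k)) (l₂ (+ n) (ev k -ᶻ γ k)))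
       where
         l₁ : ∀ e n c → e *ᶻ (+ 2 *ᶻ (n *ᶻ (1ℤ -ᶻ c))) ≡ + 2 *ᶻ (n *ᶻ (e -ᶻ e *ᶻ c))
         l₁ = solve-∀
         l₂ : ∀ n x → + 2 *ᶻ (n *ᶻ x) ≡ n *ᶻ x +ᶻ n *ᶻ x
         l₂ = solve-∀

 -- The theorem on sums of two squares: κ = θ²

 κ κ⁻ : PS
 κ  = con 1ℤ ⊕ con (+ 4) ⊛ L 0
 κ⁻ = con 1ℤ ⊕ con (+ 4) ⊛ L₀⁻

 -- The diagonal sum `τₛ` need not be evaluated: it enters for g = 1 and for g = `sgn` with the same
 -- factor g(0) = 1, and cancels.
 κ²-difference : κ ⊛ κ ⊖ κ⁻ ⊛ κ⁻ ≗ₛ con (+ 16) ⊛ (O 0 ⊖ H)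
 κ²-difference = begin
   κ ⊛ κ ⊖ κ⁻ ⊛ κ⁻
     ≈⟨ S.solve 2 (λ x y → (S.:con 1ℤ :+ S.:con (+ 4) :* x) :* (S.:con 1ℤ :+ S.:con (+ 4) :* x) :- (S.:con 1ℤ :+ S.:con (+ 4) :* y) :* (S.:con 1ℤ :+ S.:con (+ 4) :* y)
          S.:= S.:con (+ 8) :* ((S.:con (+ 2) :* (x :* x) :+ x) :- (S.:con (+ 2) :* (y :* y) :+ y))) S.refl (L 0) L₀⁻ ⟩
   con (+ 8) ⊛ ((con (+ 2) ⊛ (L 0 ⊛ L 0) ⊕ L 0) ⊖ (con (+ 2) ⊛ (L₀⁻ ⊛ L₀⁻) ⊕ L₀⁻))
     ≈⟨ S.*-cong (S.refl {con (+ 8)}) (S.+-cong α₀ (S.-‿cong α₀⁻)) ⟩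
   con (+ 8) ⊛ ((O 0 ⊕ τₛ) ⊖ (O₀⁻ ⊕ τₛ))
     ≈⟨ S.solve 3 (λ x y t → S.:con (+ 8) :* ((x :+ t) :- (y :+ t)) S.:= S.:con (+ 8) :* ((x :+ x) :- (x :+ y))) S.refl (O 0) O₀⁻ τₛ ⟩
   con (+ 8) ⊛ ((O 0 ⊕ O 0) ⊖ (O 0 ⊕ O₀⁻))
     ≈⟨ S.*-cong (S.refl {con (+ 8)}) (S.+-cong (S.refl {O 0 ⊕ O 0}) (S.-‿cong O₀+O₀⁻)) ⟩
   con (+ 8) ⊛ ((O 0 ⊕ O 0) ⊖ (H ⊕ H))
     ≈⟨ S.solve 2 (λ x h → S.:con (+ 8) :* ((x :+ x) :- (h :+ h)) S.:= S.:con (+ 16) :* (x :- h)) S.refl (O 0) H ⟩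
   con (+ 16) ⊛ (O 0 ⊖ H) ∎
   where
     open ≗-Reasoning
     open S using (_:+_; _:*_; _:-_)

 -- Rearranged, `β₀` says that L 1 is κ times O 0 - H, and 16(O 0 - H) is the difference of squares
 -- just found.
 L₁-κ : con (+ 16) ⊛ L 1 ≗ₛ κ ⊛ (κ ⊛ κ ⊖ κ⁻ ⊛ κ⁻)
 L₁-κ = begin
   con (+ 16) ⊛ L 1
     ≈⟨ S.solve 3 (λ l h k → S.:con (+ 16) :* l S.:= S.:con (+ 16) :* ((l :+ h :+ S.:con (+ 4) :* (k :* h)) :- (S.:con 1ℤ :+ S.:con (+ 4) :* k) :* h)) S.refl (L 1) H (L 0) ⟩
   con (+ 16) ⊛ ((L 1 ⊕ H ⊕ con (+ 4) ⊛ (L 0 ⊛ H)) ⊖ κ ⊛ H)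
     ≈⟨ S.*-cong (S.refl {con (+ 16)}) (S.+-cong (S.sym β₀) (S.refl {⊝ (κ ⊛ H)})) ⟩
   con (+ 16) ⊛ ((con (+ 4) ⊛ (L 0 ⊛ O 0) ⊕ O 0) ⊖ κ ⊛ H)
     ≈⟨ S.solve 3 (λ o h k → S.:con (+ 16) :* ((S.:con (+ 4) :* (k :* o) :+ o) :- (S.:con 1ℤ :+ S.:con (+ 4) :* k) :* h) S.:= (S.:con 1ℤ :+ S.:con (+ 4) :* k) :* (S.:con (+ 16) :* (o :- h))) S.refl (O 0) H (L 0) ⟩
   κ ⊛ (con (+ 16) ⊛ (O 0 ⊖ H))
     ≈⟨ S.*-cong (S.refl {κ}) (S.sym κ²-difference) ⟩
   κ ⊛ (κ ⊛ κ ⊖ κ⁻ ⊛ κ⁻) ∎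
   where
     open ≗-Reasoning
     open S using (_:+_; _:*_; _:-_)

 alt-⊕ : ∀ f g → alt (f ⊕ g) ≗ₛ alt f ⊕ alt g
 alt-⊕ f g n = ℤP.*-distribˡ-+ (sgn n) (f n) (g n)

 alt-⊝ : ∀ f → alt (⊝ f) ≗ₛ ⊝ alt f
 alt-⊝ f n = sym (ℤP.neg-distribʳ-* (sgn n) (f n))

 alt-con : ∀ c → alt (con c) ≗ₛ con c
 alt-con c zero    = ℤP.*-identityˡ c
 alt-con c (suc n) = ℤP.*-zeroʳ (sgn (suc n))

 alt-cong : ∀ {f g} → f ≗ₛ g → alt f ≗ₛ alt g
 alt-cong p n = cong (sgn n *ᶻ_) (p n)

 alt-alt : ∀ f → alt (alt f) ≗ₛ f
 alt-alt f n = trans (sym (ℤP.*-assoc (sgn n) (sgn n) (f n))) (trans (cong (_*ᶻ f n) (sgn-*2 n)) (ℤP.*-identityˡ (f n)))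

 alt-κ : alt κ ≗ₛ κ⁻
 alt-κ = S.trans (alt-⊕ (con 1ℤ) (con (+ 4) ⊛ L 0)) (S.+-cong (alt-con 1ℤ) (S.trans (alt-⊛ (con (+ 4)) (L 0))
   (S.*-cong (alt-con (+ 4)) (S.trans (alt-Lam (e 0)) (Lam-cong (λ n k → cong (χ k *ᶻ_) (ℤP.*-identityʳ (sgn n))))))))

 κ+κ⁻ : κ ⊕ κ⁻ ≗ₛ V₂ κ ⊕ V₂ κ
 κ+κ⁻ = begin
   κ ⊕ κ⁻   ≈⟨ S.solve 2 (λ x y → (S.:con 1ℤ :+ S.:con (+ 4) :* x) :+ (S.:con 1ℤ :+ S.:con (+ 4) :* y) S.:= S.:con (+ 2) :+ S.:con (+ 4) :* (x :+ y)) S.refl (L 0) L₀⁻ ⟩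
   con (+ 2) ⊕ con (+ 4) ⊛ (L 0 ⊕ L₀⁻)
     ≈⟨ S.+-cong (S.refl {con (+ 2)}) (S.*-cong (S.refl {con (+ 4)}) (S.trans
          (S.+-cong (S.refl {L 0}) (S.trans (Lam-cong (λ n k → cong (χ k *ᶻ_) (sym (ℤP.*-identityʳ (sgn n))))) (S.sym (alt-Lam (e 0)))))
          (Lam-double (e 0) 1ℤ (λ _ → refl)))) ⟩
   con (+ 2) ⊕ con (+ 4) ⊛ (con (+ 2) ⊛ V₂ (L 0))
     ≈⟨ S.solve 1 (λ x → S.:con (+ 2) :+ S.:con (+ 4) :* (S.:con (+ 2) :* x) S.:= (S.:con 1ℤ :+ S.:con (+ 4) :* x) :+ (S.:con 1ℤ :+ S.:con (+ 4) :* x)) S.refl (V₂ (L 0)) ⟩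
   (con 1ℤ ⊕ con (+ 4) ⊛ V₂ (L 0)) ⊕ (con 1ℤ ⊕ con (+ 4) ⊛ V₂ (L 0))
     ≈⟨ S.+-cong (S.sym eq) (S.sym eq) ⟩
   V₂ κ ⊕ V₂ κ ∎
   where
     open ≗-Reasoning
     open S using (_:+_; _:*_; _:-_)
     eq : V₂ κ ≗ₛ con 1ℤ ⊕ con (+ 4) ⊛ V₂ (L 0)
     eq = S.trans (V₂-⊕ (con 1ℤ) (con (+ 4) ⊛ L 0)) (S.+-cong (V-con 1 1ℤ) (S.trans (V₂-⊛ (con (+ 4)) (L 0)) (S.*-cong (V-con 1 (+ 4)) S.refl)))

 -- The recursion of the arithmetic-geometric mean: with f(q) = f(q²) + o(q), o odd, one has o(q)² = 4 f(q⁴) o(q²)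

 record AGM (f : PS) : Set where
   field
     at-even : ∀ m → f (m ℕ.* 2) ≡ f m
     square  : (f ⊖ V₂ f) ⊛ (f ⊖ V₂ f) ≗ₛ con (+ 4) ⊛ V₂ (V₂ f ⊛ (f ⊖ V₂ f))
     f₀      : f 0 ≡ 1ℤ
     f₁      : f 1 ≡ + 4

 -- Even coefficients are copies of earlier ones. Let o and p be the odd parts. As o + p begins with
 -- 8q, the product (o + p)(o - p) has coefficient 8(f(N) - g(N)) at N + 1 for odd N > 1, if all
 -- earlier coefficients agree. The recursion expresses the same coefficient by entries up to (N +
 -- 1)/2, where f and g agree.
 AGM-unique : ∀ {f g} → AGM f → AGM g → f ≗ₛ g
 AGM-unique {f} {g} F G n = <-rec (λ n → f n ≡ g n) step n
   where
     module F = AGM F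
     module G = AGM G
     o p s d : PS
     o = f ⊖ V₂ f
     p = g ⊖ V₂ g
     s = o ⊕ p
     d = o ⊖ p
     V₂-low : ∀ n → (∀ {i} → i < n → f i ≡ g i) → ∀ i → 0 < n → i ≤ n → 1 < n → V₂ f i ≡ V₂ g i
     V₂-low n ih i _ i≤ 1<n with parity i
     ... | odd m  = trans (V-odd f m) (sym (V-odd g m))
     ... | even m = trans (V-at 1 f m) (trans (ih (bound m n i≤ 1<n)) (sym (V-at 1 g m)))
       where
         bound : ∀ m n → m ℕ.* 2 ≤ n → 1 < n → m < n
         bound zero    n p q = ℕP.<⇒≤ q
         bound (suc m) n p q = ℕP.≤-trans (s≤s (s≤s (ℕP.m≤m*n m 2))) p
     sd : s ⊛ d ≗ₛ con (+ 4) ⊛ (V₂ (V₂ f ⊛ o) ⊖ V₂ (V₂ g ⊛ p))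
     sd = S.trans (S.solve 2 (λ x y → (x :+ y) :* (x :- y) S.:= x :* x :- y :* y) S.refl o p)
       (S.trans (S.+-cong F.square (S.-‿cong G.square)) (S.solve 2 (λ x y → S.:con (+ 4) :* x :- S.:con (+ 4) :* y S.:= S.:con (+ 4) :* (x :- y)) S.refl (V₂ (V₂ f ⊛ o)) (V₂ (V₂ g ⊛ p))))
       where open S using (_:+_; _:*_; _:-_)
     s₀ : s 0 ≡ 0ℤ
     s₀ = cong₂ _+ᶻ_ (ℤP.+-inverseʳ (f 0)) (ℤP.+-inverseʳ (g 0))
     s₁ : s 1 ≡ + 8
     s₁ = cong₂ _+ᶻ_ (trans (ℤP.+-identityʳ (f 1)) F.f₁) (trans (ℤP.+-identityʳ (g 1)) G.f₁)
     step : ∀ n → (∀ {i} → i < n → f i ≡ g i) → f n ≡ g n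
     step n ih with parity n
     ... | even zero    = trans F.f₀ (sym G.f₀)
     ... | even (suc m) = trans (F.at-even (suc m)) (trans (ih (s≤s (s≤s (ℕP.m≤m*n m 2)))) (sym (G.at-even (suc m))))
     ... | odd zero     = trans F.f₁ (sym G.f₁)
     ... | odd m@(suc m′) = ℤP.i-j≡0⇒i≡j (f N) (g N) (trans (sym dN) (ℤP.*-cancelˡ-≡ (+ 8) (d N) 0ℤ (trans (sym lhs) rhs)))
       where
         N = suc (m ℕ.* 2)
         1<N : 1 < N
         1<N = s≤s (s≤s z≤n)
         o≡p : ∀ i → i < N → o i ≡ p i
         o≡p i i<N = cong₂ _-ᶻ_ (ih i<N) (V₂-low N ih i (s≤s z≤n) (ℕP.<⇒≤ i<N) 1<N)
         d-low : ∀ i → i < N → d i ≡ 0ℤ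
         d-low i i<N = trans (cong (_-ᶻ p i) (o≡p i i<N)) (ℤP.+-inverseʳ (p i))
         lhs : (s ⊛ d) (suc N) ≡ + 8 *ᶻ d N
         lhs = trans (cong₂ _+ᶻ_ (cong (_*ᶻ d (suc N)) s₀) (trans (low-⊛ (tl s) d N d-low) (cong (_*ᶻ d N) s₁))) (ℤP.+-identityˡ _)
         rhs : (s ⊛ d) (suc N) ≡ + 8 *ᶻ 0ℤ
         rhs = trans (sd (suc N)) (trans (con-⊛ (+ 4) (V₂ (V₂ f ⊛ o) ⊖ V₂ (V₂ g ⊛ p)) (suc N)) (cong (+ 4 *ᶻ_)
           (trans (cong₂ _-ᶻ_ (V-at 1 (V₂ f ⊛ o) (suc m)) (V-at 1 (V₂ g ⊛ p) (suc m)))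
           (trans (cong (_-ᶻ (V₂ g ⊛ p) (suc m)) (⊛-cong-≤ (suc m)
              (λ i i≤ → V₂-low N ih i (s≤s z≤n) (ℕP.≤-trans i≤ m<N) 1<N)
              (λ i i≤ → o≡p i (ℕP.≤-<-trans i≤ m+1<N))))
             (ℤP.+-inverseʳ ((V₂ g ⊛ p) (suc m)))))))
           where
             m+1<N : suc m < N
             m+1<N = s≤s (s≤s (s≤s (ℕP.m≤m*n m′ 2)))
             m<N : suc m ≤ N
             m<N = ℕP.<⇒≤ m+1<N
         dN : d N ≡ f N -ᶻ g N
         dN = trans (cong₂ (λ x y → (f N -ᶻ x) -ᶻ (g N -ᶻ y)) (V-odd f m) (V-odd g m)) (l (f N) (g N))
           where
             l : ∀ x y → (x -ᶻ 0ℤ) -ᶻ (y -ᶻ 0ℤ) ≡ x -ᶻ y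
             l = solve-∀

 even-part : ∀ {f} → f ⊕ alt f ≗ₛ V₂ f ⊕ V₂ f → ∀ m → f (m ℕ.* 2) ≡ f m
 even-part {f} p m = double-injective (trans (cong (f (m ℕ.* 2) +ᶻ_) (sym (trans (cong (_*ᶻ f (m ℕ.* 2)) (sgn-even m)) (ℤP.*-identityˡ _))))
   (trans (p (m ℕ.* 2)) (cong₂ _+ᶻ_ (V-at 1 f m) (V-at 1 f m))))

 -- Write κ = ε + o with ε = `V₂ κ`. Then κ(-q) = ε - o and 16 L 1 = 4κεo. The even part of L 1 is 4
 -- `V₂ (L 1)`, because n² becomes 4n² at even n. Comparing gives 8εo² = 32 ε V₂(εo), and ε has
 -- constant term 1.
 AGM-κ : AGM κ
 AGM-κ = record { at-even = even-part (S.trans (S.+-cong (S.refl {κ}) alt-κ) κ+κ⁻) ; square = square ; f₀ = refl ; f₁ = refl }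
   where
     open ≗-Reasoning
     open S using (_:+_; _:*_; _:-_; :-_)
     ε o : PS
     ε = V₂ κ
     o = κ ⊖ V₂ κ
     κ≗ : κ ≗ₛ ε ⊕ o
     κ≗ = S.solve 2 (λ k e → k S.:= e :+ (k :- e)) S.refl κ ε
     κ⁻≗ : κ⁻ ≗ₛ ε ⊖ o
     κ⁻≗ = S.trans (S.solve 2 (λ k k′ → k′ S.:= (k :+ k′) :- k) S.refl κ κ⁻) (S.trans (S.+-cong κ+κ⁻ (S.refl {⊝ κ}))
       (S.solve 2 (λ k e → (e :+ e) :- k S.:= e :- (k :- e)) S.refl κ ε))
     Δ : PS
     Δ = κ ⊛ κ ⊖ κ⁻ ⊛ κ⁻
     Δ≗ : Δ ≗ₛ con (+ 4) ⊛ (ε ⊛ o)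
     Δ≗ = S.trans (S.+-cong (S.*-cong κ≗ κ≗) (S.-‿cong (S.*-cong κ⁻≗ κ⁻≗)))
       (S.solve 2 (λ e o → (e :+ o) :* (e :+ o) :- (e :- o) :* (e :- o) S.:= S.:con (+ 4) :* (e :* o)) S.refl ε o)
     altL₁ : con (+ 16) ⊛ alt (L 1) ≗ₛ ⊝ (κ⁻ ⊛ Δ)
     altL₁ = begin
       con (+ 16) ⊛ alt (L 1)            ≈⟨ S.sym (S.trans (alt-⊛ (con (+ 16)) (L 1)) (S.*-cong (alt-con (+ 16)) S.refl)) ⟩
       alt (con (+ 16) ⊛ L 1)            ≈⟨ alt-cong L₁-κ ⟩
       alt (κ ⊛ Δ)                       ≈⟨ alt-⊛ κ Δ ⟩
       alt κ ⊛ alt Δ                     ≈⟨ S.*-cong alt-κ (S.trans (alt-⊕ (κ ⊛ κ) (⊝ (κ⁻ ⊛ κ⁻))) (S.+-cong (S.trans (alt-⊛ κ κ) (S.*-cong alt-κ alt-κ)) (S.trans (alt-⊝ (κ⁻ ⊛ κ⁻)) (S.-‿cong (S.trans (alt-⊛ κ⁻ κ⁻) (S.*-cong back back)))))) ⟩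
       κ⁻ ⊛ (κ⁻ ⊛ κ⁻ ⊖ κ ⊛ κ)            ≈⟨ S.solve 2 (λ k l → l :* (l :* l :- k :* k) S.:= :- (l :* (k :* k :- l :* l))) S.refl κ κ⁻ ⟩
       ⊝ (κ⁻ ⊛ Δ) ∎
       where
         back : alt κ⁻ ≗ₛ κ
         back = S.trans (alt-cong (S.sym alt-κ)) (alt-alt κ)
     L₁-double : L 1 ⊕ alt (L 1) ≗ₛ con (+ 8) ⊛ V₂ (L 1)
     L₁-double = Lam-double (e 1) (+ 4) (λ n → trans (cong (λ z → z *ᶻ z *ᶻ 1ℤ) (ℤP.pos-* n 2)) (l (+ n)))
       where
         l : ∀ n → n *ᶻ + 2 *ᶻ (n *ᶻ + 2) *ᶻ 1ℤ ≡ + 4 *ᶻ (n *ᶻ n *ᶻ 1ℤ)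
         l = solve-∀
     V₂-16L₁ : con (+ 16) ⊛ V₂ (L 1) ≗ₛ ε ⊛ (con (+ 4) ⊛ V₂ (ε ⊛ o))
     V₂-16L₁ = begin
       con (+ 16) ⊛ V₂ (L 1)      ≈⟨ S.sym (S.trans (V₂-⊛ (con (+ 16)) (L 1)) (S.*-cong (V-con 1 (+ 16)) S.refl)) ⟩
       V₂ (con (+ 16) ⊛ L 1)      ≈⟨ V₂-cong (S.trans L₁-κ (S.*-cong (S.refl {κ}) Δ≗)) ⟩
       V₂ (κ ⊛ (con (+ 4) ⊛ (ε ⊛ o))) ≈⟨ S.trans (V₂-⊛ κ _) (S.*-cong (S.refl {V₂ κ}) (S.trans (V₂-⊛ (con (+ 4)) (ε ⊛ o)) (S.*-cong (V-con 1 (+ 4)) S.refl))) ⟩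
       ε ⊛ (con (+ 4) ⊛ V₂ (ε ⊛ o)) ∎
     eight : con (+ 8) ⊛ (ε ⊛ (o ⊛ o)) ≗ₛ con (+ 8) ⊛ (ε ⊛ (con (+ 4) ⊛ V₂ (ε ⊛ o)))
     eight = begin
       con (+ 8) ⊛ (ε ⊛ (o ⊛ o))
         ≈⟨ S.solve 2 (λ e o → S.:con (+ 8) :* (e :* (o :* o)) S.:= (e :+ o) :* (S.:con (+ 4) :* (e :* o)) :- (e :- o) :* (S.:con (+ 4) :* (e :* o))) S.refl ε o ⟩
       (ε ⊕ o) ⊛ (con (+ 4) ⊛ (ε ⊛ o)) ⊖ (ε ⊖ o) ⊛ (con (+ 4) ⊛ (ε ⊛ o))
         ≈⟨ S.+-cong (S.*-cong (S.sym κ≗) (S.sym Δ≗)) (S.-‿cong (S.*-cong (S.sym κ⁻≗) (S.sym Δ≗))) ⟩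
       κ ⊛ Δ ⊖ κ⁻ ⊛ Δ
         ≈⟨ S.+-cong (S.sym L₁-κ) (S.sym altL₁) ⟩
       con (+ 16) ⊛ L 1 ⊕ con (+ 16) ⊛ alt (L 1)
         ≈⟨ S.sym (⊛-distribˡ (con (+ 16)) (L 1) (alt (L 1))) ⟩
       con (+ 16) ⊛ (L 1 ⊕ alt (L 1))
         ≈⟨ S.*-cong (S.refl {con (+ 16)}) L₁-double ⟩
       con (+ 16) ⊛ (con (+ 8) ⊛ V₂ (L 1))
         ≈⟨ S.solve 1 (λ x → S.:con (+ 16) :* (S.:con (+ 8) :* x) S.:= S.:con (+ 8) :* (S.:con (+ 16) :* x)) S.refl (V₂ (L 1)) ⟩
       con (+ 8) ⊛ (con (+ 16) ⊛ V₂ (L 1))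
         ≈⟨ S.*-cong (S.refl {con (+ 8)}) V₂-16L₁ ⟩
       con (+ 8) ⊛ (ε ⊛ (con (+ 4) ⊛ V₂ (ε ⊛ o))) ∎
     square : o ⊛ o ≗ₛ con (+ 4) ⊛ V₂ (ε ⊛ o)
     square = cancel-unit ε refl (λ n → ℤP.*-cancelˡ-≡ (+ 8) _ _ (trans (sym (con-⊛ (+ 8) (ε ⊛ (o ⊛ o)) n)) (trans (eight n) (con-⊛ (+ 8) (ε ⊛ (con (+ 4) ⊛ V₂ (ε ⊛ o))) n))))

 V₂θ² : V₂ (θ ⊛ θ) ≗ₛ a ⊛ a ⊕ b ⊛ b
 V₂θ² = S.sym landen₊

 -- Here the odd part is 2ab, and the duplication formulas read a² = V₂(V₂ θ²) and b² = V₂(2ab).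
 AGM-θ² : AGM (θ ⊛ θ)
 AGM-θ² = record { at-even = even-part dbl ; square = sq′ ; f₀ = refl ; f₁ = refl }
   where
     open ≗-Reasoning
     open S using (_:+_; _:*_; _:-_; :-_)
     dbl : θ ⊛ θ ⊕ alt (θ ⊛ θ) ≗ₛ V₂ (θ ⊛ θ) ⊕ V₂ (θ ⊛ θ)
     dbl = begin
       θ ⊛ θ ⊕ alt (θ ⊛ θ) ≈⟨ S.+-cong (S.*-cong θ≗a+b θ≗a+b) (S.trans (alt-⊛ θ θ) (S.*-cong (S.trans altθ θ₄≗a-b) (S.trans altθ θ₄≗a-b))) ⟩
       (a ⊕ b) ⊛ (a ⊕ b) ⊕ (a ⊖ b) ⊛ (a ⊖ b) ≈⟨ S.solve 2 (λ a b → (a :+ b) :* (a :+ b) :+ (a :- b) :* (a :- b) S.:= (a :* a :+ b :* b) :+ (a :* a :+ b :* b)) S.refl a b ⟩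
       (a ⊛ a ⊕ b ⊛ b) ⊕ (a ⊛ a ⊕ b ⊛ b) ≈⟨ S.+-cong landen₊ landen₊ ⟩
       V₂ (θ ⊛ θ) ⊕ V₂ (θ ⊛ θ) ∎
     o≗ : θ ⊛ θ ⊖ V₂ (θ ⊛ θ) ≗ₛ a ⊛ b ⊕ a ⊛ b
     o≗ = S.trans (S.+-cong (S.*-cong θ≗a+b θ≗a+b) (S.-‿cong V₂θ²)) (S.solve 2 (λ a b → (a :+ b) :* (a :+ b) :- (a :* a :+ b :* b) S.:= a :* b :+ a :* b) S.refl a b)
     sq′ : (θ ⊛ θ ⊖ V₂ (θ ⊛ θ)) ⊛ (θ ⊛ θ ⊖ V₂ (θ ⊛ θ)) ≗ₛ con (+ 4) ⊛ V₂ (V₂ (θ ⊛ θ) ⊛ (θ ⊛ θ ⊖ V₂ (θ ⊛ θ)))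
     sq′ = begin
       (θ ⊛ θ ⊖ V₂ (θ ⊛ θ)) ⊛ (θ ⊛ θ ⊖ V₂ (θ ⊛ θ)) ≈⟨ S.*-cong o≗ o≗ ⟩
       (a ⊛ b ⊕ a ⊛ b) ⊛ (a ⊛ b ⊕ a ⊛ b) ≈⟨ S.solve 2 (λ a b → (a :* b :+ a :* b) :* (a :* b :+ a :* b) S.:= S.:con (+ 4) :* ((a :* a) :* (b :* b))) S.refl a b ⟩
       con (+ 4) ⊛ ((a ⊛ a) ⊛ (b ⊛ b)) ≈⟨ S.*-cong (S.refl {con (+ 4)}) (S.*-cong a² b²) ⟩
       con (+ 4) ⊛ ((a′ ⊛ a′ ⊕ b′ ⊛ b′) ⊛ (a′ ⊛ b′ ⊕ a′ ⊛ b′))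
         ≈⟨ S.*-cong (S.refl {con (+ 4)}) (S.sym (S.trans (V₂-cong (S.*-cong V₂θ² o≗)) (S.trans (V₂-⊛ _ _)
              (S.*-cong (S.trans (V₂-⊕ _ _) (S.+-cong (V₂-⊛ a a) (V₂-⊛ b b))) (S.trans (V₂-⊕ _ _) (S.+-cong (V₂-⊛ a b) (V₂-⊛ a b))))))) ⟩
       con (+ 4) ⊛ V₂ (V₂ (θ ⊛ θ) ⊛ (θ ⊛ θ ⊖ V₂ (θ ⊛ θ))) ∎

 two-squares : κ ≗ₛ θ ⊛ θ
 two-squares = AGM-unique AGM-κ AGM-θ²

-- Binary forms modulo p as coefficient vectors.

module HomogeneousForms where

 open PowerSeries
 open Substitution
 open import Data.Bool using (T)

 infixr 8 _^ₛ_
 _^ₛ_ : PS → ℕ → PS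
 f ^ₛ zero  = con 1ℤ
 f ^ₛ suc n = f ⊛ f ^ₛ n

 -- c₀ ∷ … ∷ cₙ stands for the form Σ cᵢ xⁱ yⁿ⁻ⁱ.

 ⟦_⟧ : ∀ {n} → Vec ℕ (suc n) → PS → PS → PS
 ⟦_⟧ {zero}  (c ∷ [])     x y = con (+ c)
 ⟦_⟧ {suc n} (c ∷ cs) x y = con (+ c) ⊛ y ^ₛ suc n ⊕ x ⊛ ⟦ cs ⟧ x y

 ^ₛ-cong : ∀ {f g} n → f ≗ₛ g → f ^ₛ n ≗ₛ g ^ₛ n
 ^ₛ-cong zero    p = S.refl
 ^ₛ-cong (suc n) p = S.*-cong p (^ₛ-cong n p)

 ⟦⟧-cong : ∀ {n} (v : Vec ℕ (suc n)) {x x′ y y′} → x ≗ₛ x′ → y ≗ₛ y′ → ⟦ v ⟧ x y ≗ₛ ⟦ v ⟧ x′ y′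
 ⟦⟧-cong {zero}  (c ∷ [])     p q = S.refl
 ⟦⟧-cong {suc n} (c ∷ cs) p q = S.+-cong (S.*-cong (S.refl {con (+ c)}) (^ₛ-cong (suc n) q)) (S.*-cong p (⟦⟧-cong cs p q))

 ^ₛ-+ : ∀ f m n → f ^ₛ (m ℕ.+ n) ≗ₛ f ^ₛ m ⊛ f ^ₛ n
 ^ₛ-+ f zero    n = S.sym (S.trans (λ i → con-⊛ 1ℤ (f ^ₛ n) i) (λ i → ℤP.*-identityˡ _))
 ^ₛ-+ f (suc m) n = S.trans (S.*-cong (S.refl {f}) (^ₛ-+ f m n)) (S.sym (S.*-assoc f (f ^ₛ m) (f ^ₛ n)))

 ^ₛ-⊛ : ∀ f g n → (f ⊛ g) ^ₛ n ≗ₛ f ^ₛ n ⊛ g ^ₛ n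
 ^ₛ-⊛ f g zero    = S.solve 0 (S.:con 1ℤ S.:= S.:con 1ℤ S.:* S.:con 1ℤ) S.refl
 ^ₛ-⊛ f g (suc n) = S.trans (S.*-cong (S.refl {f ⊛ g}) (^ₛ-⊛ f g n))
   (S.solve 4 (λ f g x y → (f S.:* g) S.:* (x S.:* y) S.:= (f S.:* x) S.:* (g S.:* y)) S.refl f g (f ^ₛ n) (g ^ₛ n))

 ^ₛ-* : ∀ f m n → f ^ₛ (m ℕ.* n) ≗ₛ (f ^ₛ n) ^ₛ m
 ^ₛ-* f zero    n = S.refl
 ^ₛ-* f (suc m) n = S.trans (^ₛ-+ f n (m ℕ.* n)) (S.*-cong (S.refl {f ^ₛ n}) (^ₛ-* f m n))

 con-+ : ∀ m n → con (+ (m ℕ.+ n)) ≗ₛ con (+ m) ⊕ con (+ n)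
 con-+ m n zero    = refl
 con-+ m n (suc i) = refl

 con-* : ∀ m n → con (+ (m ℕ.* n)) ≗ₛ con (+ m) ⊛ con (+ n)
 con-* m n zero    = ℤP.pos-* m n
 con-* m n (suc i) = sym (trans (con-⊛ (+ m) (con (+ n)) (suc i)) (ℤP.*-zeroʳ (+ m)))

 addV : ∀ {n} → Vec ℕ n → Vec ℕ n → Vec ℕ n
 addV = zipWith ℕ._+_

 scaleV : ∀ {n} → ℕ → Vec ℕ n → Vec ℕ n
 scaleV c = Vec.map (c ℕ.*_)

 -- Serves to add a list to the front of a longer vector, so that products of vectors involve no
 -- equations between lengths.
 addL : ∀ {n} → List ℕ → Vec ℕ n → Vec ℕ n
 addL []       v        = v
 addL (c ∷ cs) []       = []
 addL (c ∷ cs) (d ∷ ds) = c ℕ.+ d ∷ addL cs ds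

 mulV : ∀ {m n} → Vec ℕ (suc m) → Vec ℕ (suc n) → Vec ℕ (suc (m ℕ.+ n))
 mulV {zero}  (c ∷ []) v = scaleV c v
 mulV {suc m} (c ∷ cs) v = addL (toList (scaleV c v)) (0 ∷ mulV cs v)

 module _ (x y : PS) where
   open S using (_:+_; _:*_; _:-_; :-_)

   ⟦addV⟧ : ∀ {n} (u v : Vec ℕ (suc n)) → ⟦ addV u v ⟧ x y ≗ₛ ⟦ u ⟧ x y ⊕ ⟦ v ⟧ x y
   ⟦addV⟧ {zero}  (c ∷ [])     (d ∷ [])     = con-+ c d
   ⟦addV⟧ {suc n} (c ∷ cs) (d ∷ ds) = S.trans (S.+-cong (S.*-cong (con-+ c d) S.refl) (S.*-cong (S.refl {x}) (⟦addV⟧ cs ds)))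
     (S.solve 6 (λ x y c d p q → (c :+ d) :* y :+ x :* (p :+ q) S.:= (c :* y :+ x :* p) :+ (d :* y :+ x :* q)) S.refl x (y ^ₛ suc n) (con (+ c)) (con (+ d)) (⟦ cs ⟧ x y) (⟦ ds ⟧ x y))

   ⟦scaleV⟧ : ∀ {n} c (v : Vec ℕ (suc n)) → ⟦ scaleV c v ⟧ x y ≗ₛ con (+ c) ⊛ ⟦ v ⟧ x y
   ⟦scaleV⟧ {zero}  c (d ∷ [])     = con-* c d
   ⟦scaleV⟧ {suc n} c (d ∷ ds) = S.trans (S.+-cong (S.*-cong (con-* c d) S.refl) (S.*-cong (S.refl {x}) (⟦scaleV⟧ c ds)))
     (S.solve 5 (λ x y c d p → (c :* d) :* y :+ x :* (c :* p) S.:= c :* (d :* y :+ x :* p)) S.refl x (y ^ₛ suc n) (con (+ c)) (con (+ d)) (⟦ ds ⟧ x y))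

   ⟦_⟧ᴸ : List ℕ → ℕ → PS
   ⟦ []     ⟧ᴸ n       = con 0ℤ
   ⟦ c ∷ cs ⟧ᴸ zero    = con (+ c)
   ⟦ c ∷ cs ⟧ᴸ (suc n) = con (+ c) ⊛ y ^ₛ suc n ⊕ x ⊛ ⟦ cs ⟧ᴸ n

   ⟦addL⟧ : ∀ {n} cs (v : Vec ℕ (suc n)) → ⟦ addL cs v ⟧ x y ≗ₛ ⟦ cs ⟧ᴸ n ⊕ ⟦ v ⟧ x y
   ⟦addL⟧ {n}     []       v            = S.solve 1 (λ p → p S.:= S.:con 0ℤ :+ p) S.refl (⟦ v ⟧ x y)
   ⟦addL⟧ {zero}  (c ∷ []) (d ∷ [])     = con-+ c d
   ⟦addL⟧ {zero}  (c ∷ _ ∷ _) (d ∷ [])  = con-+ c d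
   ⟦addL⟧ {suc n} (c ∷ cs) (d ∷ ds) = S.trans (S.+-cong (S.*-cong (con-+ c d) S.refl) (S.*-cong (S.refl {x}) (⟦addL⟧ cs ds)))
     (S.solve 6 (λ x y c d p q → (c :+ d) :* y :+ x :* (p :+ q) S.:= (c :* y :+ x :* p) :+ (d :* y :+ x :* q)) S.refl x (y ^ₛ suc n) (con (+ c)) (con (+ d)) (⟦ cs ⟧ᴸ n) (⟦ ds ⟧ x y))

   ⟦toList⟧ : ∀ {n} d m (v : Vec ℕ (suc n)) → d ≡ m ℕ.+ n → ⟦ toList v ⟧ᴸ d ≗ₛ y ^ₛ m ⊛ ⟦ v ⟧ x y
   ⟦toList⟧ {zero}  zero    zero    (c ∷ []) eq = S.solve 1 (λ p → p S.:= S.:con 1ℤ :* p) S.refl (con (+ c))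
   ⟦toList⟧ {zero}  (suc d) m       (c ∷ []) eq = S.trans
     (S.solve 3 (λ x y c → c :* y :+ x :* S.:con 0ℤ S.:= y :* c) S.refl x (y ^ₛ suc d) (con (+ c)))
     (S.*-cong (λ i → cong (λ z → (y ^ₛ z) i) (trans eq (ℕP.+-identityʳ m))) (S.refl {con (+ c)}))
   ⟦toList⟧ {suc n} zero    m       (c ∷ cs) eq with trans eq (ℕP.+-suc m n)
   ... | ()
   ⟦toList⟧ {suc n} (suc d) m       (c ∷ cs) eq = S.trans
     (S.+-cong (S.*-cong (S.refl {con (+ c)}) (S.trans (λ i → cong (λ z → (y ^ₛ z) i) eq) (^ₛ-+ y m (suc n))))
               (S.*-cong (S.refl {x}) (⟦toList⟧ d m cs (ℕP.suc-injective (trans eq (ℕP.+-suc m n))))))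
     (S.solve 5 (λ x M Y c p → c :* (M :* Y) :+ x :* (M :* p) S.:= M :* (c :* Y :+ x :* p)) S.refl x (y ^ₛ m) (y ^ₛ suc n) (con (+ c)) (⟦ cs ⟧ x y))

   ⟦0∷⟧ : ∀ {n} (v : Vec ℕ (suc n)) → ⟦ 0 ∷ v ⟧ x y ≗ₛ x ⊛ ⟦ v ⟧ x y
   ⟦0∷⟧ {n} v = S.solve 3 (λ x Y p → S.:con 0ℤ :* Y :+ x :* p S.:= x :* p) S.refl x (y ^ₛ suc n) (⟦ v ⟧ x y)

   ⟦mulV⟧ : ∀ {m n} (u : Vec ℕ (suc m)) (v : Vec ℕ (suc n)) → ⟦ mulV u v ⟧ x y ≗ₛ ⟦ u ⟧ x y ⊛ ⟦ v ⟧ x y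
   ⟦mulV⟧ {zero}  (c ∷ [])     v = ⟦scaleV⟧ c v
   ⟦mulV⟧ {suc m} {n} (c ∷ cs) v = S.trans (⟦addL⟧ (toList (scaleV c v)) (0 ∷ mulV cs v))
     (S.trans (S.+-cong (S.trans (⟦toList⟧ (suc m ℕ.+ n) (suc m) (scaleV c v) refl) (S.*-cong (S.refl {y ^ₛ suc m}) (⟦scaleV⟧ c v)))
                        (S.trans (⟦0∷⟧ (mulV cs v)) (S.*-cong (S.refl {x}) (⟦mulV⟧ cs v))))
     (S.solve 5 (λ x Y c p q → Y :* (c :* p) :+ x :* (q :* p) S.:= (c :* Y :+ x :* q) :* p) S.refl x (y ^ₛ suc m) (con (+ c)) (⟦ v ⟧ x y) (⟦ cs ⟧ x y)))

 infixl 6 _⟨+⟩_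
 infixl 7 _⟨*⟩_
 infixr 8 _⟨^⟩_

 -- Unevaluated expressions indexed by degree, with two interpretations: power series by `eval`, and
 -- coefficient vectors modulo p by `norm`.
 data Form : ℕ → Set where
   x̂ ŷ   : Form 1
   vec   : ∀ {n} → Vec ℕ (suc n) → Form n
   _⟨+⟩_ : ∀ {n} → Form n → Form n → Form n
   _⟨*⟩_ : ∀ {m n} → Form m → Form n → Form (m ℕ.+ n)
   _⟨^⟩_ : ∀ {m} → Form m → (k : ℕ) → Form (k ℕ.* m)
   sub   : ∀ {n m} → Vec ℕ (suc n) → Form m → Form m → Form (n ℕ.* m)

 eval : ∀ {n} → Form n → PS → PS → PS
 eval x̂           x y = x
 eval ŷ           x y = y
 eval (vec v)     x y = ⟦ v ⟧ x y
 eval (f ⟨+⟩ g)   x y = eval f x y ⊕ eval g x y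
 eval (f ⟨*⟩ g)   x y = eval f x y ⊛ eval g x y
 eval (f ⟨^⟩ k)   x y = eval f x y ^ₛ k
 eval (sub v f g) x y = ⟦ v ⟧ (eval f x y) (eval g x y)

 num : ℕ → Form 0
 num c = vec (c ∷ [])

 eqV : ∀ {n} → Vec ℕ n → Vec ℕ n → Bool
 eqV []       []       = true
 eqV (c ∷ cs) (d ∷ ds) = (c ℕ.≡ᵇ d) ∧ eqV cs ds

 eqV-sound : ∀ {n} (u v : Vec ℕ n) → eqV u v ≡ true → u ≡ v
 eqV-sound []       []       _  = refl
 eqV-sound (c ∷ cs) (d ∷ ds) eq with c ℕ.≡ᵇ d in e
 ... | true = cong₂ _∷_ (ℕP.≡ᵇ⇒≡ c d (subst T (sym e) tt)) (eqV-sound cs ds eq)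

 eqL : List ℕ → List ℕ → Bool
 eqL []       []       = true
 eqL (c ∷ cs) (d ∷ ds) = (c ℕ.≡ᵇ d) ∧ eqL cs ds
 eqL _        _        = false

 eqL-sound : ∀ u v → eqL u v ≡ true → u ≡ v
 eqL-sound []       []       _  = refl
 eqL-sound (c ∷ cs) (d ∷ ds) eq with c ℕ.≡ᵇ d in e
 ... | true = cong₂ _∷_ (ℕP.≡ᵇ⇒≡ c d (subst T (sym e) tt)) (eqL-sound cs ds eq)

 module Engine (k : ℕ) where

   p : ℕ
   p = suc k

   open Mod (+ p) public

   red : ∀ {n} → Vec ℕ n → Vec ℕ n
   red = Vec.map (_% p)

   powV : ∀ {n} → Vec ℕ (suc n) → (j : ℕ) → Vec ℕ (suc (j ℕ.* n))
   powV v zero    = 1 ∷ []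
   powV v (suc j) = red (mulV v (powV v j))

   subV : ∀ {n m} → Vec ℕ (suc n) → Vec ℕ (suc m) → Vec ℕ (suc m) → Vec ℕ (suc (n ℕ.* m))
   subV {zero}      (c ∷ [])     u v = c ∷ []
   subV {suc n} (c ∷ cs) u v = red (addV (scaleV c (powV v (suc n))) (mulV u (subV cs u v)))

   norm : ∀ {n} → Form n → Vec ℕ (suc n)
   norm x̂           = 0 ∷ 1 ∷ []
   norm ŷ           = 1 ∷ 0 ∷ []
   norm (vec v)     = red v
   norm (f ⟨+⟩ g)   = red (addV (norm f) (norm g))
   norm (f ⟨*⟩ g)   = red (mulV (norm f) (norm g))
   norm (f ⟨^⟩ j)   = powV (norm f) j
   norm (sub v f g) = subV v (norm f) (norm g)

   con-% : ∀ n → con (+ (n % p)) ≈ con (+ n)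
   con-% n zero    = ≡ₘ-sym (mk (ℤD.divides (+ (n / p)) (trans (cong (λ z → + z -ᶻ + (n % p)) (ℕDM.m≡m%n+[m/n]*n n p))
                       (trans (lem (+ (n % p)) (+ (n / p ℕ.* p))) (ℤP.pos-* (n / p) p)))))
     where
       lem : ∀ x y → x +ᶻ y -ᶻ x ≡ y
       lem = solve-∀
   con-% n (suc i) = ≡ₘ-refl

   module _ (x y : PS) where

     ⟦red⟧ : ∀ {n} (v : Vec ℕ (suc n)) → ⟦ red v ⟧ x y ≈ ⟦ v ⟧ x y
     ⟦red⟧ {zero}  (c ∷ [])     = con-% c
     ⟦red⟧ {suc n} (c ∷ cs) = ⊕-congₘ (⊛-congₘ (con-% c) (≈-refl {y ^ₛ suc n})) (⊛-congₘ (≈-refl {x}) (⟦red⟧ cs))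

     ⟦powV⟧ : ∀ {n} (v : Vec ℕ (suc n)) j → ⟦ powV v j ⟧ x y ≈ ⟦ v ⟧ x y ^ₛ j
     ⟦powV⟧ v zero    = ≈-refl
     ⟦powV⟧ v (suc j) = ≈-trans (⟦red⟧ (mulV v (powV v j))) (≈-trans (exact (⟦mulV⟧ x y v (powV v j))) (⊛-congₘ (≈-refl {⟦ v ⟧ x y}) (⟦powV⟧ v j)))

     ⟦subV⟧ : ∀ {n m} (w : Vec ℕ (suc n)) (u v : Vec ℕ (suc m)) → ⟦ subV w u v ⟧ x y ≈ ⟦ w ⟧ (⟦ u ⟧ x y) (⟦ v ⟧ x y)
     ⟦subV⟧ {zero}  (c ∷ []) u v = ≈-refl
     ⟦subV⟧ {suc n} (c ∷ cs) u v = ≈-trans (⟦red⟧ (addV (scaleV c (powV v (suc n))) (mulV u (subV cs u v))))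
       (≈-trans (exact (⟦addV⟧ x y (scaleV c (powV v (suc n))) (mulV u (subV cs u v))))
       (⊕-congₘ (≈-trans (exact (⟦scaleV⟧ x y c (powV v (suc n)))) (⊛-congₘ (≈-refl {con (+ c)}) (⟦powV⟧ v (suc n))))
                (≈-trans (exact (⟦mulV⟧ x y u (subV cs u v))) (⊛-congₘ (≈-refl {⟦ u ⟧ x y}) (⟦subV⟧ cs u v)))))

   ^ₛ-congₘ : ∀ {f g} n → f ≈ g → f ^ₛ n ≈ g ^ₛ n
   ^ₛ-congₘ zero    p = ≈-refl
   ^ₛ-congₘ (suc n) p = ⊛-congₘ p (^ₛ-congₘ n p)

   ⟦⟧-congₘ : ∀ {n} (v : Vec ℕ (suc n)) {x x′ y y′} → x ≈ x′ → y ≈ y′ → ⟦ v ⟧ x y ≈ ⟦ v ⟧ x′ y′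
   ⟦⟧-congₘ {zero}  (c ∷ [])     p q = ≈-refl
   ⟦⟧-congₘ {suc n} (c ∷ cs) p q = ⊕-congₘ (⊛-congₘ (≈-refl {con (+ c)}) (^ₛ-congₘ (suc n) q)) (⊛-congₘ p (⟦⟧-congₘ cs p q))

   norm-sound : ∀ {n} (f : Form n) x y → ⟦ norm f ⟧ x y ≈ eval f x y
   norm-sound x̂           x y = exact (S.solve 2 (λ x y → S.:con 0ℤ S.:* (y S.:* S.:con 1ℤ) S.:+ x S.:* S.:con 1ℤ S.:= x) S.refl x y)
   norm-sound ŷ           x y = exact (S.solve 2 (λ x y → S.:con 1ℤ S.:* (y S.:* S.:con 1ℤ) S.:+ x S.:* S.:con 0ℤ S.:= y) S.refl x y)
   norm-sound (vec v)     x y = ⟦red⟧ x y v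
   norm-sound (f ⟨+⟩ g)   x y = ≈-trans (⟦red⟧ x y (addV (norm f) (norm g))) (≈-trans (exact (⟦addV⟧ x y (norm f) (norm g))) (⊕-congₘ (norm-sound f x y) (norm-sound g x y)))
   norm-sound (f ⟨*⟩ g)   x y = ≈-trans (⟦red⟧ x y (mulV (norm f) (norm g))) (≈-trans (exact (⟦mulV⟧ x y (norm f) (norm g))) (⊛-congₘ (norm-sound f x y) (norm-sound g x y)))
   norm-sound (f ⟨^⟩ j)   x y = ≈-trans (⟦powV⟧ x y (norm f) j) (^ₛ-congₘ j (norm-sound f x y))
   norm-sound (sub v f g) x y = ≈-trans (⟦subV⟧ x y v (norm f) (norm g)) (⟦⟧-congₘ v (norm-sound f x y) (norm-sound g x y))

   -- Congruences between forms are decided by their normal forms. The freshman's dream modulo each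
   -- p is obtained in the same way, from the p-th power of x + y.
   by-norm : ∀ {n} (f g : Form n) → eqV (norm f) (norm g) ≡ true → ∀ x y → eval f x y ≈ eval g x y
   by-norm f g eq x y = ≈-trans (≈-sym (norm-sound f x y))
     (≈-trans (λ i → ≡ₘ-reflexive (cong (λ v → ⟦ v ⟧ x y i) (eqV-sound (norm f) (norm g) eq))) (norm-sound g x y))

-- The section U in characteristic p.

module PrimeSection where

 open PowerSeries
 open Substitution
 open ThetaSeries
 open Wronskian
 open Gauss
 open LambertSeries using (alt-cong; alt-alt; alt-con)
 open HomogeneousForms

 spread-mon : ∀ k c f → spread k c f ≗ₛ mon c ⊛ V k f
 spread-mon k zero    f n       = sym (trans (con-⊛ 1ℤ (V k f) n) (ℤP.*-identityˡ _))
 spread-mon k (suc c) f zero    = refl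
 spread-mon k (suc c) f (suc n) = trans (spread-mon k c f n) (sym (ℤP.+-identityˡ _))

 shift : ∀ f → f ≗ₛ con (f 0) ⊕ mon 1 ⊛ tl f
 shift f zero    = sym (ℤP.+-identityʳ (f 0))
 shift f (suc n) = sym (trans (ℤP.+-identityˡ _) (trans (ℤP.+-identityˡ _) (trans (con-⊛ 1ℤ (tl f) n) (ℤP.*-identityˡ _))))

 mon-^ : ∀ n → mon 1 ^ₛ n ≗ₛ mon n
 mon-^ zero    = S.refl
 mon-^ (suc n) = S.trans (S.*-cong (S.refl {mon 1}) (mon-^ n)) (S.sym (mon-+ 1 n))

 D-^ : ∀ f n → D (f ^ₛ suc n) ≗ₛ con (+ suc n) ⊛ (f ^ₛ n ⊛ D f)
 D-^ f zero    = S.trans (D-⊛ f (con 1ℤ)) (S.trans (S.+-cong (S.refl {D f ⊛ con 1ℤ}) (S.*-cong (S.refl {f}) D1))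
   (S.solve 2 (λ f d → d S.:* S.:con 1ℤ S.:+ f S.:* S.:con 0ℤ S.:= S.:con 1ℤ S.:* (S.:con 1ℤ S.:* d)) S.refl f (D f)))
   where
     D1 : D (con 1ℤ) ≗ₛ con 0ℤ
     D1 zero    = refl
     D1 (suc n) = ℤP.*-zeroʳ (+ suc n)
 D-^ f (suc n) = S.trans (D-⊛ f (f ^ₛ suc n)) (S.trans (S.+-cong (S.refl {D f ⊛ (f ^ₛ suc n)}) (S.*-cong (S.refl {f}) (D-^ f n)))
   (S.trans (S.solve 4 (λ f d c x → d S.:* (f S.:* x) S.:+ f S.:* (c S.:* (x S.:* d)) S.:= (S.:con 1ℤ S.:+ c) S.:* ((f S.:* x) S.:* d)) S.refl f (D f) (con (+ suc n)) (f ^ₛ n))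
            (S.*-cong (S.sym (con-+ 1 (suc n))) S.refl)))

 quartic : PS
 quartic = (a ⊛ a ⊕ b ⊛ b) ⊛ (a ⊛ a ⊖ b ⊛ b)

 -- U_p in characteristic p = k + 1

 module Section (k : ℕ) (isPrime : Prime (suc k)) (odd-p : ¬ suc k ℕD.∣ 2)
                (freshman : ∀ f g → Engine._≈_ k ((f ⊕ g) ^ₛ suc k) (f ^ₛ suc k ⊕ g ^ₛ suc k)) where

   open Engine k
   module ≈-Reasoning = SetoidReasoning ≈-setoid

   prime-cancel : ∀ c {x} → ¬ (p ℕD.∣ ∣ c ∣) → c *ᶻ x ≡ₘ 0ℤ → x ≡ₘ 0ℤ
   prime-cancel c {x} ∤c eq with euclidsLemma ∣ c ∣ ∣ x ∣ isPrime (subst (p ℕD.∣_) (ℤP.abs-* c x) (ℤD.∣⇒∣ᵤ (≡0⇒∣ eq)))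
   ... | inj₁ ∣c = ⊥-elim (∤c ∣c)
   ... | inj₂ ∣x = ∣⇒≡0 (ℤD.∣ᵤ⇒∣ ∣x)

   1<p : 1 < p
   1<p = ℕ.nonTrivial⇒n>1 p {{Data.Nat.Primality.prime⇒nonTrivial isPrime}}
     where import Data.Nat.Primality

   low-⊛ₘ : ∀ f g r → (∀ i → i < r → g i ≡ₘ 0ℤ) → (f ⊛ g) r ≡ₘ f 0 *ᶻ g r
   low-⊛ₘ f g zero    q = ≡ₘ-refl
   low-⊛ₘ f g (suc r) q = ≡ₘ-trans (+-congₘ (≡ₘ-refl {f 0 *ᶻ g (suc r)})
       (≡ₘ-trans (low-⊛ₘ (tl f) g r (λ i i<r → q i (ℕP.m<n⇒m<1+n i<r)))
                 (≡ₘ-trans (*-congₘ (≡ₘ-refl {f 1}) (q r (ℕP.n<1+n r))) (≡ₘ-reflexive (ℤP.*-zeroʳ (f 1))))))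
     (≡ₘ-reflexive (ℤP.+-identityʳ (f 0 *ᶻ g (suc r))))

   cancelₘ : ∀ f {g h} → ¬ (p ℕD.∣ ∣ f 0 ∣) → f ⊛ g ≈ f ⊛ h → g ≈ h
   cancelₘ f {g} {h} ∤f eq n = sub0 (<-rec (λ n → (g ⊖ h) n ≡ₘ 0ℤ) step n)
     where
       sub0 : ∀ {x y} → x -ᶻ y ≡ₘ 0ℤ → x ≡ₘ y
       sub0 q = mk (≡0⇒∣ q)
       fδ : f ⊛ (g ⊖ h) ≈ con 0ℤ
       fδ = ≈-trans (exact (⊛-distribˡ f g (⊝ h))) (≈-trans (⊕-congₘ eq (≈-refl {f ⊛ ⊝ h}))
         (exact (S.solve 2 (λ f h → f S.:* h S.:+ f S.:* (S.:- h) S.:= S.:con 0ℤ) S.refl f h)))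
       con0 : ∀ n → con 0ℤ n ≡ 0ℤ
       con0 zero    = refl
       con0 (suc n) = refl
       step : ∀ n → (∀ {i} → i < n → (g ⊖ h) i ≡ₘ 0ℤ) → (g ⊖ h) n ≡ₘ 0ℤ
       step n ih = prime-cancel (f 0) ∤f (≡ₘ-trans (≡ₘ-sym (low-⊛ₘ f (g ⊖ h) n (λ i → ih))) (≡ₘ-trans (fδ n) (≡ₘ-reflexive (con0 n))))

   -- The series ab begins with 2q; after removal of q its constant term 2 is invertible modulo p.
   cancel-ab : ∀ {g h} → (a ⊛ b) ⊛ g ≈ (a ⊛ b) ⊛ h → g ≈ h
   cancel-ab {g} {h} eq = cancelₘ (tl (a ⊛ b)) odd-p
     (λ n → ≡ₘ-trans (≡ₘ-reflexive (sym (ℤP.+-identityˡ _))) (≡ₘ-trans (eq (suc n)) (≡ₘ-reflexive (ℤP.+-identityˡ _))))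

   fermat : ∀ c → con c ^ₛ p ≈ con c
   fermat (+ n)    = nat n
     where
       nat : ∀ n → con (+ n) ^ₛ p ≈ con (+ n)
       nat zero    = exact (S.solve 1 (λ x → S.:con 0ℤ S.:* x S.:= S.:con 0ℤ) S.refl (con 0ℤ ^ₛ k))
       nat (suc n) = ≈-trans (^ₛ-congₘ p (exact (con-+ 1 n))) (≈-trans (freshman (con 1ℤ) (con (+ n)))
         (≈-trans (⊕-congₘ (exact (one p)) (nat n)) (exact (S.sym (con-+ 1 n)))))
         where
           one : ∀ j → con 1ℤ ^ₛ j ≗ₛ con 1ℤ
           one zero    = S.refl
           one (suc j) = S.trans (S.*-cong (S.refl {con 1ℤ}) (one j)) (S.solve 0 (S.:con 1ℤ S.:* S.:con 1ℤ S.:= S.:con 1ℤ) S.refl)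
   fermat -[1+ n ] = begin
     c ^ₛ p                        ≈⟨ exact (S.solve 2 (λ x y → x S.:= (x S.:+ y) S.:- y) S.refl (c ^ₛ p) (d ^ₛ p)) ⟩
     (c ^ₛ p ⊕ d ^ₛ p) ⊖ d ^ₛ p    ≈⟨ ⊕-congₘ (≈-sym (freshman c d)) (⊝-congₘ (fermat (+ suc n))) ⟩
     (c ⊕ d) ^ₛ p ⊖ d              ≈⟨ ⊕-congₘ (exact (^ₛ-cong p c+d)) (≈-refl {⊝ d}) ⟩
     con 0ℤ ^ₛ p ⊖ d               ≈⟨ exact (S.solve 2 (λ x d → S.:con 0ℤ S.:* x S.:- d S.:= S.:- d) S.refl (con 0ℤ ^ₛ k) d) ⟩
     ⊝ d                           ≈⟨ exact (λ { zero → refl ; (suc i) → refl }) ⟩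
     c ∎
     where
       open ≈-Reasoning
       c = con -[1+ n ]
       d = con (+ suc n)
       c+d : c ⊕ d ≗ₛ con 0ℤ
       c+d zero    = ℤP.+-inverseˡ (+ suc n)
       c+d (suc i) = refl

   ⊛-mon-cong : ∀ j {f g} n → (∀ i → i ≤ n → f i ≡ₘ g i) → (mon j ⊛ f) n ≡ₘ (mon j ⊛ g) n
   ⊛-mon-cong zero    {f} {g} n       q = ≡ₘ-trans (≡ₘ-reflexive (trans (con-⊛ 1ℤ f n) (ℤP.*-identityˡ _)))
     (≡ₘ-trans (q n ℕP.≤-refl) (≡ₘ-reflexive (sym (trans (con-⊛ 1ℤ g n) (ℤP.*-identityˡ _)))))
   ⊛-mon-cong (suc j) zero    q = ≡ₘ-refl
   ⊛-mon-cong (suc j) (suc n) q = +-congₘ (≡ₘ-refl {0ℤ}) (⊛-mon-cong j n (λ i i≤ → q i (ℕP.m≤n⇒m≤1+n i≤)))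

   -- With f = f(0) + q·`tl f`, the freshman's dream and Fermat's theorem give f(0) + q^p
   -- (`tl f`)^p. The induction on the coefficient has to run over all series at once, since f
   -- changes to its tail.
   frobenius : ∀ f → f ^ₛ p ≈ V k f
   frobenius f n = <-rec (λ n → ∀ f → (f ^ₛ p) n ≡ₘ V k f n) step n f
     where
       step : ∀ n → (∀ {i} → i < n → ∀ f → (f ^ₛ p) i ≡ₘ V k f i) → ∀ f → (f ^ₛ p) n ≡ₘ V k f n
       step n ih f = ≡ₘ-trans (expand n) (≡ₘ-trans (last n ih) (≡ₘ-reflexive (sym (V-step n))))
         where
           expand : f ^ₛ p ≈ con (f 0) ⊕ mon p ⊛ tl f ^ₛ p
           expand = ≈-trans (exact (^ₛ-cong p (shift f))) (≈-trans (freshman (con (f 0)) (mon 1 ⊛ tl f))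
             (⊕-congₘ (fermat (f 0)) (exact (S.trans (^ₛ-⊛ (mon 1) (tl f) p) (S.*-cong (mon-^ p) S.refl)))))
           V-step : V k f ≗ₛ con (f 0) ⊕ mon p ⊛ V k (tl f)
           V-step zero    = sym (ℤP.+-identityʳ (f 0))
           V-step (suc n) = trans (spread-mon k k (tl f) n) (sym (trans (ℤP.+-identityˡ _) (ℤP.+-identityˡ _)))
           last : ∀ n → (∀ {i} → i < n → ∀ f → (f ^ₛ p) i ≡ₘ V k f i) → (con (f 0) ⊕ mon p ⊛ tl f ^ₛ p) n ≡ₘ (con (f 0) ⊕ mon p ⊛ V k (tl f)) n
           last zero    ih = ≡ₘ-refl
           last (suc n) ih = +-congₘ (≡ₘ-refl {0ℤ}) (+-congₘ (≡ₘ-refl {0ℤ}) (⊛-mon-cong k n (λ i i≤ → ih (s≤s i≤) (tl f))))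

   U-cong : ∀ {f g} → f ≈ g → U k f ≈ U k g
   U-cong q n = q (n ℕ.* p)

   U-D : ∀ f → U k (D f) ≈ con 0ℤ
   U-D f n = ≡ₘ-trans (∣⇒≡0 (ℤD.divides (+ n *ᶻ f (n ℕ.* p)) (trans (cong (_*ᶻ f (n ℕ.* p)) (ℤP.pos-* n p)) (lem (+ n) (+ p) (f (n ℕ.* p)))))) (≡ₘ-reflexive (sym (con0 n)))
     where
       lem : ∀ n p x → n *ᶻ p *ᶻ x ≡ n *ᶻ x *ᶻ p
       lem = solve-∀
       con0 : ∀ n → con 0ℤ n ≡ 0ℤ
       con0 zero    = refl
       con0 (suc n) = refl

   -- Writing fᵖ = V f + p g over ℤ and differentiating, p cancels.
   U-logD′ : ∀ f g → (∀ i → (f ^ₛ p) i ≡ V k f i +ᶻ + p *ᶻ g i) → U k (f ^ₛ k ⊛ D f) ≈ D f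
   U-logD′ f g fᵖ n = ≡ₘ-trans (≡ₘ-reflexive (eq (n ℕ.* p)))
     (≡ₘ-trans (+-congₘ (≡ₘ-reflexive (V-at k (D f) n)) (≡ₘ-trans (U-D g n) (≡ₘ-reflexive (con0 n)))) (≡ₘ-reflexive (ℤP.+-identityʳ (D f n))))
     where
       con0 : ∀ n → con 0ℤ n ≡ 0ℤ
       con0 zero    = refl
       con0 (suc n) = refl
       eq : ∀ i → (f ^ₛ k ⊛ D f) i ≡ V k (D f) i +ᶻ D g i
       eq i = ℤP.*-cancelˡ-≡ (+ p) _ _ (trans (sym (con-⊛ (+ p) (f ^ₛ k ⊛ D f) i)) (trans (sym (D-^ f k i))
         (trans (cong (+ i *ᶻ_) (fᵖ i)) (trans (lem (+ i) (V k f i) (+ p) (g i)) (trans (cong (_+ᶻ + p *ᶻ D g i) (D-V k f i)) (sym (ℤP.*-distribˡ-+ (+ p) (V k (D f) i) (D g i))))))))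
         where
           lem : ∀ i v p g → i *ᶻ (v +ᶻ p *ᶻ g) ≡ i *ᶻ v +ᶻ p *ᶻ (i *ᶻ g)
           lem = solve-∀

   U-logD : ∀ f → U k (f ^ₛ k ⊛ D f) ≈ D f
   U-logD f = U-logD′ f (λ i → quotient (div (frobenius f i)))
     (λ i → trans (lem ((f ^ₛ p) i) (V k f i)) (cong (V k f i +ᶻ_) (trans (equality (div (frobenius f i))) (ℤP.*-comm _ (+ p)))))
     where
       open ℤD._∣_
       lem : ∀ x y → x ≡ y +ᶻ (x -ᶻ y)
       lem = solve-∀

   U-V-⊛ : ∀ f g → U k (f ^ₛ p ⊛ g) ≈ f ⊛ U k g
   U-V-⊛ f g = ≈-trans (U-cong (⊛-congₘ (frobenius f) (≈-refl {g}))) (exact (U-V k f g))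

   -- As ab times the quartic is the Wronskian, (ab)^p times the quartic is a^p b^(p-1) Db - b^p
   -- a^(p-1) Da. The factors a^p and b^p leave U as a and b, and U sends b^(p-1) Db to Db: the
   -- Wronskian is reproduced.
   U-quartic : U k quartic ≈ quartic
   U-quartic = cancel-ab (begin
     (a ⊛ b) ⊛ U k quartic
       ≈⟨ ≈-sym (U-V-⊛ (a ⊛ b) quartic) ⟩
     U k ((a ⊛ b) ^ₛ p ⊛ quartic)
       ≈⟨ U-cong (exact step) ⟩
     U k (a ^ₛ p ⊛ (b ^ₛ k ⊛ D b) ⊕ b ^ₛ p ⊛ ⊝ (a ^ₛ k ⊛ D a))
       ≈⟨ ⊕-congₘ (≈-trans (U-V-⊛ a (b ^ₛ k ⊛ D b)) (⊛-congₘ (≈-refl {a}) (U-logD b)))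
                  (≈-trans (U-V-⊛ b (⊝ (a ^ₛ k ⊛ D a))) (⊛-congₘ (≈-refl {b}) (⊝-congₘ (U-logD a)))) ⟩
     a ⊛ D b ⊕ b ⊛ ⊝ D a
       ≈⟨ exact (S.trans (S.solve 4 (λ a b x y → a :* y :+ b :* (:- x) S.:= a :* y :- b :* x) S.refl a b (D a) (D b)) wronskian) ⟩
     (a ⊛ b) ⊛ quartic ∎)
     where
       open ≈-Reasoning
       open S using (_:+_; _:*_; _:-_; :-_)
       step : (a ⊛ b) ^ₛ p ⊛ quartic ≗ₛ a ^ₛ p ⊛ (b ^ₛ k ⊛ D b) ⊕ b ^ₛ p ⊛ ⊝ (a ^ₛ k ⊛ D a)
       step = S.trans (S.*-cong (^ₛ-⊛ a b p) (S.refl {quartic}))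
         (S.trans (S.solve 5 (λ a b x y q → ((a :* x) :* (b :* y)) :* q S.:= (x :* y) :* ((a :* b) :* q)) S.refl a b (a ^ₛ k) (b ^ₛ k) quartic)
         (S.trans (S.*-cong (S.refl {a ^ₛ k ⊛ b ^ₛ k}) (S.sym wronskian))
                  (S.solve 6 (λ a b x y u v → (x :* y) :* (a :* v :- b :* u) S.:= (a :* x) :* (y :* v) :+ (b :* y) :* (:- (x :* u))) S.refl a b (a ^ₛ k) (b ^ₛ k) (D a) (D b))))

   -- (a⁴ - b⁴) bⁱ aʲ is a derivative up to the factor i when p divides i + j.

   D-mono : ∀ i j → + p ∣ℤ + (i ℕ.+ j) → D (b ^ₛ i ⊛ a ^ₛ j) ≈ con (+ i) ⊛ (quartic ⊛ (b ^ₛ i ⊛ a ^ₛ j))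
   D-mono i j ∣i+j = cancel-ab (begin
     (a ⊛ b) ⊛ D (b ^ₛ i ⊛ a ^ₛ j)
       ≈⟨ exact (S.trans (S.*-cong (S.refl {a ⊛ b}) (D-⊛ (b ^ₛ i) (a ^ₛ j)))
            (S.solve 6 (λ a b x y u v → (a :* b) :* (u :* y :+ x :* v) S.:= a :* y :* (b :* u) :+ b :* x :* (a :* v)) S.refl a b (b ^ₛ i) (a ^ₛ j) (D (b ^ₛ i)) (D (a ^ₛ j)))) ⟩
     a ⊛ a ^ₛ j ⊛ (b ⊛ D (b ^ₛ i)) ⊕ b ⊛ b ^ₛ i ⊛ (a ⊛ D (a ^ₛ j))
       ≈⟨ ⊕-congₘ (⊛-congₘ (≈-refl {a ⊛ a ^ₛ j}) (exact (euler b i))) (⊛-congₘ (≈-refl {b ⊛ b ^ₛ i}) (≈-trans (exact (euler a j)) (⊛-congₘ neg-j (≈-refl {a ^ₛ j ⊛ D a})))) ⟩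
     a ⊛ a ^ₛ j ⊛ (con (+ i) ⊛ (b ^ₛ i ⊛ D b)) ⊕ b ⊛ b ^ₛ i ⊛ (⊝ con (+ i) ⊛ (a ^ₛ j ⊛ D a))
       ≈⟨ exact (S.solve 7 (λ a b x y u v c → a :* y :* (c :* (x :* v)) :+ b :* x :* (:- c :* (y :* u)) S.:= (c :* (x :* y)) :* (a :* v :- b :* u)) S.refl a b (b ^ₛ i) (a ^ₛ j) (D a) (D b) (con (+ i))) ⟩
     (con (+ i) ⊛ (b ^ₛ i ⊛ a ^ₛ j)) ⊛ (a ⊛ D b ⊖ b ⊛ D a)
       ≈⟨ exact (S.trans (S.*-cong (S.refl {con (+ i) ⊛ (b ^ₛ i ⊛ a ^ₛ j)}) wronskian)
            (S.solve 4 (λ c x s q → (c :* x) :* (s :* q) S.:= s :* (c :* (q :* x))) S.refl (con (+ i)) (b ^ₛ i ⊛ a ^ₛ j) (a ⊛ b) quartic)) ⟩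
     (a ⊛ b) ⊛ (con (+ i) ⊛ (quartic ⊛ (b ^ₛ i ⊛ a ^ₛ j))) ∎)
     where
       open ≈-Reasoning
       open S using (_:+_; _:*_; _:-_; :-_)
       euler : ∀ f n → f ⊛ D (f ^ₛ n) ≗ₛ con (+ n) ⊛ (f ^ₛ n ⊛ D f)
       euler f zero    = S.trans (S.*-cong (S.refl {f}) D1) (S.solve 2 (λ f d → f :* S.:con 0ℤ S.:= S.:con 0ℤ :* d) S.refl f (con 1ℤ ⊛ D f))
         where
           D1 : D (con 1ℤ) ≗ₛ con 0ℤ
           D1 zero    = refl
           D1 (suc n) = ℤP.*-zeroʳ (+ suc n)
       euler f (suc n) = S.trans (S.*-cong (S.refl {f}) (D-^ f n)) (S.solve 4 (λ f c x d → f :* (c :* (x :* d)) S.:= c :* ((f :* x) :* d)) S.refl f (con (+ suc n)) (f ^ₛ n) (D f))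
       neg-j : con (+ j) ≈ ⊝ con (+ i)
       neg-j zero    = mk (subst (+ p ∣ℤ_) (lem (+ i) (+ j)) ∣i+j)
         where
           lem : ∀ i j → i +ᶻ j ≡ j -ᶻ (-ᶻ i)
           lem = solve-∀
       neg-j (suc n) = ≡ₘ-refl

   -- By `D-mono` the argument of U is a derivative divided by i, a unit modulo p, and U annihilates
   -- derivatives modulo p.
   U-mono-off : ∀ i j → + p ∣ℤ + (i ℕ.+ j) → ¬ (p ℕD.∣ i) → U k (quartic ⊛ (b ^ₛ i ⊛ a ^ₛ j)) ≈ con 0ℤ
   U-mono-off i j ∣i+j ∤i n = ≡ₘ-trans (prime-cancel (+ i) ∤i
     (≡ₘ-trans (≡ₘ-reflexive (sym (con-⊛ (+ i) (quartic ⊛ (b ^ₛ i ⊛ a ^ₛ j)) (n ℕ.* p))))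
     (≡ₘ-trans (≡ₘ-sym (D-mono i j ∣i+j (n ℕ.* p))) (≡ₘ-trans (U-D (b ^ₛ i ⊛ a ^ₛ j) n) (≡ₘ-reflexive (con0 n)))))) (≡ₘ-reflexive (sym (con0 n)))
     where
       con0 : ∀ n → con 0ℤ n ≡ 0ℤ
       con0 zero    = refl
       con0 (suc n) = refl

   U-mono-on : ∀ q l → U k (quartic ⊛ (b ^ₛ (q ℕ.* p) ⊛ a ^ₛ (l ℕ.* p))) ≈ quartic ⊛ (b ^ₛ q ⊛ a ^ₛ l)
   U-mono-on q l = begin
     U k (quartic ⊛ (b ^ₛ (q ℕ.* p) ⊛ a ^ₛ (l ℕ.* p)))
       ≈⟨ U-cong (exact (S.trans (S.*-comm quartic _) (S.*-cong (S.trans (S.*-cong (pow b q) (pow a l)) (S.sym (^ₛ-⊛ (b ^ₛ q) (a ^ₛ l) p))) (S.refl {quartic})))) ⟩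
     U k ((b ^ₛ q ⊛ a ^ₛ l) ^ₛ p ⊛ quartic)
       ≈⟨ U-V-⊛ (b ^ₛ q ⊛ a ^ₛ l) quartic ⟩
     (b ^ₛ q ⊛ a ^ₛ l) ⊛ U k quartic
       ≈⟨ ⊛-congₘ (≈-refl {b ^ₛ q ⊛ a ^ₛ l}) U-quartic ⟩
     (b ^ₛ q ⊛ a ^ₛ l) ⊛ quartic
       ≈⟨ exact (S.*-comm _ quartic) ⟩
     quartic ⊛ (b ^ₛ q ⊛ a ^ₛ l) ∎
     where
       open ≈-Reasoning
       pow : ∀ f n → f ^ₛ (n ℕ.* p) ≗ₛ (f ^ₛ n) ^ₛ p
       pow f n = S.trans (λ i → cong (λ z → (f ^ₛ z) i) (ℕP.*-comm n p)) (^ₛ-* f p n)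

   -- Forms listed from bⁱ aʲ onwards, and the sieve keeping every p-th coefficient after r more steps

   from : ℕ → ℕ → List ℕ → PS
   from i j []       = con 0ℤ
   from i j (c ∷ cs) = con (+ c) ⊛ (b ^ₛ i ⊛ a ^ₛ j) ⊕ from (suc i) (j ℕ.∸ 1) cs

   sieve : ℕ → List ℕ → List ℕ
   sieve r       []       = []
   sieve zero    (c ∷ cs) = c ∷ sieve k cs
   sieve (suc r) (c ∷ cs) = sieve r cs

   ⟦⟧-from : ∀ {n} i (v : Vec ℕ (suc n)) → b ^ₛ i ⊛ ⟦ v ⟧ b a ≗ₛ from i n (toList v)
   ⟦⟧-from {zero}  i (c ∷ []) = S.solve 2 (λ x c → x S.:* c S.:= c S.:* (x S.:* S.:con 1ℤ) S.:+ S.:con 0ℤ) S.refl (b ^ₛ i) (con (+ c))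
   ⟦⟧-from {suc n} i (c ∷ cs) = S.trans (S.solve 5 (λ x c y b p → x S.:* (c S.:* y S.:+ b S.:* p) S.:= c S.:* (x S.:* y) S.:+ (b S.:* x) S.:* p) S.refl (b ^ₛ i) (con (+ c)) (a ^ₛ suc n) b (⟦ cs ⟧ b a))
     (S.+-cong (S.refl {con (+ c) ⊛ (b ^ₛ i ⊛ (a ^ₛ suc n))}) (⟦⟧-from (suc i) cs))

   -- In a total degree divisible by p the exponents i and j are multiples of p together. Then bⁱaʲ
   -- is a p-th power and leaves U; in all other cases the term is annihilated. So U keeps every
   -- p-th coefficient. The number r counts the steps from i to the next multiple qp of p.
   U-sieve : ∀ i j q l r cs → r ≤ k → i ℕ.+ r ≡ q ℕ.* p → (j ≡ r ℕ.+ l ℕ.* p ⊎ cs ≡ []) → length cs ≤ suc j →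
             U k (quartic ⊛ from i j cs) ≈ quartic ⊛ from q l (sieve r cs)
   U-sieve i j q l r [] _ _ _ _ = exact (λ n → trans (z (n ℕ.* p)) (sym (z n)))
     where
       z : ∀ n → (quartic ⊛ con 0ℤ) n ≡ 0ℤ
       z n = vanish-⊛ quartic (con 0ℤ) n (λ { zero _ → refl ; (suc i) _ → refl })
   U-sieve i j q l zero (c ∷ cs) r≤ ei (inj₁ ej) (s≤s len) = begin
     U k (quartic ⊛ (con (+ c) ⊛ (b ^ₛ i ⊛ a ^ₛ j) ⊕ from (suc i) (j ℕ.∸ 1) cs))
       ≈⟨ U-cong (exact (S.solve 4 (λ Q c x y → Q :* (c :* x :+ y) S.:= c :* (Q :* x) :+ Q :* y) S.refl quartic (con (+ c)) (b ^ₛ i ⊛ a ^ₛ j) (from (suc i) (j ℕ.∸ 1) cs))) ⟩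
     U k (con (+ c) ⊛ (quartic ⊛ (b ^ₛ i ⊛ a ^ₛ j)) ⊕ quartic ⊛ from (suc i) (j ℕ.∸ 1) cs)
       ≈⟨ ⊕-congₘ (≈-trans (exact (U-con (+ c) (quartic ⊛ (b ^ₛ i ⊛ a ^ₛ j))))
            (⊛-congₘ (≈-refl {con (+ c)}) (≈-trans (exact (λ n → cong₂ (λ s t → (quartic ⊛ (b ^ₛ s ⊛ a ^ₛ t)) (n ℕ.* p)) (trans (sym (ℕP.+-identityʳ i)) ei) ej)) (U-mono-on q l))))
          (rest l ej) ⟩
     con (+ c) ⊛ (quartic ⊛ (b ^ₛ q ⊛ a ^ₛ l)) ⊕ quartic ⊛ from (suc q) (l ℕ.∸ 1) (sieve k cs)
       ≈⟨ exact (S.solve 4 (λ Q c x y → c :* (Q :* x) :+ Q :* y S.:= Q :* (c :* x :+ y)) S.refl quartic (con (+ c)) (b ^ₛ q ⊛ a ^ₛ l) (from (suc q) (l ℕ.∸ 1) (sieve k cs))) ⟩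
     quartic ⊛ (con (+ c) ⊛ (b ^ₛ q ⊛ a ^ₛ l) ⊕ from (suc q) (l ℕ.∸ 1) (sieve k cs)) ∎
     where
       open ≈-Reasoning
       open S using (_:+_; _:*_; _:-_; :-_)
       U-con : ∀ c f → U k (con c ⊛ f) ≗ₛ con c ⊛ U k f
       U-con c f n = trans (con-⊛ c f (n ℕ.* p)) (sym (con-⊛ c (U k f) n))
       rest : ∀ l → j ≡ l ℕ.* p → U k (quartic ⊛ from (suc i) (j ℕ.∸ 1) cs) ≈ quartic ⊛ from (suc q) (l ℕ.∸ 1) (sieve k cs)
       rest l ej = U-sieve (suc i) (j ℕ.∸ 1) (suc q) (l ℕ.∸ 1) k cs ℕP.≤-refl
         (trans (sym (ℕP.+-suc i k)) (trans (cong (ℕ._+ p) (trans (sym (ℕP.+-identityʳ i)) ei)) (ℕP.+-comm (q ℕ.* p) p))) (split l ej) (bound cs len)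
         where
           split : ∀ l → j ≡ l ℕ.* p → (j ℕ.∸ 1 ≡ k ℕ.+ (l ℕ.∸ 1) ℕ.* p) ⊎ (cs ≡ [])
           -- For l = 0 the exponent j is 0, and the length bound leaves no further coefficient.
           split zero    e = inj₂ (empty cs (ℕP.≤-trans len (ℕP.≤-reflexive e)))
             where
               empty : ∀ (cs : List ℕ) → length cs ≤ 0 → cs ≡ []
               empty [] _ = refl
           split (suc l) e = inj₁ (cong (ℕ._∸ 1) e)
           bound : ∀ cs → length cs ≤ j → length cs ≤ suc (j ℕ.∸ 1)
           bound cs q = ℕP.≤-trans q (ℕP.m≤n+m∸n j 1)
   U-sieve i j q l zero (c ∷ cs) r≤ ei (inj₂ ()) len
   U-sieve i j q l (suc r) (c ∷ cs) r≤ ei (inj₁ ej) (s≤s len) = begin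
     U k (quartic ⊛ (con (+ c) ⊛ (b ^ₛ i ⊛ a ^ₛ j) ⊕ from (suc i) (j ℕ.∸ 1) cs))
       ≈⟨ U-cong (exact (S.solve 4 (λ Q c x y → Q :* (c :* x :+ y) S.:= c :* (Q :* x) :+ Q :* y) S.refl quartic (con (+ c)) (b ^ₛ i ⊛ a ^ₛ j) (from (suc i) (j ℕ.∸ 1) cs))) ⟩
     U k (con (+ c) ⊛ (quartic ⊛ (b ^ₛ i ⊛ a ^ₛ j)) ⊕ quartic ⊛ from (suc i) (j ℕ.∸ 1) cs)
       ≈⟨ ⊕-congₘ (≈-trans (exact (U-con (+ c) (quartic ⊛ (b ^ₛ i ⊛ a ^ₛ j)))) (⊛-congₘ (≈-refl {con (+ c)}) (U-mono-off i j ∣i+j ∤i)))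
            (U-sieve (suc i) (j ℕ.∸ 1) q l r cs (ℕP.<⇒≤ r≤) (trans (sym (ℕP.+-suc i r)) ei) (inj₁ (cong (ℕ._∸ 1) ej)) (ℕP.≤-trans len (ℕP.m≤n+m∸n j 1))) ⟩
     con (+ c) ⊛ con 0ℤ ⊕ quartic ⊛ from q l (sieve r cs)
       ≈⟨ exact (S.solve 2 (λ c y → c :* S.:con 0ℤ :+ y S.:= y) S.refl (con (+ c)) (quartic ⊛ from q l (sieve r cs))) ⟩
     quartic ⊛ from q l (sieve r cs) ∎
     where
       open ≈-Reasoning
       open S using (_:+_; _:*_; _:-_; :-_)
       U-con : ∀ c f → U k (con c ⊛ f) ≗ₛ con c ⊛ U k f
       U-con c f n = trans (con-⊛ c f (n ℕ.* p)) (sym (con-⊛ c (U k f) n))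
       ∣i+j : + p ∣ℤ + (i ℕ.+ j)
       ∣i+j = ℤD.∣ᵤ⇒∣ (ℕD.divides (q ℕ.+ l) (trans (cong (i ℕ.+_) ej) (trans (sym (ℕP.+-assoc i (suc r) (l ℕ.* p))) (trans (cong (ℕ._+ l ℕ.* p) ei) (sym (ℕP.*-distribʳ-+ p q l))))))
       ∤i : ¬ (p ℕD.∣ i)
       ∤i ∣i = ℕP.<-irrefl refl (ℕP.≤-trans (s≤s r≤) (ℕD.∣⇒≤ (ℕD.∣m+n∣m⇒∣n (subst (p ℕD.∣_) (sym ei) (ℕD.n∣m*n q)) ∣i)))
   U-sieve i j q l (suc r) (c ∷ cs) r≤ ei (inj₂ ()) len

   1/θ : PS
   1/θ = alt overpartitions

   θ-1/θ : θ ⊛ 1/θ ≗ₛ con 1ℤ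
   θ-1/θ = S.trans (S.*-cong (S.trans (S.sym (alt-alt θ)) (alt-cong altθ)) (S.refl {1/θ}))
     (S.trans (S.sym (alt-⊛ θ₄ overpartitions)) (S.trans (alt-cong gauss) (alt-con 1ℤ)))

   module _ {d} (gs : Vec ℕ (suc d)) (d≡ : d ≡ k ℕ.* p) (gs≈ : ⟦ gs ⟧ b a ≈ quartic ^ₛ k ⊛ θ ^ₛ k) (𝔤 : Vec ℕ p) (𝔤≡ : toList 𝔤 ≡ sieve 0 (toList gs)) where

     -- The factor θ·quartic is drawn into U as its p-th power, and (θ·quartic)^p/θ is the quartic
     -- times quartic^(p-1) θ^(p-1). In a and b the latter has degree 5(p - 1), whereas the sieve
     -- needs a multiple of p; `gs` is a congruent form of degree (p - 1)p.
     θ-section : θ ⊛ U k 1/θ ≈ ⟦ 𝔤 ⟧ b a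
     θ-section = cancelₘ quartic (λ ∣1 → ℕP.<-irrefl refl (ℕP.≤-trans 1<p (ℕD.∣⇒≤ ∣1))) (begin
       quartic ⊛ (θ ⊛ U k 1/θ)
         ≈⟨ exact (S.solve 3 (λ q t u → q :* (t :* u) S.:= (t :* q) :* u) S.refl quartic θ (U k 1/θ)) ⟩
       (θ ⊛ quartic) ⊛ U k 1/θ
         ≈⟨ ≈-sym (U-V-⊛ (θ ⊛ quartic) 1/θ) ⟩
       U k ((θ ⊛ quartic) ^ₛ p ⊛ 1/θ)
         ≈⟨ U-cong (≈-trans (exact step) (⊛-congₘ (≈-refl {quartic}) (≈-trans (≈-sym gs≈) (exact (S.trans (S.solve 1 (λ x → x S.:= S.:con 1ℤ :* x) S.refl (⟦ gs ⟧ b a)) (⟦⟧-from 0 gs)))))) ⟩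
       U k (quartic ⊛ from 0 d (toList gs))
         ≈⟨ U-sieve 0 d 0 k 0 (toList gs) z≤n refl (inj₁ d≡) (ℕP.≤-reflexive (len gs)) ⟩
       quartic ⊛ from 0 k (sieve 0 (toList gs))
         ≈⟨ ⊛-congₘ (≈-refl {quartic}) (exact (S.trans (λ i → cong (λ z → from 0 k z i) (sym 𝔤≡)) (S.sym (S.trans (S.solve 1 (λ x → x S.:= S.:con 1ℤ :* x) S.refl (⟦ 𝔤 ⟧ b a)) (⟦⟧-from 0 𝔤))))) ⟩
       quartic ⊛ ⟦ 𝔤 ⟧ b a ∎)
       where
         open ≈-Reasoning
         open S using (_:+_; _:*_; _:-_; :-_)
         len : ∀ {n} (v : Vec ℕ n) → length (toList v) ≡ n
         len []       = refl
         len (c ∷ cs) = cong suc (len cs)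
         step : (θ ⊛ quartic) ^ₛ p ⊛ 1/θ ≗ₛ quartic ⊛ (quartic ^ₛ k ⊛ θ ^ₛ k)
         step = S.trans (S.*-cong (^ₛ-⊛ θ quartic p) (S.refl {1/θ}))
           (S.trans (S.solve 5 (λ t q x y w → ((t :* x) :* (q :* y)) :* w S.:= (t :* w) :* (q :* (y :* x))) S.refl θ quartic (θ ^ₛ k) (quartic ^ₛ k) 1/θ)
           (S.trans (S.*-cong θ-1/θ (S.refl {quartic ⊛ (quartic ^ₛ k ⊛ θ ^ₛ k)})) (S.solve 1 (λ x → S.:con 1ℤ :* x S.:= x) S.refl _)))

   -- An odd coefficient is zero, and a positive even one equals the coefficient at half its index.
   V₂-fixed : ∀ {f} → f ≈ V₂ f → f ≈ con (f 0)
   V₂-fixed {f} fix n = <-rec (λ n → f n ≡ₘ con (f 0) n) step n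
     where
       step : ∀ n → (∀ {i} → i < n → f i ≡ₘ con (f 0) i) → f n ≡ₘ con (f 0) n
       step zero    ih = ≡ₘ-refl
       step (suc n) ih = ≡ₘ-trans (fix (suc n)) (go (parity (suc n)) refl)
         where
           go : ∀ {N} → Parity N → N ≡ suc n → V₂ f N ≡ₘ 0ℤ
           go (odd m)        eq = ≡ₘ-reflexive (V-odd f m)
           go (even zero)    ()
           go (even (suc m)) eq = ≡ₘ-trans (≡ₘ-reflexive (V-at 1 f (suc m))) (ih (subst (suc m <_) eq (s≤s (s≤s (ℕP.m≤m*n m 2)))))

-- Lambert series as polynomials in θ(q)² and θ(-q)².

module LambertForms where

 open PowerSeries
 open FiniteSums
 open Substitution
 open ThetaSeries
 open Wronskian
 open Gauss
 open Factorizations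
 open LambertSeries
 open HomogeneousForms
 open PrimeSection

 -- s = θ(q)² and t = θ(-q)²

 s t : PS
 s = (b ⊕ a) ⊛ (b ⊕ a)
 t = (a ⊖ b) ⊛ (a ⊖ b)

 θ²≗s : θ ⊛ θ ≗ₛ s
 θ²≗s = S.*-cong eq eq
   where
     eq : θ ≗ₛ b ⊕ a
     eq = S.trans θ≗a+b (S.+-comm a b)

 κ≗s : κ ≗ₛ s
 κ≗s = S.trans two-squares θ²≗s

 alt-s : alt s ≗ₛ t
 alt-s = S.trans (alt-cong (S.sym θ²≗s)) (S.trans (alt-⊛ θ θ) (S.*-cong eq eq))
   where
     eq : alt θ ≗ₛ a ⊖ b
     eq = S.trans altθ θ₄≗a-b

 alt-t : alt t ≗ₛ s
 alt-t = S.trans (alt-cong (S.sym alt-s)) (alt-alt s)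

 κ⁻≗t : κ⁻ ≗ₛ t
 κ⁻≗t = S.trans (S.sym alt-κ) (S.trans (alt-cong κ≗s) alt-s)

 V₂s : V₂ s ≗ₛ b ⊛ b ⊕ a ⊛ a
 V₂s = S.trans (V₂-cong (S.sym θ²≗s)) (S.trans (S.sym landen₊) (S.+-comm (a ⊛ a) (b ⊛ b)))

 V₂t : V₂ t ≗ₛ a ⊛ a ⊖ b ⊛ b
 V₂t = S.trans (V₂-cong (S.*-cong (S.sym θ₄≗a-b) (S.sym θ₄≗a-b))) (S.sym landen₋)

 V₂-^ : ∀ f n → V₂ (f ^ₛ n) ≗ₛ V₂ f ^ₛ n
 V₂-^ f zero    = V-con 1 1ℤ
 V₂-^ f (suc n) = S.trans (V₂-⊛ f (f ^ₛ n)) (S.*-cong (S.refl {V₂ f}) (V₂-^ f n))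

 V₂-⟦⟧ : ∀ {n} (v : Vec ℕ (suc n)) x y → V₂ (⟦ v ⟧ x y) ≗ₛ ⟦ v ⟧ (V₂ x) (V₂ y)
 V₂-⟦⟧ {zero}  (c ∷ [])     x y = V-con 1 (+ c)
 V₂-⟦⟧ {suc n} (c ∷ cs) x y = S.trans (V₂-⊕ (con (+ c) ⊛ y ^ₛ suc n) (x ⊛ ⟦ cs ⟧ x y))
   (S.+-cong (S.trans (V₂-⊛ (con (+ c)) (y ^ₛ suc n)) (S.*-cong (V-con 1 (+ c)) (V₂-^ y (suc n)))) (S.trans (V₂-⊛ x (⟦ cs ⟧ x y)) (S.*-cong (S.refl {V₂ x}) (V₂-⟦⟧ cs x y))))

 alt-^ : ∀ f n → alt (f ^ₛ n) ≗ₛ alt f ^ₛ n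
 alt-^ f zero    = alt-con 1ℤ
 alt-^ f (suc n) = S.trans (alt-⊛ f (f ^ₛ n)) (S.*-cong (S.refl {alt f}) (alt-^ f n))

 alt-⟦⟧ : ∀ {n} (v : Vec ℕ (suc n)) x y → alt (⟦ v ⟧ x y) ≗ₛ ⟦ v ⟧ (alt x) (alt y)
 alt-⟦⟧ {zero}  (c ∷ [])     x y = alt-con (+ c)
 alt-⟦⟧ {suc n} (c ∷ cs) x y = S.trans (alt-⊕ (con (+ c) ⊛ y ^ₛ suc n) (x ⊛ ⟦ cs ⟧ x y))
   (S.+-cong (S.trans (alt-⊛ (con (+ c)) (y ^ₛ suc n)) (S.*-cong (alt-con (+ c)) (alt-^ y (suc n)))) (S.trans (alt-⊛ x (⟦ cs ⟧ x y)) (S.*-cong (S.refl {alt x}) (alt-⟦⟧ cs x y))))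

 private
   open S using (_:+_; _:*_; _:-_; :-_)
   Δst : PS
   Δst = s ⊛ s ⊖ t ⊛ t

 16[O₀-H] : con (+ 16) ⊛ (O 0 ⊖ H) ≗ₛ Δst
 16[O₀-H] = S.trans (S.sym κ²-difference) (S.+-cong (S.*-cong κ≗s κ≗s) (S.-‿cong (S.*-cong κ⁻≗t κ⁻≗t)))

 1+4L₀ : con 1ℤ ⊕ con (+ 4) ⊛ L 0 ≗ₛ s
 1+4L₀ = κ≗s

 L₁-form : con (+ 16) ⊛ L 1 ≗ₛ s ⊛ (s ⊛ s ⊖ t ⊛ t)
 L₁-form = S.trans L₁-κ (S.*-cong κ≗s (S.+-cong (S.*-cong κ≗s κ≗s) (S.-‿cong (S.*-cong κ⁻≗t κ⁻≗t))))

 O₁-form : O 1 ≗ₛ s ⊛ L 1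
 O₁-form = S.trans (S.sym α₁) (S.trans (S.solve 2 (λ x y → S.:con (+ 4) :* (x :* y) :+ y S.:= (S.:con 1ℤ :+ S.:con (+ 4) :* x) :* y) S.refl (L 0) (L 1)) (S.*-cong 1+4L₀ S.refl))

 O₂-form : O 2 ≗ₛ s ⊛ L 2 ⊕ con (+ 12) ⊛ (L 1 ⊛ L 1)
 O₂-form = S.trans (S.sym α₂) (S.trans (S.solve 3 (λ x y z → S.:con (+ 4) :* (x :* z) :+ S.:con (+ 12) :* (y :* y) :+ z S.:= (S.:con 1ℤ :+ S.:con (+ 4) :* x) :* z :+ S.:con (+ 12) :* (y :* y)) S.refl (L 0) (L 1) (L 2))
   (S.+-cong (S.*-cong 1+4L₀ S.refl) S.refl))

 O₃-form : O 3 ≗ₛ s ⊛ L 3 ⊕ con (+ 60) ⊛ (L 1 ⊛ L 2)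
 O₃-form = S.trans (S.sym α₃) (S.trans (S.solve 3 (λ x y z → S.:con (+ 4) :* (x :* z) :+ y :+ z S.:= (S.:con 1ℤ :+ S.:con (+ 4) :* x) :* z :+ y) S.refl (L 0) (con (+ 60) ⊛ (L 1 ⊛ L 2)) (L 3))
   (S.+-cong (S.*-cong 1+4L₀ S.refl) S.refl))

 -- In `β₁` the series O 0 and H occur only through 16(O 0 - H) = s² - t², and O 1 is s times L 1.
 -- The formula for L 3 comes from `β₂` in the same manner.
 L₂-form : con (+ 4) ⊛ L 2 ≗ₛ L 1 ⊛ (con (+ 5) ⊛ (s ⊛ s) ⊖ t ⊛ t)
 L₂-form = begin
   con (+ 4) ⊛ L 2
     ≈⟨ S.solve 3 (λ l₁ l₂ h → S.:con (+ 4) :* l₂ S.:= S.:con (+ 4) :* ((l₂ :+ S.:con (+ 4) :* (l₁ :* h)) :- S.:con (+ 4) :* (l₁ :* h))) S.refl (L 1) (L 2) H ⟩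
   con (+ 4) ⊛ ((L 2 ⊕ con (+ 4) ⊛ (L 1 ⊛ H)) ⊖ con (+ 4) ⊛ (L 1 ⊛ H))
     ≈⟨ S.*-cong (S.refl {con (+ 4)}) (S.+-cong (S.sym β₁) (S.refl {⊝ (con (+ 4) ⊛ (L 1 ⊛ H))})) ⟩
   con (+ 4) ⊛ ((con (+ 4) ⊛ (L 1 ⊛ O 0 ⊕ L 0 ⊛ O 1) ⊕ O 1) ⊖ con (+ 4) ⊛ (L 1 ⊛ H))
     ≈⟨ S.solve 5 (λ l₀ l₁ o₀ o₁ h → S.:con (+ 4) :* ((S.:con (+ 4) :* (l₁ :* o₀ :+ l₀ :* o₁) :+ o₁) :- S.:con (+ 4) :* (l₁ :* h))
          S.:= l₁ :* (S.:con (+ 16) :* (o₀ :- h)) :+ S.:con (+ 4) :* ((S.:con 1ℤ :+ S.:con (+ 4) :* l₀) :* o₁)) S.refl (L 0) (L 1) (O 0) (O 1) H ⟩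
   L 1 ⊛ (con (+ 16) ⊛ (O 0 ⊖ H)) ⊕ con (+ 4) ⊛ ((con 1ℤ ⊕ con (+ 4) ⊛ L 0) ⊛ O 1)
     ≈⟨ S.+-cong (S.*-cong (S.refl {L 1}) 16[O₀-H]) (S.*-cong (S.refl {con (+ 4)}) (S.*-cong 1+4L₀ O₁-form)) ⟩
   L 1 ⊛ (s ⊛ s ⊖ t ⊛ t) ⊕ con (+ 4) ⊛ (s ⊛ (s ⊛ L 1))
     ≈⟨ S.solve 3 (λ l s t → l :* (s :* s :- t :* t) :+ S.:con (+ 4) :* (s :* (s :* l)) S.:= l :* (S.:con (+ 5) :* (s :* s) :- t :* t)) S.refl (L 1) s t ⟩
   L 1 ⊛ (con (+ 5) ⊛ (s ⊛ s) ⊖ t ⊛ t) ∎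
   where open ≗-Reasoning

 L₃-form : con (+ 4) ⊛ L 3 ≗ₛ con (+ 4) ⊛ (s ⊛ O 2) ⊕ (s ⊛ s ⊖ t ⊛ t) ⊛ L 2 ⊕ con (+ 96) ⊛ (s ⊛ (L 1 ⊛ L 1))
 L₃-form = begin
   con (+ 4) ⊛ L 3
     ≈⟨ S.solve 3 (λ l₂ l₃ h → S.:con (+ 4) :* l₃ S.:= S.:con (+ 4) :* ((l₃ :+ S.:con (+ 4) :* (l₂ :* h)) :- S.:con (+ 4) :* (l₂ :* h))) S.refl (L 2) (L 3) H ⟩
   con (+ 4) ⊛ ((L 3 ⊕ con (+ 4) ⊛ (L 2 ⊛ H)) ⊖ con (+ 4) ⊛ (L 2 ⊛ H))
     ≈⟨ S.*-cong (S.refl {con (+ 4)}) (S.+-cong (S.sym β₂) (S.refl {⊝ (con (+ 4) ⊛ (L 2 ⊛ H))})) ⟩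
   con (+ 4) ⊛ ((con (+ 4) ⊛ (L 2 ⊛ O 0 ⊕ con (+ 6) ⊛ (L 1 ⊛ O 1) ⊕ L 0 ⊛ O 2) ⊕ O 2) ⊖ con (+ 4) ⊛ (L 2 ⊛ H))
     ≈⟨ S.solve 6 (λ l₀ l₂ o₀ o₂ h x → S.:con (+ 4) :* ((S.:con (+ 4) :* (l₂ :* o₀ :+ S.:con (+ 6) :* x :+ l₀ :* o₂) :+ o₂) :- S.:con (+ 4) :* (l₂ :* h))
          S.:= S.:con (+ 4) :* ((S.:con 1ℤ :+ S.:con (+ 4) :* l₀) :* o₂) :+ (S.:con (+ 16) :* (o₀ :- h)) :* l₂ :+ S.:con (+ 96) :* x) S.refl (L 0) (L 2) (O 0) (O 2) H (L 1 ⊛ O 1) ⟩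
   con (+ 4) ⊛ ((con 1ℤ ⊕ con (+ 4) ⊛ L 0) ⊛ O 2) ⊕ (con (+ 16) ⊛ (O 0 ⊖ H)) ⊛ L 2 ⊕ con (+ 96) ⊛ (L 1 ⊛ O 1)
     ≈⟨ S.+-cong (S.+-cong (S.*-cong (S.refl {con (+ 4)}) (S.*-cong 1+4L₀ S.refl)) (S.*-cong 16[O₀-H] S.refl))
          (S.*-cong (S.refl {con (+ 96)}) (S.trans (S.*-cong (S.refl {L 1}) O₁-form) (S.solve 2 (λ l s → l :* (s :* l) S.:= s :* (l :* l)) S.refl (L 1) s))) ⟩
   con (+ 4) ⊛ (s ⊛ O 2) ⊕ (s ⊛ s ⊖ t ⊛ t) ⊛ L 2 ⊕ con (+ 96) ⊛ (s ⊛ (L 1 ⊛ L 1)) ∎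
   where open ≗-Reasoning

 tw : PS → PS
 tw f n = χ n *ᶻ f n

 χ-% : ∀ n → χ n ≡ χ (n % 4)
 χ-% n = trans (cong χ (ℕDM.m≡m%n+[m/n]*n n 4)) (go (n % 4) (n / 4))
   where
     γ4 : ∀ m → χ (m ℕ.* 4) ≡ 0ℤ × γ (m ℕ.* 4) ≡ 1ℤ
     γ4 zero    = refl , refl
     γ4 (suc m) = trans (ℤP.neg-involutive _) (proj₁ (γ4 m)) , trans (ℤP.neg-involutive _) (proj₂ (γ4 m))
     go : ∀ r m → χ (r ℕ.+ m ℕ.* 4) ≡ χ r
     go r m = trans (χ-+ r (m ℕ.* 4)) (trans (cong₂ (λ x y → χ r *ᶻ x +ᶻ γ r *ᶻ y) (proj₂ (γ4 m)) (proj₁ (γ4 m))) (lem (χ r) (γ r)))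
       where
         lem : ∀ x y → x *ᶻ 1ℤ +ᶻ y *ᶻ 0ℤ ≡ x
         lem = solve-∀

 -- The exponents of f, shifted by o, are congruent to r modulo 4.

 Supp : ℕ → ℕ → PS → Set
 Supp o r f = ∀ n → (o ℕ.+ n) % 4 ≡ r % 4 ⊎ f n ≡ 0ℤ

 %-+-cong : ∀ {a b c d} → a % 4 ≡ c % 4 → b % 4 ≡ d % 4 → (a ℕ.+ b) % 4 ≡ (c ℕ.+ d) % 4
 %-+-cong {a} {b} {c} {d} p q = trans (ℕDM.%-distribˡ-+ a b 4) (trans (cong₂ (λ x y → (x ℕ.+ y) % 4) p q) (sym (ℕDM.%-distribˡ-+ c d 4)))

 Supp-⊛ : ∀ o r s f g → Supp o r f → Supp 0 s g → Supp o (r ℕ.+ s) (f ⊛ g)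
 Supp-⊛ o r s f g F G zero with F 0 | G 0
 ... | inj₁ p | inj₁ q = inj₁ (trans (cong (λ z → (z ℕ.+ 0) % 4) (sym (ℕP.+-identityʳ o))) (%-+-cong {o ℕ.+ 0} {0} {r} {s} p q))
 ... | inj₂ p | _      = inj₂ (cong (_*ᶻ g 0) p)
 ... | inj₁ _ | inj₂ q = inj₂ (trans (cong (f 0 *ᶻ_) q) (ℤP.*-zeroʳ (f 0)))
 Supp-⊛ o r s f g F G (suc n) with Supp-⊛ (suc o) r s (tl f) g (λ i → subst (λ z → z % 4 ≡ r % 4 ⊎ f (suc i) ≡ 0ℤ) (ℕP.+-suc o i) (F (suc i))) G n
 ... | inj₁ p = inj₁ (trans (cong (_% 4) (ℕP.+-suc o n)) p)
 ... | inj₂ p with F 0 | G (suc n)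
 ...   | inj₁ u | inj₁ v = inj₁ (trans (cong (λ z → (z ℕ.+ suc n) % 4) (sym (ℕP.+-identityʳ o))) (%-+-cong {o ℕ.+ 0} {suc n} {r} {s} u v))
 ...   | inj₂ u | _      = inj₂ (cong₂ _+ᶻ_ (cong (_*ᶻ g (suc n)) u) p)
 ...   | inj₁ _ | inj₂ v = inj₂ (cong₂ _+ᶻ_ (trans (cong (f 0 *ᶻ_) v) (ℤP.*-zeroʳ (f 0))) p)

 Supp-con : ∀ c → Supp 0 0 (con c)
 Supp-con c zero    = inj₁ refl
 Supp-con c (suc n) = inj₂ refl

 Supp-^ : ∀ r f → Supp 0 r f → ∀ n → Supp 0 (n ℕ.* r) (f ^ₛ n)
 Supp-^ r f F zero    = Supp-con 1ℤ
 Supp-^ r f F (suc n) = Supp-⊛ 0 r (n ℕ.* r) f (f ^ₛ n) F (Supp-^ r f F n)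

 root-% : ∀ s → (ev ∣ s ∣ ≡ 0ℤ × sq s % 4 ≡ 1) ⊎ (od ∣ s ∣ ≡ 0ℤ × sq s % 4 ≡ 0)
 root-% s with ∣ s ∣ | parity ∣ s ∣
 ... | _ | even m = inj₂ (od-even m , trans (cong (_% 4) (lem m)) (ℕDM.m*n%n≡0 (m ℕ.* m) 4))
   where
     lem : ∀ m → m ℕ.* 2 ℕ.* (m ℕ.* 2) ≡ m ℕ.* m ℕ.* 4
     lem = ℕSolver.solve-∀
 ... | _ | odd m  = inj₁ (od-even m , trans (cong (_% 4) (lem m)) (ℕDM.[m+kn]%n≡m%n 1 (m ℕ.* m ℕ.+ m) 4))
   where
     lem : ∀ m → suc (m ℕ.* 2) ℕ.* suc (m ℕ.* 2) ≡ 1 ℕ.+ (m ℕ.* m ℕ.+ m) ℕ.* 4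
     lem = ℕSolver.solve-∀

 Supp-a : Supp 0 0 a
 Supp-a n with n % 4 ℕ.≟ 0
 ... | yes p = inj₁ p
 ... | no ≢ = inj₂ (∑-zero (roots n) (λ {s} s∈ → go s (proj₂ (sound (roots-Graded n) s∈)) (root-% s)))
   where
     go : ∀ s → sq s ≡ n → (ev ∣ s ∣ ≡ 0ℤ × sq s % 4 ≡ 1) ⊎ (od ∣ s ∣ ≡ 0ℤ × sq s % 4 ≡ 0) → ev ∣ s ∣ ≡ 0ℤ
     go s refl (inj₁ (p , _)) = p
     go s refl (inj₂ (_ , p)) = ⊥-elim (≢ p)

 Supp-b : Supp 0 1 b
 Supp-b n with n % 4 ℕ.≟ 1
 ... | yes p = inj₁ p
 ... | no ≢ = inj₂ (∑-zero (roots n) (λ {s} s∈ → go s (proj₂ (sound (roots-Graded n) s∈)) (root-% s)))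
   where
     go : ∀ s → sq s ≡ n → (ev ∣ s ∣ ≡ 0ℤ × sq s % 4 ≡ 1) ⊎ (od ∣ s ∣ ≡ 0ℤ × sq s % 4 ≡ 0) → od ∣ s ∣ ≡ 0ℤ
     go s refl (inj₁ (_ , p)) = ⊥-elim (≢ p)
     go s refl (inj₂ (p , _)) = p

 tw-Supp : ∀ r f → Supp 0 r f → tw f ≗ₛ con (χ r) ⊛ f
 tw-Supp r f F n with F n
 ... | inj₁ p = trans (cong (_*ᶻ f n) (trans (χ-% n) (trans (cong χ p) (sym (χ-% r))))) (sym (con-⊛ (χ r) f n))
 ... | inj₂ p = trans (trans (cong (χ n *ᶻ_) p) (ℤP.*-zeroʳ (χ n))) (sym (trans (con-⊛ (χ r) f n) (trans (cong (χ r *ᶻ_) p) (ℤP.*-zeroʳ (χ r)))))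

 -- Even squares are 0 and odd squares are 1 modulo 4, so all exponents of bⁱaʲ are congruent to i.
 -- The twist by χ therefore acts on the coefficients of a form in b and a.
 tw-mono : ∀ i j → tw (b ^ₛ i ⊛ a ^ₛ j) ≗ₛ con (χ i) ⊛ (b ^ₛ i ⊛ a ^ₛ j)
 tw-mono i j = S.trans (tw-Supp (i ℕ.* 1 ℕ.+ j ℕ.* 0) (b ^ₛ i ⊛ a ^ₛ j) (Supp-⊛ 0 (i ℕ.* 1) (j ℕ.* 0) (b ^ₛ i) (a ^ₛ j) (Supp-^ 1 b Supp-b i) (Supp-^ 0 a Supp-a j)))
   (S.*-cong (λ n → cong (λ z → con (χ z) n) (lem i j)) S.refl)
   where
     lem : ∀ i j → i ℕ.* 1 ℕ.+ j ℕ.* 0 ≡ i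
     lem = ℕSolver.solve-∀

 tw-⊕ : ∀ f g → tw (f ⊕ g) ≗ₛ tw f ⊕ tw g
 tw-⊕ f g n = ℤP.*-distribˡ-+ (χ n) (f n) (g n)

 tw-scale : ∀ c f → tw (con c ⊛ f) ≗ₛ con c ⊛ tw f
 tw-scale c f n = trans (cong (χ n *ᶻ_) (con-⊛ c f n)) (trans (lem (χ n) c (f n)) (sym (con-⊛ c (tw f) n)))
   where
     lem : ∀ x c y → x *ᶻ (c *ᶻ y) ≡ c *ᶻ (x *ᶻ y)
     lem = solve-∀

 -- The partners Σ χ(n) n²ʲ qⁿᵏ and Σ n²ʲ⁺¹ qⁿᵏ of L j and O j

 E G* : ℕ → PS
 E j  = Lam (λ n k → χ n *ᶻ e j n)
 G* j = Lam (λ n k → + n *ᶻ e j n)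

 χ-* : ∀ m n → χ (m ℕ.* n) ≡ χ m *ᶻ χ n
 χ-* m n = trans (χ-% (m ℕ.* n)) (trans (cong χ (ℕDM.%-distribˡ-* m n 4)) (trans (sym (χ-% (m % 4 ℕ.* (n % 4))))
   (trans (table (m % 4) (n % 4) (ℕDM.m%n<n m 4) (ℕDM.m%n<n n 4)) (sym (cong₂ _*ᶻ_ (χ-% m) (χ-% n))))))
   where
     row₃ : ∀ s → s < 4 → χ (3 ℕ.* s) ≡ χ 3 *ᶻ χ s
     row₃ 0 _ = refl
     row₃ 1 _ = refl
     row₃ 2 _ = refl
     row₃ 3 _ = refl
     row₃ (suc (suc (suc (suc _)))) (s≤s (s≤s (s≤s (s≤s ()))))
     row₂ : ∀ s → s < 4 → χ (2 ℕ.* s) ≡ χ 2 *ᶻ χ s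
     row₂ 0 _ = refl
     row₂ 1 _ = refl
     row₂ 2 _ = refl
     row₂ 3 _ = refl
     row₂ (suc (suc (suc (suc _)))) (s≤s (s≤s (s≤s (s≤s ()))))
     table : ∀ r s → r < 4 → s < 4 → χ (r ℕ.* s) ≡ χ r *ᶻ χ s
     table 0 s _ _ = refl
     table 1 s _ _ = trans (cong χ (ℕP.+-identityʳ s)) (sym (ℤP.*-identityˡ (χ s)))
     table 2 s _ p = row₂ s p
     table 3 s _ p = row₃ s p
     table (suc (suc (suc (suc _)))) s (s≤s (s≤s (s≤s (s≤s ())))) _

 Lam-od : ∀ (φ : ℕ → ℤ) → Lam (λ n k → φ n) ⊖ V₂ (Lam (λ n k → φ n)) ≗ₛ Lam (λ n k → od k *ᶻ φ n)
 Lam-od φ = S.trans (S.+-cong split (S.-‿cong (S.sym evens))) (S.solve 2 (λ x y → x S.:+ y S.:- x S.:= y) S.refl (Lam (λ n k → ev k *ᶻ φ n)) (Lam (λ n k → od k *ᶻ φ n)))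
   where
     split : Lam (λ n k → φ n) ≗ₛ Lam (λ n k → ev k *ᶻ φ n) ⊕ Lam (λ n k → od k *ᶻ φ n)
     split = S.trans (Lam-cong (λ n k → trans (sym (ℤP.*-identityˡ (φ n))) (trans (cong (_*ᶻ φ n) (sym (ev+od k))) (ℤP.*-distribʳ-+ (φ n) (ev k) (od k))))) (Lam-⊕ _ _)
     evens : Lam (λ n k → ev k *ᶻ φ n) ≗ₛ V₂ (Lam (λ n k → φ n))
     evens = S.trans (Lam-flip _) (S.trans (Lam-ev (λ k n → φ n)) (V₂-cong (Lam-flip (λ k n → φ n))))

 -- The terms with even k make up the part in q²; for odd k one has χ(nk)χ(k) = χ(n).
 E-partner : ∀ j → E j ⊖ V₂ (E j) ≗ₛ tw (L j)
 E-partner j = S.trans (Lam-od (λ n → χ n *ᶻ e j n)) (λ m → sym (trans (sym (∑-scale (χ m) (factorizations m) _))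
   (∑-cong-∈ (factorizations m) (λ { {n , k} z∈ → go n k (proj₂ (sound (factorizations-Graded m) z∈)) }))))
   where
     go : ∀ {m} n k → n ℕ.* k ≡ m → χ m *ᶻ (χ k *ᶻ e j n) ≡ od k *ᶻ (χ n *ᶻ e j n)
     go n k refl = trans (cong (_*ᶻ (χ k *ᶻ e j n)) (χ-* n k)) (trans (lem (χ n) (χ k) (e j n)) (cong (_*ᶻ (χ n *ᶻ e j n)) (sym (od≡χ² k))))
       where
         lem : ∀ x y z → x *ᶻ y *ᶻ (y *ᶻ z) ≡ y *ᶻ y *ᶻ (x *ᶻ z)
         lem = solve-∀

 G*-partner : ∀ j → G* j ⊖ V₂ (G* j) ≗ₛ O j
 G*-partner j = S.trans (Lam-od (λ n → + n *ᶻ e j n)) (Lam-cong (λ n k → lem (+ n) (od k) (e j n)))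
   where
     lem : ∀ n o x → o *ᶻ (n *ᶻ x) ≡ n *ᶻ o *ᶻ x
     lem = solve-∀

 -- First Rankin-Cohen bracket of θ with a form g of degree n

 bracket : ℕ → PS → PS
 bracket n g = θ ⊛ D g ⊖ con (+ n) ⊛ (g ⊛ D θ)

 ŷ^_ : (n : ℕ) → Form n
 ŷ^ zero  = num 1
 ŷ^ suc n = ŷ ⟨*⟩ ŷ^ n

 module Forms (k : ℕ) (isPrime : Prime (suc k)) (odd-p : ¬ suc k ℕD.∣ 2)
              (freshman : ∀ f g → Engine._≈_ k ((f ⊕ g) ^ₛ suc k) (f ^ₛ suc k ⊕ g ^ₛ suc k)) where

   open Engine k
   open Section k isPrime odd-p freshman public

   minus-one : con (+ k) ≈ ⊝ con 1ℤ
   minus-one zero    = mk (ℤD.divides 1ℤ (trans (ℤP.+-comm (+ k) 1ℤ) (sym (ℤP.*-identityˡ (+ p)))))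
   minus-one (suc n) = ≡ₘ-refl

   -f : ∀ f → con (+ k) ⊛ f ≈ ⊝ f
   -f f = ≈-trans (⊛-congₘ minus-one (≈-refl {f})) (exact (S.solve 1 (λ f → S.:- S.:con 1ℤ S.:* f S.:= S.:- f) S.refl f))

   -- Read with b for `x̂` and a for `ŷ`. The index 2 marks the values at q², given by Landen's
   -- transformation; k stands for -1, as coefficients are natural numbers.
   ŝ t̂ ŝ₂ t̂₂ : Form 2
   ŝ  = (x̂ ⟨+⟩ ŷ) ⟨*⟩ (x̂ ⟨+⟩ ŷ)
   t̂  = (ŷ ⟨+⟩ num k ⟨*⟩ x̂) ⟨*⟩ (ŷ ⟨+⟩ num k ⟨*⟩ x̂)
   ŝ₂ = x̂ ⟨*⟩ x̂ ⟨+⟩ ŷ ⟨*⟩ ŷ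
   t̂₂ = ŷ ⟨*⟩ ŷ ⟨+⟩ num k ⟨*⟩ (x̂ ⟨*⟩ x̂)

   t̂-eval : eval t̂ b a ≈ t
   t̂-eval = ⊛-congₘ q q
     where
       q : a ⊕ con (+ k) ⊛ b ≈ a ⊖ b
       q = ⊕-congₘ (≈-refl {a}) (-f b)

   t̂₂-eval : eval t̂₂ b a ≈ V₂ t
   t̂₂-eval = ≈-trans (⊕-congₘ (≈-refl {a ⊛ a}) (-f (b ⊛ b))) (exact (S.sym V₂t))

   ↓ ↓₂ : ∀ {n} → Vec ℕ (suc n) → Form (n ℕ.* 2)
   ↓ v  = sub v ŝ t̂
   ↓₂ v = sub v ŝ₂ t̂₂

   ↓-eval : ∀ {n} (v : Vec ℕ (suc n)) → eval (↓ v) b a ≈ ⟦ v ⟧ s t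
   ↓-eval v = ⟦⟧-congₘ v (≈-refl {s}) t̂-eval

   ↓₂-eval : ∀ {n} (v : Vec ℕ (suc n)) → eval (↓₂ v) b a ≈ V₂ (⟦ v ⟧ s t)
   ↓₂-eval v = ≈-trans (⟦⟧-congₘ v (exact (S.sym V₂s)) t̂₂-eval) (exact (S.sym (V₂-⟦⟧ v s t)))

   -- If the expressions at q and at q² give the same form in b and a modulo p, the series is
   -- unchanged by q ↦ q², hence constant. This is how a nonconstant polynomial in s and t is seen
   -- to be constant modulo p.
   landen-fixed : ∀ {n} (v : Vec ℕ (suc n)) → eqV (norm (↓ v)) (norm (↓₂ v)) ≡ true → ⟦ v ⟧ s t ≈ con (⟦ v ⟧ s t 0)
   landen-fixed v eq = V₂-fixed (≈-trans (≈-sym (↓-eval v)) (≈-trans (by-norm (↓ v) (↓₂ v) eq b a) (↓₂-eval v)))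

   -- f - V₂ f determines f up to a constant.

   partner : ∀ {n} f (v : Vec ℕ (suc n)) (w : Form (n ℕ.* 2)) → f ⊖ V₂ f ≈ eval w b a → eqV (norm (↓ v)) (norm (↓₂ v ⟨+⟩ w)) ≡ true →
             ⟦ v ⟧ s t ≈ f ⊕ con ((⟦ v ⟧ s t ⊖ f) 0)
   partner f v w fw eq = ≈-trans (exact (S.solve 2 (λ x f → x S.:= f :+ (x :- f)) S.refl F f)) (⊕-congₘ (≈-refl {f}) (V₂-fixed fixed))
     where
       open S using (_:+_; _:*_; _:-_; :-_)
       F = ⟦ v ⟧ s t
       fixed : F ⊖ f ≈ V₂ (F ⊖ f)
       fixed = ≈-trans (⊕-congₘ (≈-trans (≈-sym (↓-eval v)) (≈-trans (by-norm (↓ v) (↓₂ v ⟨+⟩ w) eq b a) (⊕-congₘ (↓₂-eval v) (≈-sym fw)))) (≈-refl {⊝ f}))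
         (≈-trans (exact (S.solve 3 (λ x f g → x :+ (f :- g) :- f S.:= x :- g) S.refl (V₂ F) f (V₂ f))) (exact (S.sym (V₂-⊖ F f))))

   χₖ : ℕ → ℕ
   χₖ 0 = 0
   χₖ 1 = 1
   χₖ 2 = 0
   χₖ 3 = k
   χₖ (suc (suc (suc (suc n)))) = χₖ n

   χₖ-χ : ∀ n → con (+ χₖ n) ≈ con (χ n)
   χₖ-χ 0 = ≈-refl
   χₖ-χ 1 = ≈-refl
   χₖ-χ 2 = ≈-refl
   χₖ-χ 3 = ≈-trans minus-one (exact (λ { zero → refl ; (suc n) → refl }))
   χₖ-χ (suc (suc (suc (suc n)))) = ≈-trans (χₖ-χ n) (exact (λ i → cong (λ z → con z i) (sym (ℤP.neg-involutive (χ n)))))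

   twV : ∀ {n} → ℕ → Vec ℕ n → Vec ℕ n
   twV i []       = []
   twV i (c ∷ cs) = χₖ i ℕ.* c ∷ twV (suc i) cs

   twV-eval : ∀ {n} i (v : Vec ℕ (suc n)) → tw (b ^ₛ i ⊛ ⟦ v ⟧ b a) ≈ b ^ₛ i ⊛ ⟦ twV i v ⟧ b a
   twV-eval {zero} i (c ∷ []) = ≈-trans (exact (S.trans (tw-cong (S.solve 2 (λ x c → x :* c S.:= c :* (x :* S.:con 1ℤ)) S.refl (b ^ₛ i) (con (+ c)))) (S.trans (tw-scale (+ c) _) (S.*-cong (S.refl {con (+ c)}) (tw-mono i 0)))))
     (≈-trans (⊛-congₘ (≈-refl {con (+ c)}) (⊛-congₘ (≈-sym (χₖ-χ i)) (≈-refl {b ^ₛ i ⊛ con 1ℤ})))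
       (exact (S.trans (S.solve 3 (λ c z x → c :* (z :* (x :* S.:con 1ℤ)) S.:= x :* (z :* c)) S.refl (con (+ c)) (con (+ χₖ i)) (b ^ₛ i)) (S.*-cong (S.refl {b ^ₛ i}) (S.sym (con-* (χₖ i) c))))))
     where
       open S using (_:+_; _:*_; _:-_; :-_)
       tw-cong : ∀ {f g} → f ≗ₛ g → tw f ≗ₛ tw g
       tw-cong q n = cong (χ n *ᶻ_) (q n)
   twV-eval {suc n} i (c ∷ cs) = ≈-trans
     (exact (S.trans (tw-cong (S.solve 5 (λ x c y b p → x :* (c :* y :+ b :* p) S.:= c :* (x :* y) :+ (b :* x) :* p) S.refl (b ^ₛ i) (con (+ c)) (a ^ₛ suc n) b (⟦ cs ⟧ b a)))
       (S.trans (tw-⊕ (con (+ c) ⊛ (b ^ₛ i ⊛ a ^ₛ suc n)) (b ^ₛ suc i ⊛ ⟦ cs ⟧ b a)) (S.+-cong (S.trans (tw-scale (+ c) _) (S.*-cong (S.refl {con (+ c)}) (tw-mono i (suc n)))) S.refl))))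
     (≈-trans (⊕-congₘ (⊛-congₘ (≈-refl {con (+ c)}) (⊛-congₘ (≈-sym (χₖ-χ i)) (≈-refl {b ^ₛ i ⊛ a ^ₛ suc n}))) (twV-eval (suc i) cs))
       (exact (S.trans (S.solve 6 (λ x c z y b p → c :* (z :* (x :* y)) :+ (b :* x) :* p S.:= x :* ((z :* c) :* y :+ b :* p)) S.refl (b ^ₛ i) (con (+ c)) (con (+ χₖ i)) (a ^ₛ suc n) b (⟦ twV (suc i) cs ⟧ b a))
         (S.*-cong (S.refl {b ^ₛ i}) (S.+-cong (S.*-cong (S.sym (con-* (χₖ i) c)) S.refl) S.refl)))))
     where
       open S using (_:+_; _:*_; _:-_; :-_)
       tw-cong : ∀ {f g} → f ≗ₛ g → tw f ≗ₛ tw g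
       tw-cong q n = cong (χ n *ᶻ_) (q n)

   tw-eval : ∀ {n} f (w : Form n) → f ≈ eval w b a → tw f ≈ eval (vec (twV 0 (norm w))) b a
   tw-eval f w fw = ≈-trans (λ n → *-congₘ (≡ₘ-refl {χ n}) (≈-trans fw (≈-sym (norm-sound w b a)) n))
     (≈-trans (exact (λ n → cong (χ n *ᶻ_) (one (⟦ norm w ⟧ b a) n))) (≈-trans (twV-eval 0 (norm w)) (exact (S.sym (one _)))))
     where
       one : ∀ f → f ≗ₛ b ^ₛ 0 ⊛ f
       one f = S.solve 1 (λ x → x S.:= S.:con 1ℤ S.:* x) S.refl f

   brF : ∀ {n} → Vec ℕ (suc n) → Form (suc n)
   brF {zero}  (c ∷ []) = num 0 ⟨*⟩ x̂
   brF {suc n} (c ∷ cs) = num (k ℕ.* (suc n ℕ.* c)) ⟨*⟩ (x̂ ⟨*⟩ ŷ^ suc n) ⟨+⟩ x̂ ⟨*⟩ brF cs ⟨+⟩ x̂ ⟨*⟩ (ŷ ⟨*⟩ vec cs)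

   ŷ^-eval : ∀ n x y → eval (ŷ^ n) x y ≗ₛ y ^ₛ n
   ŷ^-eval zero    x y = S.refl
   ŷ^-eval (suc n) x y = S.*-cong (S.refl {y}) (ŷ^-eval n x y)

   Dθ : D θ ≗ₛ D a ⊕ D b
   Dθ = S.trans (D-cong θ≗a+b) (D-⊕ a b)

   -- By homogeneity the derivatives of a and b enter only through their Wronskian, which is ab
   -- times the quartic: the bracket of θ with b is the Wronskian, with a its negative. What remains
   -- after removal of the quartic is `brF`.
   bracket-⟦⟧ : ∀ {n} (v : Vec ℕ (suc n)) → bracket n (⟦ v ⟧ b a) ≈ quartic ⊛ eval (brF v) b a
   bracket-⟦⟧ {zero} (c ∷ []) = exact (S.trans (S.+-cong (S.*-cong (S.refl {θ}) D0) (S.refl {⊝ (con 0ℤ ⊛ (con (+ c) ⊛ D θ))}))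
     (S.solve 4 (λ θ q b d → θ S.:* S.:con 0ℤ S.:- S.:con 0ℤ S.:* d S.:= q S.:* (S.:con 0ℤ S.:* b)) S.refl θ quartic b (con (+ c) ⊛ D θ)))
     where
       D0 : D (con (+ c)) ≗ₛ con 0ℤ
       D0 zero    = ℤP.*-zeroˡ (+ c)
       D0 (suc n) = ℤP.*-zeroʳ (+ suc n)
   bracket-⟦⟧ {suc n} (c ∷ cs) = ≈-trans (exact step₁) (≈-trans (⊕-congₘ (⊕-congₘ (≈-refl {⊝ (C ⊛ N ⊛ A ⊛ W)}) (⊛-congₘ (≈-refl {b}) (bracket-⟦⟧ cs))) (≈-refl {g ⊛ W})) step₂)
     where
       open S using (_:+_; _:*_; _:-_; :-_)
       C = con (+ c)
       N = con (+ suc n)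
       A = a ^ₛ n
       g = ⟦ cs ⟧ b a
       W = a ⊛ D b ⊖ b ⊛ D a
       step₁ : bracket (suc n) (C ⊛ (a ⊛ A) ⊕ b ⊛ g) ≗ₛ ⊝ (C ⊛ N ⊛ A ⊛ W) ⊕ b ⊛ bracket n g ⊕ g ⊛ W
       step₁ = S.trans (S.+-cong (S.*-cong θ≗a+b (S.trans (D-⊕ (C ⊛ (a ⊛ A)) (b ⊛ g)) (S.+-cong
                  (S.trans (λ i → trans (cong (+ i *ᶻ_) (con-⊛ (+ c) (a ⊛ A) i)) (trans (lem (+ i) (+ c) ((a ⊛ A) i)) (sym (con-⊛ (+ c) (D (a ⊛ A)) i)))) (S.*-cong (S.refl {C}) (D-^ a n)))
                  (D-⊛ b g)))) (S.-‿cong (S.*-cong (con-+ 1 n) (S.*-cong (S.refl {C ⊛ (a ⊛ A) ⊕ b ⊛ g}) Dθ))))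
         (S.trans (S.+-cong (S.*-cong (S.refl {a ⊕ b}) (S.+-cong (S.*-cong (S.refl {C}) (S.*-cong (con-+ 1 n) S.refl)) S.refl)) S.refl)
         (S.trans (S.solve 9 (λ a b C M A u v g d →
             (a :+ b) :* (C :* ((S.:con 1ℤ :+ M) :* (A :* u)) :+ (v :* g :+ b :* d)) :- (S.:con 1ℤ :+ M) :* ((C :* (a :* A) :+ b :* g) :* (u :+ v))
             S.:= (:- (C :* (S.:con 1ℤ :+ M) :* A :* (a :* v :- b :* u)) :+ b :* ((a :+ b) :* d :- M :* (g :* (u :+ v)))) :+ g :* (a :* v :- b :* u))
             S.refl a b C (con (+ n)) A (D a) (D b) g (D g))
           (S.+-cong (S.+-cong (S.-‿cong (S.*-cong (S.*-cong (S.*-cong (S.refl {C}) (S.sym (con-+ 1 n))) S.refl) S.refl))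
              (S.*-cong (S.refl {b}) (S.+-cong (S.*-cong (S.sym θ≗a+b) S.refl) (S.-‿cong (S.*-cong (S.refl {con (+ n)}) (S.*-cong (S.refl {g}) (S.sym Dθ))))))) S.refl)))
         where
           lem : ∀ i c x → i *ᶻ (c *ᶻ x) ≡ c *ᶻ (i *ᶻ x)
           lem = solve-∀
       num-eval : con (+ (k ℕ.* (suc n ℕ.* c))) ≈ ⊝ (N ⊛ C)
       num-eval = ≈-trans (exact (S.trans (con-* k (suc n ℕ.* c)) (S.*-cong (S.refl {con (+ k)}) (con-* (suc n) c)))) (-f (N ⊛ C))
       step₂ : ⊝ (C ⊛ N ⊛ A ⊛ W) ⊕ b ⊛ (quartic ⊛ eval (brF cs) b a) ⊕ g ⊛ W ≈ quartic ⊛ eval (brF (c ∷ cs)) b a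
       step₂ = ≈-trans (exact (S.+-cong (S.+-cong (S.-‿cong (S.*-cong (S.refl {C ⊛ N ⊛ A}) wronskian)) S.refl) (S.*-cong (S.refl {g}) wronskian)))
         (≈-trans (exact (S.solve 8 (λ a b C N A q r g → (:- (C :* N :* A :* ((a :* b) :* q)) :+ b :* (q :* r)) :+ g :* ((a :* b) :* q)
             S.:= q :* ((:- (N :* C) :* (b :* (a :* A)) :+ b :* r) :+ b :* (a :* g))) S.refl a b C N A quartic (eval (brF cs) b a) g))
         (⊛-congₘ (≈-refl {quartic}) (⊕-congₘ (⊕-congₘ (⊛-congₘ (≈-sym num-eval) (⊛-congₘ (≈-refl {b}) (⊛-congₘ (≈-refl {a}) (exact (S.sym (ŷ^-eval n b a)))))) (≈-refl {b ⊛ eval (brF cs) b a})) (≈-refl {b ⊛ (a ⊛ g)}))))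

   module Lambert (i₄ i₁₆ : ℕ) (inv₄ : con (+ (i₄ ℕ.* 4)) ≈ con 1ℤ) (inv₁₆ : con (+ (i₁₆ ℕ.* 16)) ≈ con 1ℤ) where

     -- In this module the variables `x̂` and `ŷ` stand for s and t.
     x²-y² : Form 2
     x²-y² = x̂ ⟨*⟩ x̂ ⟨+⟩ num k ⟨*⟩ (ŷ ⟨*⟩ ŷ)

     L̂₁ : Form 3
     L̂₁ = num i₁₆ ⟨*⟩ (x̂ ⟨*⟩ x²-y²)

     L̂₂ : Form 5
     L̂₂ = num i₄ ⟨*⟩ (L̂₁ ⟨*⟩ (num 5 ⟨*⟩ (x̂ ⟨*⟩ x̂) ⟨+⟩ num k ⟨*⟩ (ŷ ⟨*⟩ ŷ)))

     Ô₂ : Form 6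
     Ô₂ = x̂ ⟨*⟩ L̂₂ ⟨+⟩ num 12 ⟨*⟩ (L̂₁ ⟨*⟩ L̂₁)

     L̂₃ : Form 7
     L̂₃ = num i₄ ⟨*⟩ (num 4 ⟨*⟩ (x̂ ⟨*⟩ Ô₂) ⟨+⟩ x²-y² ⟨*⟩ L̂₂ ⟨+⟩ num 96 ⟨*⟩ (x̂ ⟨*⟩ (L̂₁ ⟨*⟩ L̂₁)))

     Ô₃ : Form 8
     Ô₃ = x̂ ⟨*⟩ L̂₃ ⟨+⟩ num 60 ⟨*⟩ (L̂₁ ⟨*⟩ L̂₂)

     private
       divide : ∀ i c {f g} → con (+ (i ℕ.* c)) ≈ con 1ℤ → con (+ c) ⊛ f ≈ g → f ≈ con (+ i) ⊛ g
       divide i c {f} {g} inv eq = ≈-trans (exact (S.solve 1 (λ f → f S.:= S.:con 1ℤ S.:* f) S.refl f)) (≈-trans (⊛-congₘ (≈-sym inv) (≈-refl {f}))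
         (≈-trans (exact (S.trans (S.*-cong (con-* i c) (S.refl {f})) (S.*-assoc (con (+ i)) (con (+ c)) f))) (⊛-congₘ (≈-refl {con (+ i)}) eq)))
       diff : ∀ f g → f ⊖ g ≈ f ⊕ con (+ k) ⊛ g
       diff f g = ⊕-congₘ (≈-refl {f}) (≈-sym (-f g))

     L̂₁-eval : L 1 ≈ eval L̂₁ s t
     L̂₁-eval = divide i₁₆ 16 inv₁₆ (≈-trans (exact L₁-form) (⊛-congₘ (≈-refl {s}) (diff (s ⊛ s) (t ⊛ t))))

     L̂₂-eval : L 2 ≈ eval L̂₂ s t
     L̂₂-eval = divide i₄ 4 inv₄ (≈-trans (exact L₂-form) (⊛-congₘ L̂₁-eval (diff (con (+ 5) ⊛ (s ⊛ s)) (t ⊛ t))))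

     Ô₂-eval : O 2 ≈ eval Ô₂ s t
     Ô₂-eval = ≈-trans (exact O₂-form) (⊕-congₘ (⊛-congₘ (≈-refl {s}) L̂₂-eval) (⊛-congₘ (≈-refl {con (+ 12)}) (⊛-congₘ L̂₁-eval L̂₁-eval)))

     L̂₃-eval : L 3 ≈ eval L̂₃ s t
     L̂₃-eval = divide i₄ 4 inv₄ (≈-trans (exact L₃-form) (⊕-congₘ (⊕-congₘ (⊛-congₘ (≈-refl {con (+ 4)}) (⊛-congₘ (≈-refl {s}) Ô₂-eval))
       (⊛-congₘ (diff (s ⊛ s) (t ⊛ t)) L̂₂-eval)) (⊛-congₘ (≈-refl {con (+ 96)}) (⊛-congₘ (≈-refl {s}) (⊛-congₘ L̂₁-eval L̂₁-eval)))))

     Ô₃-eval : O 3 ≈ eval Ô₃ s t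
     Ô₃-eval = ≈-trans (exact O₃-form) (⊕-congₘ (⊛-congₘ (≈-refl {s}) L̂₃-eval) (⊛-congₘ (≈-refl {con (+ 60)}) (⊛-congₘ L̂₁-eval L̂₂-eval)))

   Q̂ : Form 4
   Q̂ = (ŷ ⟨*⟩ ŷ ⟨+⟩ x̂ ⟨*⟩ x̂) ⟨*⟩ (ŷ ⟨*⟩ ŷ ⟨+⟩ num k ⟨*⟩ (x̂ ⟨*⟩ x̂))

   Q̂-eval : eval Q̂ b a ≈ quartic
   Q̂-eval = ⊛-congₘ (≈-refl {a ⊛ a ⊕ b ⊛ b}) (⊕-congₘ (≈-refl {a ⊛ a}) (-f (b ⊛ b)))

   θ̂ : Form 1
   θ̂ = x̂ ⟨+⟩ ŷ

   θ̂-eval : eval θ̂ b a ≈ θ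
   θ̂-eval = exact (S.trans (S.+-comm b a) (S.sym θ≗a+b))

   -- Factors congruent to 1 raise the degree without changing the series; a suitable j reaches the
   -- degree (p - 1)p that the sieve requires.
   hasse-power : ∀ {n} (α : Vec ℕ (suc n)) → eqV (norm (↓ α)) (norm (↓₂ α)) ≡ true → (⟦ α ⟧ s t 0) ≡ₘ 1ℤ → ∀ j →
                 eval (↓ α ⟨^⟩ j ⟨*⟩ (Q̂ ⟨^⟩ k ⟨*⟩ θ̂ ⟨^⟩ k)) b a ≈ quartic ^ₛ k ⊛ θ ^ₛ k
   hasse-power α eq α₀ j = ≈-trans (⊛-congₘ (≈-trans (^ₛ-congₘ j α≈1) (exact (one j))) (⊛-congₘ (^ₛ-congₘ k Q̂-eval) (^ₛ-congₘ k θ̂-eval)))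
     (exact (S.solve 1 (λ x → S.:con 1ℤ S.:* x S.:= x) S.refl (quartic ^ₛ k ⊛ θ ^ₛ k)))
     where
       one : ∀ j → con 1ℤ ^ₛ j ≗ₛ con 1ℤ
       one zero    = S.refl
       one (suc j) = S.trans (S.*-cong (S.refl {con 1ℤ}) (one j)) (S.solve 0 (S.:con 1ℤ S.:* S.:con 1ℤ S.:= S.:con 1ℤ) S.refl)
       α≈1 : eval (↓ α) b a ≈ con 1ℤ
       α≈1 = ≈-trans (↓-eval α) (≈-trans (landen-fixed α eq) (λ { zero → α₀ ; (suc n) → ≡ₘ-refl }))

   cancel-θ : ∀ {f g} → θ ⊛ f ≈ θ ⊛ g → f ≈ g
   cancel-θ = cancelₘ θ (λ ∣1 → ℕP.<-irrefl refl (ℕP.≤-trans 1<p (ℕD.∣⇒≤ ∣1)))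

   θ-section-form : ∀ {n} (α : Vec ℕ (suc n)) → eqV (norm (↓ α)) (norm (↓₂ α)) ≡ true → (⟦ α ⟧ s t 0) ≡ₘ 1ℤ →
                    ∀ j → j ℕ.* (n ℕ.* 2) ℕ.+ (k ℕ.* 4 ℕ.+ k ℕ.* 1) ≡ k ℕ.* p → (𝔤 : Vec ℕ p) →
                    eqL (toList 𝔤) (sieve 0 (toList (norm (↓ α ⟨^⟩ j ⟨*⟩ (Q̂ ⟨^⟩ k ⟨*⟩ θ̂ ⟨^⟩ k))))) ≡ true → θ ⊛ U k 1/θ ≈ ⟦ 𝔤 ⟧ b a
   θ-section-form α eq α₀ j deg 𝔤 eq′ = θ-section (norm numerator) deg (≈-trans (norm-sound numerator b a) (hasse-power α eq α₀ j)) 𝔤 (eqL-sound _ _ eq′)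
     where numerator = ↓ α ⟨^⟩ j ⟨*⟩ (Q̂ ⟨^⟩ k ⟨*⟩ θ̂ ⟨^⟩ k)

   list-eval : ∀ {m n} (u : Vec ℕ (suc m)) (v : Vec ℕ (suc n)) x y → toList u ≡ toList v → ⟦ u ⟧ x y ≗ₛ ⟦ v ⟧ x y
   list-eval {zero}  {zero}  (c ∷ [])     (.c ∷ [])     x y refl = S.refl
   list-eval {suc m} {suc n} (c ∷ cs)     (d ∷ ds)      x y eq with cong len eq | head-≡ eq | tail-≡ eq
     where
       len : List ℕ → ℕ
       len = length
       head-≡ : ∀ {c d : ℕ} {cs ds} → _≡_ {A = List ℕ} (c ∷ cs) (d ∷ ds) → c ≡ d
       head-≡ refl = refl
       tail-≡ : ∀ {c d : ℕ} {cs ds} → _≡_ {A = List ℕ} (c ∷ cs) (d ∷ ds) → cs ≡ ds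
       tail-≡ refl = refl
   ... | l | refl | te = S.+-cong (S.*-cong (S.refl {con (+ c)}) (λ i → cong (λ z → (y ^ₛ z) i) (trans (sym (len-≡ cs)) (trans (ℕP.suc-injective l) (len-≡ ds))))) (S.*-cong (S.refl {x}) (list-eval cs ds x y te))
     where
       len-≡ : ∀ {n} (v : Vec ℕ n) → length (toList v) ≡ n
       len-≡ []       = refl
       len-≡ (c ∷ cs) = cong suc (len-≡ cs)
   list-eval {zero}  {suc n} (c ∷ [])     (d ∷ d′ ∷ ds) x y ()
   list-eval {suc m} {zero}  (c ∷ c′ ∷ cs) (d ∷ [])     x y ()

   by-list : ∀ {m n} (v : Vec ℕ (suc m)) (f : Form n) → eqL (toList v) (toList (norm f)) ≡ true → ⟦ v ⟧ b a ≈ eval f b a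
   by-list v f eq = ≈-trans (exact (list-eval v (norm f) b a (eqL-sound _ _ eq))) (norm-sound f b a)

   -- An explicit vector in place of an expression keeps the later normal forms cheap.
   literal : ∀ {n} {g} (f : Form n) (v : Vec ℕ (suc n)) → g ≈ eval f s t → eqV (norm f) v ≡ true → g ≈ ⟦ v ⟧ s t
   literal f v gf eq = ≈-trans gf (≈-trans (≈-sym (norm-sound f s t)) (λ i → ≡ₘ-reflexive (cong (λ v → ⟦ v ⟧ s t i) (eqV-sound (norm f) v eq))))

   E-form : ∀ {n} j (l v : Vec ℕ (suc n)) → L j ≈ ⟦ l ⟧ s t → eqV (norm (↓ v)) (norm (↓₂ v ⟨+⟩ vec (twV 0 (norm (↓ l))))) ≡ true →
            ∃ λ c → ⟦ v ⟧ s t ≈ E j ⊕ con c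
   E-form j l v Ll eq = _ , partner (E j) v (vec (twV 0 (norm (↓ l)))) (≈-trans (exact (E-partner j)) (tw-eval (L j) (↓ l) (≈-trans Ll (≈-sym (↓-eval l))))) eq

   G*-form : ∀ {n} j (o v : Vec ℕ (suc n)) → O j ≈ ⟦ o ⟧ s t → eqV (norm (↓ v)) (norm (↓₂ v ⟨+⟩ ↓ o)) ≡ true →
             ∃ λ c → ⟦ v ⟧ s t ≈ G* j ⊕ con c
   G*-form j o v Oo eq = _ , partner (G* j) v (↓ o) (≈-trans (exact (G*-partner j)) (≈-trans Oo (≈-sym (↓-eval o)))) eq

   -- The section is compared with θ²f. One factor θ is cancelled against that of `θ ⊛ U k 1/θ`, the
   -- other supplies the square in N = s² + de.
   θ²-form : ∀ {n} → Vec ℕ (suc n) → Form (2 ℕ.+ n ℕ.* 2)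
   θ²-form v = ŝ ⟨*⟩ ↓ v

   θ²-form-eval : ∀ {n f} (v : Vec ℕ (suc n)) → f ≈ ⟦ v ⟧ s t → eval (θ²-form v) b a ≈ θ ⊛ (θ ⊛ f)
   θ²-form-eval {f = f} v fv = ≈-trans (⊛-congₘ (≈-refl {s}) (≈-trans (↓-eval v) (≈-sym fv))) (exact (S.trans (S.*-cong (S.sym θ²≗s) (S.refl {f})) (S.*-assoc θ θ f)))

   bracket-form : ∀ {n} → Vec ℕ (suc n) → Form (1 ℕ.+ (4 ℕ.+ suc (n ℕ.* 2)))
   bracket-form v = θ̂ ⟨*⟩ (Q̂ ⟨*⟩ brF (norm (↓ v)))

   bracket-cong : ∀ n {f g} → f ≈ g → bracket n f ≈ bracket n g
   bracket-cong n q = ⊕-congₘ (⊛-congₘ (≈-refl {θ}) (λ i → *-congₘ (≡ₘ-refl {+ i}) (q i))) (⊝-congₘ (⊛-congₘ (≈-refl {con (+ n)}) (⊛-congₘ q (≈-refl {D θ}))))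

   bracket-form-eval : ∀ {n f} (v : Vec ℕ (suc n)) → f ≈ ⟦ v ⟧ s t → eval (bracket-form v) b a ≈ θ ⊛ bracket (n ℕ.* 2) f
   bracket-form-eval {n} v fv = ⊛-congₘ θ̂-eval (≈-trans (⊛-congₘ Q̂-eval (≈-refl {eval (brF (norm (↓ v))) b a})) (≈-trans (≈-sym (bracket-⟦⟧ (norm (↓ v))))
     (bracket-cong (n ℕ.* 2) (≈-trans (norm-sound (↓ v) b a) (≈-trans (↓-eval v) (≈-sym fv))))))

-- Sums over the representations N = s² + de.

module TripleSums where

 open PowerSeries
 open FiniteSums
 open Substitution
 open ThetaSeries
 open Factorizations
 open LambertSeries
 open HomogeneousForms
 open PrimeSection
 open LambertForms
 open import Data.Bool using (T)

 -- The representations N = s² + de with d, e > 0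

 Triple : Set
 Triple = ℤ × (ℕ × ℕ)

 triples : ℕ → List Triple
 triples = roots ⊠ factorizations

 IsTriple : ℕ → Triple → Set
 IsTriple N z = Pos (proj₂ z) × sq (proj₁ z) ℕ.+ proj₁ (proj₂ z) ℕ.* proj₂ (proj₂ z) ≡ N

 triples-Enum : ∀ N → Enum (IsTriple N) (triples N)
 triples-Enum N = Enum-⇔ (λ { ((_ , p) , eq) → p , eq }) (λ { (p , eq) → (tt , p) , eq }) (⊠-Graded₀ roots-Graded factorizations-Graded N)

 on : (ℤ → ℕ → ℕ → ℤ) → Triple → ℤ
 on F z = F (proj₁ z) (proj₁ (proj₂ z)) (proj₂ (proj₂ z))

 θ-Lam : ∀ φ → θ ⊛ Lam φ ≗ₛ ser triples (on (λ _ d e → φ d e))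
 θ-Lam φ N = trans (ser-⊛ roots factorizations (λ _ → 1ℤ) (unc φ) N) (∑-cong (triples N) (λ z → ℤP.*-identityˡ _))

 D-Lam : ∀ φ → D (Lam φ) ≗ₛ Lam (λ n k → + (n ℕ.* k) *ᶻ φ n k)
 D-Lam φ N = trans (sym (∑-scale (+ N) (factorizations N) (unc φ))) (∑-cong-∈ (factorizations N)
   (λ { {n , k} z∈ → cong (λ m → + m *ᶻ φ n k) (sym (proj₂ (sound (factorizations-Graded N) z∈))) }))

 Dθ-roots : D θ ≗ₛ ser roots (λ s → + sq s)
 Dθ-roots N = trans (sym (∑-scale (+ N) (roots N) (λ _ → 1ℤ))) (∑-cong-∈ (roots N)
   (λ {s} s∈ → trans (ℤP.*-identityʳ (+ N)) (cong +_ (sym (proj₂ (sound (roots-Graded N) s∈))))))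

 -- The derivation multiplies the Lambert term of (d, e) by de and the theta term of s by s².
 bracket-Lam : ∀ n φ → bracket n (Lam φ) ≗ₛ ser triples (on (λ s d e → φ d e *ᶻ (+ (d ℕ.* e) -ᶻ + n *ᶻ + sq s)))
 bracket-Lam n φ N = trans (cong₂ _-ᶻ_
     (trans (S.*-cong (S.refl {θ}) (D-Lam φ) N) (θ-Lam _ N))
     (trans (con-⊛ (+ n) (Lam φ ⊛ D θ) N) (trans (cong (+ n *ᶻ_) (trans (S.trans (S.*-comm (Lam φ) (D θ)) (S.*-cong Dθ-roots S.refl) N)
       (ser-⊛ roots factorizations (λ s → + sq s) (unc φ) N))) (sym (∑-scale (+ n) (triples N) _)))))
   (trans (cong (λ z → ∑ (triples N) (on (λ _ d e → + (d ℕ.* e) *ᶻ φ d e)) +ᶻ z) (sym (∑-neg (triples N) _)))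
   (trans (sym (∑-⊕ (triples N) _ _)) (∑-cong (triples N) (λ { (s , d , e) → lem (+ (d ℕ.* e)) (φ d e) (+ n) (+ sq s) }))))
   where
     lem : ∀ x f n s → x *ᶻ f +ᶻ -ᶻ (n *ᶻ (s *ᶻ f)) ≡ f *ᶻ (x -ᶻ n *ᶻ s)
     lem = solve-∀

 NonSquare : ℕ → Set
 NonSquare N = ∀ s → sq s ≢ N

 θ-nonsquare : ∀ {N} → NonSquare N → θ N ≡ 0ℤ
 θ-nonsquare {N} ns = ∑-zero (roots N) (λ {s} s∈ → ⊥-elim (ns s (proj₂ (sound (roots-Graded N) s∈))))

 -- The constant c multiplies θ, whose coefficient at a nonsquare is zero.
 θ-Lam-nonsquare : ∀ {N} φ c → NonSquare N → (θ ⊛ (Lam φ ⊕ con c)) N ≡ ∑ (triples N) (on (λ _ d e → φ d e))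
 θ-Lam-nonsquare {N} φ c ns = trans (⊛-distribˡ θ (Lam φ) (con c) N) (trans (cong₂ _+ᶻ_ (θ-Lam φ N)
   (trans (⊛-comm θ (con c) N) (trans (con-⊛ c θ N) (trans (cong (c *ᶻ_) (θ-nonsquare ns)) (ℤP.*-zeroʳ c))))) (ℤP.+-identityʳ _))

 bracket-⊕ : ∀ n f g → bracket n (f ⊕ g) ≗ₛ bracket n f ⊕ bracket n g
 bracket-⊕ n f g = S.trans (S.+-cong (S.*-cong (S.refl {θ}) (D-⊕ f g)) S.refl)
   (S.solve 7 (λ t n f g f′ g′ d → t :* (f′ :+ g′) :- n :* ((f :+ g) :* d) S.:= (t :* f′ :- n :* (f :* d)) :+ (t :* g′ :- n :* (g :* d))) S.refl θ (con (+ n)) f g (D f) (D g) (D θ))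
   where open S using (_:+_; _:*_; _:-_)

 bracket-Lam-nonsquare : ∀ {N} n φ c → NonSquare N →
   (bracket n (Lam φ ⊕ con c)) N ≡ ∑ (triples N) (on (λ s d e → φ d e *ᶻ (+ (d ℕ.* e) -ᶻ + n *ᶻ + sq s)))
 bracket-Lam-nonsquare {N} n φ c ns = trans (bracket-⊕ n (Lam φ) (con c) N) (trans (cong₂ _+ᶻ_ (bracket-Lam n φ N) zero′) (ℤP.+-identityʳ _))
   where
     Dc : D (con c) ≗ₛ con 0ℤ
     Dc zero    = ℤP.*-zeroˡ c
     Dc (suc i) = ℤP.*-zeroʳ (+ suc i)
     zero′ : bracket n (con c) N ≡ 0ℤ
     zero′ = trans (S.trans (S.+-cong (S.*-cong (S.refl {θ}) Dc) (S.refl {⊝ (con (+ n) ⊛ (con c ⊛ D θ))}))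
         (S.solve 4 (λ t n c d → t :* S.:con 0ℤ :- n :* (c :* d) S.:= (:- (n :* c)) :* d) S.refl θ (con (+ n)) (con c) (D θ)) N)
       (trans (⊛-comm (⊝ (con (+ n) ⊛ con c)) (D θ) N) (trans (S.*-cong (S.refl {D θ}) (S.sym hom) N) (trans (⊛-comm (D θ) (con (-ᶻ (+ n *ᶻ c))) N)
       (trans (con-⊛ (-ᶻ (+ n *ᶻ c)) (D θ) N) (trans (cong (λ z → -ᶻ (+ n *ᶻ c) *ᶻ (+ N *ᶻ z)) (θ-nonsquare ns)) (trans (cong (-ᶻ (+ n *ᶻ c) *ᶻ_) (ℤP.*-zeroʳ (+ N))) (ℤP.*-zeroʳ (-ᶻ (+ n *ᶻ c)))))))))
       where
         open S using (_:+_; _:*_; _:-_; :-_)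
         hom : con (-ᶻ (+ n *ᶻ c)) ≗ₛ ⊝ (con (+ n) ⊛ con c)
         hom i = sym (trans (cong -ᶻ_ (con-⊛ (+ n) (con c) i)) (h i))
           where
             h : ∀ i → -ᶻ (+ n *ᶻ con c i) ≡ con (-ᶻ (+ n *ᶻ c)) i
             h zero    = refl
             h (suc i) = cong -ᶻ_ (ℤP.*-zeroʳ (+ n))

 Lam-combine : ∀ c φ d ψ → con c ⊛ Lam φ ⊕ con d ⊛ Lam ψ ≗ₛ Lam (λ n k → c *ᶻ φ n k +ᶻ d *ᶻ ψ n k)
 Lam-combine c φ d ψ = S.sym (S.trans (Lam-⊕ _ _) (S.+-cong (Lam-scale c φ) (Lam-scale d ψ)))

 con-⊕ : ∀ c d → con c ⊕ con d ≗ₛ con (c +ᶻ d)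
 con-⊕ c d zero    = refl
 con-⊕ c d (suc n) = refl

 con-⊛-con : ∀ c d → con c ⊛ con d ≗ₛ con (c *ᶻ d)
 con-⊛-con c d i = trans (con-⊛ c (con d) i) (h i)
   where
     h : ∀ i → c *ᶻ con d i ≡ con (c *ᶻ d) i
     h zero    = refl
     h (suc i) = ℤP.*-zeroʳ c

 alt-Lam′ : ∀ φ → alt (Lam φ) ≗ₛ Lam (λ n k → sgn (n ℕ.* k) *ᶻ φ n k)
 alt-Lam′ φ N = trans (sym (∑-scale (sgn N) (factorizations N) (unc φ))) (∑-cong-∈ (factorizations N)
   (λ { {n , k} z∈ → cong (λ m → sgn m *ᶻ φ n k) (sym (proj₂ (sound (factorizations-Graded N) z∈))) }))

 module Representations (k : ℕ) (isPrime : Prime (suc k)) (odd-p : ¬ suc k ℕD.∣ 2)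
                        (freshman : ∀ f g → Engine._≈_ k ((f ⊕ g) ^ₛ suc k) (f ^ₛ suc k ⊕ g ^ₛ suc k)) where

   open Engine k
   open Forms k isPrime odd-p freshman public

   -- A partner series is found only up to a constant. That constant is carried along without being
   -- evaluated, because it drops out at nonsquare N.
   record LamForm {n} (φ : ℕ → ℕ → ℤ) (v : Vec ℕ (suc n)) : Set where
     constructor _,_
     field
       constant : ℤ
       lamForm  : Lam φ ⊕ con constant ≈ ⟦ v ⟧ s t

   plain : ∀ {n φ} (v : Vec ℕ (suc n)) → Lam φ ≈ ⟦ v ⟧ s t → LamForm φ v
   plain {φ = φ} v eq = 0ℤ , ≈-trans (exact (S.solve 1 (λ x → x S.:+ S.:con 0ℤ S.:= x) S.refl (Lam φ))) eq

   E-LamForm : ∀ {n} j (l v : Vec ℕ (suc n)) → L j ≈ ⟦ l ⟧ s t → eqV (norm (↓ v)) (norm (↓₂ v ⟨+⟩ vec (twV 0 (norm (↓ l))))) ≡ true →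
               LamForm (λ n k → χ n *ᶻ e j n) v
   E-LamForm j l v Ll eq = _ , ≈-sym (proj₂ (E-form j l v Ll eq))

   G*-LamForm : ∀ {n} j (o v : Vec ℕ (suc n)) → O j ≈ ⟦ o ⟧ s t → eqV (norm (↓ v)) (norm (↓₂ v ⟨+⟩ ↓ o)) ≡ true →
               LamForm (λ n k → + n *ᶻ e j n) v
   G*-LamForm j o v Oo eq = _ , ≈-sym (proj₂ (G*-form j o v Oo eq))

   combine : ∀ {n φ ψ} (u v w : Vec ℕ (suc n)) x y → LamForm φ u → LamForm ψ v → eqV (norm (num x ⟨*⟩ vec u ⟨+⟩ num y ⟨*⟩ vec v)) w ≡ true →
             LamForm (λ n k → + x *ᶻ φ n k +ᶻ + y *ᶻ ψ n k) w
   combine {φ = φ} {ψ} u v w x y (c , U) (d , W) eq = + x *ᶻ c +ᶻ + y *ᶻ d , literal (num x ⟨*⟩ vec u ⟨+⟩ num y ⟨*⟩ vec v) w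
     (≈-trans (exact (S.trans (S.+-cong (S.sym (Lam-combine (+ x) φ (+ y) ψ)) (S.sym (S.trans (S.+-cong (con-⊛-con (+ x) c) (con-⊛-con (+ y) d)) (con-⊕ _ _))))
         (S.solve 6 (λ x f c y g d → (x S.:* f S.:+ y S.:* g) S.:+ (x S.:* c S.:+ y S.:* d) S.:= x S.:* (f S.:+ c) S.:+ y S.:* (g S.:+ d)) S.refl (con (+ x)) (Lam φ) (con c) (con (+ y)) (Lam ψ) (con d))))
       (⊕-congₘ (⊛-congₘ (≈-refl {con (+ x)}) U) (⊛-congₘ (≈-refl {con (+ y)}) W))) eq

   section-sum : ∀ {n φ} (v : Vec ℕ (suc n)) (𝔤 : Vec ℕ p) → θ ⊛ U k 1/θ ≈ ⟦ 𝔤 ⟧ b a → LamForm φ v →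
                 eqL (toList 𝔤) (toList (norm (θ²-form v))) ≡ true → ∀ {N} → NonSquare N →
                 U k 1/θ N ≡ₘ ∑ (triples N) (on (λ _ d e → φ d e))
   section-sum {φ = φ} v 𝔤 sec (c , V) eq {N} ns = ≡ₘ-trans
     (cancel-θ (≈-trans sec (≈-trans (by-list 𝔤 (θ²-form v) eq) (θ²-form-eval v V))) N) (≡ₘ-reflexive (θ-Lam-nonsquare φ c ns))

   -- For the case where 𝔤 is a multiple of θ² plus θ times a bracket, of equal degree in a and b.
   -- The bracket contributes the factor de - 2n′s².
   section-sum-bracket : ∀ {n n′ φ ψ} (v : Vec ℕ (suc n)) (v′ : Vec ℕ (suc n′)) (𝔤 : Vec ℕ p) → θ ⊛ U k 1/θ ≈ ⟦ 𝔤 ⟧ b a → LamForm φ v → LamForm ψ v′ →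
                 (deg : 1 ℕ.+ (4 ℕ.+ suc (n′ ℕ.* 2)) ≡ 2 ℕ.+ n ℕ.* 2) →
                 eqL (toList 𝔤) (toList (norm (θ²-form v ⟨+⟩ subst Form deg (bracket-form v′)))) ≡ true → ∀ {N} → NonSquare N →
                 U k 1/θ N ≡ₘ ∑ (triples N) (on (λ s d e → φ d e +ᶻ ψ d e *ᶻ (+ (d ℕ.* e) -ᶻ + (n′ ℕ.* 2) *ᶻ + sq s)))
   section-sum-bracket {n} {n′} {φ} {ψ} v v′ 𝔤 sec (c , V) (c′ , V′) deg eq {N} ns = ≡ₘ-trans
     (cancel-θ (≈-trans sec (≈-trans (by-list 𝔤 (θ²-form v ⟨+⟩ subst Form deg (bracket-form v′)) eq)
       (≈-trans (⊕-congₘ (θ²-form-eval v V) (≈-trans (exact (transport deg (bracket-form v′))) (bracket-form-eval v′ V′)))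
         (exact (S.sym (⊛-distribˡ θ (θ ⊛ (Lam φ ⊕ con c)) (bracket (n′ ℕ.* 2) (Lam ψ ⊕ con c′)))))))) N)
     (≡ₘ-reflexive (trans (cong₂ _+ᶻ_ (θ-Lam-nonsquare φ c ns) (bracket-Lam-nonsquare (n′ ℕ.* 2) ψ c′ ns)) (sym (∑-⊕ (triples N) _ _))))
     where
       transport : ∀ {m m′} (eq : m ≡ m′) (f : Form m) → eval (subst Form eq f) b a ≗ₛ eval f b a
       transport refl f = S.refl

   residue-one : ∀ n q → + n -ᶻ 1ℤ ≡ + q *ᶻ + p → con (+ n) ≈ con 1ℤ
   residue-one n q eq zero    = mk (ℤD.divides (+ q) eq)
   residue-one n q eq (suc i) = ≡ₘ-refl

 -- hasse consists of the numbers (-1)ʰ C(h,i)² modulo p = 2h + 1, and 𝔤 is the resulting form for θ · U_p(1/θ);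
 -- the other vectors are Lambert series, their partners and the combinations of these that give 𝔤.

 module Mod13 where

   open Engine 12 hiding (p)

   open Representations 12 (from-yes (prime? 13)) (from-no (13 ℕD.∣? 2)) (by-norm ((x̂ ⟨+⟩ ŷ) ⟨^⟩ 13) (x̂ ⟨^⟩ 13 ⟨+⟩ ŷ ⟨^⟩ 13) refl)

   -- Inverses of 4 and 16 modulo 13: 10·4 = 1 + 3·13 and 9·16 = 1 + 11·13.
   open Lambert 10 9 (residue-one 40 3 refl) (residue-one 144 11 refl)

   hasse 𝔤 : Vec ℕ 13
   hasse = 1 ∷ 0 ∷ 10 ∷ 0 ∷ 4 ∷ 0 ∷ 10 ∷ 0 ∷ 4 ∷ 0 ∷ 10 ∷ 0 ∷ 1 ∷ []
   𝔤     = 1 ∷ 1 ∷ 1 ∷ 6 ∷ 1 ∷ 3 ∷ 1 ∷ 3 ∷ 1 ∷ 6 ∷ 1 ∷ 1 ∷ 1 ∷ []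

   section : θ ⊛ U 12 1/θ ≈ ⟦ 𝔤 ⟧ b a
   -- The vector `hasse` is, up to sign, the Deuring polynomial of the Legendre curve, its Hasse
   -- invariant, homogenized in s² and t². At q = 0 both s and t are 1, so the constant is the
   -- coefficient sum 40 = 1 + 3·13. The exponent 4 yields the degree 4·24 + 5·12 = 12·13.
   section = θ-section-form hasse refl (mk (ℤD.divides (+ 3) refl)) 4 refl 𝔤 refl

   l₂ ẽ₂ f : Vec ℕ 6
   l₂ = 0 ∷ 12 ∷ 0 ∷ 6 ∷ 0 ∷ 8 ∷ []
   ẽ₂ = 0 ∷ 10 ∷ 0 ∷ 1 ∷ 0 ∷ 0 ∷ []
   f  = 0 ∷ 3 ∷ 0 ∷ 10 ∷ 0 ∷ 1 ∷ []

   L₂ : L 2 ≈ ⟦ l₂ ⟧ s t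
   L₂ = literal L̂₂ l₂ L̂₂-eval refl

   F : ℤ → ℕ → ℕ → ℤ
   F _ d k = + 6 *ᶻ (χ d *ᶻ e 2 d) +ᶻ + 5 *ᶻ (χ k *ᶻ e 2 d)

   section-triples : ∀ {N} → NonSquare N → U 12 1/θ N ≡ₘ ∑ (triples N) (on F)
   section-triples = section-sum f 𝔤 section (combine ẽ₂ l₂ f 6 5 (E-LamForm 2 l₂ ẽ₂ L₂ refl) (plain l₂ L₂) refl) refl

 module Mod17 where

   open Engine 16 hiding (p)

   open Representations 16 (from-yes (prime? 17)) (from-no (17 ℕD.∣? 2)) (by-norm ((x̂ ⟨+⟩ ŷ) ⟨^⟩ 17) (x̂ ⟨^⟩ 17 ⟨+⟩ ŷ ⟨^⟩ 17) refl)

   open Lambert 13 16 (residue-one 52 3 refl) (residue-one 256 15 refl)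

   hasse 𝔤 : Vec ℕ 17
   hasse = 1 ∷ 0 ∷ 13 ∷ 0 ∷ 2 ∷ 0 ∷ 8 ∷ 0 ∷ 4 ∷ 0 ∷ 8 ∷ 0 ∷ 2 ∷ 0 ∷ 13 ∷ 0 ∷ 1 ∷ []
   𝔤     = 1 ∷ 14 ∷ 10 ∷ 10 ∷ 0 ∷ 12 ∷ 9 ∷ 11 ∷ 3 ∷ 11 ∷ 9 ∷ 12 ∷ 0 ∷ 10 ∷ 10 ∷ 14 ∷ 1 ∷ []

   section : θ ⊛ U 16 1/θ ≈ ⟦ 𝔤 ⟧ b a
   -- The coefficient sum is 52 = 1 + 3·17, and the degree is 6·32 + 5·16 = 16·17.
   section = θ-section-form hasse refl (mk (ℤD.divides (+ 3) refl)) 6 refl 𝔤 refl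

   l₂ ẽ₂ g : Vec ℕ 6
   l₂ = 0 ∷ 4 ∷ 0 ∷ 10 ∷ 0 ∷ 3 ∷ []
   ẽ₂ = 0 ∷ 13 ∷ 0 ∷ 1 ∷ 0 ∷ 0 ∷ []
   g  = 0 ∷ 0 ∷ 0 ∷ 9 ∷ 0 ∷ 4 ∷ []

   l₃ ẽ₃ f : Vec ℕ 8
   l₃ = 0 ∷ 16 ∷ 0 ∷ 13 ∷ 0 ∷ 12 ∷ 0 ∷ 10 ∷ []
   ẽ₃ = 0 ∷ 4 ∷ 0 ∷ 6 ∷ 0 ∷ 13 ∷ 0 ∷ 0 ∷ []
   f  = 0 ∷ 0 ∷ 0 ∷ 4 ∷ 0 ∷ 13 ∷ 0 ∷ 1 ∷ []

   L₂ : L 2 ≈ ⟦ l₂ ⟧ s t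
   L₂ = literal L̂₂ l₂ L̂₂-eval refl

   L₃ : L 3 ≈ ⟦ l₃ ⟧ s t
   L₃ = literal L̂₃ l₃ L̂₃-eval refl

   F : ℤ → ℕ → ℕ → ℤ
   F s d k = (+ 3 *ᶻ (χ d *ᶻ e 3 d) +ᶻ + 12 *ᶻ (χ k *ᶻ e 3 d)) +ᶻ (+ 7 *ᶻ (χ d *ᶻ e 2 d) +ᶻ + 7 *ᶻ (χ k *ᶻ e 2 d)) *ᶻ (+ (d ℕ.* k) -ᶻ + 10 *ᶻ + sq s)

   section-triples : ∀ {N} → NonSquare N → U 16 1/θ N ≡ₘ ∑ (triples N) (on F)
   section-triples = section-sum-bracket f g 𝔤 section
     (combine ẽ₃ l₃ f 3 12 (E-LamForm 3 l₃ ẽ₃ L₃ refl) (plain l₃ L₃) refl)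
     (combine ẽ₂ l₂ g 7 7 (E-LamForm 2 l₂ ẽ₂ L₂ refl) (plain l₂ L₂) refl) refl refl

 module Mod19 where

   open Engine 18 hiding (p)

   open Representations 18 (from-yes (prime? 19)) (from-no (19 ℕD.∣? 2)) (by-norm ((x̂ ⟨+⟩ ŷ) ⟨^⟩ 19) (x̂ ⟨^⟩ 19 ⟨+⟩ ŷ ⟨^⟩ 19) refl)

   open Lambert 5 6 (residue-one 20 1 refl) (residue-one 96 5 refl)

   hasse 𝔤 : Vec ℕ 19
   hasse = 18 ∷ 0 ∷ 14 ∷ 0 ∷ 15 ∷ 0 ∷ 12 ∷ 0 ∷ 8 ∷ 0 ∷ 8 ∷ 0 ∷ 12 ∷ 0 ∷ 15 ∷ 0 ∷ 14 ∷ 0 ∷ 18 ∷ []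
   𝔤     = 1 ∷ 18 ∷ 16 ∷ 12 ∷ 17 ∷ 13 ∷ 13 ∷ 0 ∷ 5 ∷ 18 ∷ 5 ∷ 0 ∷ 13 ∷ 13 ∷ 17 ∷ 12 ∷ 16 ∷ 18 ∷ 1 ∷ []

   section : θ ⊛ U 18 1/θ ≈ ⟦ 𝔤 ⟧ b a
   -- The coefficient sum is 134 = 1 + 7·19, and the degree is 7·36 + 5·18 = 18·19.
   section = θ-section-form hasse refl (mk (ℤD.divides (+ 7) refl)) 7 refl 𝔤 refl

   o₂ g̃₂ g : Vec ℕ 7
   o₂ = 0 ∷ 0 ∷ 6 ∷ 0 ∷ 1 ∷ 0 ∷ 12 ∷ []
   g̃₂ = 2 ∷ 0 ∷ 3 ∷ 0 ∷ 17 ∷ 0 ∷ 14 ∷ []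
   g  = 5 ∷ 0 ∷ 1 ∷ 0 ∷ 5 ∷ 0 ∷ 3 ∷ []

   o₃ o₃⁻ g̃₃ f₁ f : Vec ℕ 9
   o₃  = 0 ∷ 0 ∷ 13 ∷ 0 ∷ 0 ∷ 0 ∷ 12 ∷ 0 ∷ 13 ∷ []
   o₃⁻ = 13 ∷ 0 ∷ 12 ∷ 0 ∷ 0 ∷ 0 ∷ 13 ∷ 0 ∷ 0 ∷ []
   g̃₃  = 4 ∷ 0 ∷ 5 ∷ 0 ∷ 12 ∷ 0 ∷ 4 ∷ 0 ∷ 17 ∷ []
   f₁  = 1 ∷ 0 ∷ 15 ∷ 0 ∷ 3 ∷ 0 ∷ 2 ∷ 0 ∷ 18 ∷ []
   f   = 4 ∷ 0 ∷ 9 ∷ 0 ∷ 3 ∷ 0 ∷ 5 ∷ 0 ∷ 18 ∷ []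

   O₂ : O 2 ≈ ⟦ o₂ ⟧ s t
   O₂ = literal Ô₂ o₂ Ô₂-eval refl

   O₃ : O 3 ≈ ⟦ o₃ ⟧ s t
   O₃ = literal Ô₃ o₃ Ô₃-eval refl

   -- The substitution q ↦ -q exchanges s and t, hence the two arguments of the form.
   O₃⁻ : Lam (λ n k → sgn (n ℕ.* k) *ᶻ (+ n *ᶻ od k *ᶻ e 3 n)) ≈ ⟦ o₃⁻ ⟧ s t
   O₃⁻ = ≈-trans (exact (S.sym (alt-Lam′ _))) (literal (sub o₃ ŷ x̂) o₃⁻
     (≈-trans (λ i → *-congₘ (≡ₘ-refl {sgn i}) (O₃ i)) (exact (S.trans (alt-⟦⟧ o₃ s t) (⟦⟧-cong o₃ alt-s alt-t)))) refl)

   F : ℤ → ℕ → ℕ → ℤ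
   F s d k = (+ 1 *ᶻ (+ 5 *ᶻ (+ d *ᶻ e 3 d) +ᶻ + 8 *ᶻ (+ d *ᶻ od k *ᶻ e 3 d)) +ᶻ + 9 *ᶻ (sgn (d ℕ.* k) *ᶻ (+ d *ᶻ od k *ᶻ e 3 d)))
     +ᶻ (+ 12 *ᶻ (+ d *ᶻ e 2 d) +ᶻ + 10 *ᶻ (+ d *ᶻ od k *ᶻ e 2 d)) *ᶻ (+ (d ℕ.* k) -ᶻ + 12 *ᶻ + sq s)

   section-triples : ∀ {N} → NonSquare N → U 18 1/θ N ≡ₘ ∑ (triples N) (on F)
   section-triples = section-sum-bracket f g 𝔤 section
     (combine f₁ o₃⁻ f 1 9 (combine g̃₃ o₃ f₁ 5 8 (G*-LamForm 3 o₃ g̃₃ O₃ refl) (plain o₃ O₃) refl) (plain o₃⁻ O₃⁻) refl)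
     (combine g̃₂ o₂ g 12 10 (G*-LamForm 2 o₂ g̃₂ O₂ refl) (plain o₂ O₂) refl) refl refl

-- Binary quadratic forms that separate two points.

module QuadraticForms where

 open PowerSeries
 open FiniteSums
 open ThetaSeries
 open Factorizations
 open TripleSums

 -- (a , b , c) stands for the binary quadratic form a x² + 2 b x y + c y².

 Quadratic Point Matrix : Set
 Quadratic = ℤ × ℤ × ℤ
 Point     = ℤ × ℤ
 Matrix    = Point × Point

 value : Quadratic → Point → ℤ
 value (a , b , c) (x , y) = a *ᶻ (x *ᶻ x) +ᶻ + 2 *ᶻ (b *ᶻ (x *ᶻ y)) +ᶻ c *ᶻ (y *ᶻ y)

 polar : Quadratic → Point → Point → ℤ
 polar (a , b , c) (x , y) (x′ , y′) = a *ᶻ (x *ᶻ x′) +ᶻ b *ᶻ (x *ᶻ y′ +ᶻ y *ᶻ x′) +ᶻ c *ᶻ (y *ᶻ y′)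

 disc : Quadratic → ℤ
 disc (a , b , c) = b *ᶻ b -ᶻ a *ᶻ c

 negate : Quadratic → Quadratic
 negate (a , b , c) = -ᶻ a , -ᶻ b , -ᶻ c

 -- Matrices are pairs of columns.

 infixr 7 _·_ _⊡_
 infixl 7 _∘ᴹ_

 _·_ : Matrix → Point → Point
 ((x₁ , y₁) , (x₂ , y₂)) · (x , y) = x₁ *ᶻ x +ᶻ x₂ *ᶻ y , y₁ *ᶻ x +ᶻ y₂ *ᶻ y

 _⊡_ : Matrix → Matrix → Matrix
 M ⊡ (u , v) = M · u , M · v

 _∘ᴹ_ : Quadratic → Matrix → Quadratic
 Q ∘ᴹ (u , v) = value Q u , polar Q u v , value Q v

 det : Matrix → ℤ
 det ((x₁ , y₁) , (x₂ , y₂)) = x₁ *ᶻ y₂ -ᶻ x₂ *ᶻ y₁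

 e₁ e₂ : Point
 e₁ = 1ℤ , 0ℤ
 e₂ = 0ℤ , 1ℤ

 𝟙 : Matrix
 𝟙 = e₁ , e₂

 polar-diagonal : ∀ Q u → value Q u ≡ polar Q u u
 polar-diagonal (a , b , c) (x , y) = lem a b c x y
   where
     lem : ∀ a b c x y → a *ᶻ (x *ᶻ x) +ᶻ + 2 *ᶻ (b *ᶻ (x *ᶻ y)) +ᶻ c *ᶻ (y *ᶻ y) ≡ a *ᶻ (x *ᶻ x) +ᶻ b *ᶻ (x *ᶻ y +ᶻ y *ᶻ x) +ᶻ c *ᶻ (y *ᶻ y)
     lem = solve-∀

 polar-comm : ∀ Q u v → polar Q u v ≡ polar Q v u
 polar-comm (a , b , c) (x , y) (x′ , y′) = lem a b c x y x′ y′
   where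
     lem : ∀ a b c x y x′ y′ → a *ᶻ (x *ᶻ x′) +ᶻ b *ᶻ (x *ᶻ y′ +ᶻ y *ᶻ x′) +ᶻ c *ᶻ (y *ᶻ y′) ≡ a *ᶻ (x′ *ᶻ x) +ᶻ b *ᶻ (x′ *ᶻ y +ᶻ y′ *ᶻ x) +ᶻ c *ᶻ (y′ *ᶻ y)
     lem = solve-∀

 gradient : Quadratic → Point → Point
 gradient (a , b , c) (x , y) = a *ᶻ x +ᶻ b *ᶻ y , b *ᶻ x +ᶻ c *ᶻ y

 dot₂ : Point → Point → ℤ
 dot₂ (x , y) (x′ , y′) = x *ᶻ x′ +ᶻ y *ᶻ y′

 polar-gradient : ∀ Q u v → polar Q u v ≡ dot₂ v (gradient Q u)
 polar-gradient (a , b , c) (x , y) (x′ , y′) = lem a b c x y x′ y′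
   where
     lem : ∀ a b c x y x′ y′ → a *ᶻ (x *ᶻ x′) +ᶻ b *ᶻ (x *ᶻ y′ +ᶻ y *ᶻ x′) +ᶻ c *ᶻ (y *ᶻ y′) ≡ x′ *ᶻ (a *ᶻ x +ᶻ b *ᶻ y) +ᶻ y′ *ᶻ (b *ᶻ x +ᶻ c *ᶻ y)
     lem = solve-∀

 polar-· : ∀ Q M u v → polar Q u (M · v) ≡ dot₂ v (polar Q u (proj₁ M) , polar Q u (proj₂ M))
 polar-· Q M@((x₁ , y₁) , (x₂ , y₂)) u v@(s , t) = trans (polar-gradient Q u (M · v)) (trans (lem x₁ x₂ y₁ y₂ s t _ _)
   (sym (cong (dot₂ v) (cong₂ _,_ (polar-gradient Q u (x₁ , y₁)) (polar-gradient Q u (x₂ , y₂))))))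
   where
     lem : ∀ x₁ x₂ y₁ y₂ s t l₁ l₂ → (x₁ *ᶻ s +ᶻ x₂ *ᶻ t) *ᶻ l₁ +ᶻ (y₁ *ᶻ s +ᶻ y₂ *ᶻ t) *ᶻ l₂ ≡ s *ᶻ (x₁ *ᶻ l₁ +ᶻ y₁ *ᶻ l₂) +ᶻ t *ᶻ (x₂ *ᶻ l₁ +ᶻ y₂ *ᶻ l₂)
     lem = solve-∀

 polar-∘ : ∀ Q M u v → polar (Q ∘ᴹ M) u v ≡ polar Q (M · u) (M · v)
 polar-∘ Q M@(u₁ , u₂) u@(x , y) v@(x′ , y′) = trans
   (trans (cong₂ (λ A C → A *ᶻ (x *ᶻ x′) +ᶻ polar Q u₁ u₂ *ᶻ (x *ᶻ y′ +ᶻ y *ᶻ x′) +ᶻ C *ᶻ (y *ᶻ y′)) (polar-diagonal Q u₁) (polar-diagonal Q u₂))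
          (lem (polar Q u₁ u₁) (polar Q u₁ u₂) (polar Q u₂ u₂) x y x′ y′))
   (sym (trans (polar-· Q M (M · u) v) (cong (dot₂ v) (cong₂ _,_
     (trans (polar-comm Q (M · u) u₁) (polar-· Q M u₁ u))
     (trans (polar-comm Q (M · u) u₂) (trans (polar-· Q M u₂ u) (cong (λ z → dot₂ u (z , polar Q u₂ u₂)) (polar-comm Q u₂ u₁))))))))
   where
     lem : ∀ a b c x y x′ y′ → a *ᶻ (x *ᶻ x′) +ᶻ b *ᶻ (x *ᶻ y′ +ᶻ y *ᶻ x′) +ᶻ c *ᶻ (y *ᶻ y′) ≡ x′ *ᶻ (x *ᶻ a +ᶻ y *ᶻ b) +ᶻ y′ *ᶻ (x *ᶻ b +ᶻ y *ᶻ c)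
     lem = solve-∀

 value-∘ : ∀ Q M u → value (Q ∘ᴹ M) u ≡ value Q (M · u)
 value-∘ Q M u = trans (polar-diagonal (Q ∘ᴹ M) u) (trans (polar-∘ Q M u u) (sym (polar-diagonal Q (M · u))))

 ∘-⊡ : ∀ Q M N → Q ∘ᴹ M ∘ᴹ N ≡ Q ∘ᴹ (M ⊡ N)
 ∘-⊡ Q M (u , v) = cong₂ _,_ (value-∘ Q M u) (cong₂ _,_ (polar-∘ Q M u v) (value-∘ Q M v))

 ∘-𝟙 : ∀ Q → Q ∘ᴹ 𝟙 ≡ Q
 ∘-𝟙 (a , b , c) = cong₂ _,_ (l₁ a b c) (cong₂ _,_ (l₂ a b c) (l₃ a b c))
   where
     l₁ : ∀ a b c → a *ᶻ 1ℤ +ᶻ + 2 *ᶻ (b *ᶻ 0ℤ) +ᶻ c *ᶻ 0ℤ ≡ a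
     l₁ = solve-∀
     l₂ : ∀ a b c → a *ᶻ 0ℤ +ᶻ b *ᶻ 1ℤ +ᶻ c *ᶻ 0ℤ ≡ b
     l₂ = solve-∀
     l₃ : ∀ a b c → a *ᶻ 0ℤ +ᶻ + 2 *ᶻ (b *ᶻ 0ℤ) +ᶻ c *ᶻ 1ℤ ≡ c
     l₃ = solve-∀

 ·-𝟙 : ∀ u → 𝟙 · u ≡ u
 ·-𝟙 (x , y) = cong₂ _,_ (l₁ x y) (l₂ x y)
   where
     l₁ : ∀ x y → 1ℤ *ᶻ x +ᶻ 0ℤ *ᶻ y ≡ x
     l₁ = solve-∀
     l₂ : ∀ x y → 0ℤ *ᶻ x +ᶻ 1ℤ *ᶻ y ≡ y
     l₂ = solve-∀

 ·-⊡ : ∀ M N u → M · N · u ≡ (M ⊡ N) · u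
 ·-⊡ ((x₁ , y₁) , (x₂ , y₂)) ((a , b) , (c , d)) (x , y) = cong₂ _,_ (lem x₁ x₂ a b c d x y) (lem y₁ y₂ a b c d x y)
   where
     lem : ∀ x₁ x₂ a b c d x y → x₁ *ᶻ (a *ᶻ x +ᶻ c *ᶻ y) +ᶻ x₂ *ᶻ (b *ᶻ x +ᶻ d *ᶻ y) ≡ (x₁ *ᶻ a +ᶻ x₂ *ᶻ b) *ᶻ x +ᶻ (x₁ *ᶻ c +ᶻ x₂ *ᶻ d) *ᶻ y
     lem = solve-∀

 disc-∘ : ∀ Q M → disc (Q ∘ᴹ M) ≡ det M *ᶻ det M *ᶻ disc Q
 disc-∘ Q@(a , b , c) (u₁@(x₁ , y₁) , u₂@(x₂ , y₂)) = trans
   (cong₂ _-ᶻ_ (cong₂ _*ᶻ_ (polar-gradient Q u₁ u₂) (trans (polar-comm Q u₁ u₂) (polar-gradient Q u₂ u₁)))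
               (cong₂ _*ᶻ_ (trans (polar-diagonal Q u₁) (polar-gradient Q u₁ u₁)) (trans (polar-diagonal Q u₂) (polar-gradient Q u₂ u₂))))
   (trans (lem₁ x₁ y₁ x₂ y₂ _ _ _ _) (trans (cong (det (u₁ , u₂) *ᶻ_) (lem₂ a b c x₁ y₁ x₂ y₂)) (sym (ℤP.*-assoc (det (u₁ , u₂)) _ _))))
   where
     lem₁ : ∀ x₁ y₁ x₂ y₂ l₁ l₂ k₁ k₂ → (x₂ *ᶻ l₁ +ᶻ y₂ *ᶻ l₂) *ᶻ (x₁ *ᶻ k₁ +ᶻ y₁ *ᶻ k₂) -ᶻ (x₁ *ᶻ l₁ +ᶻ y₁ *ᶻ l₂) *ᶻ (x₂ *ᶻ k₁ +ᶻ y₂ *ᶻ k₂)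
       ≡ (x₁ *ᶻ y₂ -ᶻ x₂ *ᶻ y₁) *ᶻ (l₂ *ᶻ k₁ -ᶻ l₁ *ᶻ k₂)
     lem₁ = solve-∀
     lem₂ : ∀ a b c x₁ y₁ x₂ y₂ → (b *ᶻ x₁ +ᶻ c *ᶻ y₁) *ᶻ (a *ᶻ x₂ +ᶻ b *ᶻ y₂) -ᶻ (a *ᶻ x₁ +ᶻ b *ᶻ y₁) *ᶻ (b *ᶻ x₂ +ᶻ c *ᶻ y₂)
       ≡ (x₁ *ᶻ y₂ -ᶻ x₂ *ᶻ y₁) *ᶻ (b *ᶻ b -ᶻ a *ᶻ c)
     lem₂ = solve-∀

 value-negate : ∀ Q u → value (negate Q) u ≡ -ᶻ value Q u
 value-negate (a , b , c) (x , y) = lem a b c x y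
   where
     lem : ∀ a b c x y → -ᶻ a *ᶻ (x *ᶻ x) +ᶻ + 2 *ᶻ (-ᶻ b *ᶻ (x *ᶻ y)) +ᶻ -ᶻ c *ᶻ (y *ᶻ y) ≡ -ᶻ (a *ᶻ (x *ᶻ x) +ᶻ + 2 *ᶻ (b *ᶻ (x *ᶻ y)) +ᶻ c *ᶻ (y *ᶻ y))
     lem = solve-∀

 negate-∘ : ∀ Q M → negate Q ∘ᴹ M ≡ negate (Q ∘ᴹ M)
 negate-∘ Q@(a , b , c) (u@(x , y) , v@(x′ , y′)) = cong₂ _,_ (value-negate Q u) (cong₂ _,_ (lem a b c x y x′ y′) (value-negate Q v))
   where
     lem : ∀ a b c x y x′ y′ → -ᶻ a *ᶻ (x *ᶻ x′) +ᶻ -ᶻ b *ᶻ (x *ᶻ y′ +ᶻ y *ᶻ x′) +ᶻ -ᶻ c *ᶻ (y *ᶻ y′) ≡ -ᶻ (a *ᶻ (x *ᶻ x′) +ᶻ b *ᶻ (x *ᶻ y′ +ᶻ y *ᶻ x′) +ᶻ c *ᶻ (y *ᶻ y′))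
     lem = solve-∀

 disc-negate : ∀ Q → disc (negate Q) ≡ disc Q
 disc-negate (a , b , c) = lem a b c
   where
     lem : ∀ a b c → -ᶻ b *ᶻ -ᶻ b -ᶻ -ᶻ a *ᶻ -ᶻ c ≡ b *ᶻ b -ᶻ a *ᶻ c
     lem = solve-∀

 negate² : ∀ Q → negate (negate Q) ≡ Q
 negate² (a , b , c) = cong₂ _,_ (ℤP.neg-involutive a) (cong₂ _,_ (ℤP.neg-involutive b) (ℤP.neg-involutive c))

 Irrational : ℕ → Set
 Irrational N = ∀ u y → u *ᶻ u ≡ + N *ᶻ (y *ᶻ y) → y ≡ 0ℤ

 -- Completing the square: if Q(x, y) = 0, then both N y² and N x² are squares of integers.
 nonvanishing : ∀ {N} → Irrational N → ∀ Q v → disc Q ≡ + N → v ≢ (0ℤ , 0ℤ) → value Q v ≢ 0ℤ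
 nonvanishing {N} irr Q@(a , b , c) (x , y) dN v≢0 Qv = v≢0 (cong₂ _,_
   (irr (b *ᶻ x +ᶻ c *ᶻ y) x (trans (l₂ a b c x y) (rhs c x)))
   (irr (a *ᶻ x +ᶻ b *ᶻ y) y (trans (l₁ a b c x y) (rhs a y))))
   where
     rhs : ∀ a y → a *ᶻ value Q (x , _) +ᶻ disc Q *ᶻ (y *ᶻ y) ≡ + N *ᶻ (y *ᶻ y)
     rhs a y = trans (cong₂ _+ᶻ_ (trans (cong (a *ᶻ_) Qv) (ℤP.*-zeroʳ a)) (cong (_*ᶻ (y *ᶻ y)) dN)) (ℤP.+-identityˡ _)
     l₁ : ∀ a b c x y → (a *ᶻ x +ᶻ b *ᶻ y) *ᶻ (a *ᶻ x +ᶻ b *ᶻ y) ≡ a *ᶻ (a *ᶻ (x *ᶻ x) +ᶻ + 2 *ᶻ (b *ᶻ (x *ᶻ y)) +ᶻ c *ᶻ (y *ᶻ y)) +ᶻ (b *ᶻ b -ᶻ a *ᶻ c) *ᶻ (y *ᶻ y)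
     l₁ = solve-∀
     l₂ : ∀ a b c x y → (b *ᶻ x +ᶻ c *ᶻ y) *ᶻ (b *ᶻ x +ᶻ c *ᶻ y) ≡ c *ᶻ (a *ᶻ (x *ᶻ x) +ᶻ + 2 *ᶻ (b *ᶻ (x *ᶻ y)) +ᶻ c *ᶻ (y *ᶻ y)) +ᶻ (b *ᶻ b -ᶻ a *ᶻ c) *ᶻ (x *ᶻ x)
     l₂ = solve-∀

 neg-<0 : ∀ {x} → 0ℤ ℤ.< x → -ᶻ x ℤ.< 0ℤ
 neg-<0 = ℤP.neg-mono-<

 neg->0 : ∀ {x} → x ℤ.< 0ℤ → 0ℤ ℤ.< -ᶻ x
 neg->0 = ℤP.neg-mono-<

 ≮0⇒>0 : ∀ {x} → x ≢ 0ℤ → ¬ (x ℤ.< 0ℤ) → 0ℤ ℤ.< x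
 ≮0⇒>0 {x} x≢0 x≮0 with ℤP.<-cmp x 0ℤ
 ... | tri< x<0 _ _ = ⊥-elim (x≮0 x<0)
 ... | tri≈ _ x≡0 _ = ⊥-elim (x≢0 x≡0)
 ... | tri> _ _ x>0 = x>0

 ≯0⇒<0 : ∀ {x} → x ≢ 0ℤ → ¬ (0ℤ ℤ.< x) → x ℤ.< 0ℤ
 ≯0⇒<0 {x} x≢0 x≯0 with ℤP.<-cmp x 0ℤ
 ... | tri< x<0 _ _ = x<0
 ... | tri≈ _ x≡0 _ = ⊥-elim (x≢0 x≡0)
 ... | tri> _ _ x>0 = ⊥-elim (x≯0 x>0)

 record Separates (N : ℕ) (α β : Point) (Q : Quadratic) : Set where
   constructor sep
   field
     discriminant : disc Q ≡ + N
     positive     : 0ℤ ℤ.< value Q α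
     negative     : value Q β ℤ.< 0ℤ
 open Separates

 -- Finiteness of the set of separating forms is carried as data. For the points e₁ and e₂ it comes
 -- from N = s² + de, and the operations below transport it to other pairs of points.
 record Cut (N : ℕ) (α β : Point) (f : Quadratic → ℤ) (z : ℤ) : Set where
   constructor cut
   field
     members : List Quadratic
     enum    : Enum (Separates N α β) members
     total   : ∑ members f ≡ z
 open Cut

 Odd : (Quadratic → ℤ) → Set
 Odd f = ∀ Q → f (negate Q) ≡ -ᶻ f Q

 Cut-unique : ∀ {N α β f z w} → Cut N α β f z → Cut N α β f w → z ≡ w
 Cut-unique {f = f} (cut xs e p) (cut ys e′ q) = trans (sym p) (trans (∑-Enum f e e′) q)

 Cut-cong : ∀ {N α β f g z} → (∀ Q → f Q ≡ g Q) → Cut N α β f z → Cut N α β g z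
 Cut-cong eq (cut xs e p) = cut xs e (trans (sym (∑-cong xs eq)) p)

 module _ {N : ℕ} (irr : Irrational N) where

   private
     ≢0 : ∀ {α β Q} v → v ≢ (0ℤ , 0ℤ) → Separates N α β Q → value Q v ≢ 0ℤ
     ≢0 {Q = Q} v v≢0 S = nonvanishing irr Q v (discriminant S) v≢0

   -- A form that is negative at β and positive at γ is cancelled by its negative.
   Cut-split : ∀ {f α β γ z w} → Odd f → α ≢ (0ℤ , 0ℤ) → β ≢ (0ℤ , 0ℤ) → γ ≢ (0ℤ , 0ℤ) →
               Cut N α β f z → Cut N β γ f w → Cut N α γ f (z +ᶻ w)
   Cut-split {f} {α} {β} {γ} {z} {w} odd α≢0 β≢0 γ≢0 (cut xs e p) (cut ys e′ q) = cut (xs₁ ++ ys₁)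
     (Enum-⇔ (λ { (inj₁ (S , n)) → sep (discriminant S) (positive S) n ; (inj₂ (S , p)) → sep (discriminant S) p (negative S) })
             complete′
             (Enum-++ (Enum-filter neg? e) (Enum-filter pos? e′) (λ { (S , _) (S′ , _) → ℤP.<-asym (negative S) (positive S′) })))
     (trans (∑-++ xs₁ ys₁ f) (trans (lem (∑ xs₁ f) (∑ ys₁ f) (∑ xs₂ f) (∑ ys₂ f) cancel)
       (cong₂ _+ᶻ_ (trans (sym (∑-filter neg? xs f)) p) (trans (sym (∑-filter pos? ys f)) q))))
     where
       neg? : ∀ Q → Dec (value Q γ ℤ.< 0ℤ)
       neg? Q = value Q γ ℤ.<? 0ℤ
       pos? : ∀ Q → Dec (0ℤ ℤ.< value Q α)
       pos? Q = 0ℤ ℤ.<? value Q α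
       xs₁ = filter neg? xs
       xs₂ = filter (¬? ∘ neg?) xs
       ys₁ = filter pos? ys
       ys₂ = filter (¬? ∘ pos?) ys
       complete′ : ∀ {Q} → Separates N α γ Q → (Separates N α β Q × value Q γ ℤ.< 0ℤ) ⊎ (Separates N β γ Q × 0ℤ ℤ.< value Q α)
       complete′ {Q} S with value Q β ℤ.<? 0ℤ
       ... | yes Qβ<0 = inj₁ (sep (discriminant S) (positive S) Qβ<0 , negative S)
       ... | no  Qβ≮0 = inj₂ (sep (discriminant S) (≮0⇒>0 (≢0 β β≢0 S) Qβ≮0) (negative S) , positive S)
       cancel : ∑ xs₂ f ≡ -ᶻ ∑ ys₂ f
       cancel = trans (∑-bij (Enum-filter (¬? ∘ neg?) e) (Enum-filter (¬? ∘ pos?) e′) negate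
           (λ { {Q} (S , Qγ≮0) → sep (trans (disc-negate Q) (discriminant S)) (subst (0ℤ ℤ.<_) (sym (value-negate Q β)) (neg->0 (negative S)))
                               (subst (ℤ._< 0ℤ) (sym (value-negate Q γ)) (neg-<0 (≮0⇒>0 (≢0 γ γ≢0 S) Qγ≮0)))
                           , λ pos → ℤP.<-asym (positive S) (subst (ℤ._< 0ℤ) (ℤP.neg-involutive (value Q α)) (neg-<0 (subst (0ℤ ℤ.<_) (value-negate Q α) pos))) })
           (λ _ _ eq → trans (sym (negate² _)) (trans (cong negate eq) (negate² _)))
           (λ { {Q} (S , Qα≯0) → negate Q
                  , (sep (trans (disc-negate Q) (discriminant S)) (subst (0ℤ ℤ.<_) (sym (value-negate Q α)) (neg->0 (≯0⇒<0 (≢0 α α≢0 S) Qα≯0)))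
                         (subst (ℤ._< 0ℤ) (sym (value-negate Q β)) (neg-<0 (positive S)))
                  , λ neg → ℤP.<-asym (negative S) (subst (0ℤ ℤ.<_) (ℤP.neg-involutive (value Q γ)) (neg->0 (subst (ℤ._< 0ℤ) (value-negate Q γ) neg))))
                  , negate² Q })
           (λ {Q} _ → trans (sym (ℤP.neg-involutive (f Q))) (cong -ᶻ_ (sym (odd Q)))))
         (∑-neg ys₂ f)
       lem : ∀ a b c d → c ≡ -ᶻ d → a +ᶻ b ≡ (a +ᶻ c) +ᶻ (b +ᶻ d)
       lem a b .(-ᶻ d) d refl = lem′ a b d
         where
           lem′ : ∀ a b d → a +ᶻ b ≡ (a +ᶻ -ᶻ d) +ᶻ (b +ᶻ d)
           lem′ = solve-∀

 record Inverse (h k : Matrix) : Set where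
   field
     hk  : h ⊡ k ≡ 𝟙
     kh  : k ⊡ h ≡ 𝟙
     det² : det k *ᶻ det k ≡ 1ℤ

 det-⊡ : ∀ h k → det (h ⊡ k) ≡ det h *ᶻ det k
 det-⊡ ((x₁ , y₁) , (x₂ , y₂)) ((a , b) , (c , d)) = lem x₁ y₁ x₂ y₂ a b c d
   where
     lem : ∀ x₁ y₁ x₂ y₂ a b c d → (x₁ *ᶻ a +ᶻ x₂ *ᶻ b) *ᶻ (y₁ *ᶻ c +ᶻ y₂ *ᶻ d) -ᶻ (x₁ *ᶻ c +ᶻ x₂ *ᶻ d) *ᶻ (y₁ *ᶻ a +ᶻ y₂ *ᶻ b) ≡ (x₁ *ᶻ y₂ -ᶻ x₂ *ᶻ y₁) *ᶻ (a *ᶻ d -ᶻ c *ᶻ b)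
     lem = solve-∀

 unit : ∀ x y → x *ᶻ y ≡ 1ℤ → y *ᶻ y ≡ 1ℤ → x *ᶻ x ≡ 1ℤ
 unit x y xy yy = trans (sym (ℤP.*-identityʳ _)) (trans (cong (x *ᶻ x *ᶻ_) (sym yy)) (trans (lem x y) (cong (λ z → z *ᶻ z) xy)))
   where
     lem : ∀ x y → x *ᶻ x *ᶻ (y *ᶻ y) ≡ x *ᶻ y *ᶻ (x *ᶻ y)
     lem = solve-∀

 -- Substituting k maps the forms separating α and β bijectively to those separating h·α and h·β;
 -- the discriminant is preserved because det k is 1 or -1.
 Cut-transform : ∀ {N f α β z h k} → Inverse h k → Cut N α β (λ Q → f (Q ∘ᴹ k)) z → Cut N (h · α) (h · β) f z
 Cut-transform {N} {f} {α} {β} {z} {h} {k} inv (cut xs e p) = cut (map (_∘ᴹ k) xs)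
   (Enum-map {P = Separates N α β} {Q = Separates N (h · α) (h · β)} e (_∘ᴹ k) forward injective backward)
   (trans (∑-map (_∘ᴹ k) xs f) p)
   where
     open Inverse inv
     back : ∀ {h k} → h ⊡ k ≡ 𝟙 → ∀ Q → Q ∘ᴹ h ∘ᴹ k ≡ Q
     back {h} {k} eq Q = trans (∘-⊡ Q h k) (trans (cong (Q ∘ᴹ_) eq) (∘-𝟙 Q))
     at : ∀ Q v → value (Q ∘ᴹ k) (h · v) ≡ value Q v
     at Q v = trans (value-∘ Q k (h · v)) (cong (value Q) (trans (·-⊡ k h v) (trans (cong (_· v) kh) (·-𝟙 v))))
     same-disc : ∀ h → det h *ᶻ det h ≡ 1ℤ → ∀ Q → disc (Q ∘ᴹ h) ≡ disc Q
     same-disc h eq Q = trans (disc-∘ Q h) (trans (cong (_*ᶻ disc Q) eq) (ℤP.*-identityˡ (disc Q)))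
     forward : ∀ {Q} → Separates N α β Q → Separates N (h · α) (h · β) (Q ∘ᴹ k)
     forward {Q} (sep d p n) = sep (trans (same-disc k det² Q) d) (subst (0ℤ ℤ.<_) (sym (at Q α)) p) (subst (ℤ._< 0ℤ) (sym (at Q β)) n)
     injective : ∀ {Q Q′} → Separates N α β Q → Separates N α β Q′ → Q ∘ᴹ k ≡ Q′ ∘ᴹ k → Q ≡ Q′
     injective {Q} {Q′} _ _ eq = trans (sym (back {k} {h} kh Q)) (trans (cong (_∘ᴹ h) eq) (back {k} {h} kh Q′))
     backward : ∀ {Q} → Separates N (h · α) (h · β) Q → ∃ λ Q′ → Separates N α β Q′ × Q′ ∘ᴹ k ≡ Q
     backward {Q} (sep d p n) = Q ∘ᴹ h
       , sep (trans (same-disc h (unit (det h) (det k) (trans (sym (det-⊡ h k)) (cong det hk)) det²) Q) d)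
             (subst (0ℤ ℤ.<_) (sym (value-∘ Q h α)) p) (subst (ℤ._< 0ℤ) (sym (value-∘ Q h β)) n)
       , back {h} {k} hk Q

 form : Triple → Quadratic
 form (s , d , e) = + d , s , -ᶻ + e

 forms : ℕ → List Quadratic
 forms N = map form (triples N)

 value-e₁ : ∀ Q → value Q e₁ ≡ proj₁ Q
 value-e₁ Q = cong proj₁ (∘-𝟙 Q)

 value-e₂ : ∀ Q → value Q e₂ ≡ proj₂ (proj₂ Q)
 value-e₂ Q = cong (proj₂ ∘ proj₂) (∘-𝟙 Q)

 sq-ℤ : ∀ s → s *ᶻ s ≡ + sq s
 sq-ℤ (+ n)    = sym (ℤP.pos-* n n)
 sq-ℤ -[1+ n ] = refl

 forms-Enum : ∀ N → Enum (Separates N e₁ e₂) (forms N)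
 forms-Enum N = Enum-map (triples-Enum N) form
   (λ { {s , d , e} ((d>0 , e>0) , eq) → sep (trans (cong₂ _-ᶻ_ (sq-ℤ s) (sym (ℤP.neg-distribʳ-* (+ d) (+ e)))) (trans (cong (+ sq s +ᶻ_) (trans (ℤP.neg-involutive (+ d *ᶻ + e)) (sym (ℤP.pos-* d e)))) (cong +_ eq)))
       (subst (0ℤ ℤ.<_) (sym (value-e₁ (form (s , d , e)))) (ℤ.+<+ d>0))
       (subst (ℤ._< 0ℤ) (sym (value-e₂ (form (s , d , e)))) (neg-<0 (ℤ.+<+ e>0))) })
   (λ { {s , d , e} {s′ , d′ , e′} _ _ eq → inj d e s d′ e′ s′ eq })
   surj
   where
     inj : ∀ d e s d′ e′ s′ → (+ d , s , -ᶻ + e) ≡ (+ d′ , s′ , -ᶻ + e′) → (s , d , e) ≡ (s′ , d′ , e′)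
     inj d e s d′ e′ s′ eq = cong₂ _,_ (cong (proj₁ ∘ proj₂) eq) (cong₂ _,_ (ℤP.+-injective (cong proj₁ eq)) (ℤP.+-injective (ℤP.neg-injective (cong (proj₂ ∘ proj₂) eq))))
     surj : ∀ {Q} → Separates N e₁ e₂ Q → ∃ λ z → IsTriple N z × form z ≡ Q
     surj {a , b , c} (sep d p n) with a | c | subst (0ℤ ℤ.<_) (value-e₁ (a , b , c)) p | subst (ℤ._< 0ℤ) (value-e₂ (a , b , c)) n | d
     ... | + m | -[1+ k ] | ℤ.+<+ m>0 | _ | d = (b , m , suc k) , ((m>0 , ℕ.s≤s ℕ.z≤n)
       , ℤP.+-injective (trans (cong₂ _+ᶻ_ (sym (sq-ℤ b)) (trans (ℤP.pos-* m (suc k)) (lem (+ m) (+ suc k)))) d)) , refl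
       where
         lem : ∀ x y → x *ᶻ y ≡ -ᶻ (x *ᶻ -ᶻ y)
         lem = solve-∀
     ... | _ | + k | _ | ℤ.+<+ () | _

 Cut-forms : ∀ N f → Cut N e₁ e₂ f (∑ (forms N) f)
 Cut-forms N f = cut (forms N) (forms-Enum N) refl

 sq-pos : ∀ {k} → k ≢ 0ℤ → 0ℤ ℤ.< k *ᶻ k
 sq-pos {+ zero}  k≢0 = ⊥-elim (k≢0 refl)
 sq-pos {+ suc n} _   = ℤ.+<+ (ℕ.s≤s ℕ.z≤n)
 sq-pos { -[1+ n ]} _ = ℤ.+<+ (ℕ.s≤s ℕ.z≤n)

 -- Only the signs at the two points matter, and Q(kv) = k²Q(v).
 Cut-scale : ∀ {N f z} k l → k ≢ 0ℤ → l ≢ 0ℤ → Cut N e₁ e₂ f z → Cut N (k , 0ℤ) (0ℤ , l) f z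
 Cut-scale k l k≢0 l≢0 (cut xs e p) = cut xs (Enum-⇔
   (λ { {Q} (sep d p n) → sep d (subst (0ℤ ℤ.<_) (sym (s₁ Q)) (pos (sq-pos k≢0) p)) (subst (ℤ._< 0ℤ) (sym (s₂ Q)) (neg (sq-pos l≢0) n)) })
   (λ { {Q} (sep d p n) → sep d (unpos (sq-pos k≢0) (subst (0ℤ ℤ.<_) (s₁ Q) p)) (unneg (sq-pos l≢0) (subst (ℤ._< 0ℤ) (s₂ Q) n)) }) e) p
   where
     s₁ : ∀ Q → value Q (k , 0ℤ) ≡ k *ᶻ k *ᶻ value Q e₁
     s₁ (a , b , c) = lem a b c k
       where
         lem : ∀ a b c k → a *ᶻ (k *ᶻ k) +ᶻ + 2 *ᶻ (b *ᶻ (k *ᶻ 0ℤ)) +ᶻ c *ᶻ 0ℤ ≡ k *ᶻ k *ᶻ (a *ᶻ 1ℤ +ᶻ + 2 *ᶻ (b *ᶻ 0ℤ) +ᶻ c *ᶻ 0ℤ)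
         lem = solve-∀
     s₂ : ∀ Q → value Q (0ℤ , l) ≡ l *ᶻ l *ᶻ value Q e₂
     s₂ (a , b , c) = lem a b c l
       where
         lem : ∀ a b c k → a *ᶻ 0ℤ +ᶻ + 2 *ᶻ (b *ᶻ (0ℤ *ᶻ k)) +ᶻ c *ᶻ (k *ᶻ k) ≡ k *ᶻ k *ᶻ (a *ᶻ 0ℤ +ᶻ + 2 *ᶻ (b *ᶻ 0ℤ) +ᶻ c *ᶻ 1ℤ)
         lem = solve-∀
     pos : ∀ {m x} → 0ℤ ℤ.< m → 0ℤ ℤ.< x → 0ℤ ℤ.< m *ᶻ x
     pos {m} m>0 x>0 = subst (ℤ._< m *ᶻ _) (ℤP.*-zeroʳ m) (ℤP.*-monoˡ-<-pos m {{ℤ.positive m>0}} x>0)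
     neg : ∀ {m x} → 0ℤ ℤ.< m → x ℤ.< 0ℤ → m *ᶻ x ℤ.< 0ℤ
     neg {m} m>0 x<0 = subst (m *ᶻ _ ℤ.<_) (ℤP.*-zeroʳ m) (ℤP.*-monoˡ-<-pos m {{ℤ.positive m>0}} x<0)
     unpos : ∀ {m x} → 0ℤ ℤ.< m → 0ℤ ℤ.< m *ᶻ x → 0ℤ ℤ.< x
     unpos {m} m>0 p = ℤP.*-cancelˡ-<-nonNeg m {{ℤ.nonNegative (ℤP.<⇒≤ m>0)}} (subst (ℤ._< m *ᶻ _) (sym (ℤP.*-zeroʳ m)) p)
     unneg : ∀ {m x} → 0ℤ ℤ.< m → m *ᶻ x ℤ.< 0ℤ → x ℤ.< 0ℤ
     unneg {m} m>0 p = ℤP.*-cancelˡ-<-nonNeg m {{ℤ.nonNegative (ℤP.<⇒≤ m>0)}} (subst (m *ᶻ _ ℤ.<_) (sym (ℤP.*-zeroʳ m)) p)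

-- Cutting cones by the Euclidean algorithm.

module EuclideanPaths where

 open FiniteSums
 open QuadraticForms
 open TripleSums

 -- Reduction of the cone from e₁ to (x , y) by the Euclidean algorithm

 τ τ⁻¹ : ℤ → Matrix
 τ   t = e₂ , (1ℤ , t)
 τ⁻¹ t = (-ᶻ t , 1ℤ) , e₁

 Inverse-τ : ∀ t → Inverse (τ t) (τ⁻¹ t)
 Inverse-τ t = record { hk = cong₂ _,_ (cong₂ _,_ (l₁ t) (l₂ t)) (cong₂ _,_ refl (l₃ t)) ; kh = cong₂ _,_ (cong₂ _,_ (l₄ t) refl) (cong₂ _,_ (l₅ t) refl) ; det² = l₆ t }
   where
     l₁ : ∀ t → 0ℤ *ᶻ (-ᶻ t) +ᶻ 1ℤ ≡ 1ℤ
     l₁ = solve-∀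
     l₂ : ∀ t → 1ℤ *ᶻ (-ᶻ t) +ᶻ t *ᶻ 1ℤ ≡ 0ℤ
     l₂ = solve-∀
     l₃ : ∀ t → 1ℤ +ᶻ t *ᶻ 0ℤ ≡ 1ℤ
     l₃ = solve-∀
     l₄ : ∀ t → (-ᶻ t) *ᶻ 0ℤ +ᶻ 1ℤ ≡ 1ℤ
     l₄ = solve-∀
     l₅ : ∀ t → (-ᶻ t) *ᶻ 1ℤ +ᶻ 1ℤ *ᶻ t ≡ 0ℤ
     l₅ = solve-∀
     l₆ : ∀ t → ((-ᶻ t) *ᶻ 0ℤ -ᶻ 1ℤ) *ᶻ ((-ᶻ t) *ᶻ 0ℤ -ᶻ 1ℤ) ≡ 1ℤ
     l₆ = solve-∀

 path : ℕ → Point → ℕ → ℕ → List Matrix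
 path zero    u x       y = []
 path (suc f) u zero    y = (u , (0ℤ , + y)) ∷ []
 path (suc f) u (suc x) y = (u , (+ suc x , + y)) ∷ path f (τ⁻¹ (+ (y / suc x)) · u) (y % suc x) (suc x)

 module _ {N : ℕ} (irr : Irrational N) (F : Quadratic → ℤ) (odd : Odd F) where

   cone : Matrix → ℤ
   cone M = ∑ (forms N) (λ Q → F (Q ∘ᴹ M))

   odd-∘ : ∀ M → Odd (λ Q → F (Q ∘ᴹ M))
   odd-∘ M Q = trans (cong F (negate-∘ Q M)) (odd (Q ∘ᴹ M))

   -- The cone from e₁ to (x, y) is split at e₂. With y = r + tx the matrix `τ t` carries the cone
   -- from e₁ to (r, x) onto the second piece, and r < x. The transformation is absorbed into the
   -- matrix along which F is evaluated; its second column remains the end point of the cone. At x =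
   -- 0 the end point is a multiple of e₂.
   Cut-path : ∀ f u x y → x < f → 0 < y → Cut N e₁ (+ x , + y) (λ Q → F (Q ∘ᴹ (u , (+ x , + y)))) (∑ (path f u x y) cone)
   Cut-path (suc f) u zero    (suc y) _         _   = subst (Cut N e₁ (0ℤ , + suc y) _) (sym (ℤP.+-identityʳ _))
     (Cut-scale 1ℤ (+ suc y) (λ ()) (λ ()) (Cut-forms N (λ Q → F (Q ∘ᴹ (u , (0ℤ , + suc y))))))
   Cut-path (suc f) u (suc x) y (s≤s x<f) _ = Cut-split irr {α = e₁} {e₂} {+ suc x , + y} (odd-∘ M) (λ ()) (λ ()) (λ ()) (Cut-forms N _)
     (subst (λ z → Cut N z (+ suc x , + y) (λ Q → F (Q ∘ᴹ M)) (∑ (path f u′ r (suc x)) cone)) τe₁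
     (subst (λ z → Cut N (τ t · e₁) z (λ Q → F (Q ∘ᴹ M)) (∑ (path f u′ r (suc x)) cone)) τv
       (Cut-transform {N} {λ Q → F (Q ∘ᴹ M)} {e₁} {+ r , + suc x} {_} {τ t} {τ⁻¹ t} (Inverse-τ t)
         (Cut-cong (λ Q → cong F (sym (trans (∘-⊡ Q (τ⁻¹ t) M) (cong (λ z → Q ∘ᴹ (u′ , z)) τ⁻¹v))))
           (Cut-path f u′ r (suc x) (ℕP.<-≤-trans (ℕDM.m%n<n y (suc x)) x<f) (s≤s z≤n))))))
     where
       M = u , (+ suc x , + y)
       r = y % suc x
       t = + (y / suc x)
       u′ = τ⁻¹ t · u
       y≡ : + y ≡ + r +ᶻ t *ᶻ + suc x
       y≡ = trans (cong +_ (ℕDM.m≡m%n+[m/n]*n y (suc x))) (cong (+ r +ᶻ_) (ℤP.pos-* (y / suc x) (suc x)))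
       τe₁ : τ t · e₁ ≡ e₂
       τe₁ = cong₂ _,_ refl (lem t)
         where
           lem : ∀ t → 1ℤ +ᶻ t *ᶻ 0ℤ ≡ 1ℤ
           lem = solve-∀
       τv : τ t · (+ r , + suc x) ≡ (+ suc x , + y)
       τv = cong₂ _,_ (l₁ (+ r) (+ suc x)) (trans (l₂ (+ r) t (+ suc x)) (sym y≡))
         where
           l₁ : ∀ r x → 0ℤ *ᶻ r +ᶻ 1ℤ *ᶻ x ≡ x
           l₁ = solve-∀
           l₂ : ∀ r t x → 1ℤ *ᶻ r +ᶻ t *ᶻ x ≡ r +ᶻ t *ᶻ x
           l₂ = solve-∀
       τ⁻¹v : τ⁻¹ t · (+ suc x , + y) ≡ (+ r , + suc x)
       τ⁻¹v = cong₂ _,_ (trans (cong (λ z → (-ᶻ t) *ᶻ + suc x +ᶻ 1ℤ *ᶻ z) y≡) (l₁ (+ r) t (+ suc x))) (l₂ (+ suc x) (+ y))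
         where
           l₁ : ∀ r t x → (-ᶻ t) *ᶻ x +ᶻ 1ℤ *ᶻ (r +ᶻ t *ᶻ x) ≡ r
           l₁ = solve-∀
           l₂ : ∀ x y → 1ℤ *ᶻ x +ᶻ 0ℤ *ᶻ y ≡ x
           l₂ = solve-∀

 module PrimeDivisor {ℓ : ℕ} (ℓ-prime : Prime ℓ) where

   instance
     ℓ-nonZero : ℕ.NonZero ℓ
     ℓ-nonZero = prime⇒nonZero ℓ-prime

   L : ℤ
   L = + ℓ

   L-nonZero : ℤ.NonZero L
   L-nonZero = ℓ-nonZero

   infix 4 ℓ∣_
   ℓ∣_ : ℤ → Set
   ℓ∣ x = ∃ λ q → x ≡ L *ᶻ q

   to∣ : ∀ {x} → ℓ∣ x → ℓ ℕD.∣ ∣ x ∣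
   to∣ (q , refl) = subst (ℓ ℕD.∣_) (sym (ℤP.abs-* L q)) (ℕD.m∣m*n ∣ q ∣)

   from∣ : ∀ {x} → ℓ ℕD.∣ ∣ x ∣ → ℓ∣ x
   from∣ {x} d with ℤD.∣ᵤ⇒∣ {+ ℓ} {x} d
   ... | ℤD.divides q eq = q , trans eq (ℤP.*-comm q L)

   ℓ∣? : ∀ x → Dec (ℓ∣ x)
   ℓ∣? x with ℓ ℕD.∣? ∣ x ∣
   ... | yes d = yes (from∣ d)
   ... | no ¬d = no (¬d ∘ to∣)

   split : ∀ {x y} → ℓ∣ x *ᶻ y → ℓ∣ x ⊎ ℓ∣ y
   split {x} {y} d with euclidsLemma ∣ x ∣ ∣ y ∣ ℓ-prime (subst (ℓ ℕD.∣_) (ℤP.abs-* x y) (to∣ d))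
   ... | inj₁ p = inj₁ (from∣ p)
   ... | inj₂ p = inj₂ (from∣ p)

   split-sq : ∀ {x} → ℓ∣ x *ᶻ x → ℓ∣ x
   split-sq d with split d
   ... | inj₁ p = p
   ... | inj₂ p = p

   other : ∀ {x y} → ¬ ℓ∣ x → ℓ∣ x *ᶻ y → ℓ∣ y
   other ∤x d with split d
   ... | inj₁ p = ⊥-elim (∤x p)
   ... | inj₂ p = p

   cancel : ∀ {x y} → L *ᶻ x ≡ L *ᶻ y → x ≡ y
   cancel {x} {y} = ℤP.*-cancelˡ-≡ L x y {{L-nonZero}}

   solve-linear : ∀ A B → ¬ ℓ∣ A → ∃ λ b → b < ℓ × ℓ∣ (B -ᶻ A *ᶻ + b)
   solve-linear A B ∤A = go (coprime-Bézout coprime)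
     where
       coprime : Coprime ∣ A ∣ ℓ
       coprime (d∣A , d∣ℓ) with prime⇒irreducible ℓ-prime d∣ℓ
       ... | inj₁ p    = p
       ... | inj₂ refl = ⊥-elim (∤A (from∣ d∣A))
       from-unit : (∃ λ u → ℓ∣ (1ℤ -ᶻ A *ᶻ u)) → ∃ λ b → b < ℓ × ℓ∣ (B -ᶻ A *ᶻ + b)
       from-unit (u , v , eq) = c ℤDM.%ℕ ℓ , ℤDM.n%ℕd<d c ℓ , v *ᶻ B +ᶻ A *ᶻ q ,
         trans (lem₁ A B u b q L (ℤDM.a≡a%ℕn+[a/ℕn]*n c ℓ)) (trans (cong (λ z → z *ᶻ B +ᶻ A *ᶻ (q *ᶻ L)) eq) (lem₂ L v B A q))
         where
           c = u *ᶻ B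
           b = + (c ℤDM.%ℕ ℓ)
           q = c ℤDM./ℕ ℓ
           lem₁ : ∀ A B u b q L → u *ᶻ B ≡ b +ᶻ q *ᶻ L → B -ᶻ A *ᶻ b ≡ (1ℤ -ᶻ A *ᶻ u) *ᶻ B +ᶻ A *ᶻ (q *ᶻ L)
           lem₁ A B u b q L eq = trans (l A B b q L) (trans (cong (λ z → B -ᶻ A *ᶻ z +ᶻ A *ᶻ (q *ᶻ L)) (sym eq)) (r A B u (q *ᶻ L)))
             where
               l : ∀ A B b q L → B -ᶻ A *ᶻ b ≡ B -ᶻ A *ᶻ (b +ᶻ q *ᶻ L) +ᶻ A *ᶻ (q *ᶻ L)
               l = solve-∀
               r : ∀ A B u q → B -ᶻ A *ᶻ (u *ᶻ B) +ᶻ A *ᶻ q ≡ (1ℤ -ᶻ A *ᶻ u) *ᶻ B +ᶻ A *ᶻ q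
               r = solve-∀
           lem₂ : ∀ L v B A q → L *ᶻ v *ᶻ B +ᶻ A *ᶻ (q *ᶻ L) ≡ L *ᶻ (v *ᶻ B +ᶻ A *ᶻ q)
           lem₂ = solve-∀
       abs-unit : ∀ A → (∃ λ u → ℓ∣ (1ℤ -ᶻ + ∣ A ∣ *ᶻ u)) → ∃ λ u → ℓ∣ (1ℤ -ᶻ A *ᶻ u)
       abs-unit (+ n)    p           = p
       abs-unit -[1+ n ] (u , v , eq) = -ᶻ u , v , trans (cong (λ z → 1ℤ -ᶻ z) (lem (+ suc n) u)) eq
         where
           lem : ∀ n u → (-ᶻ n) *ᶻ (-ᶻ u) ≡ n *ᶻ u
           lem = solve-∀
       go : Bézout.Identity 1 ∣ A ∣ ℓ → ∃ λ b → b < ℓ × ℓ∣ (B -ᶻ A *ᶻ + b)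
       go (Bézout.+- x y eq) = from-unit (abs-unit A (+ x , -ᶻ + y , lem (+ ∣ A ∣) (+ x) (+ y) L
         (trans (cong (1ℤ +ᶻ_) (sym (ℤP.pos-* y ℓ))) (trans (cong +_ eq) (ℤP.pos-* x ∣ A ∣)))))
         where
           lem : ∀ a x y l → 1ℤ +ᶻ y *ᶻ l ≡ x *ᶻ a → 1ℤ -ᶻ a *ᶻ x ≡ l *ᶻ -ᶻ y
           lem a x y l eq = trans (r a x) (trans (cong (λ z → 1ℤ -ᶻ z) (sym eq)) (t y l))
             where
               r : ∀ a x → 1ℤ -ᶻ a *ᶻ x ≡ 1ℤ -ᶻ x *ᶻ a
               r = solve-∀
               t : ∀ y l → 1ℤ -ᶻ (1ℤ +ᶻ y *ᶻ l) ≡ l *ᶻ -ᶻ y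
               t = solve-∀
       go (Bézout.-+ x y eq) = from-unit (abs-unit A (-ᶻ + x , + y , lem (+ ∣ A ∣) (+ x) (+ y) L
         (trans (cong (1ℤ +ᶻ_) (sym (ℤP.pos-* x ∣ A ∣))) (trans (cong +_ eq) (ℤP.pos-* y ℓ)))))
         where
           lem : ∀ a x y l → 1ℤ +ᶻ x *ᶻ a ≡ y *ᶻ l → 1ℤ -ᶻ a *ᶻ -ᶻ x ≡ l *ᶻ y
           lem a x y l eq = trans (r a x) (trans eq (ℤP.*-comm y l))
             where
               r : ∀ a x → 1ℤ -ᶻ a *ᶻ -ᶻ x ≡ 1ℤ +ᶻ x *ᶻ a
               r = solve-∀

   residue-unique : ∀ {b c} → b < ℓ → c < ℓ → ℓ∣ (+ b -ᶻ + c) → b ≡ c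
   residue-unique {b} {c} b<ℓ c<ℓ d = ℤP.+-injective (ℤP.i-j≡0⇒i≡j (+ b) (+ c) (ℤP.∣i∣≡0⇒i≡0 (small (subst (λ z → ℓ ℕD.∣ ∣ z ∣) (ℤP.m-n≡m⊖n b c) (to∣ d)))))
     where
       zero-if-small : ∀ {n} → n < ℓ → ℓ ℕD.∣ n → n ≡ 0
       zero-if-small {zero}  _   _ = refl
       zero-if-small {suc n} n<ℓ d = ⊥-elim (ℕP.<⇒≱ n<ℓ (ℕD.∣⇒≤ d))
       small : ℓ ℕD.∣ ∣ b ℤ.⊖ c ∣ → ∣ + b -ᶻ + c ∣ ≡ 0
       small d = trans (cong ∣_∣ (ℤP.m-n≡m⊖n b c)) (zero-if-small (ℕP.≤-<-trans (ℤP.∣m⊝n∣≤m⊔n b c) (ℕP.⊔-lub b<ℓ c<ℓ)) d)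

-- Forms of discriminant ℓ³n and matrices of determinant ℓ.

module HeckeCosets where

 open TripleSums
 open QuadraticForms
 open EuclideanPaths

 module Hecke {ℓ : ℕ} (ℓ-prime : Prime ℓ) (n : ℕ) (ℓ∤n : ¬ ℓ ℕD.∣ n) where

   open PrimeDivisor ℓ-prime

   ∤n : ¬ ℓ∣ + n
   ∤n = ℓ∤n ∘ to∣

   N : ℕ
   N = ℓ ℕ.* n

   N-pos : + N ≡ L *ᶻ + n
   N-pos = ℤP.pos-* ℓ n

   -- The exponent of ℓ is even in u² and odd in ℓn·y² unless y = 0. This is carried out as a
   -- descent on |y|: first ℓ divides u, then y.
   irrational : Irrational N
   irrational u y eq = descent (suc ∣ y ∣) u y ℕP.≤-refl eq
     where
       1<ℓ : 1 < ℓ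
       1<ℓ = ℕ.nonTrivial⇒n>1 ℓ {{prime⇒nonTrivial ℓ-prime}}
       shift : ∀ {y y′} → y ≡ L *ᶻ y′ → (∣ y ∣ ≡ 0) ⊎ (∣ y′ ∣ < ∣ y ∣)
       shift {y′ = y′} refl = by ∣ y′ ∣ refl
         where
           by : ∀ k → ∣ y′ ∣ ≡ k → (∣ L *ᶻ y′ ∣ ≡ 0) ⊎ (∣ y′ ∣ < ∣ L *ᶻ y′ ∣)
           by zero    eq = inj₁ (trans (ℤP.abs-* L y′) (trans (cong (ℓ ℕ.*_) eq) (ℕP.*-zeroʳ ℓ)))
           by (suc k) eq = inj₂ (subst₂ _<_ (sym eq) (trans (ℕP.*-comm (suc k) ℓ) (sym (trans (ℤP.abs-* L y′) (cong (ℓ ℕ.*_) eq)))) (ℕP.m<m*n (suc k) ℓ 1<ℓ))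
       l₁ : ∀ L u → L *ᶻ (L *ᶻ (u *ᶻ u)) ≡ L *ᶻ u *ᶻ (L *ᶻ u)
       l₁ = solve-∀
       l₂ : ∀ L n y → L *ᶻ n *ᶻ (L *ᶻ y *ᶻ (L *ᶻ y)) ≡ L *ᶻ (L *ᶻ (L *ᶻ n *ᶻ (y *ᶻ y)))
       l₂ = solve-∀
       expand : ∀ {x y} → x ≡ + N *ᶻ (y *ᶻ y) → x ≡ L *ᶻ (+ n *ᶻ (y *ᶻ y))
       expand {y = y} eq = trans eq (trans (cong (_*ᶻ (y *ᶻ y)) N-pos) (ℤP.*-assoc L (+ n) (y *ᶻ y)))
       descent : ∀ f u y → ∣ y ∣ < f → u *ᶻ u ≡ + N *ᶻ (y *ᶻ y) → y ≡ 0ℤ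
       descent-u : ∀ f u y → ∣ y ∣ ≤ f → u *ᶻ u ≡ + N *ᶻ (y *ᶻ y) → ℓ∣ u → y ≡ 0ℤ
       descent-y : ∀ f u′ y → ∣ y ∣ ≤ f → L *ᶻ u′ *ᶻ (L *ᶻ u′) ≡ + N *ᶻ (y *ᶻ y) → (d : ℓ∣ y) → (∣ y ∣ ≡ 0) ⊎ (∣ proj₁ d ∣ < ∣ y ∣) → y ≡ 0ℤ
       descent (suc f) u y (s≤s y≤f) eq = descent-u f u y y≤f eq (split-sq {u} (+ n *ᶻ (y *ᶻ y) , expand {y = y} eq))
       descent-u f _ y y≤f eq (u′ , refl) = descent-y f u′ y y≤f eq d (shift {y} (proj₂ d))
         where
           d : ℓ∣ y
           d = split-sq {y} (other {+ n} {y *ᶻ y} ∤n (u′ *ᶻ u′ , sym (cancel (trans (l₁ L u′) (expand {y = y} eq)))))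
       descent-y f u′ y y≤f eq _          (inj₁ y=0)  = ℤP.∣i∣≡0⇒i≡0 y=0
       descent-y f u′ _ y≤f eq (y′ , refl) (inj₂ y′<y) = trans (cong (L *ᶻ_) (descent f u′ y′ (ℕP.<-≤-trans y′<y y≤f) (cancel (cancel (trans (l₁ L u′) (trans eq
         (trans (cong (λ m → m *ᶻ (L *ᶻ y′ *ᶻ (L *ᶻ y′))) N-pos) (trans (l₂ L (+ n) y′) (cong (λ m → L *ᶻ (L *ᶻ (m *ᶻ (y′ *ᶻ y′)))) (sym N-pos)))))))))) (ℤP.*-zeroʳ L)

   irrational′ : Irrational (N ℕ.* (ℓ ℕ.* ℓ))
   irrational′ u y eq = cancel (trans (irrational u (L *ᶻ y) (trans eq (trans (cong (_*ᶻ (y *ᶻ y)) (trans (ℤP.pos-* N (ℓ ℕ.* ℓ)) (cong (+ N *ᶻ_) (ℤP.pos-* ℓ ℓ)))) (lem (+ N) L y)))) (sym (ℤP.*-zeroʳ L)))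
     where
       lem : ∀ N L y → N *ᶻ (L *ᶻ L) *ᶻ (y *ᶻ y) ≡ N *ᶻ (L *ᶻ y *ᶻ (L *ᶻ y))
       lem = solve-∀

   -- Representatives of the matrices of determinant ℓ modulo SL₂(ℤ)

   g∞ : Matrix
   g∞ = (L , 0ℤ) , e₂

   g : ℕ → Matrix
   g b = e₁ , (+ b , L)

   From : Matrix → Quadratic → Set
   From M Q′ = ∃ λ Q → disc Q ≡ + N × Q ∘ᴹ M ≡ Q′

   g-coefficients : ∀ a β c b → (a , β , c) ∘ᴹ g b ≡ (a , a *ᶻ + b +ᶻ β *ᶻ L , a *ᶻ (+ b *ᶻ + b) +ᶻ + 2 *ᶻ (β *ᶻ (+ b *ᶻ L)) +ᶻ c *ᶻ (L *ᶻ L))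
   g-coefficients a β c b = cong₂ _,_ (value-e₁ (a , β , c)) (cong₂ _,_ (lem a β c (+ b) L) refl)
     where
       lem : ∀ a β c b L → a *ᶻ (1ℤ *ᶻ b) +ᶻ β *ᶻ (1ℤ *ᶻ L +ᶻ 0ℤ *ᶻ b) +ᶻ c *ᶻ (0ℤ *ᶻ L) ≡ a *ᶻ b +ᶻ β *ᶻ L
       lem = solve-∀

   g∞-coefficients : ∀ a β c → (a , β , c) ∘ᴹ g∞ ≡ (a *ᶻ (L *ᶻ L) , β *ᶻ L , c)
   g∞-coefficients a β c = cong₂ _,_ (l₁ a β c L) (cong₂ _,_ (l₂ a β c L) (value-e₂ (a , β , c)))
     where
       l₁ : ∀ a β c L → a *ᶻ (L *ᶻ L) +ᶻ + 2 *ᶻ (β *ᶻ (L *ᶻ 0ℤ)) +ᶻ c *ᶻ 0ℤ ≡ a *ᶻ (L *ᶻ L)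
       l₁ = solve-∀
       l₂ : ∀ a β c L → a *ᶻ (L *ᶻ 0ℤ) +ᶻ β *ᶻ (L *ᶻ 1ℤ +ᶻ 0ℤ) +ᶻ c *ᶻ 0ℤ ≡ β *ᶻ L
       l₂ = solve-∀

   disc-N : ∀ {a β c} → disc (a , β , c) ≡ + N → β *ᶻ β ≡ a *ᶻ c +ᶻ L *ᶻ + n
   disc-N {a} {β} {c} eq = trans (lem β a c) (cong (a *ᶻ c +ᶻ_) (trans eq N-pos))
     where
       lem : ∀ β a c → β *ᶻ β ≡ a *ᶻ c +ᶻ (β *ᶻ β -ᶻ a *ᶻ c)
       lem = solve-∀

   -- ℓ divides the discriminant exactly once, hence a at most once.
   ramified : ∀ {a β c} → disc (a , β , c) ≡ + N → ℓ∣ a → ∃₂ λ a′ β′ → a ≡ L *ᶻ a′ × β ≡ L *ᶻ β′ × ¬ ℓ∣ a′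
   ramified {β = β} {c} eq (a′ , refl) = go eq (split-sq {β} (a′ *ᶻ c +ᶻ + n , trans (disc-N {L *ᶻ a′} {β} {c} eq) (l₀ L a′ c (+ n))))
     where
       l₁ : ∀ n x → n ≡ (x +ᶻ n) -ᶻ x
       l₁ = solve-∀
       l₂ : ∀ L β → L *ᶻ (L *ᶻ (β *ᶻ β)) ≡ L *ᶻ β *ᶻ (L *ᶻ β)
       l₂ = solve-∀
       l₃ : ∀ L q c n → L *ᶻ (L *ᶻ q) *ᶻ c +ᶻ L *ᶻ n ≡ L *ᶻ (L *ᶻ q *ᶻ c +ᶻ n)
       l₃ = solve-∀
       l₄ : ∀ L β q c → L *ᶻ (β *ᶻ β) -ᶻ L *ᶻ q *ᶻ c ≡ L *ᶻ (β *ᶻ β -ᶻ q *ᶻ c)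
       l₄ = solve-∀
       l₀ : ∀ L a c n → L *ᶻ a *ᶻ c +ᶻ L *ᶻ n ≡ L *ᶻ (a *ᶻ c +ᶻ n)
       l₀ = solve-∀
       go : ∀ {β} → disc (L *ᶻ a′ , β , c) ≡ + N → ℓ∣ β → ∃₂ λ a″ β′ → L *ᶻ a′ ≡ L *ᶻ a″ × β ≡ L *ᶻ β′ × ¬ ℓ∣ a″
       go eq (β′ , refl) = a′ , β′ , refl , refl , not eq
         where
           not : ∀ {a} → disc (L *ᶻ a , L *ᶻ β′ , c) ≡ + N → ¬ ℓ∣ a
           not eq (q , refl) = ∤n (β′ *ᶻ β′ -ᶻ q *ᶻ c , trans (l₁ (+ n) (L *ᶻ q *ᶻ c))
             (trans (cong (λ z → z -ᶻ L *ᶻ q *ᶻ c) (sym (cancel (trans (l₂ L β′) (trans (disc-N {L *ᶻ (L *ᶻ q)} {L *ᶻ β′} {c} eq) (l₃ L q c (+ n)))))))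
                    (l₄ L β′ q c)))

   -- A form coming from g∞ has leading coefficient divisible by ℓ². A form coming from `g b` keeps
   -- the leading coefficient of a form of discriminant ℓn, which contains ℓ at most once.
   disjoint∞ : ∀ {Q′} b → From g∞ Q′ → From (g b) Q′ → ⊥
   disjoint∞ b ((a , β , c) , d , eq) ((a₂ , β₂ , c₂) , d₂ , eq₂) = go (ramified {a₂} {β₂} {c₂} d₂ (L *ᶻ a , trans a₂≡ (lem a L)))
     where
       a₂≡ : a₂ ≡ a *ᶻ (L *ᶻ L)
       a₂≡ = cong proj₁ (trans (sym (g-coefficients a₂ β₂ c₂ b)) (trans eq₂ (trans (sym eq) (g∞-coefficients a β c))))
       lem : ∀ a L → a *ᶻ (L *ᶻ L) ≡ L *ᶻ (L *ᶻ a)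
       lem = solve-∀
       go : (∃₂ λ a′ β′ → a₂ ≡ L *ᶻ a′ × β₂ ≡ L *ᶻ β′ × ¬ ℓ∣ a′) → ⊥
       go (a′ , _ , p , _ , ∤a′) = ∤a′ (a , cancel (trans (sym p) (trans a₂≡ (lem a L))))

   -- Comparing the middle coefficients, ℓ divides a(b - b₂). If ℓ divides a, it also divides both β
   -- and β₂, and the equation can be divided by ℓ once more, with a/ℓ now prime to ℓ.
   disjoint : ∀ {Q′} b b₂ → b < ℓ → b₂ < ℓ → From (g b) Q′ → From (g b₂) Q′ → b ≡ b₂
   disjoint b b₂ b<ℓ b₂<ℓ ((a , β , c) , d , eq) ((a₂ , β₂ , c₂) , d₂ , eq₂) = residue-unique b<ℓ b₂<ℓ (go (ℓ∣? a))
     where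
       same = trans (sym (g-coefficients a β c b)) (trans eq (trans (sym eq₂) (g-coefficients a₂ β₂ c₂ b₂)))
       a≡ : a ≡ a₂
       a≡ = cong proj₁ same
       mid : a *ᶻ + b +ᶻ β *ᶻ L ≡ a *ᶻ + b₂ +ᶻ β₂ *ᶻ L
       mid = trans (cong (proj₁ ∘ proj₂) same) (cong (λ z → z *ᶻ + b₂ +ᶻ β₂ *ᶻ L) (sym a≡))
       diff : a *ᶻ (+ b -ᶻ + b₂) ≡ L *ᶻ (β₂ -ᶻ β)
       diff = trans (l₁ a (+ b) (+ b₂) (β *ᶻ L)) (trans (cong (λ z → z -ᶻ (a *ᶻ + b₂ +ᶻ β *ᶻ L)) mid) (l₂ a (+ b₂) β₂ β L))
         where
           l₁ : ∀ a b c x → a *ᶻ (b -ᶻ c) ≡ (a *ᶻ b +ᶻ x) -ᶻ (a *ᶻ c +ᶻ x)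
           l₁ = solve-∀
           l₂ : ∀ a b x y L → (a *ᶻ b +ᶻ x *ᶻ L) -ᶻ (a *ᶻ b +ᶻ y *ᶻ L) ≡ L *ᶻ (x -ᶻ y)
           l₂ = solve-∀
       go : Dec (ℓ∣ a) → ℓ∣ (+ b -ᶻ + b₂)
       go (no ∤a) = other ∤a (β₂ -ᶻ β , diff)
       go (yes d′) with ramified {a} {β} {c} d d′ | ramified {a₂} {β₂} {c₂} d₂ (subst ℓ∣_ a≡ d′)
       ... | a′ , β′ , a= , β= , ∤a′ | _ , β₂′ , _ , β₂= , _ = other ∤a′ (β₂′ -ᶻ β′ , cancel (trans (l₁ L a′ (+ b -ᶻ + b₂))
             (trans (cong (_*ᶻ (+ b -ᶻ + b₂)) (sym a=)) (trans diff (trans (cong₂ (λ x y → L *ᶻ (x -ᶻ y)) β₂= β=) (l₂ L β₂′ β′))))))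
         where
           l₁ : ∀ L a x → L *ᶻ (a *ᶻ x) ≡ L *ᶻ a *ᶻ x
           l₁ = solve-∀
           l₂ : ∀ L x y → L *ᶻ (L *ᶻ x -ᶻ L *ᶻ y) ≡ L *ᶻ (L *ᶻ (x -ᶻ y))
           l₂ = solve-∀

   -- Coming from `g b` means that a translation by b makes the middle coefficient divisible by ℓ
   -- and the last one by ℓ². The discriminant ℓ³n forces the second condition once b is chosen
   -- properly; how often ℓ divides A decides between g∞ and the matrices `g b`.
   cover : ∀ Q′ → disc Q′ ≡ + (N ℕ.* (ℓ ℕ.* ℓ)) → From g∞ Q′ ⊎ ∃ λ b → b < ℓ × From (g b) Q′
   cover (A , B , C) eq = go (ℓ∣? A)
     where
       δ = + n
       disc′ : ∀ {A B C} → disc (A , B , C) ≡ + (N ℕ.* (ℓ ℕ.* ℓ)) → B *ᶻ B ≡ A *ᶻ C +ᶻ L *ᶻ (L *ᶻ (L *ᶻ δ))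
       disc′ {A} {B} {C} eq = trans (l₁ A B C) (cong (A *ᶻ C +ᶻ_) (trans eq (trans (ℤP.pos-* N (ℓ ℕ.* ℓ)) (trans (cong₂ _*ᶻ_ N-pos (ℤP.pos-* ℓ ℓ)) (l₂ L δ)))))
         where
           l₁ : ∀ A B C → B *ᶻ B ≡ A *ᶻ C +ᶻ (B *ᶻ B -ᶻ A *ᶻ C)
           l₁ = solve-∀
           l₂ : ∀ L δ → L *ᶻ δ *ᶻ (L *ᶻ L) ≡ L *ᶻ (L *ᶻ (L *ᶻ δ))
           l₂ = solve-∀
       disc-from : ∀ a β c → β *ᶻ β ≡ a *ᶻ c +ᶻ L *ᶻ δ → disc (a , β , c) ≡ + N
       disc-from a β c eq = trans (cong (λ z → z -ᶻ a *ᶻ c) eq) (trans (lem (a *ᶻ c) (L *ᶻ δ)) (sym N-pos))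
         where
           lem : ∀ x y → x +ᶻ y -ᶻ x ≡ y
           lem = solve-∀
       subtract : ∀ {x y z} → x -ᶻ y ≡ z → x ≡ z +ᶻ y
       subtract {x} {y} refl = lem x y
         where
           lem : ∀ x y → x ≡ x -ᶻ y +ᶻ y
           lem = solve-∀

       go : Dec (ℓ∣ A) → From g∞ (A , B , C) ⊎ ∃ λ b → b < ℓ × From (g b) (A , B , C)
       -- With B - Ab = ℓβ the translated last coefficient X satisfies AX = ℓ²β² - ℓ³n, so ℓ²
       -- divides X.
       go (no ∤A) = inj₂ (at (solve-linear A B ∤A))
         where
          at : (∃ λ b → b < ℓ × ℓ∣ (B -ᶻ A *ᶻ + b)) → ∃ λ b → b < ℓ × From (g b) (A , B , C)
          at (b , b<ℓ , β , lin) = b , b<ℓ , finish (other {A} {X} ∤A (_ , key₁))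
           where
             X = C -ᶻ + 2 *ᶻ (+ b *ᶻ B) +ᶻ A *ᶻ (+ b *ᶻ + b)
             key : A *ᶻ X ≡ L *ᶻ β *ᶻ (L *ᶻ β) -ᶻ L *ᶻ (L *ᶻ (L *ᶻ δ))
             key = trans (l A B C (+ b)) (trans (cong₂ (λ x y → x *ᶻ x -ᶻ (y -ᶻ A *ᶻ C)) lin (disc′ {A} {B} {C} eq)) (r (L *ᶻ β *ᶻ (L *ᶻ β)) (A *ᶻ C) _))
               where
                 l : ∀ A B C b → A *ᶻ (C -ᶻ + 2 *ᶻ (b *ᶻ B) +ᶻ A *ᶻ (b *ᶻ b)) ≡ (B -ᶻ A *ᶻ b) *ᶻ (B -ᶻ A *ᶻ b) -ᶻ (B *ᶻ B -ᶻ A *ᶻ C)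
                 l = solve-∀
                 r : ∀ x y z → x -ᶻ (y +ᶻ z -ᶻ y) ≡ x -ᶻ z
                 r = solve-∀
             key₁ : A *ᶻ X ≡ L *ᶻ (L *ᶻ (β *ᶻ β -ᶻ L *ᶻ δ))
             key₁ = trans key (l L β δ)
               where
                 l : ∀ L β δ → L *ᶻ β *ᶻ (L *ᶻ β) -ᶻ L *ᶻ (L *ᶻ (L *ᶻ δ)) ≡ L *ᶻ (L *ᶻ (β *ᶻ β -ᶻ L *ᶻ δ))
                 l = solve-∀
             finish : ℓ∣ X → From (g b) (A , B , C)
             finish (X₁ , X≡) = finish₁ (cancel {A *ᶻ X₁} (trans (c₀ A X₁ L) (trans (cong (A *ᶻ_) (sym X≡)) key₁)))
               where
                 c₀ : ∀ A x L → L *ᶻ (A *ᶻ x) ≡ A *ᶻ (L *ᶻ x)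
                 c₀ = solve-∀
                 finish₁ : A *ᶻ X₁ ≡ L *ᶻ (β *ᶻ β -ᶻ L *ᶻ δ) → From (g b) (A , B , C)
                 finish₁ key₂ = finish₂ (other {A} {X₁} ∤A (_ , key₂))
                   where
                    finish₂ : ℓ∣ X₁ → From (g b) (A , B , C)
                    finish₂ (c , X₁≡) = (A , β , c) , disc-from A β c (trans (s (β *ᶻ β) (L *ᶻ δ)) (cong (_+ᶻ L *ᶻ δ) (sym (cancel (trans (t A c L) (trans (cong (A *ᶻ_) (sym X₁≡)) key₂))))))
                      , trans (g-coefficients A β c b) (cong₂ _,_ refl (cong₂ _,_ (trans (u A (+ b) β L) (sym B≡))
                       (trans (v A (+ b) β c L) (trans (cong₂ (λ x y → x +ᶻ + 2 *ᶻ (+ b *ᶻ y) -ᶻ A *ᶻ (+ b *ᶻ + b)) (sym (trans X≡ (cong (L *ᶻ_) X₁≡))) (sym B≡)) (w A B C (+ b))))))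
                     where
                       B≡ : B ≡ L *ᶻ β +ᶻ A *ᶻ + b
                       B≡ = subtract lin
                       s : ∀ x y → x ≡ x -ᶻ y +ᶻ y
                       s = solve-∀
                       t : ∀ A c L → L *ᶻ (A *ᶻ c) ≡ A *ᶻ (L *ᶻ c)
                       t = solve-∀
                       u : ∀ A b β L → A *ᶻ b +ᶻ β *ᶻ L ≡ L *ᶻ β +ᶻ A *ᶻ b
                       u = solve-∀
                       v : ∀ A b β c L → A *ᶻ (b *ᶻ b) +ᶻ + 2 *ᶻ (β *ᶻ (b *ᶻ L)) +ᶻ c *ᶻ (L *ᶻ L) ≡ L *ᶻ (L *ᶻ c) +ᶻ + 2 *ᶻ (b *ᶻ (L *ᶻ β +ᶻ A *ᶻ b)) -ᶻ A *ᶻ (b *ᶻ b)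
                       v = solve-∀
                       w : ∀ A B C b → (C -ᶻ + 2 *ᶻ (b *ᶻ B) +ᶻ A *ᶻ (b *ᶻ b)) +ᶻ + 2 *ᶻ (b *ᶻ B) -ᶻ A *ᶻ (b *ᶻ b) ≡ C
                       w = solve-∀
       -- Now B = ℓB₁ and ℓB₁² = A₁C + ℓ²n. If ℓ divides A₁, the matrix is g∞. Otherwise ℓ divides
       -- C, the form (A₁, B₁, C/ℓ) has discriminant ℓn, and the translation argument applies with b
       -- solving B₁ = A₁b modulo ℓ.
       go (yes (A₁ , A≡)) = over A₁ A≡ eq (split-sq {B} (_ , trans (disc′ {L *ᶻ A₁} {B} {C} (subst (λ z → disc (z , B , C) ≡ + (N ℕ.* (ℓ ℕ.* ℓ))) A≡ eq)) (l₀ L A₁ C (L *ᶻ (L *ᶻ δ)))))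
         where
          l₀ : ∀ L A C x → L *ᶻ A *ᶻ C +ᶻ L *ᶻ x ≡ L *ᶻ (A *ᶻ C +ᶻ x)
          l₀ = solve-∀
          over : ∀ {A B C} A₁ → A ≡ L *ᶻ A₁ → disc (A , B , C) ≡ + (N ℕ.* (ℓ ℕ.* ℓ)) → ℓ∣ B → From g∞ (A , B , C) ⊎ ∃ λ b → b < ℓ × From (g b) (A , B , C)
          over {C = C} A₁ refl eq (B₁ , refl) = go₁ (ℓ∣? A₁)
           where
           key : L *ᶻ (B₁ *ᶻ B₁) ≡ A₁ *ᶻ C +ᶻ L *ᶻ (L *ᶻ δ)
           key = cancel (trans (l L B₁) (trans (disc′ {L *ᶻ A₁} {L *ᶻ B₁} {C} eq) (r L A₁ C (L *ᶻ (L *ᶻ δ)))))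
             where
               l : ∀ L B → L *ᶻ (L *ᶻ (B *ᶻ B)) ≡ L *ᶻ B *ᶻ (L *ᶻ B)
               l = solve-∀
               r : ∀ L A C x → L *ᶻ A *ᶻ C +ᶻ L *ᶻ x ≡ L *ᶻ (A *ᶻ C +ᶻ x)
               r = solve-∀
           A₁C : A₁ *ᶻ C ≡ L *ᶻ (B₁ *ᶻ B₁ -ᶻ L *ᶻ δ)
           A₁C = trans (l (A₁ *ᶻ C) (L *ᶻ (L *ᶻ δ))) (trans (cong (λ z → z -ᶻ L *ᶻ (L *ᶻ δ)) (sym key)) (r L (B₁ *ᶻ B₁) (L *ᶻ δ)))
             where
               l : ∀ x y → x ≡ x +ᶻ y -ᶻ y
               l = solve-∀
               r : ∀ L x y → L *ᶻ x -ᶻ L *ᶻ y ≡ L *ᶻ (x -ᶻ y)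
               r = solve-∀
           go₁ : Dec (ℓ∣ A₁) → From g∞ (L *ᶻ A₁ , L *ᶻ B₁ , C) ⊎ ∃ λ b → b < ℓ × From (g b) (L *ᶻ A₁ , L *ᶻ B₁ , C)
           go₁ (yes (A₂ , refl)) = inj₁ ((A₂ , B₁ , C) , disc-from A₂ B₁ C (cancel (trans key (l L A₂ C (L *ᶻ δ))))
               , trans (g∞-coefficients A₂ B₁ C) (cong₂ _,_ (r A₂ L) (cong₂ _,_ (ℤP.*-comm B₁ L) refl)))
             where
               l : ∀ L A C x → L *ᶻ A *ᶻ C +ᶻ L *ᶻ x ≡ L *ᶻ (A *ᶻ C +ᶻ x)
               l = solve-∀
               r : ∀ A L → A *ᶻ (L *ᶻ L) ≡ L *ᶻ (L *ᶻ A)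
               r = solve-∀
           go₁ (no ∤A₁) = inj₂ (below A₁C (other {A₁} {C} ∤A₁ (_ , A₁C)) (solve-linear A₁ B₁ ∤A₁))
            where
            below : ∀ {C} → A₁ *ᶻ C ≡ L *ᶻ (B₁ *ᶻ B₁ -ᶻ L *ᶻ δ) → ℓ∣ C → (∃ λ b → b < ℓ × ℓ∣ (B₁ -ᶻ A₁ *ᶻ + b)) → ∃ λ b → b < ℓ × From (g b) (L *ᶻ A₁ , L *ᶻ B₁ , C)
            below A₁C (C₁ , refl) (b , b<ℓ , β , lin) = b , b<ℓ , finish (other {A₁} {X} ∤A₁ (_ , key₂))
             where
               X = C₁ -ᶻ + 2 *ᶻ (+ b *ᶻ B₁) +ᶻ A₁ *ᶻ (+ b *ᶻ + b)
               key₁ : A₁ *ᶻ C₁ ≡ B₁ *ᶻ B₁ -ᶻ L *ᶻ δ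
               key₁ = cancel (trans (l A₁ C₁ L) A₁C)
                 where
                   l : ∀ A x L → L *ᶻ (A *ᶻ x) ≡ A *ᶻ (L *ᶻ x)
                   l = solve-∀
               key₂ : A₁ *ᶻ X ≡ L *ᶻ (L *ᶻ (β *ᶻ β) -ᶻ δ)
               key₂ = trans (l A₁ B₁ C₁ (+ b)) (trans (cong₂ (λ x y → x *ᶻ x -ᶻ (B₁ *ᶻ B₁ -ᶻ y)) lin key₁) (r L β δ (B₁ *ᶻ B₁)))
                 where
                   l : ∀ A B C b → A *ᶻ (C -ᶻ + 2 *ᶻ (b *ᶻ B) +ᶻ A *ᶻ (b *ᶻ b)) ≡ (B -ᶻ A *ᶻ b) *ᶻ (B -ᶻ A *ᶻ b) -ᶻ (B *ᶻ B -ᶻ A *ᶻ C)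
                   l = solve-∀
                   r : ∀ L β δ x → L *ᶻ β *ᶻ (L *ᶻ β) -ᶻ (x -ᶻ (x -ᶻ L *ᶻ δ)) ≡ L *ᶻ (L *ᶻ (β *ᶻ β) -ᶻ δ)
                   r = solve-∀
               finish : ℓ∣ X → From (g b) (L *ᶻ A₁ , L *ᶻ B₁ , L *ᶻ C₁)
               finish (c , X≡) = (L *ᶻ A₁ , L *ᶻ β , c) , disc-from (L *ᶻ A₁) (L *ᶻ β) c
                   (trans (s L β δ) (cong (_+ᶻ L *ᶻ δ) (trans (sym key₂) (trans (cong (A₁ *ᶻ_) X≡) (t A₁ c L)))))
                 , trans (g-coefficients (L *ᶻ A₁) (L *ᶻ β) c b) (cong₂ _,_ refl (cong₂ _,_
                     (trans (u L A₁ (+ b) β) (cong (L *ᶻ_) (sym B≡)))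
                     (trans (v L A₁ (+ b) β c) (trans (cong₂ (λ x y → L *ᶻ (x +ᶻ + 2 *ᶻ (+ b *ᶻ y) -ᶻ A₁ *ᶻ (+ b *ᶻ + b))) (sym X≡) (sym B≡)) (cong (L *ᶻ_) (w A₁ B₁ C₁ (+ b)))))))
                 where
                   B≡ : B₁ ≡ L *ᶻ β +ᶻ A₁ *ᶻ + b
                   B≡ = subtract lin
                   s : ∀ L β δ → L *ᶻ β *ᶻ (L *ᶻ β) ≡ L *ᶻ (L *ᶻ (β *ᶻ β) -ᶻ δ) +ᶻ L *ᶻ δ
                   s = solve-∀
                   t : ∀ A c L → A *ᶻ (L *ᶻ c) ≡ L *ᶻ A *ᶻ c
                   t = solve-∀
                   u : ∀ L A b β → L *ᶻ A *ᶻ b +ᶻ L *ᶻ β *ᶻ L ≡ L *ᶻ (L *ᶻ β +ᶻ A *ᶻ b)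
                   u = solve-∀
                   v : ∀ L A b β c → L *ᶻ A *ᶻ (b *ᶻ b) +ᶻ + 2 *ᶻ (L *ᶻ β *ᶻ (b *ᶻ L)) +ᶻ c *ᶻ (L *ᶻ L) ≡ L *ᶻ (L *ᶻ c +ᶻ + 2 *ᶻ (b *ᶻ (L *ᶻ β +ᶻ A *ᶻ b)) -ᶻ A *ᶻ (b *ᶻ b))
                   v = solve-∀
                   w : ∀ A B C b → (C -ᶻ + 2 *ᶻ (b *ᶻ B) +ᶻ A *ᶻ (b *ᶻ b)) +ᶻ + 2 *ᶻ (b *ᶻ B) -ᶻ A *ᶻ (b *ᶻ b) ≡ C
                   w = solve-∀

-- The Hecke operator as a sum over cones.

module HeckeOperator where

 open FiniteSums
 open TripleSums
 open QuadraticForms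
 open EuclideanPaths
 open HeckeCosets

 hecke-matrices : ℕ → ℕ → List Matrix
 hecke-matrices ℓ zero    = ((+ ℓ , 0ℤ) , e₂) ∷ []
 hecke-matrices ℓ (suc b) = path (suc b) e₁ b ℓ ++ hecke-matrices ℓ b

 module HeckeSum {ℓ : ℕ} (ℓ-prime : Prime ℓ) (n : ℕ) (ℓ∤n : ¬ ℓ ℕD.∣ n) (F : Quadratic → ℤ) (odd : Odd F) where

   open PrimeDivisor ℓ-prime
   open Hecke ℓ-prime n ℓ∤n public

   N′ : ℕ
   N′ = N ℕ.* (ℓ ℕ.* ℓ)

   total-cone : Matrix → ℤ
   total-cone = cone {N} irrational F odd

   scalar : ∀ Q → Q ∘ᴹ ((L , 0ℤ) , (0ℤ , L)) ≡ (L *ᶻ (L *ᶻ proj₁ Q) , L *ᶻ (L *ᶻ proj₁ (proj₂ Q)) , L *ᶻ (L *ᶻ proj₂ (proj₂ Q)))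
   scalar (a , b , c) = cong₂ _,_ (l₁ a b c L) (cong₂ _,_ (l₂ a b c L) (l₃ a b c L))
     where
       l₁ : ∀ a b c L → a *ᶻ (L *ᶻ L) +ᶻ + 2 *ᶻ (b *ᶻ (L *ᶻ 0ℤ)) +ᶻ c *ᶻ 0ℤ ≡ L *ᶻ (L *ᶻ a)
       l₁ = solve-∀
       l₂ : ∀ a b c L → a *ᶻ (L *ᶻ 0ℤ) +ᶻ b *ᶻ (L *ᶻ L +ᶻ 0ℤ) +ᶻ c *ᶻ (0ℤ *ᶻ L) ≡ L *ᶻ (L *ᶻ b)
       l₂ = solve-∀
       l₃ : ∀ a b c L → a *ᶻ 0ℤ +ᶻ + 2 *ᶻ (b *ᶻ (0ℤ *ᶻ L)) +ᶻ c *ᶻ (L *ᶻ L) ≡ L *ᶻ (L *ᶻ c)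
       l₃ = solve-∀

   adjugate : Matrix → Matrix
   adjugate ((x₁ , y₁) , (x₂ , y₂)) = (y₂ , -ᶻ y₁) , (-ᶻ x₂ , x₁)

   ⊡-adjugate : ∀ M → det M ≡ L → M ⊡ adjugate M ≡ ((L , 0ℤ) , (0ℤ , L))
   ⊡-adjugate ((x₁ , y₁) , (x₂ , y₂)) eq = cong₂ _,_ (cong₂ _,_ (trans (l₁ x₁ y₁ x₂ y₂) eq) (l₂ y₁ y₂)) (cong₂ _,_ (l₃ x₁ x₂) (trans (l₄ x₁ y₁ x₂ y₂) eq))
     where
       l₁ : ∀ x₁ y₁ x₂ y₂ → x₁ *ᶻ y₂ +ᶻ x₂ *ᶻ (-ᶻ y₁) ≡ x₁ *ᶻ y₂ -ᶻ x₂ *ᶻ y₁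
       l₁ = solve-∀
       l₂ : ∀ y₁ y₂ → y₁ *ᶻ y₂ +ᶻ y₂ *ᶻ (-ᶻ y₁) ≡ 0ℤ
       l₂ = solve-∀
       l₃ : ∀ x₁ x₂ → x₁ *ᶻ (-ᶻ x₂) +ᶻ x₂ *ᶻ x₁ ≡ 0ℤ
       l₃ = solve-∀
       l₄ : ∀ x₁ y₁ x₂ y₂ → y₁ *ᶻ (-ᶻ x₂) +ᶻ y₂ *ᶻ x₁ ≡ x₁ *ᶻ y₂ -ᶻ x₂ *ᶻ y₁
       l₄ = solve-∀

   -- Composing with the adjugate multiplies the form by ℓ², which can be cancelled.
   ∘-injective : ∀ M → det M ≡ L → ∀ Q Q′ → Q ∘ᴹ M ≡ Q′ ∘ᴹ M → Q ≡ Q′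
   ∘-injective M eq Q Q′ q = cong₂ _,_ (c (cong proj₁ same)) (cong₂ _,_ (c (cong (proj₁ ∘ proj₂) same)) (c (cong (proj₂ ∘ proj₂) same)))
     where
       c : ∀ {x y} → L *ᶻ (L *ᶻ x) ≡ L *ᶻ (L *ᶻ y) → x ≡ y
       c = cancel ∘ cancel
       via : ∀ Q → Q ∘ᴹ M ∘ᴹ adjugate M ≡ (L *ᶻ (L *ᶻ proj₁ Q) , L *ᶻ (L *ᶻ proj₁ (proj₂ Q)) , L *ᶻ (L *ᶻ proj₂ (proj₂ Q)))
       via Q = trans (∘-⊡ Q M (adjugate M)) (trans (cong (Q ∘ᴹ_) (⊡-adjugate M eq)) (scalar Q))
       same = trans (sym (via Q)) (trans (cong (_∘ᴹ adjugate M) q) (via Q′))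

   Enumerated : (Quadratic → Set) → ℤ → Set
   Enumerated P z = ∃ λ xs → Enum (λ Q′ → Separates N′ e₁ e₂ Q′ × P Q′) xs × ∑ xs F ≡ z

   -- The values of Q ∘ M at e₁ and e₂ are those of Q at the columns of M. Hence the forms from M
   -- that separate e₁ and e₂ correspond to the forms of discriminant N that separate these columns.
   pull : ∀ M {z} → det M ≡ L → Cut N (proj₁ M) (proj₂ M) (λ Q → F (Q ∘ᴹ M)) z → Enumerated (From M) z
   pull M {z} eq (cut xs e p) = map (_∘ᴹ M) xs
     , Enum-map {P = Separates N (proj₁ M) (proj₂ M)} {Q = λ Q′ → Separates N′ e₁ e₂ Q′ × From M Q′} e (_∘ᴹ M) forward
         (λ {Q} {Q′} _ _ → ∘-injective M eq Q Q′) backward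
     , trans (∑-map (_∘ᴹ M) xs F) p
     where
       forward : ∀ {Q} → Separates N (proj₁ M) (proj₂ M) Q → Separates N′ e₁ e₂ (Q ∘ᴹ M) × From M (Q ∘ᴹ M)
       forward {Q} (sep d p n) = sep (trans (disc-∘ Q M) (trans (cong₂ _*ᶻ_ (trans (cong₂ _*ᶻ_ eq eq) (sym (ℤP.pos-* ℓ ℓ))) d) (trans (ℤP.*-comm (+ (ℓ ℕ.* ℓ)) (+ N)) (sym (ℤP.pos-* N (ℓ ℕ.* ℓ))))))
           (subst (0ℤ ℤ.<_) (sym (value-e₁ (Q ∘ᴹ M))) p) (subst (ℤ._< 0ℤ) (sym (value-e₂ (Q ∘ᴹ M))) n)
         , Q , d , refl
       backward : ∀ {Q′} → Separates N′ e₁ e₂ Q′ × From M Q′ → ∃ λ Q → Separates N (proj₁ M) (proj₂ M) Q × Q ∘ᴹ M ≡ Q′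
       backward {Q′} (S , Q , d , refl) = Q , sep d (subst (0ℤ ℤ.<_) (value-e₁ (Q ∘ᴹ M)) (Separates.positive S)) (subst (ℤ._< 0ℤ) (value-e₂ (Q ∘ᴹ M)) (Separates.negative S)) , refl

   Upto : ℕ → Quadratic → Set
   Upto k Q′ = From g∞ Q′ ⊎ ∃ λ b → b < k × From (g b) Q′

   ℓ>0 : 0 < ℓ
   ℓ>0 = ℕP.<-trans (s≤s z≤n) (ℕ.nonTrivial⇒n>1 ℓ {{prime⇒nonTrivial ℓ-prime}})

   L≢0 : L ≢ 0ℤ
   L≢0 eq = ℕP.<-irrefl (sym (ℤP.+-injective eq)) ℓ>0

   det-g∞ : det g∞ ≡ L
   det-g∞ = lem L
     where
       lem : ∀ L → L *ᶻ 1ℤ -ᶻ 0ℤ ≡ L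
       lem = solve-∀

   det-g : ∀ b → det (g b) ≡ L
   det-g b = lem (+ b) L
     where
       lem : ∀ b L → 1ℤ *ᶻ L -ᶻ b *ᶻ 0ℤ ≡ L
       lem = solve-∀

   union : ∀ k → k ≤ ℓ → Enumerated (Upto k) (∑ (hecke-matrices ℓ k) total-cone)
   union zero    _   = from∞ (pull g∞ {total-cone g∞} det-g∞ (Cut-scale {N} {λ Q → F (Q ∘ᴹ g∞)} {total-cone g∞} L 1ℤ L≢0 (λ ()) (Cut-forms N (λ Q → F (Q ∘ᴹ g∞)))))
     where
       only : ∀ {Q′} → Separates N′ e₁ e₂ Q′ × Upto 0 Q′ → Separates N′ e₁ e₂ Q′ × From g∞ Q′
       only (S , inj₁ f) = S , f
       only (S , inj₂ (_ , () , _))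
       from∞ : Enumerated (From g∞) (total-cone g∞) → Enumerated (Upto 0) (total-cone g∞ +ᶻ 0ℤ)
       from∞ (xs , e , p) = xs , Enum-⇔ (λ { (S , f) → S , inj₁ f }) only e , trans p (sym (ℤP.+-identityʳ _))
   union (suc k) k<ℓ = both
     (pull (g k) {∑ (path (suc k) e₁ k ℓ) total-cone} (det-g k) (Cut-path {N} irrational F odd (suc k) e₁ k ℓ ℕP.≤-refl ℓ>0)) (union k (ℕP.<⇒≤ k<ℓ))
     where
       separate : ∀ {Q′} → Separates N′ e₁ e₂ Q′ × From (g k) Q′ → Separates N′ e₁ e₂ Q′ × Upto k Q′ → ⊥
       separate (_ , f) (_ , inj₁ f∞) = disjoint∞ k f∞ f
       separate (_ , f) (_ , inj₂ (b , b<k , f′)) = ℕP.<-irrefl (disjoint b k (ℕP.<-trans b<k k<ℓ) k<ℓ f′ f) b<k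
       to : ∀ {Q′} → (Separates N′ e₁ e₂ Q′ × From (g k) Q′) ⊎ (Separates N′ e₁ e₂ Q′ × Upto k Q′) → Separates N′ e₁ e₂ Q′ × Upto (suc k) Q′
       to (inj₁ (S , f)) = S , inj₂ (k , ℕP.≤-refl , f)
       to (inj₂ (S , inj₁ f)) = S , inj₁ f
       to (inj₂ (S , inj₂ (b , b<k , f))) = S , inj₂ (b , ℕP.m<n⇒m<1+n b<k , f)
       from : ∀ {Q′} → Separates N′ e₁ e₂ Q′ × Upto (suc k) Q′ → (Separates N′ e₁ e₂ Q′ × From (g k) Q′) ⊎ (Separates N′ e₁ e₂ Q′ × Upto k Q′)
       from (S , inj₁ f) = inj₂ (S , inj₁ f)
       from (S , inj₂ (b , s≤s b≤k , f)) with ℕP.m≤n⇒m<n∨m≡n b≤k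
       ... | inj₁ b<k  = inj₂ (S , inj₂ (b , b<k , f))
       ... | inj₂ refl = inj₁ (S , f)

       both : Enumerated (From (g k)) (∑ (path (suc k) e₁ k ℓ) total-cone) → Enumerated (Upto k) (∑ (hecke-matrices ℓ k) total-cone) →
              Enumerated (Upto (suc k)) (∑ (path (suc k) e₁ k ℓ ++ hecke-matrices ℓ k) total-cone)
       both (xs , e , p) (ys , e′ , q) = xs ++ ys , Enum-⇔ to from (Enum-++ e e′ separate)
         , trans (∑-++ xs ys F) (trans (cong₂ _+ᶻ_ p q) (sym (∑-++ (path (suc k) e₁ k ℓ) (hecke-matrices ℓ k) total-cone)))

   -- By `cover` the ℓ + 1 pieces collected in `union` exhaust the forms of discriminant ℓ²N.
   hecke : ∑ (forms N′) F ≡ ∑ (hecke-matrices ℓ ℓ) total-cone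
   hecke with union ℓ ℕP.≤-refl
   ... | xs , e , p = trans (∑-Enum F (forms-Enum N′) (Enum-⇔ proj₁ (λ {Q} S → S , cover Q (Separates.discriminant S)) e)) p

-- Rows of coefficients, and powers of quadratic forms.

module CoefficientRows where

 open TripleSums
 open QuadraticForms
 open import Data.Bool using (T)
 open import Data.Nat using (_∸_; _≡ᵇ_)

 nth : ∀ {A : Set} → A → List A → ℕ → A
 nth z []       _       = z
 nth z (x ∷ xs) zero    = x
 nth z (x ∷ xs) (suc i) = nth z xs i

 tab : ∀ {A : Set} → (ℕ → A) → ℕ → ℕ → List A
 tab f zero    i = []
 tab f (suc m) i = f i ∷ tab f m (suc i)

 nth-tab : ∀ {A : Set} (z : A) f m i k → k < m → nth z (tab f m i) k ≡ f (i ℕ.+ k)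
 nth-tab z f (suc m) i zero    _         = cong f (sym (ℕP.+-identityʳ i))
 nth-tab z f (suc m) i (suc k) (s≤s k<m) = trans (nth-tab z f m (suc i) k k<m) (cong f (sym (ℕP.+-suc i k)))

 add : List ℕ → List ℕ → List ℕ
 add []       ys       = ys
 add (x ∷ xs) []       = x ∷ xs
 add (x ∷ xs) (y ∷ ys) = x ℕ.+ y ∷ add xs ys

 scale : ℕ → List ℕ → List ℕ
 scale c []       = []
 scale c (x ∷ xs) = c ℕ.* x ∷ scale c xs

 zeros : ℕ → List ℕ → List ℕ
 zeros zero    r = r
 zeros (suc i) r = 0 ∷ zeros i r

 unit-row : ℕ → List ℕ
 unit-row i = zeros i (1 ∷ [])

 dot : List ℕ → (ℕ → ℤ) → ℤ
 dot []      c = 0ℤ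
 dot (x ∷ r) c = + x *ᶻ c 0 +ᶻ dot r (c ∘ suc)

 dot-cong : ∀ r {c d} → (∀ i → c i ≡ d i) → dot r c ≡ dot r d
 dot-cong []      eq = refl
 dot-cong (x ∷ r) eq = cong₂ (λ u v → + x *ᶻ u +ᶻ v) (eq 0) (dot-cong r (eq ∘ suc))

 dot-add : ∀ r s c → dot (add r s) c ≡ dot r c +ᶻ dot s c
 dot-add []      s       c = sym (ℤP.+-identityˡ _)
 dot-add (x ∷ r) []      c = sym (ℤP.+-identityʳ _)
 dot-add (x ∷ r) (y ∷ s) c = trans (cong₂ (λ u v → u *ᶻ c 0 +ᶻ v) (ℤP.pos-+ x y) (dot-add r s (c ∘ suc))) (lem (+ x) (+ y) (c 0) _ _)
   where
     lem : ∀ x y c u v → (x +ᶻ y) *ᶻ c +ᶻ (u +ᶻ v) ≡ (x *ᶻ c +ᶻ u) +ᶻ (y *ᶻ c +ᶻ v)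
     lem = solve-∀

 dot-scale : ∀ m r c → dot (scale m r) c ≡ + m *ᶻ dot r c
 dot-scale m []      c = sym (ℤP.*-zeroʳ (+ m))
 dot-scale m (x ∷ r) c = trans (cong₂ (λ u v → u *ᶻ c 0 +ᶻ v) (ℤP.pos-* m x) (dot-scale m r (c ∘ suc))) (lem (+ m) (+ x) (c 0) _)
   where
     lem : ∀ m x c u → m *ᶻ x *ᶻ c +ᶻ m *ᶻ u ≡ m *ᶻ (x *ᶻ c +ᶻ u)
     lem = solve-∀

 dot-zeros : ∀ m x r c → dot (zeros m (x ∷ r)) c ≡ + x *ᶻ dot (unit-row m) c +ᶻ dot (zeros (suc m) r) c
 dot-zeros zero    x r c = lem (+ x) (c 0) (dot r (c ∘ suc))
   where
     lem : ∀ x c u → x *ᶻ c +ᶻ u ≡ x *ᶻ (1ℤ *ᶻ c +ᶻ 0ℤ) +ᶻ (0ℤ *ᶻ c +ᶻ u)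
     lem = solve-∀
 dot-zeros (suc m) x r c = trans (cong (0ℤ *ᶻ c 0 +ᶻ_) (dot-zeros m x r (c ∘ suc))) (lem (+ x) (c 0) (dot (unit-row m) (c ∘ suc)) (dot (zeros (suc m) r) (c ∘ suc)))
   where
     lem : ∀ x c u v → 0ℤ *ᶻ c +ᶻ (x *ᶻ u +ᶻ v) ≡ x *ᶻ (0ℤ *ᶻ c +ᶻ u) +ᶻ (0ℤ *ᶻ c +ᶻ v)
     lem = solve-∀

 dot-[] : ∀ m c → dot (zeros m []) c ≡ 0ℤ
 dot-[] zero    c = refl
 dot-[] (suc m) c = trans (cong (0ℤ *ᶻ c 0 +ᶻ_) (dot-[] m (c ∘ suc))) (lem (c 0))
   where
     lem : ∀ c → 0ℤ *ᶻ c +ᶻ 0ℤ ≡ 0ℤ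
     lem = solve-∀

 dot-0 : ∀ r → dot r (λ _ → 0ℤ) ≡ 0ℤ
 dot-0 []      = refl
 dot-0 (x ∷ r) = cong₂ _+ᶻ_ (ℤP.*-zeroʳ (+ x)) (dot-0 r)

 dot-*ˡ : ∀ r s c → dot r (λ i → s *ᶻ c i) ≡ s *ᶻ dot r c
 dot-*ˡ []      s c = sym (ℤP.*-zeroʳ s)
 dot-*ˡ (x ∷ r) s c = trans (cong (+ x *ᶻ (s *ᶻ c 0) +ᶻ_) (dot-*ˡ r s (c ∘ suc))) (lem (+ x) s (c 0) _)
   where
     lem : ∀ x s c u → x *ᶻ (s *ᶻ c) +ᶻ s *ᶻ u ≡ s *ᶻ (x *ᶻ c +ᶻ u)
     lem = solve-∀

 cat : ℕ → (ℕ → ℤ) → (ℕ → ℤ) → ℕ → ℤ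
 cat zero    f g i       = g i
 cat (suc m) f g zero    = f 0
 cat (suc m) f g (suc i) = cat m (f ∘ suc) g i

 dot-cat-skip : ∀ m r f g → dot (zeros m r) (cat m f g) ≡ dot r g
 dot-cat-skip zero    r f g = refl
 dot-cat-skip (suc m) r f g = trans (cong (0ℤ *ᶻ f 0 +ᶻ_) (dot-cat-skip m r (f ∘ suc) g)) (lem (f 0) (dot r g))
   where
     lem : ∀ c u → 0ℤ *ᶻ c +ᶻ u ≡ u
     lem = solve-∀

 dot-cat-take : ∀ m r f g → length r ≤ m → dot r (cat m f g) ≡ dot r f
 dot-cat-take m       []      f g _         = refl
 dot-cat-take (suc m) (x ∷ r) f g (s≤s r≤m) = cong (+ x *ᶻ f 0 +ᶻ_) (dot-cat-take m r (f ∘ suc) g r≤m)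

 zeros-+ : ∀ m n r → zeros (m ℕ.+ n) r ≡ zeros m (zeros n r)
 zeros-+ zero    n r = refl
 zeros-+ (suc m) n r = cong (0 ∷_) (zeros-+ m n r)

 -- Coefficients of (a x² + 2 b x y + c y²)ʲ; the i-th one belongs to xⁱ.

 shift : (ℕ → ℤ) → ℕ → ℤ
 shift f zero    = 0ℤ
 shift f (suc i) = f i

 coefficient : Quadratic → ℕ → ℕ → ℤ
 coefficient Q           zero    zero    = 1ℤ
 coefficient Q           zero    (suc i) = 0ℤ
 coefficient (a , b , c) (suc j) i       = c *ᶻ coefficient (a , b , c) j i +ᶻ + 2 *ᶻ (b *ᶻ shift (coefficient (a , b , c) j) i) +ᶻ a *ᶻ shift (shift (coefficient (a , b , c) j)) i

 homogeneous : ℤ → ℤ → ℕ → (ℕ → ℤ) → ℤ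
 homogeneous x y zero    f = f 0
 homogeneous x y (suc n) f = f 0 *ᶻ y ^ᶻ suc n +ᶻ x *ᶻ homogeneous x y n (f ∘ suc)

 homogeneous-suc : ∀ x y n f → homogeneous x y (suc n) f ≡ y *ᶻ homogeneous x y n f +ᶻ x ^ᶻ suc n *ᶻ f (suc n)
 homogeneous-suc x y zero    f = lem x y (f 0) (f 1)
   where
     lem : ∀ x y u v → u *ᶻ (y *ᶻ 1ℤ) +ᶻ x *ᶻ v ≡ y *ᶻ u +ᶻ x *ᶻ 1ℤ *ᶻ v
     lem = solve-∀
 homogeneous-suc x y (suc n) f = trans (cong (λ z → f 0 *ᶻ y ^ᶻ suc (suc n) +ᶻ x *ᶻ z) (homogeneous-suc x y n (f ∘ suc)))
   (lem x y (f 0) (y ^ᶻ suc n) (homogeneous x y n (f ∘ suc)) (x ^ᶻ suc n) (f (suc (suc n))))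
   where
     lem : ∀ x y u Y h X v → u *ᶻ (y *ᶻ Y) +ᶻ x *ᶻ (y *ᶻ h +ᶻ X *ᶻ v) ≡ y *ᶻ (u *ᶻ Y +ᶻ x *ᶻ h) +ᶻ x *ᶻ X *ᶻ v
     lem = solve-∀

 homogeneous-linear : ∀ x y n s t u f g h → homogeneous x y n (λ i → s *ᶻ f i +ᶻ + 2 *ᶻ (t *ᶻ g i) +ᶻ u *ᶻ h i)
                      ≡ s *ᶻ homogeneous x y n f +ᶻ + 2 *ᶻ (t *ᶻ homogeneous x y n g) +ᶻ u *ᶻ homogeneous x y n h
 homogeneous-linear x y zero    s t u f g h = refl
 homogeneous-linear x y (suc n) s t u f g h = trans (cong (λ z → (s *ᶻ f 0 +ᶻ + 2 *ᶻ (t *ᶻ g 0) +ᶻ u *ᶻ h 0) *ᶻ y ^ᶻ suc n +ᶻ x *ᶻ z) (homogeneous-linear x y n s t u (f ∘ suc) (g ∘ suc) (h ∘ suc)))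
   (trans (left s t u (f 0) (g 0) (h 0) (y ^ᶻ suc n) (x *ᶻ (s *ᶻ F +ᶻ + 2 *ᶻ (t *ᶻ G) +ᶻ u *ᶻ H))) (right x s t u (f 0 *ᶻ y ^ᶻ suc n) (g 0 *ᶻ y ^ᶻ suc n) (h 0 *ᶻ y ^ᶻ suc n) F G H))
   where
     F = homogeneous x y n (f ∘ suc)
     G = homogeneous x y n (g ∘ suc)
     H = homogeneous x y n (h ∘ suc)
     left : ∀ s t u f g h Y z → (s *ᶻ f +ᶻ + 2 *ᶻ (t *ᶻ g) +ᶻ u *ᶻ h) *ᶻ Y +ᶻ z ≡ (s *ᶻ (f *ᶻ Y) +ᶻ + 2 *ᶻ (t *ᶻ (g *ᶻ Y)) +ᶻ u *ᶻ (h *ᶻ Y)) +ᶻ z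
     left = solve-∀
     right : ∀ x s t u f g h F G H → (s *ᶻ f +ᶻ + 2 *ᶻ (t *ᶻ g) +ᶻ u *ᶻ h) +ᶻ x *ᶻ (s *ᶻ F +ᶻ + 2 *ᶻ (t *ᶻ G) +ᶻ u *ᶻ H) ≡ s *ᶻ (f +ᶻ x *ᶻ F) +ᶻ + 2 *ᶻ (t *ᶻ (g +ᶻ x *ᶻ G)) +ᶻ u *ᶻ (h +ᶻ x *ᶻ H)
     right = solve-∀

 homogeneous-shift : ∀ x y n f → homogeneous x y (suc n) (shift f) ≡ x *ᶻ homogeneous x y n f
 homogeneous-shift x y n f = lem (y ^ᶻ suc n) (x *ᶻ homogeneous x y n f)
   where
     lem : ∀ y z → 0ℤ *ᶻ y +ᶻ z ≡ z
     lem = solve-∀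

 coefficient-0 : ∀ Q j i → j ℕ.* 2 < i → coefficient Q j i ≡ 0ℤ
 coefficient-0 Q           zero    (suc i)       _ = refl
 coefficient-0 (a , b , c) (suc j) (suc (suc i)) (s≤s (s≤s lt)) = trans
   (cong₂ _+ᶻ_ (cong₂ (λ u v → c *ᶻ u +ᶻ + 2 *ᶻ (b *ᶻ v)) (coefficient-0 (a , b , c) j (suc (suc i)) (ℕP.m<n⇒m<1+n (ℕP.m<n⇒m<1+n lt))) (coefficient-0 (a , b , c) j (suc i) (ℕP.m<n⇒m<1+n lt)))
              (cong (a *ᶻ_) (coefficient-0 (a , b , c) j i lt))) (lem a b c)
   where
     lem : ∀ a b c → c *ᶻ 0ℤ +ᶻ + 2 *ᶻ (b *ᶻ 0ℤ) +ᶻ a *ᶻ 0ℤ ≡ 0ℤ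
     lem = solve-∀

 homogeneous-coefficient : ∀ Q x y j → homogeneous x y (j ℕ.* 2) (coefficient Q j) ≡ value Q (x , y) ^ᶻ j
 homogeneous-coefficient Q           x y zero    = refl
 homogeneous-coefficient Q@(a , b , c) x y (suc j) = trans (homogeneous-linear x y (suc (suc n)) c b a f (shift f) (shift (shift f)))
   (trans (cong₂ _+ᶻ_ (cong₂ (λ u v → c *ᶻ u +ᶻ + 2 *ᶻ (b *ᶻ v)) (trans (up (suc n) (ℕP.n≤1+n n)) (cong (y *ᶻ_) (up n ℕP.≤-refl))) (trans (homogeneous-shift x y (suc n) f) (cong (x *ᶻ_) (up n ℕP.≤-refl))))
       (cong (a *ᶻ_) (trans (homogeneous-shift x y (suc n) (shift f)) (cong (x *ᶻ_) (homogeneous-shift x y n f)))))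
     (trans (lem a b c x y (homogeneous x y n f)) (cong (value Q (x , y) *ᶻ_) (homogeneous-coefficient Q x y j))))
   where
     n = j ℕ.* 2
     f = coefficient Q j
     up : ∀ m → n ≤ m → homogeneous x y (suc m) f ≡ y *ᶻ homogeneous x y m f
     up m n≤m = trans (homogeneous-suc x y m f) (trans (cong (λ z → y *ᶻ homogeneous x y m f +ᶻ x ^ᶻ suc m *ᶻ z) (coefficient-0 Q j (suc m) (s≤s n≤m)))
       (trans (cong (y *ᶻ homogeneous x y m f +ᶻ_) (ℤP.*-zeroʳ (x ^ᶻ suc m))) (ℤP.+-identityʳ _)))
     lem : ∀ a b c x y h → c *ᶻ (y *ᶻ (y *ᶻ h)) +ᶻ + 2 *ᶻ (b *ᶻ (x *ᶻ (y *ᶻ h))) +ᶻ a *ᶻ (x *ᶻ (x *ᶻ h)) ≡ (a *ᶻ (x *ᶻ x) +ᶻ + 2 *ᶻ (b *ᶻ (x *ᶻ y)) +ᶻ c *ᶻ (y *ᶻ y)) *ᶻ h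
     lem = solve-∀

 coefficient-top : ∀ a b c j → coefficient (a , b , c) j (j ℕ.* 2) ≡ a ^ᶻ j
 coefficient-top a b c zero    = refl
 coefficient-top a b c (suc j) = trans (cong₂ _+ᶻ_ (cong₂ (λ u v → c *ᶻ u +ᶻ + 2 *ᶻ (b *ᶻ v)) (coefficient-0 Q j _ (ℕP.m<n⇒m<1+n ℕP.≤-refl)) (coefficient-0 Q j _ ℕP.≤-refl)) (cong (a *ᶻ_) (coefficient-top a b c j))) (lem a b c (a ^ᶻ j))
   where
     Q = a , b , c
     lem : ∀ a b c x → c *ᶻ 0ℤ +ᶻ + 2 *ᶻ (b *ᶻ 0ℤ) +ᶻ a *ᶻ x ≡ a *ᶻ x
     lem = solve-∀

 coefficient-second : ∀ a b c j → coefficient (a , b , c) (suc j) (suc (j ℕ.* 2)) ≡ + 2 *ᶻ + suc j *ᶻ (b *ᶻ a ^ᶻ j)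
 coefficient-second a b c zero    = lem a b c
   where
     lem : ∀ a b c → c *ᶻ 0ℤ +ᶻ + 2 *ᶻ (b *ᶻ 1ℤ) +ᶻ a *ᶻ 0ℤ ≡ + 2 *ᶻ 1ℤ *ᶻ (b *ᶻ 1ℤ)
     lem = solve-∀
 coefficient-second a b c (suc j) = trans (cong₂ _+ᶻ_ (cong₂ (λ u v → c *ᶻ u +ᶻ + 2 *ᶻ (b *ᶻ v)) (coefficient-0 Q (suc j) _ ℕP.≤-refl) (coefficient-top a b c (suc j))) (cong (a *ᶻ_) (coefficient-second a b c j))) (lem a b c (+ suc j) (a ^ᶻ j))
   where
     Q = a , b , c
     lem : ∀ a b c m x → c *ᶻ 0ℤ +ᶻ + 2 *ᶻ (b *ᶻ (a *ᶻ x)) +ᶻ a *ᶻ (+ 2 *ᶻ m *ᶻ (b *ᶻ x)) ≡ + 2 *ᶻ (1ℤ +ᶻ m) *ᶻ (b *ᶻ (a *ᶻ x))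
     lem = solve-∀

 -- With a = d, b = s, c = -e and the power J = j + 2, the last factor is -(de - 2(J - 1)s²). This
 -- is the factor that the Rankin-Cohen bracket produces, with 10 for J = 6 and 12 for J = 7; so the
 -- bracket sums are coefficients of powers of Q.
 coefficient-third : ∀ a b c j → coefficient (a , b , c) (suc (suc j)) (suc (suc (j ℕ.* 2))) ≡ + suc (suc j) *ᶻ a ^ᶻ j *ᶻ (a *ᶻ c +ᶻ + 2 *ᶻ + suc j *ᶻ (b *ᶻ b))
 coefficient-third a b c zero    = lem a b c
   where
     lem : ∀ a b c → c *ᶻ (c *ᶻ 0ℤ +ᶻ + 2 *ᶻ (b *ᶻ 0ℤ) +ᶻ a *ᶻ 1ℤ) +ᶻ + 2 *ᶻ (b *ᶻ (c *ᶻ 0ℤ +ᶻ + 2 *ᶻ (b *ᶻ 1ℤ) +ᶻ a *ᶻ 0ℤ)) +ᶻ a *ᶻ (c *ᶻ 1ℤ +ᶻ + 2 *ᶻ (b *ᶻ 0ℤ) +ᶻ a *ᶻ 0ℤ)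
       ≡ + 2 *ᶻ 1ℤ *ᶻ (a *ᶻ c +ᶻ + 2 *ᶻ 1ℤ *ᶻ (b *ᶻ b))
     lem = solve-∀
 coefficient-third a b c (suc j) = trans (cong₂ _+ᶻ_ (cong₂ (λ u v → c *ᶻ u +ᶻ + 2 *ᶻ (b *ᶻ v)) (coefficient-top a b c (suc (suc j))) (coefficient-second a b c (suc j))) (cong (a *ᶻ_) (coefficient-third a b c j))) (lem a b c (+ suc j) (a ^ᶻ j))
   where
     lem : ∀ a b c m x → c *ᶻ (a *ᶻ (a *ᶻ x)) +ᶻ + 2 *ᶻ (b *ᶻ (+ 2 *ᶻ (1ℤ +ᶻ m) *ᶻ (b *ᶻ (a *ᶻ x)))) +ᶻ a *ᶻ ((1ℤ +ᶻ m) *ᶻ x *ᶻ (a *ᶻ c +ᶻ + 2 *ᶻ m *ᶻ (b *ᶻ b)))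
       ≡ (1ℤ +ᶻ (1ℤ +ᶻ m)) *ᶻ (a *ᶻ x) *ᶻ (a *ᶻ c +ᶻ + 2 *ᶻ (1ℤ +ᶻ m) *ᶻ (b *ᶻ b))
     lem = solve-∀

-- Period relations for the sums over forms.

module PeriodRelations where

 open PowerSeries
 open FiniteSums
 open TripleSums
 open QuadraticForms
 open CoefficientRows
 open import Data.Bool using (T)
 open import Data.Nat using (_∸_; _≡ᵇ_)

 k₁ h₁ k₂ h₂ ε σ : Matrix
 h₁ = e₁ , (1ℤ , 1ℤ)
 k₁ = e₁ , (-1ℤ , 1ℤ)
 h₂ = (1ℤ , 1ℤ) , e₂
 k₂ = (1ℤ , -1ℤ) , e₂
 ε  = e₁ , (0ℤ , -1ℤ)
 σ  = e₂ , e₁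

 Separates-negate : ∀ {N α β Q} → Separates N α β Q → Separates N β α (negate Q)
 Separates-negate {N} {α} {β} {Q} (sep d p n) = sep (trans (disc-negate Q) d)
   (subst (0ℤ ℤ.<_) (sym (value-negate Q β)) (neg->0 n)) (subst (ℤ._< 0ℤ) (sym (value-negate Q α)) (neg-<0 p))

 Cut-swap : ∀ {N α β f z} → Odd f → Cut N α β f z → Cut N β α f (-ᶻ z)
 Cut-swap {N} {α} {β} {f} odd (cut xs e p) = cut (map negate xs)
   (Enum-map {P = Separates N α β} {Q = Separates N β α} e negate Separates-negate
     (λ {Q} {Q′} _ _ eq → trans (sym (negate² Q)) (trans (cong negate eq) (negate² Q′)))
     (λ {Q} S → negate Q , Separates-negate S , negate² Q))
   (trans (∑-map negate xs f) (trans (∑-cong xs odd) (trans (∑-neg xs f) (cong -ᶻ_ p))))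

 module Lattice (k j : ℕ) (ψ : ℤ → ℤ) (period : ∀ x z → ψ (x +ᶻ + 4 *ᶻ z) ≡ ψ x)
                (ψ-odd : ∀ x y → ψ (-ᶻ x) *ᶻ (-ᶻ y) ^ᶻ j ≡ -ᶻ (ψ x *ᶻ y ^ᶻ j)) where

   p : ℕ
   p = suc k

   n : ℕ
   n = j ℕ.* 2

   open Mod (+ p) public

   -- The test functions: κ carries the condition modulo 4 and v the polynomial weight. A change of
   -- variables simply acts on both points.
   monomial : Point → Point → Quadratic → ℤ
   monomial κ v Q = ψ (value Q κ) *ᶻ value Q v ^ᶻ j

   monomial-odd : ∀ κ v → Odd (monomial κ v)
   monomial-odd κ v Q = trans (cong₂ (λ x y → ψ x *ᶻ y ^ᶻ j) (value-negate Q κ) (value-negate Q v)) (ψ-odd (value Q κ) (value Q v))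

   monomial-∘ : ∀ κ v M Q → monomial κ v (Q ∘ᴹ M) ≡ monomial (M · κ) (M · v) Q
   monomial-∘ κ v M Q = cong₂ (λ x y → ψ x *ᶻ y ^ᶻ j) (value-∘ Q M κ) (value-∘ Q M v)

   Φ : ℕ → Point → Point → ℤ
   Φ N κ v = ∑ (forms N) (monomial κ v)

   -- Since the middle term of Q is 2bxy, a shift of the argument by even integers changes the value
   -- by a multiple of 4.
   ψ-mod-2 : ∀ Q x y s t → ψ (value Q (x +ᶻ + 2 *ᶻ s , y +ᶻ + 2 *ᶻ t)) ≡ ψ (value Q (x , y))
   ψ-mod-2 Q@(a , b , c) x y s t = trans (cong ψ (lem a b c x y s t)) (period (value Q (x , y)) _)
     where
       lem : ∀ a b c x y s t → a *ᶻ ((x +ᶻ + 2 *ᶻ s) *ᶻ (x +ᶻ + 2 *ᶻ s)) +ᶻ + 2 *ᶻ (b *ᶻ ((x +ᶻ + 2 *ᶻ s) *ᶻ (y +ᶻ + 2 *ᶻ t))) +ᶻ c *ᶻ ((y +ᶻ + 2 *ᶻ t) *ᶻ (y +ᶻ + 2 *ᶻ t))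
         ≡ (a *ᶻ (x *ᶻ x) +ᶻ + 2 *ᶻ (b *ᶻ (x *ᶻ y)) +ᶻ c *ᶻ (y *ᶻ y)) +ᶻ + 4 *ᶻ (a *ᶻ (x *ᶻ s +ᶻ s *ᶻ s) +ᶻ b *ᶻ (x *ᶻ t +ᶻ s *ᶻ y +ᶻ + 2 *ᶻ (s *ᶻ t)) +ᶻ c *ᶻ (y *ᶻ t +ᶻ t *ᶻ t))
       lem = solve-∀

   ^-congₘ : ∀ {x y} i → x ≡ₘ y → x ^ᶻ i ≡ₘ y ^ᶻ i
   ^-congₘ zero    eq = ≡ₘ-refl
   ^-congₘ (suc i) eq = *-congₘ eq (^-congₘ i eq)

   ∑-congₘ : ∀ {A : Set} (xs : List A) {f g} → (∀ x → f x ≡ₘ g x) → ∑ xs f ≡ₘ ∑ xs g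
   ∑-congₘ []       eq = ≡ₘ-refl
   ∑-congₘ (x ∷ xs) eq = +-congₘ (eq x) (∑-congₘ xs eq)

   -- κ matters modulo 2, v modulo p.
   Φ-cong : ∀ N {X Y X′ Y′ x y x′ y′} s t → X ≡ X′ +ᶻ + 2 *ᶻ s → Y ≡ Y′ +ᶻ + 2 *ᶻ t → x ≡ₘ x′ → y ≡ₘ y′ →
            Φ N (X , Y) (x , y) ≡ₘ Φ N (X′ , Y′) (x′ , y′)
   Φ-cong N {X′ = X′} {Y′} {x} {y} {x′} {y′} s t refl refl x≡ y≡ = ∑-congₘ (forms N) (λ Q → *-congₘ (≡ₘ-reflexive (ψ-mod-2 Q X′ Y′ s t))
     (^-congₘ j (value-congₘ Q)))
     where
       value-congₘ : ∀ Q → value Q (x , y) ≡ₘ value Q (x′ , y′)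
       value-congₘ (a , b , c) = +-congₘ (+-congₘ (*-congₘ (≡ₘ-refl {a}) (*-congₘ x≡ x≡)) (*-congₘ (≡ₘ-refl {+ 2}) (*-congₘ (≡ₘ-refl {b}) (*-congₘ x≡ y≡)))) (*-congₘ (≡ₘ-refl {c}) (*-congₘ y≡ y≡))

   module _ {N : ℕ} (irr : Irrational N) where

     private
       Cut-Φ : ∀ {h k} κ v → Inverse h k → Cut N (h · e₁) (h · e₂) (monomial κ v) (Φ N (k · κ) (k · v))
       Cut-Φ {h} {k} κ v inv = Cut-transform {N} {monomial κ v} {e₁} {e₂} {_} {h} {k} inv (Cut-cong (λ Q → sym (monomial-∘ κ v k Q)) (Cut-forms N (monomial (k · κ) (k · v))))

     -- Cutting the cone from e₁ to e₂ at (1, 1) leaves two unimodular cones, which `k₁` and `k₂`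
     -- carry back to the first. This is the three-term relation of modular symbols.
     Φ-split : ∀ κ v → Φ N κ v ≡ Φ N (k₁ · κ) (k₁ · v) +ᶻ Φ N (k₂ · κ) (k₂ · v)
     Φ-split κ v = Cut-unique (Cut-forms N (monomial κ v)) (Cut-split irr {α = e₁} {1ℤ , 1ℤ} {e₂} (monomial-odd κ v) (λ ()) (λ ()) (λ ())
       (Cut-Φ {h₁} {k₁} κ v (record { hk = refl ; kh = refl ; det² = refl })) (Cut-Φ {h₂} {k₂} κ v (record { hk = refl ; kh = refl ; det² = refl })))

     -- Separating e₁ from e₂ is the same as separating e₁ from -e₂.
     Φ-flip : ∀ κ v → Φ N κ v ≡ Φ N (ε · κ) (ε · v)
     Φ-flip κ v = Cut-unique (Cut-scale {N} {monomial κ v} 1ℤ -1ℤ (λ ()) (λ ()) (Cut-forms N (monomial κ v))) (Cut-Φ {ε} {ε} κ v (record { hk = refl ; kh = refl ; det² = refl }))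

     Φ-swap : ∀ κ v → -ᶻ Φ N κ v ≡ Φ N (σ · κ) (σ · v)
     Φ-swap κ v = Cut-unique (Cut-swap (monomial-odd κ v) (Cut-forms N (monomial κ v))) (Cut-Φ {σ} {σ} κ v (record { hk = refl ; kh = refl ; det² = refl }))

   -- Coordinates: for κ = (0,0), (1,0), (0,1), (1,1) in turn, the sums over Q of ψ(Q(κ)) times the coefficients of Qʲ

   twisted : Point → Quadratic → ℕ → ℤ
   twisted κ Q i = ψ (value Q κ) *ᶻ coefficient Q j i

   entries : Quadratic → ℕ → ℤ
   entries Q = cat (suc n) (twisted (0ℤ , 0ℤ) Q) (cat (suc n) (twisted (1ℤ , 0ℤ) Q) (cat (suc n) (twisted (0ℤ , 1ℤ) Q) (twisted (1ℤ , 1ℤ) Q)))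

   val : ℕ → List ℕ → ℤ
   val N r = ∑ (forms N) (λ Q → dot r (entries Q))

   val-add : ∀ N r s → val N (add r s) ≡ val N r +ᶻ val N s
   val-add N r s = trans (∑-cong (forms N) (λ Q → dot-add r s (entries Q))) (∑-⊕ (forms N) _ _)

   val-scale : ∀ N c r → val N (scale c r) ≡ + c *ᶻ val N r
   val-scale N c r = trans (∑-cong (forms N) (λ Q → dot-scale c r (entries Q))) (∑-scale (+ c) (forms N) _)

   val-zeros : ∀ N m x r → val N (zeros m (x ∷ r)) ≡ + x *ᶻ val N (unit-row m) +ᶻ val N (zeros (suc m) r)
   val-zeros N m x r = trans (∑-cong (forms N) (λ Q → dot-zeros m x r (entries Q))) (trans (∑-⊕ (forms N) _ _) (cong (_+ᶻ val N (zeros (suc m) r)) (∑-scale (+ x) (forms N) _)))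

   val-[] : ∀ N m → val N (zeros m []) ≡ 0ℤ
   val-[] N m = ∑-zero (forms N) (λ {Q} _ → dot-[] m (entries Q))

   red : List ℕ → List ℕ
   red []      = []
   red (x ∷ r) = x % p ∷ red r

   %-≡ₘ : ∀ x → + (x % p) ≡ₘ + x
   %-≡ₘ x = ≡ₘ-sym (mk (ℤD.divides (+ (x / p)) (trans (cong (λ z → + z -ᶻ + (x % p)) (ℕDM.m≡m%n+[m/n]*n x p))
                       (trans (lem (+ (x % p)) (+ (x / p ℕ.* p))) (ℤP.pos-* (x / p) p)))))
     where
       lem : ∀ x y → x +ᶻ y -ᶻ x ≡ y
       lem = solve-∀

   dot-red : ∀ r c → dot (red r) c ≡ₘ dot r c
   dot-red []      c = ≡ₘ-refl
   dot-red (x ∷ r) c = +-congₘ (*-congₘ (%-≡ₘ x) (≡ₘ-refl {c 0})) (dot-red r (c ∘ suc))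

   val-red : ∀ N r → val N (red r) ≡ₘ val N r
   val-red N r = ∑-congₘ (forms N) (λ Q → dot-red r (entries Q))

   monos : ℕ → ℕ → ℕ → List ℕ
   monos x y zero    = 1 ∷ []
   monos x y (suc i) = y ℕ.^ suc i % p ∷ red (scale x (monos x y i))

   length-monos : ∀ x y i → length (monos x y i) ≡ suc i
   length-monos x y zero    = refl
   length-monos x y (suc i) = cong suc (trans (length-red (scale x (monos x y i))) (trans (length-scale (monos x y i)) (length-monos x y i)))
     where
       length-red : ∀ r → length (red r) ≡ length r
       length-red []      = refl
       length-red (_ ∷ r) = cong suc (length-red r)
       length-scale : ∀ r → length (scale x r) ≡ length r
       length-scale []      = refl
       length-scale (_ ∷ r) = cong suc (length-scale r)

   dot-monos : ∀ x y i f → dot (monos x y i) f ≡ₘ homogeneous (+ x) (+ y) i f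
   dot-monos x y zero    f = ≡ₘ-reflexive (trans (ℤP.+-identityʳ _) (ℤP.*-identityˡ (f 0)))
   dot-monos x y (suc i) f = +-congₘ (≡ₘ-trans (*-congₘ (≡ₘ-trans (%-≡ₘ (y ℕ.^ suc i)) (≡ₘ-reflexive (pos-^ y (suc i)))) (≡ₘ-refl {f 0})) (≡ₘ-reflexive (ℤP.*-comm _ (f 0))))
     (≡ₘ-trans (dot-red (scale x (monos x y i)) (f ∘ suc)) (≡ₘ-trans (≡ₘ-reflexive (dot-scale x (monos x y i) (f ∘ suc))) (*-congₘ (≡ₘ-refl {+ x}) (dot-monos x y i (f ∘ suc)))))
     where
       pos-^ : ∀ y i → + (y ℕ.^ i) ≡ (+ y) ^ᶻ i
       pos-^ y zero    = refl
       pos-^ y (suc i) = trans (ℤP.pos-* y (y ℕ.^ i)) (cong (+ y *ᶻ_) (pos-^ y i))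

   representative : ℕ → Point
   representative 0 = 0ℤ , 0ℤ
   representative 1 = 1ℤ , 0ℤ
   representative 2 = 0ℤ , 1ℤ
   representative _ = 1ℤ , 1ℤ

   dot-block : ∀ κ r Q → κ < 4 → length r ≤ suc n → dot (zeros (κ ℕ.* suc n) r) (entries Q) ≡ dot r (twisted (representative κ) Q)
   dot-block κ r Q κ<4 len = go κ κ<4
     where
       c₀ c₁ c₂ c₃ b₁ b₂ : ℕ → ℤ
       c₀ = twisted (0ℤ , 0ℤ) Q
       c₁ = twisted (1ℤ , 0ℤ) Q
       c₂ = twisted (0ℤ , 1ℤ) Q
       c₃ = twisted (1ℤ , 1ℤ) Q
       b₂ = cat (suc n) c₂ c₃
       b₁ = cat (suc n) c₁ b₂
       skip : ∀ i f g → dot (zeros (suc i ℕ.* suc n) r) (cat (suc n) f g) ≡ dot (zeros (i ℕ.* suc n) r) g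
       skip i f g = trans (cong (λ z → dot z (cat (suc n) f g)) (zeros-+ (suc n) (i ℕ.* suc n) r)) (dot-cat-skip (suc n) (zeros (i ℕ.* suc n) r) f g)
       go : ∀ κ → κ < 4 → dot (zeros (κ ℕ.* suc n) r) (entries Q) ≡ dot r (twisted (representative κ) Q)
       go 0 _ = dot-cat-take (suc n) r c₀ b₁ len
       go 1 _ = trans (skip 0 c₀ b₁) (dot-cat-take (suc n) r c₁ b₂ len)
       go 2 _ = trans (skip 1 c₀ b₁) (trans (skip 0 c₁ b₂) (dot-cat-take (suc n) r c₂ c₃ len))
       go 3 _ = trans (skip 2 c₀ b₁) (trans (skip 1 c₁ b₂) (skip 0 c₂ c₃))
       go (suc (suc (suc (suc _)))) (s≤s (s≤s (s≤s (s≤s ()))))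

   val-monos : ∀ N κ x y → κ < 4 → val N (zeros (κ ℕ.* suc n) (monos x y n)) ≡ₘ Φ N (representative κ) (+ x , + y)
   val-monos N κ x y κ<4 = ∑-congₘ (forms N) (λ Q → ≡ₘ-trans
     (≡ₘ-reflexive (trans (dot-block κ (monos x y n) Q κ<4 (ℕP.≤-reflexive (length-monos x y n))) (dot-*ˡ (monos x y n) (ψ (value Q (representative κ))) (coefficient Q j))))
     (*-congₘ (≡ₘ-refl {ψ (value Q (representative κ))}) (≡ₘ-trans (dot-monos x y n (coefficient Q j)) (≡ₘ-reflexive (homogeneous-coefficient Q (+ x) (+ y) j)))))

   index : ℕ → ℕ → ℕ
   index X Y = X % 2 ℕ.+ 2 ℕ.* (Y % 2)

   index-representative : ∀ X Y → index X Y < 4 × representative (index X Y) ≡ (+ (X % 2) , + (Y % 2))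
   index-representative X Y = go (X % 2) (Y % 2) (ℕDM.m%n<n X 2) (ℕDM.m%n<n Y 2)
     where
       go : ∀ a b → a < 2 → b < 2 → a ℕ.+ 2 ℕ.* b < 4 × representative (a ℕ.+ 2 ℕ.* b) ≡ (+ a , + b)
       go 0 0 _ _ = s≤s z≤n , refl
       go 1 0 _ _ = s≤s (s≤s z≤n) , refl
       go 0 1 _ _ = s≤s (s≤s (s≤s z≤n)) , refl
       go 1 1 _ _ = s≤s (s≤s (s≤s (s≤s z≤n))) , refl
       go (suc (suc _)) _ (s≤s (s≤s ())) _
       go 0 (suc (suc _)) _ (s≤s (s≤s ()))
       go 1 (suc (suc _)) _ (s≤s (s≤s ()))

   row : ℕ → ℕ → ℕ → ℕ → List ℕ
   row X Y x y = zeros (index X Y ℕ.* suc n) (monos x y n)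

   halves : ∀ X → + X ≡ + (X % 2) +ᶻ + 2 *ᶻ + (X / 2)
   halves X = trans (cong +_ (trans (ℕDM.m≡m%n+[m/n]*n X 2) (cong (X % 2 ℕ.+_) (ℕP.*-comm (X / 2) 2)))) (cong (+ (X % 2) +ᶻ_) (ℤP.pos-* 2 (X / 2)))

   val-row : ∀ N X Y x y → val N (row X Y x y) ≡ₘ Φ N (+ X , + Y) (+ x , + y)
   val-row N X Y x y = ≡ₘ-trans (val-monos N (index X Y) x y (proj₁ (index-representative X Y)))
     (≡ₘ-sym (subst (λ z → Φ N (+ X , + Y) (+ x , + y) ≡ₘ Φ N z (+ x , + y)) (sym (proj₂ (index-representative X Y)))
       (Φ-cong N {+ X} {+ Y} {+ (X % 2)} {+ (Y % 2)} {+ x} {+ y} {+ x} {+ y} (+ (X / 2)) (+ (Y / 2)) (halves X) (halves Y) ≡ₘ-refl ≡ₘ-refl)))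

   neg : List ℕ → List ℕ
   neg = scale k

   k≡-1 : + k ≡ₘ -1ℤ
   k≡-1 = mk (ℤD.divides 1ℤ (trans (lem (+ k)) (sym (ℤP.*-identityˡ (+ p)))))
     where
       lem : ∀ k → k -ᶻ -1ℤ ≡ 1ℤ +ᶻ k
       lem = solve-∀

   minus : ∀ x y → + (x ℕ.+ k ℕ.* y) ≡ₘ + x -ᶻ + y
   minus x y = +-congₘ (≡ₘ-refl {+ x}) (≡ₘ-trans (≡ₘ-reflexive (ℤP.pos-* k y)) (≡ₘ-trans (*-congₘ k≡-1 (≡ₘ-refl {+ y})) (≡ₘ-reflexive (ℤP.-1*i≡-i (+ y)))))

   val-neg : ∀ N r → val N (neg r) ≡ₘ -ᶻ val N r
   val-neg N r = ≡ₘ-trans (≡ₘ-reflexive (val-scale N k r)) (≡ₘ-trans (*-congₘ k≡-1 (≡ₘ-refl {val N r})) (≡ₘ-reflexive (ℤP.-1*i≡-i (val N r))))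

   -- Flip, swap and split of one test function, written as rows modulo p. Differences in v are
   -- formed with k for -1; in κ signs do not matter, as it counts modulo 2.
   relations : ℕ → ℕ → ℕ → ℕ → List (List ℕ)
   relations X Y x y =
       red (add (row X Y x y) (neg (row X Y x (0 ℕ.+ k ℕ.* y))))
     ∷ red (add (row X Y x y) (row Y X y x))
     ∷ red (add (row X Y x y) (neg (add (row (X ℕ.+ Y) Y (x ℕ.+ k ℕ.* y) y) (row X (X ℕ.+ Y) x (y ℕ.+ k ℕ.* x)))))
     ∷ []

   Null : ℕ → List ℕ → Set
   Null N r = val N r ≡ₘ 0ℤ

   module _ {N : ℕ} (irr : Irrational N) where

     private
       lin : ∀ x y → + 1 *ᶻ x +ᶻ 0ℤ *ᶻ y ≡ x
       lin = solve-∀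
       double : ∀ x → x ≡ (-1ℤ *ᶻ x) +ᶻ + 2 *ᶻ x
       double = solve-∀
       same : ∀ x → x ≡ x +ᶻ + 2 *ᶻ 0ℤ
       same = solve-∀

     relations-null : ∀ X Y x y → All (Null N) (relations X Y x y)
     relations-null X Y x y = flip ∷ swap ∷ cross ∷ []
       where
         a  = + X ; b = + Y ; u = + x ; v = + y
         start : val N (row X Y x y) ≡ₘ Φ N (a , b) (u , v)
         start = val-row N X Y x y
         flip : Null N (red (add (row X Y x y) (neg (row X Y x (0 ℕ.+ k ℕ.* y)))))
         flip = ≡ₘ-trans (val-red N (add (row X Y x y) (neg (row X Y x (k ℕ.* y))))) (≡ₘ-trans (≡ₘ-reflexive (val-add N (row X Y x y) (neg (row X Y x (k ℕ.* y)))))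
           (≡ₘ-trans (+-congₘ (≡ₘ-trans start (≡ₘ-reflexive (Φ-flip {N} irr (a , b) (u , v)))) (≡ₘ-trans (val-neg N (row X Y x (k ℕ.* y))) (-‿congₘ (≡ₘ-trans (val-row N X Y x (k ℕ.* y))
              (Φ-cong N {+ X} {+ Y} {1ℤ *ᶻ a +ᶻ 0ℤ *ᶻ b} {0ℤ *ᶻ a +ᶻ -1ℤ *ᶻ b} 0ℤ b (l₁ a b) (l₂ a b) (≡ₘ-reflexive (sym (lin u v))) (≡ₘ-trans (minus 0 y) (≡ₘ-reflexive (l₃ u v))))))))
            (≡ₘ-reflexive (ℤP.+-inverseʳ (Φ N (ε · (a , b)) (ε · (u , v)))))))
           where
             l₁ : ∀ a b → a ≡ (1ℤ *ᶻ a +ᶻ 0ℤ *ᶻ b) +ᶻ + 2 *ᶻ 0ℤ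
             l₁ = solve-∀
             l₂ : ∀ a b → b ≡ (0ℤ *ᶻ a +ᶻ -1ℤ *ᶻ b) +ᶻ + 2 *ᶻ b
             l₂ = solve-∀
             l₃ : ∀ u v → 0ℤ -ᶻ v ≡ 0ℤ *ᶻ u +ᶻ -1ℤ *ᶻ v
             l₃ = solve-∀
         swap : Null N (red (add (row X Y x y) (row Y X y x)))
         swap = ≡ₘ-trans (val-red N (add (row X Y x y) (row Y X y x))) (≡ₘ-trans (≡ₘ-reflexive (val-add N (row X Y x y) (row Y X y x)))
           (≡ₘ-trans (+-congₘ start (≡ₘ-trans (val-row N Y X y x) (≡ₘ-reflexive (trans (cong₂ (Φ N) (cong₂ _,_ (l₁ a b) (l₂ a b)) (cong₂ _,_ (l₁ u v) (l₂ u v))) (sym (Φ-swap {N} irr (a , b) (u , v)))))))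
             (≡ₘ-reflexive (ℤP.+-inverseʳ (Φ N (a , b) (u , v))))))
           where
             l₁ : ∀ a b → b ≡ 0ℤ *ᶻ a +ᶻ 1ℤ *ᶻ b
             l₁ = solve-∀
             l₂ : ∀ a b → a ≡ 1ℤ *ᶻ a +ᶻ 0ℤ *ᶻ b
             l₂ = solve-∀
         R₁ = row (X ℕ.+ Y) Y (x ℕ.+ k ℕ.* y) y
         R₂ = row X (X ℕ.+ Y) x (y ℕ.+ k ℕ.* x)
         cross : Null N (red (add (row X Y x y) (neg (add R₁ R₂))))
         cross = ≡ₘ-trans (val-red N (add (row X Y x y) (neg (add R₁ R₂)))) (≡ₘ-trans (≡ₘ-reflexive (val-add N (row X Y x y) (neg (add R₁ R₂))))
           (≡ₘ-trans (+-congₘ (≡ₘ-trans start (≡ₘ-reflexive (Φ-split {N} irr (a , b) (u , v))))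
               (≡ₘ-trans (val-neg N (add R₁ R₂)) (-‿congₘ (≡ₘ-trans (≡ₘ-reflexive (val-add N R₁ R₂)) (+-congₘ
                 (≡ₘ-trans (val-row N (X ℕ.+ Y) Y (x ℕ.+ k ℕ.* y) y) (Φ-cong N {a +ᶻ b} {b} {1ℤ *ᶻ a +ᶻ -1ℤ *ᶻ b} {0ℤ *ᶻ a +ᶻ 1ℤ *ᶻ b} b 0ℤ (m₁ a b) (m₂ a b) (≡ₘ-trans (minus x y) (≡ₘ-reflexive (m₃ u v))) (≡ₘ-reflexive (m₄ u v))))
                 (≡ₘ-trans (val-row N X (X ℕ.+ Y) x (y ℕ.+ k ℕ.* x)) (Φ-cong N {a} {a +ᶻ b} {1ℤ *ᶻ a +ᶻ 0ℤ *ᶻ b} { -1ℤ *ᶻ a +ᶻ 1ℤ *ᶻ b} 0ℤ a (m₅ a b) (m₆ a b) (≡ₘ-reflexive (m₇ u v)) (≡ₘ-trans (minus y x) (≡ₘ-reflexive (m₈ u v))))))))))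
             (≡ₘ-reflexive (ℤP.+-inverseʳ (Φ N (k₁ · (a , b)) (k₁ · (u , v)) +ᶻ Φ N (k₂ · (a , b)) (k₂ · (u , v)))))))
           where
             m₁ : ∀ a b → a +ᶻ b ≡ (1ℤ *ᶻ a +ᶻ -1ℤ *ᶻ b) +ᶻ + 2 *ᶻ b
             m₁ = solve-∀
             m₂ : ∀ a b → b ≡ (0ℤ *ᶻ a +ᶻ 1ℤ *ᶻ b) +ᶻ + 2 *ᶻ 0ℤ
             m₂ = solve-∀
             m₃ : ∀ u v → u -ᶻ v ≡ 1ℤ *ᶻ u +ᶻ -1ℤ *ᶻ v
             m₃ = solve-∀
             m₄ : ∀ u v → v ≡ 0ℤ *ᶻ u +ᶻ 1ℤ *ᶻ v
             m₄ = solve-∀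
             m₅ : ∀ a b → a ≡ (1ℤ *ᶻ a +ᶻ 0ℤ *ᶻ b) +ᶻ + 2 *ᶻ 0ℤ
             m₅ = solve-∀
             m₆ : ∀ a b → a +ᶻ b ≡ (-1ℤ *ᶻ a +ᶻ 1ℤ *ᶻ b) +ᶻ + 2 *ᶻ a
             m₆ = solve-∀
             m₇ : ∀ u v → u ≡ 1ℤ *ᶻ u +ᶻ 0ℤ *ᶻ v
             m₇ = solve-∀
             m₈ : ∀ u v → v -ᶻ u ≡ -1ℤ *ᶻ u +ᶻ 1ℤ *ᶻ v
             m₈ = solve-∀

-- Linear algebra modulo p and evaluation of the Hecke operator.

module Elimination where

 open PowerSeries
 open FiniteSums
 open TripleSums
 open QuadraticForms
 open EuclideanPaths
 open HeckeCosets
 open HeckeOperator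
 open CoefficientRows
 open PeriodRelations
 open import Data.Bool using (T)
 open import Data.Nat using (_∸_; _≡ᵇ_)

 ∧-true : ∀ {x y} → x ∧ y ≡ true → x ≡ true × y ≡ true
 ∧-true {true} {true} _ = refl , refl

 module Verification (k j : ℕ) (ψ : ℤ → ℤ) (period : ∀ x z → ψ (x +ᶻ + 4 *ᶻ z) ≡ ψ x)
                     (ψ-odd : ∀ x y → ψ (-ᶻ x) *ᶻ (-ᶻ y) ^ᶻ j ≡ -ᶻ (ψ x *ᶻ y ^ᶻ j)) where

   open Lattice k j ψ period ψ-odd public

   Pivots : Set
   Pivots = List (ℕ × List ℕ)

   clear : ℕ → List ℕ → List ℕ → List ℕ
   clear zero    R r = r
   -- The multiplier represents minus the entry that is to be cleared.
   clear (suc c) R r = red (add r (scale (p ∸ suc c % p) R))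

   reduce : Pivots → List ℕ → List ℕ
   reduce []             r = r
   reduce ((i , R) ∷ ps) r = reduce ps (clear (nth 0 r i) R r)

   leading : ℕ → List ℕ → ℕ × ℕ
   leading i []          = 0 , 0
   leading i (zero ∷ r)  = leading (suc i) r
   leading i (suc c ∷ r) = i , suc c

   -- By Fermat's theorem c^(p-2) inverts a leading coefficient c. The default (0, 0) of `leading`
   -- marks a zero row, which gives no pivot.
   append : Pivots → List ℕ → ℕ × ℕ → Pivots
   append ps r (i , zero)  = ps
   append ps r (i , suc c) = ps ++ (i , red (scale (suc c ℕ.^ (p ∸ 2)) r)) ∷ []

   insert : Pivots → List ℕ → Pivots
   insert ps r = append ps r (leading 0 r)

   eliminate : Pivots → List (List ℕ) → Pivots
   eliminate ps []       = ps
   eliminate ps (r ∷ rs) = eliminate (insert ps (reduce ps r)) rs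

   vanish : List ℕ → Bool
   vanish []      = true
   vanish (x ∷ r) = (x % p ≡ᵇ 0) ∧ vanish r

   vanish-sound : ∀ r c → vanish r ≡ true → dot r c ≡ₘ 0ℤ
   vanish-sound []      c _  = ≡ₘ-refl
   vanish-sound (x ∷ r) c eq with ∧-true {x % p ≡ᵇ 0} eq
   ... | x0 , r0 = +-congₘ (≡ₘ-trans (*-congₘ {+ x} {0ℤ} {c 0} {c 0} x≡0 ≡ₘ-refl) (≡ₘ-reflexive (ℤP.*-zeroˡ (c 0)))) (vanish-sound r (c ∘ suc) r0)
     where
       x≡0 : + x ≡ₘ 0ℤ
       x≡0 = ≡ₘ-trans (≡ₘ-sym (%-≡ₘ x)) (≡ₘ-reflexive (cong +_ (ℕP.≡ᵇ⇒≡ (x % p) 0 (subst T (sym x0) tt))))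

   vanish-val : ∀ N r → vanish r ≡ true → val N r ≡ₘ 0ℤ
   vanish-val N r eq = ≡ₘ-trans (∑-congₘ (forms N) {g = λ _ → 0ℤ} (λ Q → vanish-sound r (entries Q) eq)) (≡ₘ-reflexive (∑-zero (forms N) (λ _ → refl)))

   NullPivots : ℕ → Pivots → Set
   NullPivots N = All (λ z → Null N (proj₂ z))

   module _ (N : ℕ) where

     add-null : ∀ r m R → Null N R → val N (add r (scale m R)) ≡ₘ val N r
     add-null r m R null = ≡ₘ-trans (≡ₘ-reflexive (trans (val-add N r (scale m R)) (cong (val N r +ᶻ_) (val-scale N m R))))
       (≡ₘ-trans (+-congₘ (≡ₘ-refl {val N r}) (*-congₘ (≡ₘ-refl {+ m}) null)) (≡ₘ-reflexive (trans (cong (val N r +ᶻ_) (ℤP.*-zeroʳ (+ m))) (ℤP.+-identityʳ _))))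

     val-clear : ∀ c R r → Null N R → val N (clear c R r) ≡ₘ val N r
     val-clear zero    R r null = ≡ₘ-refl
     val-clear (suc c) R r null = ≡ₘ-trans (val-red N (add r (scale (p ∸ suc c % p) R))) (add-null r (p ∸ suc c % p) R null)

     val-reduce : ∀ ps r → NullPivots N ps → val N (reduce ps r) ≡ₘ val N r
     val-reduce []             r []            = ≡ₘ-refl
     val-reduce ((i , R) ∷ ps) r (null ∷ null′) = ≡ₘ-trans (val-reduce ps (clear (nth 0 r i) R r) null′) (val-clear (nth 0 r i) R r null)

     insert-null : ∀ ps r → NullPivots N ps → Null N r → NullPivots N (insert ps r)
     insert-null ps r nulls null = go (leading 0 r)
       where
         go : ∀ l → NullPivots N (append ps r l)
         go (i , zero)  = nulls
         go (i , suc c) = AllP.++⁺ nulls (≡ₘ-trans (val-red N (scale (suc c ℕ.^ (p ∸ 2)) r)) (≡ₘ-trans (≡ₘ-reflexive (val-scale N (suc c ℕ.^ (p ∸ 2)) r))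
           (≡ₘ-trans (*-congₘ (≡ₘ-refl {+ (suc c ℕ.^ (p ∸ 2))}) null) (≡ₘ-reflexive (ℤP.*-zeroʳ (+ (suc c ℕ.^ (p ∸ 2))))))) ∷ [])

     eliminate-null : ∀ ps rs → NullPivots N ps → All (Null N) rs → NullPivots N (eliminate ps rs)
     eliminate-null ps []       nulls []          = nulls
     eliminate-null ps (r ∷ rs) nulls (null ∷ ns) = eliminate-null (insert ps (reduce ps r)) rs (insert-null ps (reduce ps r) nulls (≡ₘ-trans (val-reduce ps r nulls) null)) ns

     reduce-vanish : ∀ ps r → NullPivots N ps → vanish (reduce ps r) ≡ true → Null N r
     reduce-vanish ps r nulls eq = ≡ₘ-trans (≡ₘ-sym (val-reduce ps r nulls)) (vanish-val N (reduce ps r) eq)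

     difference-null : ∀ ps r s → NullPivots N ps → vanish (reduce ps (add r (neg s))) ≡ true → val N r ≡ₘ val N s
     difference-null ps r s nulls eq = ≡ₘ-trans (≡ₘ-reflexive (lem (val N r) (val N s))) (≡ₘ-trans (+-congₘ zero′ (≡ₘ-refl {val N s})) (≡ₘ-reflexive (ℤP.+-identityˡ (val N s))))
       where
         lem : ∀ x y → x ≡ (x +ᶻ -ᶻ y) +ᶻ y
         lem = solve-∀
         zero′ : val N r +ᶻ -ᶻ val N s ≡ₘ 0ℤ
         zero′ = ≡ₘ-trans (+-congₘ (≡ₘ-refl {val N r}) (≡ₘ-sym (val-neg N s))) (≡ₘ-trans (≡ₘ-reflexive (sym (val-add N r (neg s)))) (reduce-vanish ps (add r (neg s)) nulls eq))

   generators : List (ℕ × (ℕ × (ℕ × ℕ))) → List (List ℕ)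
   generators []                     = []
   generators ((X , Y , x , y) ∷ qs) = relations X Y x y ++ generators qs

   generators-null : ∀ {N} → Irrational N → ∀ qs → All (Null N) (generators qs)
   generators-null irr []                     = []
   generators-null {N} irr ((X , Y , x , y) ∷ qs) = AllP.++⁺ (relations-null {N} irr X Y x y) (generators-null {N} irr qs)

   -- The sums belonging to the coordinates without pivot; modulo p the relations express all others
   -- through them.
   basis : ℕ → List ℕ → ℕ → ℤ
   basis N []       _       = 0ℤ
   basis N (f ∷ fs) zero    = val N (unit-row f)
   basis N (f ∷ fs) (suc i) = basis N fs i

   rebuild : List ℕ → List ℕ → List ℕ
   rebuild []       π       = []
   rebuild (f ∷ fs) []      = []
   rebuild (f ∷ fs) (c ∷ π) = add (zeros f (c ∷ [])) (rebuild fs π)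

   val-rebuild : ∀ N fs π → val N (rebuild fs π) ≡ dot π (basis N fs)
   val-rebuild N []       π       = trans (val-[] N 0) (sym (trans (dot-cong π (λ _ → refl)) (dot-0 π)))
   val-rebuild N (f ∷ fs) []      = val-[] N 0
   val-rebuild N (f ∷ fs) (c ∷ π) = trans (val-add N (zeros f (c ∷ [])) (rebuild fs π))
     (cong₂ _+ᶻ_ (trans (val-zeros N f c []) (trans (cong (+ c *ᶻ val N (unit-row f) +ᶻ_) (val-[] N (suc f))) (ℤP.+-identityʳ (+ c *ᶻ val N (unit-row f))))) (val-rebuild N fs π))

   pick : List ℕ → List ℕ → List ℕ
   pick []       r = []
   pick (i ∷ is) r = nth 0 r i ∷ pick is r

   -- The expression of each coordinate through the free ones, read off from its reduction. It is
   -- only a proposal: `checkBlock` reduces the difference between the coordinate and the expression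
   -- to zero.
   block : Pivots → List ℕ → ℕ → List (List ℕ)
   block ps free κ = tab (λ i → pick free (reduce ps (unit-row i))) (suc n) (κ ℕ.* suc n)

   checkBlock : Pivots → List ℕ → ℕ → List (List ℕ) → Bool
   checkBlock ps free m []       = true
   checkBlock ps free m (π ∷ πs) = vanish (reduce ps (add (unit-row m) (neg (rebuild free π)))) ∧ checkBlock ps free (suc m) πs

   checkBlocks : Pivots → List ℕ → ℕ → List (List (List ℕ)) → Bool
   checkBlocks ps free zero    B = true
   checkBlocks ps free (suc κ) B = checkBlock ps free (κ ℕ.* suc n) (nth [] B κ) ∧ ((suc n ≡ᵇ length (nth [] B κ)) ∧ checkBlocks ps free κ B)

   combine : List ℕ → List (List ℕ) → List ℕ
   combine []       πs       = []
   combine (c ∷ r)  []       = []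
   combine (c ∷ r)  (π ∷ πs) = add (scale c π) (combine r πs)

   module _ (N : ℕ) {ps : Pivots} (nulls : NullPivots N ps) (free : List ℕ) where

     combine-sound : ∀ m r πs → checkBlock ps free m πs ≡ true → length r ≤ length πs → val N (zeros m r) ≡ₘ dot (combine r πs) (basis N free)
     combine-sound m []      πs       _  _         = ≡ₘ-reflexive (val-[] N m)
     combine-sound m (c ∷ r) (π ∷ πs) eq (s≤s len) with ∧-true {vanish (reduce ps (add (unit-row m) (neg (rebuild free π))))} eq
     ... | eq₁ , eq₂ = ≡ₘ-trans (≡ₘ-reflexive (val-zeros N m c r)) (≡ₘ-trans
       (+-congₘ (*-congₘ (≡ₘ-refl {+ c}) (≡ₘ-trans (difference-null N ps (unit-row m) (rebuild free π) nulls eq₁) (≡ₘ-reflexive (val-rebuild N free π)))) (combine-sound (suc m) r πs eq₂ len))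
       (≡ₘ-reflexive (sym (trans (dot-add (scale c π) (combine r πs) (basis N free)) (cong (_+ᶻ dot (combine r πs) (basis N free)) (dot-scale c π (basis N free)))))))

     block-sound : ∀ B K κ r → checkBlocks ps free K B ≡ true → κ < K → length r ≡ suc n → val N (zeros (κ ℕ.* suc n) r) ≡ₘ dot (combine r (nth [] B κ)) (basis N free)
     block-sound B (suc K) κ r eq (s≤s κ≤K) len with ∧-true {checkBlock ps free (K ℕ.* suc n) (nth [] B K)} eq
     ... | eq₁ , eq₂ with ∧-true {suc n ≡ᵇ length (nth [] B K)} eq₂ | ℕP.m≤n⇒m<n∨m≡n κ≤K
     ...   | eq₃ , eq₄ | _⊎_.inj₁ κ<K  = block-sound B K κ r eq₄ κ<K len
     ...   | eq₃ , eq₄ | _⊎_.inj₂ refl = combine-sound (κ ℕ.* suc n) r (nth [] B κ) eq₁ (ℕP.≤-reflexive (trans len (ℕP.≡ᵇ⇒≡ (suc n) _ (subst T (sym eq₃) tt))))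

   Table : Set
   Table = List (List (List (List ℕ)))

   table-entry : ℕ → List (List (List ℕ)) → ℕ → ℕ → ℕ → List ℕ
   table-entry μ B κ x y = red (scale μ (combine (monos x y n) (nth [] B κ)))

   -- All values of Φ in free coordinates, for κ modulo 2 and v modulo p and scaled by μ, so that
   -- the Euclidean walks amount to look-ups and additions.
   table : ℕ → List (List (List ℕ)) → Table
   table μ B = tab (λ κ → tab (λ x → tab (λ y → table-entry μ B κ x y) p 0) p 0) 4 0

   look : Table → ℕ → ℕ → ℕ → List ℕ
   look T κ x y = nth [] (nth [] (nth [] T κ) x) y

   look-table : ∀ μ B κ x y → κ < 4 → x < p → y < p → look (table μ B) κ x y ≡ table-entry μ B κ x y
   look-table μ B κ x y κ<4 x<p y<p = trans (cong (λ T → nth [] (nth [] T x) y) (nth-tab [] (λ κ → tab (λ x → tab (λ y → table-entry μ B κ x y) p 0) p 0) 4 0 κ κ<4))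
     (trans (cong (λ T → nth [] T y) (nth-tab [] (λ x → tab (λ y → table-entry μ B κ x y) p 0) p 0 x x<p)) (nth-tab [] (λ y → table-entry μ B κ x y) p 0 y y<p))

   -- A term (μ , s , a , b) stands for μ ψ(Q(s,0)) Q(a,b)ʲ.

   Term : Set
   Term = ℕ × (ℕ × (ℕ × ℕ))

   Entry : Set
   Entry = Table × (ℕ × (ℕ × ℕ))

   entry : List (List (List ℕ)) → Term → Entry
   entry B (μ , t) = table μ B , t

   -- The matrix with columns u and (x, y) sends (s, 0) to su and (a, b) to au + b(x, y). Terms are
   -- restricted to κ = (s, 0) so that the condition modulo 2 sees the first column alone.
   contribution : List Entry → ℕ → ℕ → ℕ → ℕ → List ℕ
   contribution []                       u₁ u₂ x y = []
   contribution ((T , (s , a , b)) ∷ E) u₁ u₂ x y = add (look T (index (s ℕ.* u₁) (s ℕ.* u₂)) ((a ℕ.* u₁ ℕ.+ b ℕ.* x) % p) ((a ℕ.* u₂ ℕ.+ b ℕ.* y) % p)) (contribution E u₁ u₂ x y)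

   -- Follows `path`, keeping the first column modulo 2p: its residues modulo 2 and modulo p are all
   -- that the values depend on. The entries x and y stay exact, as they steer the algorithm.
   walk : List Entry → ℕ → ℕ → ℕ → ℕ → ℕ → List ℕ
   walk E zero    u₁ u₂ x       y = []
   walk E (suc f) u₁ u₂ zero    y = contribution E u₁ u₂ 0 y
   -- As p + k = 2p - 1, the new first entry is u₂ - t u₁ modulo 2p, t being the quotient.
   walk E (suc f) u₁ u₂ (suc x) y = add (contribution E u₁ u₂ (suc x) y) (walk E f ((u₂ ℕ.+ (p ℕ.+ k) ℕ.* ((y / suc x) ℕ.* u₁)) % (p ℕ.+ p)) u₁ (y % suc x) (suc x))

   total : List Entry → ℕ → ℕ → List ℕ
   total E ℓ zero    = contribution E ℓ 0 0 1
   total E ℓ (suc b) = add (walk E (suc b) 1 0 b ℓ) (total E ℓ b)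

   combination : List Term → Quadratic → ℤ
   combination []                       Q = 0ℤ
   combination ((μ , (s , a , b)) ∷ ts) Q = + μ *ᶻ monomial (+ s , 0ℤ) (+ a , + b) Q +ᶻ combination ts Q

   combination-odd : ∀ ts → Odd (combination ts)
   combination-odd []                       Q = refl
   combination-odd ((μ , (s , a , b)) ∷ ts) Q = trans (cong₂ (λ x y → + μ *ᶻ x +ᶻ y) (monomial-odd (+ s , 0ℤ) (+ a , + b) Q) (combination-odd ts Q)) (lem (+ μ) _ _)
     where
       lem : ∀ m x y → m *ᶻ (-ᶻ x) +ᶻ -ᶻ y ≡ -ᶻ (m *ᶻ x +ᶻ y)
       lem = solve-∀

   ∑-term : ∀ N μ κ v M g → ∑ (forms N) (λ Q → + μ *ᶻ monomial κ v (Q ∘ᴹ M) +ᶻ g Q) ≡ + μ *ᶻ Φ N (M · κ) (M · v) +ᶻ ∑ (forms N) g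
   ∑-term N μ κ v M g = trans (∑-⊕ (forms N) _ g) (cong (_+ᶻ ∑ (forms N) g) (trans (∑-scale (+ μ) (forms N) _) (cong (+ μ *ᶻ_) (∑-cong (forms N) (monomial-∘ κ v M)))))

   _~_ : ℤ → ℕ → Set
   u ~ m = ∃ λ δ → u ≡ + m +ᶻ + (p ℕ.+ p) *ᶻ δ

   module _ (N : ℕ) {ps : Pivots} (nulls : NullPivots N ps) (free : List ℕ) (B : List (List (List ℕ))) (good : checkBlocks ps free 4 B ≡ true) (ts : List Term) where

     private
       c : ℕ → ℤ
       c = basis N free
       E : List Entry
       E = map (entry B) ts

     cone-sum : Matrix → ℤ
     cone-sum M = ∑ (forms N) (λ Q → combination ts (Q ∘ᴹ M))

     look-sound : ∀ μ κ x y → κ < 4 → x < p → y < p → dot (look (table μ B) κ x y) c ≡ₘ + μ *ᶻ Φ N (representative κ) (+ x , + y)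
     look-sound μ κ x y κ<4 x<p y<p = ≡ₘ-trans (≡ₘ-reflexive (cong (λ r → dot r c) (look-table μ B κ x y κ<4 x<p y<p)))
       (≡ₘ-trans (dot-red (scale μ (combine (monos x y n) (nth [] B κ))) c) (≡ₘ-trans (≡ₘ-reflexive (dot-scale μ (combine (monos x y n) (nth [] B κ)) c))
         (*-congₘ (≡ₘ-refl {+ μ}) (≡ₘ-trans (≡ₘ-sym (block-sound N nulls free B 4 κ (monos x y n) good κ<4 (length-monos x y n))) (val-monos N κ x y κ<4)))))

     contribution-sound : ∀ {u} u₁ u₂ x y → proj₁ u ~ u₁ → proj₂ u ~ u₂ → dot (contribution E u₁ u₂ x y) c ≡ₘ cone-sum (u , (+ x , + y))
     contribution-sound {u} u₁ u₂ x y (δ₁ , refl) (δ₂ , refl) = go ts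
       where
         M : Matrix
         M = u , (+ x , + y)
         even-part : ∀ s m δ z → (+ m +ᶻ + (p ℕ.+ p) *ᶻ δ) *ᶻ + s +ᶻ z *ᶻ 0ℤ ≡ + ((s ℕ.* m) % 2) +ᶻ + 2 *ᶻ (+ ((s ℕ.* m) / 2) +ᶻ + p *ᶻ δ *ᶻ + s)
         even-part s m δ z = trans (cong (λ w → (+ m +ᶻ w *ᶻ δ) *ᶻ + s +ᶻ z *ᶻ 0ℤ) (ℤP.pos-+ p p)) (trans (l₁ (+ m) (+ p) δ (+ s) z)
           (trans (cong (_+ᶻ + 2 *ᶻ (+ p *ᶻ δ *ᶻ + s)) (trans (sym (ℤP.pos-* s m)) (halves (s ℕ.* m)))) (l₂ (+ ((s ℕ.* m) % 2)) (+ ((s ℕ.* m) / 2)) (+ p *ᶻ δ *ᶻ + s))))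
           where
             l₁ : ∀ m p δ s z → (m +ᶻ (p +ᶻ p) *ᶻ δ) *ᶻ s +ᶻ z *ᶻ 0ℤ ≡ s *ᶻ m +ᶻ + 2 *ᶻ (p *ᶻ δ *ᶻ s)
             l₁ = solve-∀
             l₂ : ∀ r h w → (r +ᶻ + 2 *ᶻ h) +ᶻ + 2 *ᶻ w ≡ r +ᶻ + 2 *ᶻ (h +ᶻ w)
             l₂ = solve-∀
         p-part : ∀ a b m δ z → (+ m +ᶻ + (p ℕ.+ p) *ᶻ δ) *ᶻ + a +ᶻ + z *ᶻ + b ≡ₘ + ((a ℕ.* m ℕ.+ b ℕ.* z) % p)
         p-part a b m δ z = ≡ₘ-trans (mk (ℤD.divides ((δ +ᶻ δ) *ᶻ + a) (trans (cong₂ (λ w v → (+ m +ᶻ w *ᶻ δ) *ᶻ + a +ᶻ + z *ᶻ + b -ᶻ v) (ℤP.pos-+ p p)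
               (trans (ℤP.pos-+ (a ℕ.* m) (b ℕ.* z)) (cong₂ _+ᶻ_ (ℤP.pos-* a m) (ℤP.pos-* b z)))) (l (+ m) (+ p) δ (+ a) (+ z) (+ b))))) (≡ₘ-sym (%-≡ₘ (a ℕ.* m ℕ.+ b ℕ.* z)))
           where
             l : ∀ m p δ a z b → (m +ᶻ (p +ᶻ p) *ᶻ δ) *ᶻ a +ᶻ z *ᶻ b -ᶻ (a *ᶻ m +ᶻ b *ᶻ z) ≡ (δ +ᶻ δ) *ᶻ a *ᶻ p
             l = solve-∀
         go : ∀ ts → dot (contribution (map (entry B) ts) u₁ u₂ x y) c ≡ₘ ∑ (forms N) (λ Q → combination ts (Q ∘ᴹ M))
         go []                       = ≡ₘ-reflexive (sym (∑-zero (forms N) (λ _ → refl)))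
         go ((μ , (s , a , b)) ∷ ts) = ≡ₘ-trans (≡ₘ-reflexive (dot-add (look (table μ B) i X Y) (contribution (map (entry B) ts) u₁ u₂ x y) c))
           (≡ₘ-trans (+-congₘ (≡ₘ-trans (look-sound μ i X Y (proj₁ idx) (ℕDM.m%n<n (a ℕ.* u₁ ℕ.+ b ℕ.* x) p) (ℕDM.m%n<n (a ℕ.* u₂ ℕ.+ b ℕ.* y) p)) (*-congₘ (≡ₘ-refl {+ μ}) same)) (go ts))
             (≡ₘ-reflexive (sym (∑-term N μ (+ s , 0ℤ) (+ a , + b) M (λ Q → combination ts (Q ∘ᴹ M))))))
           where
             i = index (s ℕ.* u₁) (s ℕ.* u₂)
             X = (a ℕ.* u₁ ℕ.+ b ℕ.* x) % p
             Y = (a ℕ.* u₂ ℕ.+ b ℕ.* y) % p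
             idx = index-representative (s ℕ.* u₁) (s ℕ.* u₂)
             same : Φ N (representative i) (+ X , + Y) ≡ₘ Φ N (M · (+ s , 0ℤ)) (M · (+ a , + b))
             same = subst (λ z → Φ N z (+ X , + Y) ≡ₘ Φ N (M · (+ s , 0ℤ)) (M · (+ a , + b))) (sym (proj₂ idx))
               (≡ₘ-sym (Φ-cong N {proj₁ (M · (+ s , 0ℤ))} {proj₂ (M · (+ s , 0ℤ))} {+ ((s ℕ.* u₁) % 2)} {+ ((s ℕ.* u₂) % 2)} {proj₁ (M · (+ a , + b))} {proj₂ (M · (+ a , + b))} {+ X} {+ Y}
                  (+ ((s ℕ.* u₁) / 2) +ᶻ + p *ᶻ δ₁ *ᶻ + s) (+ ((s ℕ.* u₂) / 2) +ᶻ + p *ᶻ δ₂ *ᶻ + s)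
                  (even-part s u₁ δ₁ (+ x)) (even-part s u₂ δ₂ (+ y)) (p-part a b u₁ δ₁ x) (p-part a b u₂ δ₂ y)))

     walk-sound : ∀ f {u} u₁ u₂ x y → proj₁ u ~ u₁ → proj₂ u ~ u₂ → dot (walk E f u₁ u₂ x y) c ≡ₘ ∑ (path f u x y) cone-sum
     walk-sound zero    u₁ u₂ x       y _  _  = ≡ₘ-refl
     walk-sound (suc f) {u} u₁ u₂ zero    y r₁ r₂ = ≡ₘ-trans (contribution-sound {u} u₁ u₂ 0 y r₁ r₂) (≡ₘ-reflexive (sym (ℤP.+-identityʳ _)))
     walk-sound (suc f) {u} u₁ u₂ (suc x) y r₁@(δ₁ , eq₁) r₂@(δ₂ , eq₂) = ≡ₘ-trans (≡ₘ-reflexive (dot-add (contribution E u₁ u₂ (suc x) y) (walk E f (R % (p ℕ.+ p)) u₁ (y % suc x) (suc x)) c))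
       (+-congₘ (contribution-sound {u} u₁ u₂ (suc x) y r₁ r₂) (walk-sound f {τ⁻¹ (+ t) · u} (R % (p ℕ.+ p)) u₁ (y % suc x) (suc x) (δ , first) (δ₁ , trans (l₀ (proj₁ u) (proj₂ u)) eq₁)))
       where
         t = y / suc x
         R = u₂ ℕ.+ (p ℕ.+ k) ℕ.* (t ℕ.* u₁)
         m = p ℕ.+ p
         δ = + (R / m) -ᶻ + t *ᶻ + u₁ -ᶻ + t *ᶻ δ₁ +ᶻ δ₂
         l₀ : ∀ u v → 1ℤ *ᶻ u +ᶻ 0ℤ *ᶻ v ≡ u
         l₀ = solve-∀
         pk : + (p ℕ.+ k) ≡ + m -ᶻ 1ℤ
         pk = trans (ℤP.pos-+ p k) (trans (lem (+ p) (+ k)) (cong (λ z → z -ᶻ 1ℤ) (sym (ℤP.pos-+ p p))))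
           where
             lem : ∀ p k → p +ᶻ k ≡ p +ᶻ (1ℤ +ᶻ k) -ᶻ 1ℤ
             lem = solve-∀
         R≡ : + u₂ +ᶻ (+ m -ᶻ 1ℤ) *ᶻ (+ t *ᶻ + u₁) ≡ + (R % m) +ᶻ + (R / m) *ᶻ + m
         R≡ = trans (cong₂ (λ a b → + u₂ +ᶻ a *ᶻ b) (sym pk) (sym (ℤP.pos-* t u₁))) (trans (cong (+ u₂ +ᶻ_) (sym (ℤP.pos-* (p ℕ.+ k) (t ℕ.* u₁))))
           (trans (cong +_ (ℕDM.m≡m%n+[m/n]*n R m)) (cong (+ (R % m) +ᶻ_) (ℤP.pos-* (R / m) m))))
         first : (-ᶻ + t) *ᶻ proj₁ u +ᶻ 1ℤ *ᶻ proj₂ u ≡ + (R % m) +ᶻ + m *ᶻ δ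
         first = trans (cong₂ (λ a b → (-ᶻ + t) *ᶻ a +ᶻ 1ℤ *ᶻ b) eq₁ eq₂) (trans (l₁ (+ t) (+ u₁) (+ u₂) (+ m) δ₁ δ₂)
           (trans (cong (_+ᶻ + m *ᶻ (δ₂ -ᶻ + t *ᶻ δ₁ -ᶻ + t *ᶻ + u₁)) R≡) (l₂ (+ (R % m)) (+ (R / m)) (+ m) (+ t) (+ u₁) δ₁ δ₂)))
           where
             l₁ : ∀ t u v m d e → (-ᶻ t) *ᶻ (u +ᶻ m *ᶻ d) +ᶻ 1ℤ *ᶻ (v +ᶻ m *ᶻ e) ≡ (v +ᶻ (m -ᶻ 1ℤ) *ᶻ (t *ᶻ u)) +ᶻ m *ᶻ (e -ᶻ t *ᶻ d -ᶻ t *ᶻ u)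
             l₁ = solve-∀
             l₂ : ∀ r q m t u d e → (r +ᶻ q *ᶻ m) +ᶻ m *ᶻ (e -ᶻ t *ᶻ d -ᶻ t *ᶻ u) ≡ r +ᶻ m *ᶻ (q -ᶻ t *ᶻ u -ᶻ t *ᶻ d +ᶻ e)
             l₂ = solve-∀

     total-sound : ∀ ℓ b → dot (total E ℓ b) c ≡ₘ ∑ (hecke-matrices ℓ b) cone-sum
     total-sound ℓ zero    = ≡ₘ-trans (contribution-sound {+ ℓ , 0ℤ} ℓ 0 0 1 (0ℤ , lem (+ ℓ) (+ (p ℕ.+ p))) (0ℤ , lem 0ℤ (+ (p ℕ.+ p)))) (≡ₘ-reflexive (sym (ℤP.+-identityʳ _)))
       where
         lem : ∀ x m → x ≡ x +ᶻ m *ᶻ 0ℤ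
         lem = solve-∀
     total-sound ℓ (suc b) = ≡ₘ-trans (≡ₘ-reflexive (dot-add (walk E (suc b) 1 0 b ℓ) (total E ℓ b) c))
       (≡ₘ-trans (+-congₘ (walk-sound (suc b) {e₁} 1 0 b ℓ (0ℤ , lem 1ℤ (+ (p ℕ.+ p))) (0ℤ , lem 0ℤ (+ (p ℕ.+ p)))) (total-sound ℓ b)) (≡ₘ-reflexive (sym (∑-++ (path (suc b) e₁ b ℓ) (hecke-matrices ℓ b) cone-sum))))
       where
         lem : ∀ x m → x ≡ x +ᶻ m *ᶻ 0ℤ
         lem = solve-∀

   target : List (ℕ × ℕ) → List ℕ
   target []             = []
   target ((c , i) ∷ cs) = add (zeros i (c ∷ [])) (target cs)

   term-row : List Term → List ℕ
   term-row []                       = []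
   term-row ((μ , (s , a , b)) ∷ ts) = add (scale μ (row s 0 a b)) (term-row ts)

   val-term-row : ∀ N ts → val N (term-row ts) ≡ₘ ∑ (forms N) (combination ts)
   val-term-row N []                       = ≡ₘ-refl
   val-term-row N ((μ , (s , a , b)) ∷ ts) = ≡ₘ-trans (≡ₘ-reflexive (trans (val-add N (scale μ (row s 0 a b)) (term-row ts)) (cong (_+ᶻ val N (term-row ts)) (val-scale N μ (row s 0 a b)))))
     (≡ₘ-trans (+-congₘ (*-congₘ (≡ₘ-refl {+ μ}) (val-row N s 0 a b)) (val-term-row N ts))
       (≡ₘ-reflexive (sym (trans (∑-⊕ (forms N) _ (combination ts)) (cong (_+ᶻ ∑ (forms N) (combination ts)) (∑-scale (+ μ) (forms N) _))))))

   check-primes : List Entry → List ℕ → Bool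
   check-primes E []       = true
   check-primes E (ℓ ∷ ℓs) = vanish (total E ℓ ℓ) ∧ check-primes E ℓs

   -- Pivots and blocks are arguments of the successive checks, so that soundness is proved for
   -- arbitrary pivots of null rows and arbitrary blocks passing the checks.
   check-blocks : Pivots → List ℕ → List Term → List ℕ → List (List (List ℕ)) → Bool
   check-blocks ps free ts ℓs B = checkBlocks ps free 4 B ∧ check-primes (map (entry B) ts) ℓs

   check-pivots : List ℕ → List Term → List (ℕ × ℕ) → List ℕ → Pivots → Bool
   check-pivots free ts cs ℓs ps = vanish (reduce ps (add (target cs) (neg (term-row ts)))) ∧ check-blocks ps free ts ℓs (tab (block ps free) 4 0)

   check : List (ℕ × (ℕ × (ℕ × ℕ))) → List ℕ → List Term → List (ℕ × ℕ) → List ℕ → Bool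
   check qs free ts cs ℓs = check-pivots free ts cs ℓs (eliminate [] (generators qs))

   record Certified (qs : List (ℕ × (ℕ × (ℕ × ℕ)))) (free : List ℕ) (ts : List Term) (cs : List (ℕ × ℕ)) (ℓs : List ℕ) : Set where
     constructor certify
     field passes : check qs free ts cs ℓs ≡ true

   check-primes-sound : ∀ E ℓs {ℓ} → check-primes E ℓs ≡ true → ℓ ∈ ℓs → vanish (total E ℓ ℓ) ≡ true
   check-primes-sound E (ℓ ∷ ℓs) eq (here refl) = proj₁ (∧-true {vanish (total E ℓ ℓ)} eq)
   check-primes-sound E (ℓ ∷ ℓs) eq (there ℓ∈)  = check-primes-sound E ℓs (proj₂ (∧-true {vanish (total E ℓ ℓ)} eq)) ℓ∈

   -- The relations are applied for two discriminants. At ℓ²N, with N = ℓm, they replace the target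
   -- by the chosen terms. After the Hecke step they are applied at N, where the whole sum over
   -- cones is written in free coordinates and its coefficients are found to be zero modulo p.
   certified-sound : ∀ {qs free ts cs ℓs} → Certified qs free ts cs ℓs → ∀ {ℓ} → ℓ ∈ ℓs → Prime ℓ → ∀ m → ¬ ℓ ℕD.∣ m →
                 val (ℓ ℕ.* m ℕ.* (ℓ ℕ.* ℓ)) (target cs) ≡ₘ 0ℤ
   certified-sound {qs} {free} {ts} {cs} {ℓs} (certify eq) {ℓ} ℓ∈ ℓ-prime m ℓ∤m = go (eliminate [] (generators qs)) (λ {N} irr → eliminate-null N [] (generators qs) [] (generators-null {N} irr qs)) eq
     where
       open HeckeSum ℓ-prime m ℓ∤m (combination ts) (combination-odd ts) using (N; N′; irrational; irrational′; hecke)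
       go : ∀ ps → (∀ {N} → Irrational N → NullPivots N ps) → check-pivots free ts cs ℓs ps ≡ true → val N′ (target cs) ≡ₘ 0ℤ
       go ps nulls eq with ∧-true {vanish (reduce ps (add (target cs) (neg (term-row ts))))} eq
       ... | eq₁ , eq₂ = go′ (tab (block ps free) 4 0) eq₂
         where
           go′ : ∀ B → check-blocks ps free ts ℓs B ≡ true → val N′ (target cs) ≡ₘ 0ℤ
           go′ B eq₂ with ∧-true {checkBlocks ps free 4 B} eq₂
           ... | good , eq₃ = ≡ₘ-trans (difference-null N′ ps (target cs) (term-row ts) (nulls {N′} irrational′) eq₁)
             (≡ₘ-trans (val-term-row N′ ts) (≡ₘ-trans (≡ₘ-reflexive hecke)
               (≡ₘ-trans (≡ₘ-sym (total-sound N (nulls {N} irrational) free B good ts ℓ ℓ)) (vanish-sound (total (map (entry B) ts) ℓ ℓ) (basis N free) (check-primes-sound (map (entry B) ts) ℓs eq₃ ℓ∈)))))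

-- The certificates modulo 13, 17 and 19.

module Certificates where

 open Substitution using (od; od-even; ev; sgn; parity)
 open Factorizations using (χ)
 open LambertSeries using (e)
 open LambertForms using (χ-%)
 open TripleSums
 open Elimination

 -- For n < p these n + 1 points of the projective line are distinct modulo p, and evaluation at
 -- them spans the functionals on binary forms of degree n. The relations taken at these v thus span
 -- those at every v.
 points : ℕ → List (ℕ × ℕ)
 points n = (0 , 1) ∷ map (1 ,_) (upTo n)

 with-points : ℕ → List (ℕ × ℕ) → List (ℕ × (ℕ × (ℕ × ℕ)))
 with-points n = concatMap (λ { (X , Y) → map (λ v → X , Y , v) (points n) })

 χᶻ : ℤ → ℤ
 χᶻ (+ n)    = χ n
 χᶻ -[1+ n ] = -ᶻ χ (suc n)

 χᶻ-neg : ∀ x → χᶻ (-ᶻ x) ≡ -ᶻ χᶻ x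
 χᶻ-neg (+ zero)    = refl
 χᶻ-neg (+ suc n)   = refl
 χᶻ-neg -[1+ n ]    = sym (ℤP.neg-involutive (χ (suc n)))

 χᶻ-step : ∀ x → χᶻ (x +ᶻ + 4) ≡ χᶻ x
 χᶻ-step (+ n)                            = trans (cong χ (ℕP.+-comm n 4)) (ℤP.neg-involutive (χ n))
 χᶻ-step -[1+ 0 ]                         = refl
 χᶻ-step -[1+ 1 ]                         = refl
 χᶻ-step -[1+ 2 ]                         = refl
 χᶻ-step -[1+ 3 ]                         = refl
 χᶻ-step -[1+ suc (suc (suc (suc n))) ] = cong -ᶻ_ (sym (ℤP.neg-involutive (χ (suc n))))

 evᶻ : ℤ → ℤ
 evᶻ x = ev ∣ x ∣

 from-step : ∀ (ψ : ℤ → ℤ) → (∀ x → ψ (x +ᶻ + 4) ≡ ψ x) → ∀ x z → ψ (x +ᶻ + 4 *ᶻ z) ≡ ψ x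
 from-step ψ step x (+ n)    = up n x
   where
     up : ∀ n x → ψ (x +ᶻ + 4 *ᶻ + n) ≡ ψ x
     up zero    x = cong ψ (ℤP.+-identityʳ x)
     up (suc n) x = trans (cong ψ (lem x (+ n))) (trans (step _) (up n x))
       where
         lem : ∀ x n → x +ᶻ + 4 *ᶻ (1ℤ +ᶻ n) ≡ (x +ᶻ + 4 *ᶻ n) +ᶻ + 4
         lem = solve-∀
 from-step ψ step x -[1+ n ] = trans (sym (from-step ψ step (x +ᶻ + 4 *ᶻ -[1+ n ]) (+ suc n))) (cong ψ (lem x (+ suc n)))
   where
     lem : ∀ x n → x +ᶻ + 4 *ᶻ (-ᶻ n) +ᶻ + 4 *ᶻ n ≡ x
     lem = solve-∀

 even-power : ∀ y i → (-ᶻ y) ^ᶻ (i ℕ.* 2) ≡ y ^ᶻ (i ℕ.* 2)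
 even-power y zero    = refl
 even-power y (suc i) = trans (cong (λ z → (-ᶻ y) *ᶻ ((-ᶻ y) *ᶻ z)) (even-power y i)) (lem y (y ^ᶻ (i ℕ.* 2)))
   where
     lem : ∀ y z → (-ᶻ y) *ᶻ ((-ᶻ y) *ᶻ z) ≡ y *ᶻ (y *ᶻ z)
     lem = solve-∀

 χᶻ-odd : ∀ i x y → χᶻ (-ᶻ x) *ᶻ (-ᶻ y) ^ᶻ (i ℕ.* 2) ≡ -ᶻ (χᶻ x *ᶻ y ^ᶻ (i ℕ.* 2))
 χᶻ-odd i x y = trans (cong₂ _*ᶻ_ (χᶻ-neg x) (even-power y i)) (sym (ℤP.neg-distribˡ-* (χᶻ x) (y ^ᶻ (i ℕ.* 2))))

 module V13 = Verification 12 4 χᶻ (from-step χᶻ χᶻ-step) (χᶻ-odd 2)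
 module V17 = Verification 16 6 χᶻ (from-step χᶻ χᶻ-step) (χᶻ-odd 3)

 -- The power j is one less than the weight 5, 7 or 8 that remains after taking out θ². For 19 it is
 -- odd, so ψ must be even for the summand to change sign with Q.
 evᶻ-odd : ∀ i x y → evᶻ (-ᶻ x) *ᶻ (-ᶻ y) ^ᶻ suc (i ℕ.* 2) ≡ -ᶻ (evᶻ x *ᶻ y ^ᶻ suc (i ℕ.* 2))
 evᶻ-odd i x y = trans (cong₂ (λ a b → ev a *ᶻ ((-ᶻ y) *ᶻ b)) (ℤP.∣-i∣≡∣i∣ x) (even-power y i)) (lem (evᶻ x) y (y ^ᶻ (i ℕ.* 2)))
   where
     lem : ∀ e y z → e *ᶻ ((-ᶻ y) *ᶻ z) ≡ -ᶻ (e *ᶻ (y *ᶻ z))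
     lem = solve-∀

 evᶻ-step : ∀ x → evᶻ (x +ᶻ + 4) ≡ evᶻ x
 evᶻ-step (+ n)                            = cong ev (ℕP.+-comm n 4)
 evᶻ-step -[1+ 0 ]                         = refl
 evᶻ-step -[1+ 1 ]                         = refl
 evᶻ-step -[1+ 2 ]                         = refl
 evᶻ-step -[1+ 3 ]                         = refl
 evᶻ-step -[1+ suc (suc (suc (suc n))) ]   = refl

 module V19 = Verification 18 7 evᶻ (from-step evᶻ evᶻ-step) (evᶻ-odd 3)

 ℓs₁₃ ℓs₁₇ ℓs₁₉ : List ℕ
 ℓs₁₃ = 1811 ∷ 1871 ∷ 1949 ∷ 2207 ∷ 3301 ∷ 4001 ∷ 4079 ∷ 4289 ∷ 4931 ∷ []
 ℓs₁₇ = 2039 ∷ 2719 ∷ 3331 ∷ 4079 ∷ []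
 ℓs₁₉ = 151 ∷ 1091 ∷ 2659 ∷ 3989 ∷ []

 κs : List (ℕ × ℕ)
 κs = (0 , 0) ∷ (1 , 0) ∷ (0 , 1) ∷ (1 , 1) ∷ []

 -- A pair (c , i) of a target stands for c times the i-th coordinate, so that the targets are the sums F of TripleSums.
 -- The terms are combinations congruent to them modulo the relations, chosen short, and the free coordinates are those without pivot.

 target₁₃ target₁₇ target₁₉ : List (ℕ × ℕ)
 target₁₃ = (6 , 17) ∷ (8 , 26) ∷ []
 target₁₇ = (13 , 23) ∷ (3 , 25) ∷ (4 , 36) ∷ (5 , 38) ∷ []
 target₁₉ = (5 , 12) ∷ (13 , 14) ∷ (9 , 29) ∷ (15 , 42) ∷ (11 , 44) ∷ (10 , 59) ∷ []

 free₁₃ free₁₇ free₁₉ : List ℕ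
 free₁₃ = 8 ∷ 26 ∷ 33 ∷ 35 ∷ []
 free₁₇ = 12 ∷ 38 ∷ 47 ∷ 49 ∷ 51 ∷ []
 free₁₉ = 12 ∷ 14 ∷ 44 ∷ 53 ∷ 55 ∷ 57 ∷ 59 ∷ []

 terms₁₃ terms₁₇ terms₁₉ : List (ℕ × (ℕ × (ℕ × ℕ)))
 terms₁₃ = (6 , 1 , 1 , 0) ∷ (5 , 1 , 0 , 1) ∷ []
 terms₁₇ = (6 , 1 , 1 , 0) ∷ (7 , 1 , 0 , 1) ∷ (14 , 1 , 1 , 3) ∷ []
 terms₁₉ = (8 , 1 , 1 , 0) ∷ (9 , 1 , 1 , 3) ∷ (2 , 1 , 1 , 6) ∷ (4 , 0 , 1 , 2) ∷ (10 , 0 , 1 , 7) ∷ []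

 -- The arguments 8, 12 and 14 of `with-points` are the degrees 2j of the powers of Q. Each `refl`
 -- evaluates the elimination and the Euclidean walks for every listed ℓ.
 certificate₁₃ : V13.Certified (with-points 8 κs) free₁₃ terms₁₃ target₁₃ ℓs₁₃
 certificate₁₃ = V13.certify refl

 certificate₁₇ : V17.Certified (with-points 12 κs) free₁₇ terms₁₇ target₁₇ ℓs₁₇
 certificate₁₇ = V17.certify refl

 certificate₁₉ : V19.Certified (with-points 14 κs) free₁₉ terms₁₉ target₁₉ ℓs₁₉
 certificate₁₉ = V19.certify refl

-- From sums over quadratic forms to overpartitions.

module Divisibility where

 open PowerSeries
 open FiniteSums
 open Substitution using (ev; od; sgn; alt; U; Parity; parity; even; odd; ev+od; ev-sgn; sgn-+; sgn-*2; sgn-even; od-even)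
 open ThetaSeries using (sq; sgn-+ℤ)
 open Gauss using (overpartitions)
 open Factorizations using (χ)
 open LambertSeries using (e)
 open TripleSums
 open QuadraticForms
 open HeckeCosets
 open CoefficientRows
 open Elimination
 open Certificates
 open Defs using (overpartition)

 irrational⇒nonsquare : ∀ {N} → Irrational N → NonSquare N
 irrational⇒nonsquare {N} irr s eq with irr s 1ℤ (trans (sq-ℤ s) (trans (cong +_ eq) (sym (ℤP.*-identityʳ (+ N)))))
 ... | ()

 module Transfer (k j : ℕ) (ψ : ℤ → ℤ) (period : ∀ x z → ψ (x +ᶻ + 4 *ᶻ z) ≡ ψ x)
                 (ψ-odd : ∀ x y → ψ (-ᶻ x) *ᶻ (-ᶻ y) ^ᶻ j ≡ -ᶻ (ψ x *ᶻ y ^ᶻ j)) where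

   open Verification k j ψ period ψ-odd

   target-entry : ∀ c κ i Q → κ < 4 → i < suc n → dot (zeros (κ ℕ.* suc n ℕ.+ i) (c ∷ [])) (entries Q) ≡ + c *ᶻ (ψ (value Q (representative κ)) *ᶻ coefficient Q j i)
   target-entry c κ i Q κ<4 i≤n = trans (cong (λ r → dot r (entries Q)) (zeros-+ (κ ℕ.* suc n) i (c ∷ [])))
     (trans (dot-block κ (zeros i (c ∷ [])) Q κ<4 (subst (_≤ suc n) (sym (len i)) i≤n)) (at i (twisted (representative κ) Q)))
     where
       len : ∀ i → length (zeros i (c ∷ [])) ≡ suc i
       len zero    = refl
       len (suc i) = cong suc (len i)
       at : ∀ i f → dot (zeros i (c ∷ [])) f ≡ + c *ᶻ f i
       at zero    f = ℤP.+-identityʳ _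
       at (suc i) f = trans (ℤP.+-identityˡ _) (at i (f ∘ suc))

   entry-sum : List (ℕ × ℕ) → Quadratic → ℤ
   entry-sum []             Q = 0ℤ
   entry-sum ((c , i) ∷ cs) Q = dot (zeros i (c ∷ [])) (entries Q) +ᶻ entry-sum cs Q

   target-sum : ∀ cs Q → dot (target cs) (entries Q) ≡ entry-sum cs Q
   target-sum []             Q = refl
   target-sum ((c , i) ∷ cs) Q = trans (dot-add (zeros i (c ∷ [])) (target cs) (entries Q)) (cong (dot (zeros i (c ∷ [])) (entries Q) +ᶻ_) (target-sum cs Q))

   val-triples : ∀ N (F : ℤ → ℕ → ℕ → ℤ) cs → (∀ s d e → F s d e ≡ₘ dot (target cs) (entries (form (s , d , e)))) → ∑ (triples N) (on F) ≡ₘ val N (target cs)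
   val-triples N F cs eq = ≡ₘ-trans (∑-congₘ (triples N) (λ { (s , d , e) → eq s d e })) (≡ₘ-reflexive (sym (∑-map form (triples N) (λ Q → dot (target cs) (entries Q)))))

   -- The argument pℓ³n is p times N = ℓ²·ℓn. The coefficients of 1/θ carry a sign relative to
   -- overpartition numbers, removed by multiplying with the same sign again.
   overpartition-divisible : ∀ {ℓ} n cs (F : ℤ → ℕ → ℕ → ℤ) → Prime ℓ → ¬ ℓ ℕD.∣ n →
     (∀ s d e → F s d e ≡ₘ dot (target cs) (entries (form (s , d , e)))) →
     (∀ {N} → NonSquare N → U k (alt overpartitions) N ≡ₘ ∑ (triples N) (on F)) →
     val (ℓ ℕ.* n ℕ.* (ℓ ℕ.* ℓ)) (target cs) ≡ₘ 0ℤ → p ℕD.∣ overpartition (p ℕ.* ℓ ℕ.^ 3 ℕ.* n)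
   overpartition-divisible {ℓ} n cs F ℓ-prime ℓ∤n pointwise section null = ℤD.∣⇒∣ᵤ (≡0⇒∣ (≡ₘ-trans (≡ₘ-reflexive unsigned)
     (≡ₘ-trans (*-congₘ (≡ₘ-refl {sgn M}) (≡ₘ-trans (section (irrational⇒nonsquare {N} irrational′)) (≡ₘ-trans (val-triples N F cs pointwise) null)))
       (≡ₘ-reflexive (ℤP.*-zeroʳ (sgn M))))))
     where
       open Hecke ℓ-prime n ℓ∤n using (irrational′)
       N = ℓ ℕ.* n ℕ.* (ℓ ℕ.* ℓ)
       M = N ℕ.* p
       index-≡ : ∀ p ℓ n → p ℕ.* (ℓ ℕ.* (ℓ ℕ.* (ℓ ℕ.* 1))) ℕ.* n ≡ ℓ ℕ.* n ℕ.* (ℓ ℕ.* ℓ) ℕ.* p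
       index-≡ = ℕSolver.solve-∀
       unsigned : + overpartition (p ℕ.* ℓ ℕ.^ 3 ℕ.* n) ≡ sgn M *ᶻ U k (alt overpartitions) N
       unsigned = trans (cong overpartitions (index-≡ p ℓ n)) (sym (trans (sym (ℤP.*-assoc (sgn M) (sgn M) (overpartitions M))) (trans (cong (_*ᶻ overpartitions M) (sgn-*2 M)) (ℤP.*-identityˡ _))))

 module T13 = Transfer 12 4 χᶻ (from-step χᶻ χᶻ-step) (χᶻ-odd 2)
 module T17 = Transfer 16 6 χᶻ (from-step χᶻ χᶻ-step) (χᶻ-odd 3)
 module T19 = Transfer 18 7 evᶻ (from-step evᶻ evᶻ-step) (evᶻ-odd 3)

 χᶻ-e₁ : ∀ s d k → χᶻ (value (form (s , d , k)) e₁) ≡ χ d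
 χᶻ-e₁ s d k = cong χᶻ (value-e₁ (form (s , d , k)))

 χᶻ-e₂ : ∀ s d k → χᶻ (value (form (s , d , k)) e₂) ≡ -ᶻ χ k
 χᶻ-e₂ s d k = trans (cong χᶻ (value-e₂ (form (s , d , k)))) (χᶻ-neg (+ k))

 -- Blocks have length 9, so 17 = 9 + 8 and 26 = 2·9 + 8 mark the top coefficient d⁴ of Q⁴ for κ =
 -- e₁ and κ = e₂. As Q(e₂) = -k and χ is odd, the factor 5 turns into -5, which is 8 modulo 13.
 pointwise₁₃ : ∀ s d k → V13._≡ₘ_ (Mod13.F s d k) (dot (V13.target target₁₃) (V13.entries (form (s , d , k))))
 pointwise₁₃ s d k = V13.≡ₘ-trans (V13.mk (ℤD.divides (χ k *ᶻ (+ d *ᶻ + d *ᶻ (+ d *ᶻ + d *ᶻ 1ℤ))) (lem (χ d) (χ k) (+ d)))) (V13.≡ₘ-reflexive (sym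
   (trans (dot-add (zeros 17 (6 ∷ [])) (zeros 26 (8 ∷ [])) (V13.entries Q)) (cong₂ _+ᶻ_
     (trans (T13.target-entry 6 1 8 Q (s≤s (s≤s z≤n)) ℕP.≤-refl) (cong₂ (λ x y → + 6 *ᶻ (x *ᶻ y)) (χᶻ-e₁ s d k) (coefficient-top (+ d) s (-ᶻ + k) 4)))
     (trans (T13.target-entry 8 2 8 Q (s≤s (s≤s (s≤s z≤n))) ℕP.≤-refl) (cong₂ (λ x y → + 8 *ᶻ (x *ᶻ y)) (χᶻ-e₂ s d k) (coefficient-top (+ d) s (-ᶻ + k) 4)))))))
   where
     Q = form (s , d , k)
     lem : ∀ x y d → (+ 6 *ᶻ (x *ᶻ (d *ᶻ d *ᶻ (d *ᶻ d *ᶻ 1ℤ))) +ᶻ + 5 *ᶻ (y *ᶻ (d *ᶻ d *ᶻ (d *ᶻ d *ᶻ 1ℤ))))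
       -ᶻ (+ 6 *ᶻ (x *ᶻ (d *ᶻ (d *ᶻ (d *ᶻ (d *ᶻ 1ℤ))))) +ᶻ + 8 *ᶻ ((-ᶻ y) *ᶻ (d *ᶻ (d *ᶻ (d *ᶻ (d *ᶻ 1ℤ)))))) ≡ y *ᶻ (d *ᶻ d *ᶻ (d *ᶻ d *ᶻ 1ℤ)) *ᶻ + 13
     lem = solve-∀

 -- Coefficient 10 of Q⁶ is -6d⁴(dk - 10s²) and carries the bracket. For e₁ the factor is -6·13, for
 -- e₂, where χ changes sign, it is 6·4; both are 7 modulo 17.
 pointwise₁₇ : ∀ s d k → V17._≡ₘ_ (Mod17.F s d k) (dot (V17.target target₁₇) (V17.entries (form (s , d , k))))
 pointwise₁₇ s d k = V17.≡ₘ-trans (V17.≡ₘ-reflexive (cong₂ (λ u v → (+ 3 *ᶻ (χ d *ᶻ e 3 d) +ᶻ + 12 *ᶻ (χ k *ᶻ e 3 d)) +ᶻ (+ 7 *ᶻ (χ d *ᶻ e 2 d) +ᶻ + 7 *ᶻ (χ k *ᶻ e 2 d)) *ᶻ (u -ᶻ + 10 *ᶻ v)) (ℤP.pos-* d k) (sym (sq-ℤ s))))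
   (V17.≡ₘ-trans (V17.mk (ℤD.divides (+ 5 *ᶻ (χ d *ᶻ (lead *ᶻ W)) -ᶻ χ k *ᶻ (lead *ᶻ W) +ᶻ χ k *ᶻ (lead *ᶻ (+ d *ᶻ + d))) (lem (χ d) (χ k) (+ d) (+ k) s)))
   (V17.≡ₘ-reflexive (sym (trans (T17.target-sum target₁₇ Q)
     (cong₂ _+ᶻ_ (trans (T17.target-entry 13 1 10 Q (s≤s (s≤s z≤n)) (s≤s (ℕP.m≤n+m 10 2))) (cong₂ (λ x y → + 13 *ᶻ (x *ᶻ y)) (χᶻ-e₁ s d k) (coefficient-third (+ d) s (-ᶻ + k) 4)))
     (cong₂ _+ᶻ_ (trans (T17.target-entry 3 1 12 Q (s≤s (s≤s z≤n)) ℕP.≤-refl) (cong₂ (λ x y → + 3 *ᶻ (x *ᶻ y)) (χᶻ-e₁ s d k) (coefficient-top (+ d) s (-ᶻ + k) 6)))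
     (cong₂ _+ᶻ_ (trans (T17.target-entry 4 2 10 Q (s≤s (s≤s (s≤s z≤n))) (s≤s (ℕP.m≤n+m 10 2))) (cong₂ (λ x y → + 4 *ᶻ (x *ᶻ y)) (χᶻ-e₂ s d k) (coefficient-third (+ d) s (-ᶻ + k) 4)))
     (cong₂ _+ᶻ_ (trans (T17.target-entry 5 2 12 Q (s≤s (s≤s (s≤s z≤n))) ℕP.≤-refl) (cong₂ (λ x y → + 5 *ᶻ (x *ᶻ y)) (χᶻ-e₂ s d k) (coefficient-top (+ d) s (-ᶻ + k) 6))) refl))))))))
   where
     Q = form (s , d , k)
     E = V17.entries Q
     lead = + d *ᶻ + d *ᶻ (+ d *ᶻ + d)
     W = + d *ᶻ + k -ᶻ + 10 *ᶻ (s *ᶻ s)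
     lem : ∀ x y d k s →
       ((+ 3 *ᶻ (x *ᶻ (d *ᶻ d *ᶻ (d *ᶻ d *ᶻ (d *ᶻ d *ᶻ 1ℤ)))) +ᶻ + 12 *ᶻ (y *ᶻ (d *ᶻ d *ᶻ (d *ᶻ d *ᶻ (d *ᶻ d *ᶻ 1ℤ))))) +ᶻ (+ 7 *ᶻ (x *ᶻ (d *ᶻ d *ᶻ (d *ᶻ d *ᶻ 1ℤ))) +ᶻ + 7 *ᶻ (y *ᶻ (d *ᶻ d *ᶻ (d *ᶻ d *ᶻ 1ℤ)))) *ᶻ (d *ᶻ k -ᶻ + 10 *ᶻ (s *ᶻ s)))
       -ᶻ (+ 13 *ᶻ (x *ᶻ (+ 6 *ᶻ (d *ᶻ (d *ᶻ (d *ᶻ (d *ᶻ 1ℤ)))) *ᶻ (d *ᶻ (-ᶻ k) +ᶻ + 2 *ᶻ + 5 *ᶻ (s *ᶻ s))))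
         +ᶻ (+ 3 *ᶻ (x *ᶻ (d *ᶻ (d *ᶻ (d *ᶻ (d *ᶻ (d *ᶻ (d *ᶻ 1ℤ)))))))
         +ᶻ (+ 4 *ᶻ ((-ᶻ y) *ᶻ (+ 6 *ᶻ (d *ᶻ (d *ᶻ (d *ᶻ (d *ᶻ 1ℤ)))) *ᶻ (d *ᶻ (-ᶻ k) +ᶻ + 2 *ᶻ + 5 *ᶻ (s *ᶻ s))))
         +ᶻ (+ 5 *ᶻ ((-ᶻ y) *ᶻ (d *ᶻ (d *ᶻ (d *ᶻ (d *ᶻ (d *ᶻ (d *ᶻ 1ℤ))))))) +ᶻ 0ℤ))))
       ≡ (+ 5 *ᶻ (x *ᶻ (d *ᶻ d *ᶻ (d *ᶻ d) *ᶻ (d *ᶻ k -ᶻ + 10 *ᶻ (s *ᶻ s)))) -ᶻ y *ᶻ (d *ᶻ d *ᶻ (d *ᶻ d) *ᶻ (d *ᶻ k -ᶻ + 10 *ᶻ (s *ᶻ s))) +ᶻ y *ᶻ (d *ᶻ d *ᶻ (d *ᶻ d) *ᶻ (d *ᶻ d))) *ᶻ + 17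
     lem = solve-∀

 ev≡1-od : ∀ n → ev n ≡ 1ℤ -ᶻ od n
 ev≡1-od n = trans (lem (ev n) (od n)) (cong (λ z → z -ᶻ od n) (ev+od n))
   where
     lem : ∀ x y → x ≡ (x +ᶻ y) -ᶻ y
     lem = solve-∀

 sgn≡1-2od : ∀ n → sgn n ≡ 1ℤ -ᶻ + 2 *ᶻ od n
 sgn≡1-2od n = trans (lem (sgn n) (od n)) (trans (cong (λ z → z -ᶻ od n) (trans (sym (ev-sgn n)) (ev≡1-od n))) (lem′ (od n)))
   where
     lem : ∀ x y → x ≡ (y +ᶻ x) -ᶻ y
     lem = solve-∀
     lem′ : ∀ y → 1ℤ -ᶻ y -ᶻ y ≡ 1ℤ -ᶻ + 2 *ᶻ y
     lem′ = solve-∀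

 -- For odd k the product dk has the parity of d.
 sgn-*-od : ∀ d k → sgn (d ℕ.* k) *ᶻ od k ≡ (1ℤ -ᶻ + 2 *ᶻ od d) *ᶻ od k
 sgn-*-od d k = trans (go (parity k)) (cong (_*ᶻ od k) (sgn≡1-2od d))
   where
     go : ∀ {k} → Parity k → sgn (d ℕ.* k) *ᶻ od k ≡ sgn d *ᶻ od k
     go (even m) = trans (cong (sgn (d ℕ.* (m ℕ.* 2)) *ᶻ_) (od-even m)) (trans (ℤP.*-zeroʳ (sgn (d ℕ.* (m ℕ.* 2)))) (sym (trans (cong (sgn d *ᶻ_) (od-even m)) (ℤP.*-zeroʳ (sgn d)))))
     go (odd m)  = cong (_*ᶻ od (suc (m ℕ.* 2))) (trans (cong sgn (ℕP.*-suc d (m ℕ.* 2))) (trans (sgn-+ d (d ℕ.* (m ℕ.* 2)))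
       (trans (cong (λ z → sgn d *ᶻ sgn z) (sym (ℕP.*-assoc d m 2))) (trans (cong (sgn d *ᶻ_) (sgn-even (d ℕ.* m))) (ℤP.*-identityʳ (sgn d))))))

 -- Q(1, 1) = d + 2s - k has the parity of d + k. Signs are multiplicative and sgn = 1 - 2 od, which
 -- gives the formula for `od` after cancelling 2.
 evᶻ-e₁+e₂ : ∀ s d k → evᶻ (value (form (s , d , k)) (1ℤ , 1ℤ)) ≡ 1ℤ -ᶻ (od d +ᶻ od k -ᶻ + 2 *ᶻ (od d *ᶻ od k))
 evᶻ-e₁+e₂ s d k = trans (cong (ev ∘ ∣_∣) (lem (+ d) s (+ k))) (trans (ev≡1-od m) (cong (λ z → 1ℤ +ᶻ -ᶻ z) (ℤP.*-cancelˡ-≡ (+ 2) (od m) _ double)))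
   where
     v : ℤ
     v = (+ d +ᶻ (s +ᶻ s)) +ᶻ -ᶻ + k
     m = ∣ v ∣
     lem : ∀ d s k → d *ᶻ 1ℤ +ᶻ + 2 *ᶻ (s *ᶻ 1ℤ) +ᶻ (-ᶻ k) *ᶻ 1ℤ ≡ (d +ᶻ (s +ᶻ s)) +ᶻ -ᶻ k
     lem = solve-∀
     sgn-m : sgn m ≡ sgn d *ᶻ sgn k
     sgn-m = trans (sgn-+ℤ (+ d +ᶻ (s +ᶻ s)) (-ᶻ + k)) (cong₂ _*ᶻ_
       (trans (sgn-+ℤ (+ d) (s +ᶻ s)) (trans (cong (sgn d *ᶻ_) (trans (sgn-+ℤ s s) (sgn-*2 ∣ s ∣))) (ℤP.*-identityʳ (sgn d)))) (cong sgn (ℤP.∣-i∣≡∣i∣ (+ k))))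
     double : + 2 *ᶻ od m ≡ + 2 *ᶻ (od d +ᶻ od k -ᶻ + 2 *ᶻ (od d *ᶻ od k))
     double = trans (l₁ (od m)) (trans (cong (λ z → 1ℤ +ᶻ -ᶻ z) (trans (sym (sgn≡1-2od m)) (trans sgn-m (cong₂ _*ᶻ_ (sgn≡1-2od d) (sgn≡1-2od k))))) (l₂ (od d) (od k)))
       where
         l₁ : ∀ x → + 2 *ᶻ x ≡ 1ℤ +ᶻ -ᶻ (1ℤ -ᶻ + 2 *ᶻ x)
         l₁ = solve-∀
         l₂ : ∀ x y → 1ℤ +ᶻ -ᶻ ((1ℤ -ᶻ + 2 *ᶻ x) *ᶻ (1ℤ -ᶻ + 2 *ᶻ y)) ≡ + 2 *ᶻ (x +ᶻ y -ᶻ + 2 *ᶻ (x *ᶻ y))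
         l₂ = solve-∀

 -- The parity conditions on d and k in F are combinations of 1, ev d, ev k and ev(d + k), the
 -- values of ψ at the four choices of κ. Coefficient 12 of Q⁷ is -7d⁵(dk - 12s²) and carries the
 -- bracket.
 pointwise₁₉ : ∀ s d k → V19._≡ₘ_ (Mod19.F s d k) (dot (V19.target target₁₉) (V19.entries (form (s , d , k))))
 pointwise₁₉ s d k = V19.≡ₘ-trans (V19.≡ₘ-reflexive rewritten)
   (V19.≡ₘ-trans (V19.mk (ℤD.divides (lead *ᶻ (-ᶻ + 2 +ᶻ + 2 *ᶻ O +ᶻ P -ᶻ + 2 *ᶻ (P *ᶻ O)) *ᶻ (+ d *ᶻ + d) +ᶻ lead *ᶻ W *ᶻ (+ 8 -ᶻ + 5 *ᶻ O)) (lem P O (+ d) W)))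
   (V19.≡ₘ-reflexive (sym (trans (T19.target-sum target₁₉ Q)
     (cong₂ _+ᶻ_ (trans (T19.target-entry 5 0 12 Q (s≤s z≤n) (s≤s (ℕP.m≤n+m 12 2))) (cong₂ (λ x y → + 5 *ᶻ (x *ᶻ y)) at-0 third))
     (cong₂ _+ᶻ_ (trans (T19.target-entry 13 0 14 Q (s≤s z≤n) ℕP.≤-refl) (cong₂ (λ x y → + 13 *ᶻ (x *ᶻ y)) at-0 top))
     (cong₂ _+ᶻ_ (trans (T19.target-entry 9 1 14 Q (s≤s (s≤s z≤n)) ℕP.≤-refl) (cong₂ (λ x y → + 9 *ᶻ (x *ᶻ y)) at-e₁ top))
     (cong₂ _+ᶻ_ (trans (T19.target-entry 15 2 12 Q (s≤s (s≤s (s≤s z≤n))) (s≤s (ℕP.m≤n+m 12 2))) (cong₂ (λ x y → + 15 *ᶻ (x *ᶻ y)) at-e₂ third))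
     (cong₂ _+ᶻ_ (trans (T19.target-entry 11 2 14 Q (s≤s (s≤s (s≤s z≤n))) ℕP.≤-refl) (cong₂ (λ x y → + 11 *ᶻ (x *ᶻ y)) at-e₂ top))
     (cong₂ _+ᶻ_ (trans (T19.target-entry 10 3 14 Q (s≤s (s≤s (s≤s (s≤s z≤n)))) ℕP.≤-refl) (cong₂ (λ x y → + 10 *ᶻ (x *ᶻ y)) (evᶻ-e₁+e₂ s d k) top)) refl))))))))))
   where
     Q = form (s , d , k)
     E = V19.entries Q
     P = od d
     O = od k
     lead = + d *ᶻ (+ d *ᶻ + d) *ᶻ (+ d *ᶻ + d)
     W = + d *ᶻ + k -ᶻ + 12 *ᶻ (s *ᶻ s)
     at-0 : evᶻ (value Q (0ℤ , 0ℤ)) ≡ 1ℤ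
     at-0 = cong evᶻ (z (+ d) s (-ᶻ + k))
       where
         z : ∀ a b c → a *ᶻ 0ℤ +ᶻ + 2 *ᶻ (b *ᶻ 0ℤ) +ᶻ c *ᶻ 0ℤ ≡ 0ℤ
         z = solve-∀
     at-e₁ : evᶻ (value Q e₁) ≡ 1ℤ -ᶻ P
     at-e₁ = trans (cong evᶻ (value-e₁ Q)) (ev≡1-od d)
     at-e₂ : evᶻ (value Q e₂) ≡ 1ℤ -ᶻ O
     at-e₂ = trans (cong evᶻ (value-e₂ Q)) (trans (cong ev (ℤP.∣-i∣≡∣i∣ (+ k))) (ev≡1-od k))
     top : coefficient Q 7 14 ≡ (+ d) ^ᶻ 7
     top = coefficient-top (+ d) s (-ᶻ + k) 7
     third : coefficient Q 7 12 ≡ + 7 *ᶻ (+ d) ^ᶻ 5 *ᶻ (-ᶻ W)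
     third = trans (coefficient-third (+ d) s (-ᶻ + k) 5) (cong (+ 7 *ᶻ (+ d) ^ᶻ 5 *ᶻ_) (z (+ d) (+ k) s))
       where
         z : ∀ d k s → d *ᶻ (-ᶻ k) +ᶻ + 2 *ᶻ + 6 *ᶻ (s *ᶻ s) ≡ -ᶻ (d *ᶻ k -ᶻ + 12 *ᶻ (s *ᶻ s))
         z = solve-∀
     rewritten : Mod19.F s d k ≡ (+ 1 *ᶻ (+ 5 *ᶻ (+ d *ᶻ e 3 d) +ᶻ + 8 *ᶻ (+ d *ᶻ O *ᶻ e 3 d)) +ᶻ + 9 *ᶻ ((1ℤ -ᶻ + 2 *ᶻ P) *ᶻ O *ᶻ (+ d *ᶻ e 3 d)))
       +ᶻ (+ 12 *ᶻ (+ d *ᶻ e 2 d) +ᶻ + 10 *ᶻ (+ d *ᶻ O *ᶻ e 2 d)) *ᶻ W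
     rewritten = cong₂ (λ u v → (+ 1 *ᶻ (+ 5 *ᶻ (+ d *ᶻ e 3 d) +ᶻ + 8 *ᶻ (+ d *ᶻ O *ᶻ e 3 d)) +ᶻ + 9 *ᶻ u) +ᶻ (+ 12 *ᶻ (+ d *ᶻ e 2 d) +ᶻ + 10 *ᶻ (+ d *ᶻ O *ᶻ e 2 d)) *ᶻ v)
       (trans (z (sgn (d ℕ.* k)) (+ d) O (e 3 d)) (cong (_*ᶻ (+ d *ᶻ e 3 d)) (sgn-*-od d k))) (cong₂ (λ u v → u -ᶻ + 12 *ᶻ v) (ℤP.pos-* d k) (sym (sq-ℤ s)))
       where
         z : ∀ S d O x → S *ᶻ (d *ᶻ O *ᶻ x) ≡ S *ᶻ O *ᶻ (d *ᶻ x)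
         z = solve-∀
     lem : ∀ P O d W →
       ((+ 1 *ᶻ (+ 5 *ᶻ (d *ᶻ (d *ᶻ d *ᶻ (d *ᶻ d *ᶻ (d *ᶻ d *ᶻ 1ℤ)))) +ᶻ + 8 *ᶻ (d *ᶻ O *ᶻ (d *ᶻ d *ᶻ (d *ᶻ d *ᶻ (d *ᶻ d *ᶻ 1ℤ))))) +ᶻ + 9 *ᶻ ((1ℤ -ᶻ + 2 *ᶻ P) *ᶻ O *ᶻ (d *ᶻ (d *ᶻ d *ᶻ (d *ᶻ d *ᶻ (d *ᶻ d *ᶻ 1ℤ))))))
       +ᶻ (+ 12 *ᶻ (d *ᶻ (d *ᶻ d *ᶻ (d *ᶻ d *ᶻ 1ℤ))) +ᶻ + 10 *ᶻ (d *ᶻ O *ᶻ (d *ᶻ d *ᶻ (d *ᶻ d *ᶻ 1ℤ)))) *ᶻ W)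
       -ᶻ (+ 5 *ᶻ (1ℤ *ᶻ (+ 7 *ᶻ (d *ᶻ (d *ᶻ (d *ᶻ (d *ᶻ (d *ᶻ 1ℤ))))) *ᶻ (-ᶻ W)))
         +ᶻ (+ 13 *ᶻ (1ℤ *ᶻ (d *ᶻ (d *ᶻ (d *ᶻ (d *ᶻ (d *ᶻ (d *ᶻ (d *ᶻ 1ℤ))))))))
         +ᶻ (+ 9 *ᶻ ((1ℤ -ᶻ P) *ᶻ (d *ᶻ (d *ᶻ (d *ᶻ (d *ᶻ (d *ᶻ (d *ᶻ (d *ᶻ 1ℤ))))))))
         +ᶻ (+ 15 *ᶻ ((1ℤ -ᶻ O) *ᶻ (+ 7 *ᶻ (d *ᶻ (d *ᶻ (d *ᶻ (d *ᶻ (d *ᶻ 1ℤ))))) *ᶻ (-ᶻ W)))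
         +ᶻ (+ 11 *ᶻ ((1ℤ -ᶻ O) *ᶻ (d *ᶻ (d *ᶻ (d *ᶻ (d *ᶻ (d *ᶻ (d *ᶻ (d *ᶻ 1ℤ))))))))
         +ᶻ (+ 10 *ᶻ ((1ℤ -ᶻ (P +ᶻ O -ᶻ + 2 *ᶻ (P *ᶻ O))) *ᶻ (d *ᶻ (d *ᶻ (d *ᶻ (d *ᶻ (d *ᶻ (d *ᶻ (d *ᶻ 1ℤ)))))))) +ᶻ 0ℤ))))))
       ≡ (d *ᶻ (d *ᶻ d) *ᶻ (d *ᶻ d) *ᶻ (-ᶻ + 2 +ᶻ + 2 *ᶻ O +ᶻ P -ᶻ + 2 *ᶻ (P *ᶻ O)) *ᶻ (d *ᶻ d) +ᶻ d *ᶻ (d *ᶻ d) *ᶻ (d *ᶻ d) *ᶻ W *ᶻ (+ 8 -ᶻ + 5 *ᶻ O)) *ᶻ + 19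
     lem = solve-∀

 coprime⇒∤ : ∀ {ℓ n} → Prime ℓ → Coprime n ℓ → ¬ ℓ ℕD.∣ n
 coprime⇒∤ ℓ-prime coprime ℓ∣n = ¬prime[1] (subst Prime (coprime (ℓ∣n , ℕD.∣-refl)) ℓ-prime)

open TripleSums
open Certificates
open Divisibility
open import Defs
open import Data.Nat using (_*_; _^_)
open import Data.Nat.Divisibility using (_∣_)

theorem1p4 : (m ℓ : ℕ) → Prime m → Prime ℓ →
    ((m ≡ 13 × ℓ ∈ 1811 ∷ 1871 ∷ 1949 ∷ 2207 ∷ 3301 ∷ 4001 ∷ 4079 ∷ 4289 ∷ 4931 ∷ [])
      ⊎ (m ≡ 17 × ℓ ∈ 2039 ∷ 2719 ∷ 3331 ∷ 4079 ∷ [])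
      ⊎ (m ≡ 19 × ℓ ∈ 151 ∷ 1091 ∷ 2659 ∷ 3989 ∷ [])) →
    (n : ℕ) → 0 < n → Coprime n ℓ →
    m ∣ overpartition (m * ℓ ^ 3 * n)
theorem1p4 _ ℓ _ ℓ-prime (inj₁ (refl , ℓ∈)) n _ coprime = T13.overpartition-divisible n target₁₃ Mod13.F ℓ-prime (coprime⇒∤ ℓ-prime coprime) pointwise₁₃ Mod13.section-triples
  (V13.certified-sound certificate₁₃ ℓ∈ ℓ-prime n (coprime⇒∤ ℓ-prime coprime))
theorem1p4 _ ℓ _ ℓ-prime (inj₂ (inj₁ (refl , ℓ∈))) n _ coprime = T17.overpartition-divisible n target₁₇ Mod17.F ℓ-prime (coprime⇒∤ ℓ-prime coprime) pointwise₁₇ Mod17.section-triples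
  (V17.certified-sound certificate₁₇ ℓ∈ ℓ-prime n (coprime⇒∤ ℓ-prime coprime))
theorem1p4 _ ℓ _ ℓ-prime (inj₂ (inj₂ (refl , ℓ∈))) n _ coprime = T19.overpartition-divisible n target₁₉ Mod19.F ℓ-prime (coprime⇒∤ ℓ-prime coprime) pointwise₁₉ Mod19.section-triples
  (V19.certified-sound certificate₁₉ ℓ∈ ℓ-prime n (coprime⇒∤ ℓ-prime coprime))
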